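{- Up to projective equivalence, there are exactly three $4$-dimensional pseudo-ovals in ${\rm PG}(11,2)$, and each of them is elementary: they arise from a conic, a pointed conic, and a Lunelli–Sce oval of ${\rm PG}(2,16)$, respectively.
   Context: An $n$-dimensional pseudo-oval in ${\rm PG}(3n-1,q)$ is a set of $q^n+1$ subspaces of projective dimension $n-1$ such that any three span the whole space; projective equivalence is under ${\rm P\Gamma L}(3n,q)$. It is elementary if obtained from an oval (set of $q^n+1$ points, no three collinear) of ${\rm PG}(2,q^n)$ by identifying ${\rm GF}(q)^{3n}$ with ${\rm GF}(q^n)^3$, so that points of ${\rm PG}(2,q^n)$ become $(n-1)$-dimensional subspaces. A pointed conic of ${\rm PG}(2,16)$ is $\{(1,t,t^2):t\in{\rm GF}(16)\}\cup\{(0,1,0)\}$; a Lunelli–Sce oval is an oval of ${\rm PG}(2,16)$ that is projectively equivalent neither to a conic nor to a pointed conic (such ovals form a single projective equivalence class). -}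

module Defs where

open import Data.Bool using (Bool; true; false; _xor_; _∧_)
open import Data.Nat using (ℕ; zero; suc)
open import Data.Fin using (Fin; zero; suc; toℕ; _≟_)
open import Data.Vec using (Vec; []; _∷_; map; zipWith; foldr; replicate; concat; tabulate; _++_)
open import Data.Product using (Σ; _×_; _,_)
open import Data.Sum using (_⊎_)
open import Relation.Binary.PropositionalEquality using (_≡_; _≢_)
open import Relation.Nullary using (¬_)
open import Relation.Nullary.Decidable using (⌊_⌋)

-- GF(2) = Bool (xor = addition, ∧ = multiplication)

_⊕_ : ∀ {n} → Vec Bool n → Vec Bool n → Vec Bool n
_⊕_ = zipWith _xor_

zeroV : (n : ℕ) → Vec Bool n
zeroV n = replicate n false

lincomb : ∀ {n m} → Vec Bool m → Vec (Vec Bool n) m → Vec Bool n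
lincomb {n} []       []        = zeroV n
lincomb     (c ∷ cs) (v ∷ vs)  = map (c ∧_) v ⊕ lincomb cs vs

InSpan : ∀ {n m} → Vec Bool n → Vec (Vec Bool n) m → Set
InSpan {m = m} v B = Σ (Vec Bool m) λ c → lincomb c B ≡ v

LinIndep : ∀ {n m} → Vec (Vec Bool n) m → Set
LinIndep {n} {m} B = ∀ (c : Vec Bool m) → lincomb c B ≡ zeroV n → c ≡ zeroV m

SpansAll : ∀ {n m} → Vec (Vec Bool n) m → Set
SpansAll {n} B = ∀ (v : Vec Bool n) → InSpan v B

SameSpan : ∀ {n m k} → Vec (Vec Bool n) m → Vec (Vec Bool n) k → Set
SameSpan {n} B B' = ∀ (v : Vec Bool n) → (InSpan v B → InSpan v B') × (InSpan v B' → InSpan v B)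

-- n×n matrices over GF(2), stored as rows
Mat2 : ℕ → Set
Mat2 n = Vec (Vec Bool n) n

dot2 : ∀ {n} → Vec Bool n → Vec Bool n → Bool
dot2 u v = foldr _ _xor_ false (zipWith _∧_ u v)

apply2 : ∀ {n} → Mat2 n → Vec Bool n → Vec Bool n
apply2 g v = map (λ row → dot2 row v) g

mul2 : ∀ {n} → Mat2 n → Mat2 n → Mat2 n
mul2 g h = map (λ row → lincomb row h) g

id2 : (n : ℕ) → Mat2 n
id2 n = tabulate λ i → tabulate λ j → ⌊ i ≟ j ⌋

Invertible2 : ∀ {n} → Mat2 n → Set
Invertible2 {n} g = Σ (Mat2 n) λ h → (mul2 h g ≡ id2 n) × (mul2 g h ≡ id2 n)

-- an (n-1)-dimensional projective subspace of PG(11,2), n = 4, given by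
-- a GF(2)-basis of 4 vectors of GF(2)^12
Basis4 : Set
Basis4 = Vec (Vec Bool 12) 4

-- a family of q^n + 1 = 17 such subspaces
Family17 : Set
Family17 = Fin 17 → Basis4

Distinct3 : Fin 17 → Fin 17 → Fin 17 → Set
Distinct3 i j k = (i ≢ j) × (j ≢ k) × (i ≢ k)

-- each member is a 3-dimensional projective subspace and any three
-- (distinct) members span PG(11,2).  (Distinctness of the 17 members
-- follows from the spanning condition.)
IsPseudoOval : Family17 → Set
IsPseudoOval O =
  (∀ i → LinIndep (O i)) ×
  (∀ i j k → Distinct3 i j k → SpansAll (O i ++ O j ++ O k))

-- projective equivalence under PΓL(12,2) = GL(12,2) (GF(2) has trivial
-- automorphism group and only the scalar 1): some g maps the set of
-- subspaces of O onto the set of subspaces of O'.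
PseudoOvalEquiv : Family17 → Family17 → Set
PseudoOvalEquiv O O' = Σ (Mat2 12) λ g → Invertible2 g ×
  ((∀ i → Σ (Fin 17) λ j → SameSpan (map (apply2 g) (O i)) (O' j)) ×
   (∀ j → Σ (Fin 17) λ i → SameSpan (map (apply2 g) (O i)) (O' j)))

-- GF(16) = GF(2)[x]/(x^4 + x + 1), elements a0 + a1 x + a2 x^2 + a3 x^3
-- stored as [a0, a1, a2, a3]

F16 : Set
F16 = Vec Bool 4

0F 1F xF : F16
0F = false ∷ false ∷ false ∷ false ∷ []
1F = true  ∷ false ∷ false ∷ false ∷ []
xF = false ∷ true  ∷ false ∷ false ∷ []

_+F_ : F16 → F16 → F16
_+F_ = _⊕_

-- multiplication by x (using x^4 = x + 1)
timesX : F16 → F16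
timesX (a0 ∷ a1 ∷ a2 ∷ a3 ∷ []) = a3 ∷ (a0 xor a3) ∷ a1 ∷ a2 ∷ []

_*F_ : F16 → F16 → F16
a *F (b0 ∷ b1 ∷ b2 ∷ b3 ∷ []) =
  map (b0 ∧_) a ⊕ (map (b1 ∧_) (timesX a) ⊕
  (map (b2 ∧_) (timesX (timesX a)) ⊕ map (b3 ∧_) (timesX (timesX (timesX a)))))

frob : ℕ → F16 → F16
frob zero    a = a
frob (suc k) a = frob k (a *F a)

half : ℕ → ℕ
half zero = zero
half (suc zero) = zero
half (suc (suc m)) = suc (half m)

odd : ℕ → Bool
odd zero = false
odd (suc zero) = true
odd (suc (suc m)) = odd m

bits : (n : ℕ) → ℕ → Vec Bool n
bits zero    m = []
bits (suc n) m = odd m ∷ bits n (half m)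

enumF16 : Fin 16 → F16
enumF16 t = bits 4 (toℕ t)

V3 : Set
V3 = Vec F16 3

scale : F16 → V3 → V3
scale λ₀ = map (λ₀ *F_)

SamePoint : V3 → V3 → Set
SamePoint u v = Σ F16 λ λ₀ → (λ₀ ≢ 0F) × (u ≡ scale λ₀ v)

-- determinant of the 3×3 matrix with rows u, v, w (characteristic 2)
det3 : V3 → V3 → V3 → F16
det3 (u0 ∷ u1 ∷ u2 ∷ []) (v0 ∷ v1 ∷ v2 ∷ []) (w0 ∷ w1 ∷ w2 ∷ []) =
  (u0 *F ((v1 *F w2) +F (v2 *F w1))) +F
  ((u1 *F ((v0 *F w2) +F (v2 *F w0))) +F
   (u2 *F ((v0 *F w1) +F (v1 *F w0))))

Mat16 : Set
Mat16 = Vec V3 3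

detM : Mat16 → F16
detM (r0 ∷ r1 ∷ r2 ∷ []) = det3 r0 r1 r2

dot16 : V3 → V3 → F16
dot16 u v = foldr _ _+F_ 0F (zipWith _*F_ u v)

apply16 : Mat16 → V3 → V3
apply16 A v = map (λ row → dot16 row v) A

-- a family of q^n + 1 = 17 (vector representatives of) points of PG(2,16)
Points17 : Set
Points17 = Fin 17 → V3

-- oval: no three of the 17 points are collinear (this also forces the
-- points to be nonzero and pairwise distinct)
IsOval : Points17 → Set
IsOval Ω = ∀ i j k → Distinct3 i j k → det3 (Ω i) (Ω j) (Ω k) ≢ 0F

-- projective equivalence under PΓL(3,16): x ↦ A x^σ, σ = Frobenius^k,
-- mapping the point set of Ω onto the point set of Ω'
OvalEquiv : Points17 → Points17 → Set
OvalEquiv Ω Ω' = Σ Mat16 λ A → Σ (Fin 4) λ k → (detM A ≢ 0F) ×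
  ((∀ i → Σ (Fin 17) λ j → SamePoint (apply16 A (map (frob (toℕ k)) (Ω i))) (Ω' j)) ×
   (∀ j → Σ (Fin 17) λ i → SamePoint (apply16 A (map (frob (toℕ k)) (Ω i))) (Ω' j)))

conic : Points17
conic zero    = 0F ∷ 0F ∷ 1F ∷ []
conic (suc t) = 1F ∷ enumF16 t ∷ (enumF16 t *F enumF16 t) ∷ []

pointedConic : Points17
pointedConic zero    = 0F ∷ 1F ∷ 0F ∷ []
pointedConic (suc t) = 1F ∷ enumF16 t ∷ (enumF16 t *F enumF16 t) ∷ []

IsLunelliSce : Points17 → Set
IsLunelliSce Ω = IsOval Ω × ¬ OvalEquiv Ω conic × ¬ OvalEquiv Ω pointedConic

-- the elementary pseudo-oval of an oval: identify GF(16)^3 with GF(2)^12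
-- (coordinates w.r.t. the GF(2)-basis 1,x,x^2,x^3 of GF(16)); the point
-- ⟨P⟩ becomes the GF(2)-subspace {λP : λ ∈ GF(16)} with basis
-- P, xP, x^2 P, x^3 P.

toGF2 : V3 → Vec Bool 12
toGF2 = concat

basisF16 : Vec F16 4
basisF16 = 1F ∷ xF ∷ (xF *F xF) ∷ ((xF *F xF) *F xF) ∷ []

elementary : Points17 → Family17
elementary Ω i = map (λ μ → toGF2 (scale μ (Ω i))) basisF16

IsElementary : Family17 → Set
IsElementary O = Σ Points17 λ Ω → IsOval Ω × PseudoOvalEquiv O (elementary Ω)

module Submission where

-- Dually, a pseudo-oval is normalised to the functionals (0, 0, c) and (bAᵢ + cBᵢ, b, c), where
-- A₀, …, A₁₅ form a spread set: all differences Aᵢ − Aⱼ are invertible.  Up to equivalence it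
-- contains 0, 1 and one of three conjugacy types of matrices, two of which lead back to the
-- companion matrix W of x⁴ + x + 1, so an exhaustive search reduces every spread set to one of 17
-- explicit ones.  For the 16 non-Desarguesian ones no family B exists, by backtracking over
-- the first rows of the Bᵢ.  For the Desarguesian one, Aᵢ runs through GF(16), a search shows
-- that the value of B at x² is a scalar, and rescaling propagates this to all powers of x.  Then
-- the pseudo-oval comes from an oval {(1, t, f t)} ∪ {(0, 0, 1)}, and each f carries a certificate
-- of equivalence to the conic, the pointed conic or the Lunelli–Sce oval.
--
-- An equivalence of elementary pseudo-ovals onto that of the conic or the pointed conic normalises
-- multiplication by scalars, since an additive map fixing every point of such an oval is a
-- scalar; hence it is semilinear.  The three ovals are told apart by the quadratic form xz + y²
-- pulled back along an equivalence.

open import Defs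
open import Algebra.Bundles using (CommutativeMonoid; CommutativeRing)
open import Data.Bool using (Bool; _xor_; _∧_; _∨_; false; if_then_else_; not; true)
open import Data.Bool.Properties using (xor-assoc; xor-comm; ∧-comm; ∧-zeroʳ)
open import Data.Empty using (⊥; ⊥-elim)
open import Data.Fin using (Fin; combine; remQuot; suc; toℕ; zero)
open import Data.Fin.Permutation using (Permutation; permutation)
open import Data.Fin.Properties using (all?; any?; combine-remQuot; pigeonhole; remQuot-combine; suc-injective; ¬∀⟶∃¬)
open import Data.List using (List; []; _∷_; length)
open import Data.List.Relation.Unary.All using (All; []; _∷_)
open import Data.List.Relation.Unary.All.Properties using (++⁺)
open import Data.List.Relation.Unary.Any using (Any; here; there)
open import Data.Maybe using (Maybe; just; nothing)
open import Data.Nat using (_%_; _/_; _^_; suc; zero; ℕ)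
open import Data.Product using (_,_; _×_; proj₁; proj₂; Σ; ∃)
open import Data.Sum using ([_,_]′; _⊎_; inj₁; inj₂)
open import Data.Vec using (Vec; []; _++_; _∷_; concat; fromList; head; map; replicate; splitAt; tabulate; zipWith)
open import Data.Vec.Properties using (++-injectiveʳ; ++-injectiveˡ; map-cong; map-id; map-∘; tabulate-cong; tabulate-∘; zipWith-assoc; zipWith-comm; ∷-injectiveʳ; ∷-injectiveˡ; ≡-dec)
open import Function using (_∘_)
open import Level using (0ℓ)
open import Relation.Nullary using (Dec; no; yes; ¬_)
open import Relation.Nullary.Decidable using (from-yes; ⌊_⌋)
open import Tactic.RingSolver using (solve-∀)
open import Tactic.RingSolver.Core.AlmostCommutativeRing using (AlmostCommutativeRing; fromCommutativeRing)
open import Relation.Binary.PropositionalEquality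
import Algebra.Properties.CommutativeMonoid.Sum as Sum
import Data.Bool as Bool
import Data.Fin as Fin
import Data.List as List
import Data.List.Relation.Unary.All as All
import Data.Nat as ℕ
import Data.Nat.Properties as ℕₚ

-- Three facts keep the enumeration within reach of evaluation by the type checker. For a member ∞,
-- the functionals vanishing on ∞ form an 8-dimensional space in which the other 16 members cut out
-- 4-dimensional subspaces meeting pairwise in 0. Only 15 nonzero vectors remain, and together with
-- 0 they form a seventeenth subspace. Placed at infinity it turns the 16 others into graphs of
-- matrices, which are the spread set. In a spread set every vector of GF(2)⁴ is the first row of
-- exactly one element, so a search may ask for the element with a prescribed first row, in any
-- convenient order of rows. Finally, each reduction met in a search is an explicit transformation
-- that is verified on the spot, so nothing about conjugacy classes has to be proved, only that a
-- passed check is sound. All computations use row vectors: `lc c A` is the product cA. Functionals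
-- rather than vectors are used because a member of the family, given by a basis, becomes a 12 × 4
-- matrix on which functionals act in this way.

M4 : Set
M4 = Mat2 4

-- Vectors and matrices over GF(2) in a form suited to evaluation

infixl 6 _+ᵥ_ _⊞_
infixl 7 _⊗_

-- Agrees with `_⊕_`, but branches on the left vector only and leaves the bits of the right one
-- unevaluated where possible. In the same spirit `lc` skips the rows with coefficient 0 instead of
-- multiplying them by it.
_+ᵥ_ : ∀ {n} → Vec Bool n → Vec Bool n → Vec Bool n
[] +ᵥ [] = []
(false ∷ u) +ᵥ (b ∷ v) = b ∷ (u +ᵥ v)
(true ∷ u) +ᵥ (b ∷ v) = not b ∷ (u +ᵥ v)

_⊞_ : ∀ {m n} → Vec (Vec Bool n) m → Vec (Vec Bool n) m → Vec (Vec Bool n) m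
[] ⊞ [] = []
(u ∷ A) ⊞ (v ∷ B) = (u +ᵥ v) ∷ (A ⊞ B)

lc : ∀ {n m} → Vec Bool m → Vec (Vec Bool n) m → Vec Bool n
lc {n} [] [] = zeroV n
lc (false ∷ c) (_ ∷ B) = lc c B
lc (true ∷ c) (v ∷ B) = v +ᵥ lc c B

_⊗_ : ∀ {l m n} → Vec (Vec Bool m) l → Vec (Vec Bool n) m → Vec (Vec Bool n) l
[] ⊗ B = []
(u ∷ A) ⊗ B = lc u B ∷ (A ⊗ B)

eqV : ∀ {n} → Vec Bool n → Vec Bool n → Bool
eqV [] [] = true
eqV (false ∷ u) (false ∷ v) = eqV u v
eqV (false ∷ u) (true ∷ v) = false
eqV (true ∷ u) (false ∷ v) = false
eqV (true ∷ u) (true ∷ v) = eqV u v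

eqM : ∀ {m n} → Vec (Vec Bool n) m → Vec (Vec Bool n) m → Bool
eqM [] [] = true
eqM (u ∷ A) (v ∷ B) = eqV u v ∧ eqM A B

nonzero : ∀ {n} → Vec Bool n → Bool
nonzero [] = false
nonzero (false ∷ v) = nonzero v
nonzero (true ∷ v) = true

anyL : {A : Set} → (A → Bool) → List A → Bool
anyL p [] = false
anyL p (x ∷ xs) = p x ∨ anyL p xs

allL : {A : Set} → (A → Bool) → List A → Bool
allL p [] = true
allL p (x ∷ xs) = p x ∧ allL p xs

mapL : {A B : Set} → (A → B) → List A → List B
mapL f [] = []
mapL f (x ∷ xs) = f x ∷ mapL f xs

nth : {A : Set} → List A → ℕ → Maybe A
nth [] _ = nothing
nth (x ∷ xs) zero = just x
nth (x ∷ xs) (suc n) = nth xs n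

-- Sets of bit vectors as binary tries; ● is the full set.

data Trie : Set where
  ∅ ● : Trie
  _∣_ : Trie → Trie → Trie

mem : ∀ {n} → Trie → Vec Bool n → Bool
mem ∅ v = false
mem ● v = true
mem (a ∣ b) [] = false
mem (a ∣ b) (false ∷ v) = mem a v
mem (a ∣ b) (true ∷ v) = mem b v

-- Keeps intersections reduced: otherwise an empty set could survive as a tree of empty branches,
-- into which the searches would descend.
_⋈_ : Trie → Trie → Trie
∅ ⋈ ∅ = ∅
a ⋈ b = a ∣ b

-- s ∩ (v + t)
meet : ∀ {n} → Trie → Trie → Vec Bool n → Trie
meet ∅ t v = ∅
meet ● ∅ v = ∅
meet ● ● v = ●
meet ● (c ∣ d) [] = ∅
meet ● (c ∣ d) (false ∷ v) = meet ● c v ⋈ meet ● d v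
meet ● (c ∣ d) (true ∷ v) = meet ● d v ⋈ meet ● c v
meet (a ∣ b) ∅ v = ∅
meet (a ∣ b) ● v = a ∣ b
meet (a ∣ b) (c ∣ d) [] = ∅
meet (a ∣ b) (c ∣ d) (false ∷ v) = meet a c v ⋈ meet b d v
meet (a ∣ b) (c ∣ d) (true ∷ v) = meet a d v ⋈ meet b c v

-- s ∪ (v + t)
join : ∀ {n} → Trie → Trie → Vec Bool n → Trie
join ● t v = ●
join ∅ ∅ v = ∅
join ∅ ● v = ●
join ∅ (c ∣ d) [] = ∅
join ∅ (c ∣ d) (false ∷ v) = join ∅ c v ∣ join ∅ d v
join ∅ (c ∣ d) (true ∷ v) = join ∅ d v ∣ join ∅ c v
join (a ∣ b) ∅ v = a ∣ b
join (a ∣ b) ● v = ●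
join (a ∣ b) (c ∣ d) [] = ∅
join (a ∣ b) (c ∣ d) (false ∷ v) = join a c v ∣ join b d v
join (a ∣ b) (c ∣ d) (true ∷ v) = join a d v ∣ join b c v

lo hi : Trie → Trie
lo ∅ = ∅
lo ● = ●
lo (a ∣ b) = a
hi ∅ = ∅
hi ● = ●
hi (a ∣ b) = b

-- all extensions of the given prefix
prefix : ∀ {n} → Vec Bool n → Trie
prefix [] = ●
prefix (false ∷ v) = prefix v ∣ ∅
prefix (true ∷ v) = ∅ ∣ prefix v

insert : ∀ {n} → Vec Bool n → Trie → Trie
insert v ● = ●
insert [] t = ●
insert (false ∷ v) ∅ = insert v ∅ ∣ ∅
insert (true ∷ v) ∅ = ∅ ∣ insert v ∅
insert (false ∷ v) (a ∣ b) = insert v a ∣ b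
insert (true ∷ v) (a ∣ b) = a ∣ insert v b

-- The pairs (u, w) with u outside s and w in `f u`. Excluding s is what makes `frames` produce
-- independent vectors.
graft : (n : ℕ) → Trie → (Vec Bool n → Trie) → Trie
graft zero ● f = ∅
graft zero _ f = f []
graft (suc n) s f = graft n (lo s) (λ v → f (false ∷ v)) ⋈ graft n (hi s) (λ v → f (true ∷ v))

-- k-tuples of vectors that are linearly independent modulo the subspace S
frames : ℕ → Trie → Trie
frames zero S = ●
frames (suc k) S = graft 4 S (λ v → frames k (join S S v))

-- Starting from the zero subspace, each chosen row v replaces S by S ∪ (v + S), the subspace
-- spanned by S and v. The result is the set of invertible 4 × 4 matrices, written as 16-bit
-- strings.
GL : Trie
GL = frames 4 (prefix 0F)

every : (n : ℕ) → Trie → (Vec Bool n → Bool) → Bool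
every n ∅ f = true
every zero ● f = f []
every zero (a ∣ b) f = true
every (suc n) ● f = every n ● (λ v → f (false ∷ v)) ∧ every n ● (λ v → f (true ∷ v))
every (suc n) (a ∣ b) f = every n a (λ v → f (false ∷ v)) ∧ every n b (λ v → f (true ∷ v))

-- A check consumes a stream of certificates; nothing is failure.

Check : Set
Check = List ℕ → Maybe (List ℕ)

_▷_ : Maybe (List ℕ) → Check → Maybe (List ℕ)
nothing ▷ f = nothing
just c ▷ f = f c

run : (n : ℕ) → Trie → (Vec Bool n → Check) → Check
run n ∅ f c = just c
run zero ● f c = f [] c
run zero (a ∣ b) f c = just c
run (suc n) ● f c = run n ● (λ v → f (false ∷ v)) c ▷ run n ● (λ v → f (true ∷ v))
run (suc n) (a ∣ b) f c = run n a (λ v → f (false ∷ v)) c ▷ run n b (λ v → f (true ∷ v))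

passes : Maybe (List ℕ) → Bool
passes (just []) = true
passes _ = false

rows : Vec Bool 16 → M4
rows (a ∷ b ∷ c ∷ d ∷ e ∷ f ∷ g ∷ h ∷ i ∷ j ∷ k ∷ l ∷ m ∷ n ∷ o ∷ p ∷ []) =
  (a ∷ b ∷ c ∷ d ∷ []) ∷ (e ∷ f ∷ g ∷ h ∷ []) ∷ (i ∷ j ∷ k ∷ l ∷ []) ∷ (m ∷ n ∷ o ∷ p ∷ []) ∷ []

binary : (k : ℕ) → ℕ → Vec Bool k
binary zero m = []
binary (suc k) m = odd (m % 2) ∷ binary k (m / 2)

mat : ℕ → M4
mat m = rows (binary 16 m)

-- If A and A + 1 are invertible, the characteristic polynomial of A has no root in GF(2), so it is
-- an irreducible quartic or (x² + x + 1)². The matrix `W` has x⁴ + x + 1 and equals `scal xF`; `W₆`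
-- has minimal polynomial (x² + x + 1)² and `W₃` has x² + x + 1, the subscripts being their orders.
0M 1M W W₆ W₃ : M4
0M = mat 0
1M = mat 0x8421
W  = mat 0x4298
W₆ = mat 0x4258
W₃ = mat 0x9268

-- Spread sets

meets : Trie → Vec Bool 16 → ∀ {k} → Vec Trie k → Vec Trie k
meets gl p [] = []
meets gl p (t ∷ ts) = meet t gl p ∷ meets gl p ts

-- For each outstanding first row there is a trie of the matrices that differ from all chosen ones
-- by an invertible matrix; a row without candidates closes the branch. The test `early` is applied
-- after every choice, so a branch also closes as soon as a reduction becomes available.
spread : Trie → (List M4 → Bool) → (List M4 → Check) → ∀ {k} → Vec Trie k → List M4 → Check
visit : Trie → (List M4 → Bool) → (List M4 → Check) → ∀ {k} → Vec Trie k → List M4 → Bool → Check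
spread gl early leaf ts X = visit gl early leaf ts X (early X)
visit gl early leaf ts X true c = just c
visit gl early leaf [] X false c = leaf X c
visit gl early leaf (t ∷ ts) X false c =
  run 16 t (λ p → spread gl early leaf (meets gl p ts) (rows p ∷ X)) c

compatible : Trie → List M4 → Trie → Trie
compatible gl [] t = t
compatible gl (A ∷ X) t = meet (compatible gl X t) gl (concat A)

rowsFrom : Trie → List M4 → ∀ {k} → Vec F16 k → Vec Trie k
rowsFrom gl X [] = []
rowsFrom gl X (a ∷ as) = compatible gl X (prefix a) ∷ rowsFrom gl X as

fresh : F16 → List M4 → Bool
fresh a X = allL (λ A → not (eqV a (lc 1F A))) X

differs : F16 → ∀ {k} → Vec F16 k → Bool
differs a [] = true
differs a (b ∷ bs) = not (eqV a b) ∧ differs a bs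

admissible : List M4 → ∀ {k} → Vec F16 k → Bool
admissible X [] = true
admissible X (a ∷ as) = fresh a X ∧ differs a as ∧ admissible X as

spreadCheck : (List M4 → Bool) → (List M4 → Check) → ∀ {k} → Vec F16 k → List M4 → List ℕ → Trie → Bool
spreadCheck early leaf as X c gl = admissible X as ∧ passes (spread gl early leaf (rowsFrom gl X as) X c)

-- Equivalences A ↦ P (A + R) Q of spread sets

regular : M4 → Bool
regular A = every 4 ● (λ c → not (nonzero c) ∨ nonzero (lc c A))

covers : List M4 → List M4 → Bool
covers X Y = allL (λ B → anyL (eqM B) X) Y

-- It is enough that the image of `X` contains `Y`: what is known about all spread sets containing
-- `Y` then holds for all those containing `X`.
iso : M4 → M4 → M4 → List M4 → List M4 → Bool
iso P Q R X Y = covers (mapL (λ A → (P ⊗ (A ⊞ R)) ⊗ Q) X) Y ∧ regular P ∧ regular Q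

isoTo : M4 → M4 → Maybe M4 → List M4 → Maybe (List M4) → Bool
isoTo P Q (just R) X (just Y) = iso P Q R X Y
isoTo P Q _ X _ = false

-- a certificate packs P, Q, the position of R in X and the number of the target
certified : List (List M4) → List M4 → Check
certified env X [] = nothing
certified env X (c ∷ cs) =
  if isoTo (mat (c % 65536)) (mat (c / 65536 % 65536)) (nth X (c / 4294967296 % 16)) X (nth env (c / 68719476736))
  then just cs else nothing

search : ∀ n → (Vec Bool n → Bool) → Maybe (Vec Bool n)
search zero p = if p [] then just [] else nothing
search (suc n) p with search n (λ v → p (false ∷ v))
... | just v = just (false ∷ v)
... | nothing with search n (λ v → p (true ∷ v))
...   | just v = just (true ∷ v)
...   | nothing = nothing

solve : M4 → F16 → F16
solve A v with search 4 (λ c → eqV (lc c A) v)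
... | just c = c
-- Default for a system without solution. The results are used either for an injective `A` or in a
-- transformation that `iso` verifies afterwards.
... | nothing = 0F

inverse : M4 → M4
inverse A = solve A e₁ ∷ solve A e₂ ∷ solve A e₃ ∷ solve A e₄ ∷ []
  where
  e₁ e₂ e₃ e₄ : F16
  e₁ = binary 4 1
  e₂ = binary 4 2
  e₃ = binary 4 4
  e₄ = binary 4 8

vectors : List F16
vectors = mapL (binary 4) (1 ∷ 2 ∷ 3 ∷ 4 ∷ 5 ∷ 6 ∷ 7 ∷ 8 ∷ 9 ∷ 10 ∷ 11 ∷ 12 ∷ 13 ∷ 14 ∷ 15 ∷ [])

-- N is conjugate to W if xN⁴ = x + xN, by the basis x, xN³, xN², xN,
-- and to W₆ if xN⁴ = x + xN²
companion : (F16 → M4 → F16) → M4 → F16 → Maybe M4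
companion f N x = go (lc x N)
  where
  last : F16 → F16 → F16 → Maybe M4
  last x₁ x₂ x₃ = if eqV (lc x₃ N) (x +ᵥ f x N) then just (x ∷ x₃ ∷ x₂ ∷ x₁ ∷ []) else nothing
  more : F16 → F16 → Maybe M4
  more x₁ x₂ = last x₁ x₂ (lc x₂ N)
  go : F16 → Maybe M4
  go x₁ = more x₁ (lc x₁ N)

module _ (X Y : List M4) where
  conjugates : M4 → M4 → Maybe M4 → Bool
  conjugates P R nothing = false
  conjugates P R (just T) = iso (T ⊗ P) (inverse T) R X Y

  cyclic : (F16 → M4 → F16) → List F16 → M4 → M4 → M4 → Bool
  cyclic f xs P R N = anyL (λ x → conjugates P R (companion f N x)) xs

  frame : (F16 → M4 → F16) → List F16 → M4 → M4 → M4 → Bool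
  frame f xs A C P = cyclic f xs P A (P ⊗ (C ⊞ A))

  -- The counterpart for `W₃`, which has no cyclic vector: if N² + N + 1 = 0 and x, xN, u, uN are
  -- independent, then the basis x, uN, u, xN turns N into `W₃`.
  quartic : M4 → Bool
  quartic N = anyL (λ x → anyL (λ u → conjugates 1M 0M (just (x ∷ lc u N ∷ u ∷ lc x N ∷ []))) vectors) vectors

normalFrame : List M4
normalFrame = 0M ∷ 1M ∷ W ∷ []

-- If N = B⁻¹A is irreducible, then one of N, N⁻¹ and (N + 1)⁻¹ N is conjugate to W.
module _ (X : List M4) (A B : M4) where
  -- With e the first unit vector, x₁, x₂, x₃ are eN, eN², eN³ and y is e + eN⁴. The three tests
  -- recognise x⁴ + x + 1, x⁴ + x³ + 1 and x⁴ + x³ + x² + x + 1, which are all the irreducible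
  -- quartics over GF(2). The chain `kind₁`, `kind₂`, `kind₃` binds each power once, so that it is
  -- shared by the tests.
  kind : M4 → F16 → F16 → F16 → F16 → Bool
  kind P x₁ x₂ x₃ y =
    if eqV y x₁ then try 0M A P
    else if eqV y x₃ then try 0M B (inverse A)
    else if eqV y (x₁ +ᵥ x₂ +ᵥ x₃) then try A 0M (inverse (B ⊞ A))
    else false
    where
    try : M4 → M4 → M4 → Bool
    try = frame X normalFrame lc (binary 4 1 ∷ [])

  kind₃ : M4 → M4 → F16 → F16 → F16 → Bool
  kind₃ P N x₁ x₂ x₃ = kind P x₁ x₂ x₃ (binary 4 1 +ᵥ lc x₃ N)

  kind₂ : M4 → M4 → F16 → F16 → Bool
  kind₂ P N x₁ x₂ = kind₃ P N x₁ x₂ (lc x₂ N)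

  kind₁ : M4 → M4 → F16 → Bool
  kind₁ P N x₁ = kind₂ P N x₁ (lc x₁ N)

  crossRatio : M4 → M4 → Bool
  crossRatio P N = kind₁ P N (lc (binary 4 1) N)

irreducible : List M4 → Bool
irreducible [] = false
irreducible (B ∷ X) = scan (inverse B)
  where
  scan : M4 → Bool
  scan P = anyL (λ A → crossRatio (B ∷ X) A B P (P ⊗ A)) X

-- The last two alternatives treat characteristic polynomial (x² + x + 1)²: with a cyclic vector B
-- is conjugate to `W₆`, and otherwise B² + B + 1 = 0 and B is conjugate to `W₃`. Conjugation fixes
-- 0 and 1, so the frame is kept.
normalisable : List M4 → Bool
normalisable [] = false
normalisable (B ∷ X) = irreducible (B ∷ X)
  ∨ frame (B ∷ X) (0M ∷ 1M ∷ W₆ ∷ []) (λ x N → lc (lc x N) N) vectors 0M B 1M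
  ∨ quartic (B ∷ X) (0M ∷ 1M ∷ W₃ ∷ []) B

never : List M4 → Bool
never X = false

-- For searches in which every branch must close, by `early` or for want of candidates, before all
-- rows are filled.
failing : List M4 → Check
failing X c = nothing

-- Lookup tables and the search for functions with distinct slopes

data Table (A : Set) : Set where
  val : A → Table A
  _∥_ : Table A → Table A → Table A

table : {A : Set} (n : ℕ) → (Vec Bool n → A) → Table A
table zero f = val (f [])
table (suc n) f = table n (λ v → f (false ∷ v)) ∥ table n (λ v → f (true ∷ v))

get : {A : Set} → A → ∀ {n} → Table A → Vec Bool n → A
get d (val x) _ = x
get d (s ∥ t) [] = d
get d (s ∥ t) (false ∷ u) = get d s u
get d (s ∥ t) (true ∷ u) = get d t u

-- The entry at u + v, found by walking along both vectors without forming their sum.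
at : ∀ {n} → Table F16 → Vec Bool n → Vec Bool n → F16
at (val x) _ _ = x
at (s ∥ t) [] [] = 0F
at (s ∥ t) (false ∷ u) (false ∷ v) = at s u v
at (s ∥ t) (false ∷ u) (true ∷ v) = at t u v
at (s ∥ t) (true ∷ u) (false ∷ v) = at t u v
at (s ∥ t) (true ∷ u) (true ∷ v) = at s u v

-- Search for the values of a function with prescribed slope tables, the slopes
-- from each point being distinct

-- A surviving candidate value carries the set of slopes that it already makes with the values fixed
-- so far. A repeated slope removes the candidate.
data Cand : Set where
  none : Cand
  cand : F16 → Trie → Cand → Cand

keep : Bool → F16 → F16 → Trie → Cand → Cand
keep true b u m l = l
keep false b u m l = cand u (insert b m) l

keepIf : F16 → F16 → Trie → Cand → Cand
keepIf b u m l = keep (mem m b) b u m l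

extend : Table F16 → F16 → Cand → Cand
extend T v none = none
extend T v (cand u m l) = keepIf (at T u v) u m (extend T v l)

-- The pending tables give the slopes against the earlier points in the order in which these receive
-- values; none is left when the turn of the item comes.
data Item : Set where
  item : List (Table F16) → Cand → Item

step : F16 → Item → Item
step v (item [] l) = item [] l
step v (item (T ∷ Ts) l) = item Ts (extend T v l)

steps : F16 → ∀ {k} → Vec Item k → Vec Item k
steps v [] = []
steps v (i ∷ is) = step v i ∷ steps v is

assign : (List F16 → Check) → ∀ {k} → Vec Item k → List F16 → Check
choose : (List F16 → Check) → Cand → ∀ {k} → Vec Item k → List F16 → Check
assign leaf [] vs c = leaf vs c
assign leaf (item _ l ∷ is) vs c = choose leaf l is vs c
choose leaf none is vs c = just c
choose leaf (cand u _ l) is vs c = assign leaf (steps u is) (u ∷ vs) c ▷ choose leaf l is vs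

allCands : List F16 → Cand
allCands [] = none
allCands (u ∷ us) = cand u ∅ (allCands us)

snoc : {A : Set} → List A → A → List A
snoc [] y = y ∷ []
snoc (x ∷ xs) y = x ∷ snoc xs y

items : {P : Set} → (P → P → Table F16) → List P → ∀ {k} → Vec P k → Vec Item k
items slope X [] = []
items slope X (A ∷ As) = item (mapL (slope A) X) (allCands (0F ∷ vectors)) ∷ items slope (snoc X A) As

linear : M4 → Table F16
linear D = table 4 (λ w → lc w D)

matrixSlope : M4 → M4 → Table F16
matrixSlope A B = linear (inverse (A ⊞ B))

distinct : List M4 → Bool
distinct [] = true
distinct (A ∷ X) = allL (λ B → not (eqM A B)) X ∧ distinct X

-- no three concurrent lines of the translation plane form a line oval with the line at infinity
noOval : List M4 → Bool
noOval (A ∷ B ∷ C ∷ X) = distinct (A ∷ B ∷ C ∷ X) ∧ passes (assign (λ _ _ → nothing)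
  (steps 1F (steps 0F (steps 0F (items matrixSlope (A ∷ B ∷ C ∷ []) (fromList X))))) [] [])
noOval _ = false

-- Scalar matrices and the search for values of B

-- transpose of the matrix of multiplication by t
scal : F16 → M4
scal (a ∷ b ∷ c ∷ d ∷ []) =
  (a ∷ d ∷ c ∷ b ∷ []) ∷
  (b ∷ (a xor d) ∷ (d xor c) ∷ (c xor b) ∷ []) ∷
  (c ∷ b ∷ (a xor d) ∷ (d xor c) ∷ []) ∷
  (d ∷ c ∷ b ∷ (a xor d) ∷ []) ∷ []

unscal : M4 → F16
unscal ((a ∷ d ∷ c ∷ b ∷ []) ∷ _) = a ∷ b ∷ c ∷ d ∷ []

isScalar : M4 → Bool
isScalar B = eqM B (scal (unscal B))

-- The power a¹⁴, because a¹⁵ = 1 for a ≠ 0.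
inv : F16 → F16
inv a = a² *F (a⁴ *F (a⁴ *F a⁴))
  where
  a² a⁴ : F16
  a² = a *F a
  a⁴ = a² *F a²

x² : F16
x² = binary 4 4

Table₂ : Set
Table₂ = Table (Table F16)

quotients products : Table₂
quotients = table 4 (λ a → table 4 (λ b → a *F inv b))
products = table 4 (λ a → table 4 (λ b → a *F b))

get₂ : Table₂ → F16 → F16 → F16
get₂ T a b = get 0F (get (val 0F) T a) b

-- `pt r M` records that B has the value M at the field element r, while `op r t` leaves the value
-- at r open among the members of t.
data Point : Set where
  pt : F16 → M4 → Point

data Open : Set where
  op : F16 → Trie → Open

openAll : ∀ {k} → Vec F16 k → Vec Open k
openAll [] = []
openAll (r ∷ rs) = op r ● ∷ openAll rs

basePoints : List Point
basePoints = pt xF 1M ∷ pt 1F 0M ∷ pt 0F 0M ∷ []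

collect : List M4 → Trie
collect [] = ∅
collect (M ∷ Ms) = insert (concat M) (collect Ms)

-- Applied with P = W⁻¹ and Q = W. Since W has order 15, fuel 15 reaches the whole orbit of M under
-- conjugation.
conjugateIn : M4 → M4 → ℕ → Trie → M4 → Bool
conjugateIn P Q zero t M = false
conjugateIn P Q (suc n) t M = mem t (concat M) ∨ conjugateIn P Q n t ((P ⊗ M) ⊗ Q)

conjugates-refuted : M4 → M4 → Trie → Vec Open 1 → Bool
conjugates-refuted P Q ms (op _ t ∷ []) = every 16 t (λ y → isScalar (rows y) ∨ conjugateIn P Q 15 ms (rows y))

allDiffer : ∀ {k} → Vec F16 k → Bool
allDiffer [] = true
allDiffer (a ∷ as) = differs a as ∧ allDiffer as

module _ (gl : Trie) (quot : Table₂) where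

  -- Linear interpolation: the function affine over GF(16) with value B at p and C at q, evaluated
  -- at r. The condition on three members says that the true value at r differs from it by an
  -- invertible matrix.
  forbidden : F16 → M4 → F16 → M4 → F16 → M4
  forbidden p B q C r = B ⊞ ((B ⊞ C) ⊗ scal (get₂ quot (r +ᵥ p) (p +ᵥ q)))

  refine : F16 → M4 → F16 → List Point → Trie → Trie
  refine p B r [] t = t
  refine p B r (pt q C ∷ ps) t = refine p B r ps (meet t gl (concat (forbidden p B q C r)))

  refines : F16 → M4 → List Point → ∀ {k} → Vec Open k → Vec Open k
  refines p B ps [] = []
  refines p B ps (op r t ∷ os) = op r (refine p B r ps t) ∷ refines p B ps os

  refute : List Point → ∀ {k} → Vec Open k → Bool
  -- All open points have received compatible values, so there is no contradiction.
  refute ps [] = false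
  refute ps (op r t ∷ os) = every 16 t (λ x → refute (pt r (rows x) ∷ ps) (refines r (rows x) ps os))

  -- the values of B that are compatible with B(0) = B(1) = 0 and B(x) = 1
  initially : ∀ {k} → Vec F16 k → Vec Open k
  initially rs = refines xF 1M (pt 1F 0M ∷ pt 0F 0M ∷ []) (refines 1F 0M (pt 0F 0M ∷ []) (openAll rs))

  refuteAll : List M4 → ∀ {k} → Vec Open k → Bool
  refuteAll Ms os = allL (λ M → refute (pt x² M ∷ basePoints) (refines x² M basePoints os)) Ms

  -- Two statements together force a scalar value at x²: each representative in `Ms` fails to extend
  -- to the points of `rs`, and each value compatible with the normalised values at 0, 1 and x is a
  -- scalar or conjugate, under powers of x, to a representative. Conjugation shortens the list,
  -- because it preserves all scalars and hence the normalisation.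
  scalarCheck : List M4 → ∀ {k} → Vec F16 k → Bool
  scalarCheck Ms rs = allDiffer (0F ∷ 1F ∷ xF ∷ x² ∷ rs) ∧ refuteAll Ms (initially rs) ∧ conjugates-refuted (scal (inv xF)) W (collect Ms) (initially (x² ∷ []))

-- Lunelli–Sce o-polynomial x¹² + x¹⁰ + η¹¹x⁸ + x⁶ + η²x⁴ + η⁹x²
hLS : F16 → F16
hLS x = s *F (η⁹ +F (s *F (η² +F (s *F (1F +F (s *F (η¹¹ +F (s *F (1F +F s)))))))))
  where
  s η² η⁹ η¹¹ : F16
  s = x *F x
  η² = binary 4 4
  η⁹ = binary 4 10
  η¹¹ = binary 4 14

lunelliSce : Points17
lunelliSce zero    = 0F ∷ 0F ∷ 1F ∷ []
lunelliSce (suc t) = 1F ∷ enumF16 t ∷ hLS (enumF16 t) ∷ []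

-- Certificates of equivalence for ovals

data Kind : Set where
  regularK pointedK lunelliSceK : Kind

data Cert : Set where
  cert : Kind → Fin 4 → Mat16 → Cert

oval : Kind → Points17
oval regularK = conic
oval pointedK = pointedConic
oval lunelliSceK = lunelliSce

-- Multiplication, division and the polynomial `hLS` are parameters so that evaluation can read them
-- from tables. The soundness proof assumes only that they agree with the field operations and with
-- `hLS`.
module _ (mul quo : F16 → F16 → F16) (h : Table F16) where

  dotm : V3 → V3 → F16
  dotm (a ∷ b ∷ c ∷ []) (x ∷ y ∷ z ∷ []) = mul a x +ᵥ (mul b y +ᵥ mul c z)

  frobm : ℕ → F16 → F16
  frobm zero a = a
  frobm (suc k) a = frobm k (mul a a)

  value : Kind → F16 → F16
  value lunelliSceK t = get 0F h t
  value _ t = mul t t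

  atInfinity : Kind → F16 → F16 → Bool
  atInfinity pointedK y z = nonzero y ∧ not (nonzero z)
  atInfinity _ y z = nonzero z ∧ not (nonzero y)

  onOval : Kind → F16 → F16 → F16 → Bool
  onOval K x y z = if nonzero x then eqV z (mul x (value K (quo y x))) else atInfinity K y z

  onImage : Kind → Mat16 → F16 → F16 → F16 → Bool
  onImage K (r₀ ∷ r₁ ∷ r₂ ∷ []) x y z = onOval K (dotm r₀ v) (dotm r₁ v) (dotm r₂ v)
    where
    v : V3
    v = x ∷ y ∷ z ∷ []

  affine : Kind → ℕ → Mat16 → List F16 → List F16 → Bool
  affine K k A (p ∷ ps) (q ∷ qs) = onImage K A 1F (frobm k p) (frobm k q) ∧ affine K k A ps qs
  affine K k A _ _ = true

  maps : List F16 → List F16 → Cert → Bool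
  maps ps qs (cert K k A) = affine K (toℕ k) A ps qs ∧ (onImage K A 0F 0F 1F ∧ nonzero (detM A))

frobenius : ℕ → Fin 4
frobenius 0 = zero
frobenius 1 = suc zero
frobenius 2 = suc (suc zero)
frobenius _ = suc (suc (suc zero))

kindOf : ℕ → Kind
kindOf 0 = regularK
kindOf 1 = pointedK
kindOf _ = lunelliSceK

nibbles : (k : ℕ) → ℕ → Vec F16 k
nibbles zero m = []
nibbles (suc k) m = binary 4 (m % 16) ∷ nibbles k (m / 16)

decode : ℕ → Cert
decode m = go (nibbles 9 (m / 16))
  where
  go : Vec F16 9 → Cert
  go (a ∷ b ∷ c ∷ d ∷ e ∷ f ∷ g ∷ h ∷ i ∷ []) = cert (kindOf (m / 4 % 4)) (frobenius (m % 4))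
    ((a ∷ b ∷ c ∷ []) ∷ (d ∷ e ∷ f ∷ []) ∷ (g ∷ h ∷ i ∷ []) ∷ [])

fieldSlope : Table₂ → F16 → F16 → Table F16
fieldSlope qu p q = table 4 (λ w → get₂ qu w (p +ᵥ q))

ovalLeaf : Table₂ → Table₂ → Table F16 → List F16 → List F16 → Check
ovalLeaf pr qu h ps vs [] = nothing
ovalLeaf pr qu h ps vs (c ∷ cs) =
  if maps (get₂ pr) (get₂ qu) h ps vs (decode c) then just cs else nothing

-- The search puts each new value in front, so the list of points that matches the values is in
-- reverse order of assignment.
reverseOnto : {A : Set} → ∀ {k} → Vec A k → List A → List A
reverseOnto [] ys = ys
reverseOnto (x ∷ xs) ys = reverseOnto xs (x ∷ ys)

ovalSearch : Table₂ → Table₂ → Table F16 → ∀ {k} → Vec F16 k → List ℕ → Bool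
ovalSearch pr qu h ps cs = passes (assign (ovalLeaf pr qu h (reverseOnto ps (xF ∷ 1F ∷ 0F ∷ [])))
  -- The normalised values f(0) = f(1) = 0 and f(x) = 1 are processed before the first choice.
  (steps 1F (steps 0F (steps 0F (items (fieldSlope qu) (0F ∷ 1F ∷ xF ∷ []) ps)))) (1F ∷ 0F ∷ 0F ∷ []) cs)

-- Data of the searches

-- A 4 × 4 matrix is packed into 16 bits, row by row.
nonDesarguesian : List (List M4)
nonDesarguesian = mapL (mapL mat) (
    (0xb5f6 ∷ 0xdf19 ∷ 0x4872 ∷ 0xcbae ∷ 0xfa23 ∷ 0xe357 ∷ 0x2485 ∷ 0x673c ∷ 0x39cb ∷ 0x816d ∷ 0x5d4a ∷ 0xaed1 ∷ 0x129f ∷ 0x96b8 ∷ 0x7ce4 ∷ 0x0 ∷ [])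
  ∷ (0x8f45 ∷ 0x63da ∷ 0x195e ∷ 0xec9f ∷ 0x0 ∷ 0x47a2 ∷ 0x2478 ∷ 0x5efc ∷ 0xf5c1 ∷ 0xb263 ∷ 0xc8e7 ∷ 0x7a84 ∷ 0x961b ∷ 0xab3d ∷ 0x3d26 ∷ 0xd1b9 ∷ [])
  ∷ (0xcf5e ∷ 0xfdba ∷ 0x58fc ∷ 0x3c24 ∷ 0xd769 ∷ 0x1a3f ∷ 0x62eb ∷ 0x8943 ∷ 0xa375 ∷ 0xe69d ∷ 0x9ec1 ∷ 0x41a2 ∷ 0x0 ∷ 0x7b86 ∷ 0xb5d7 ∷ 0x2418 ∷ [])
  ∷ (0xa924 ∷ 0x9751 ∷ 0x5e16 ∷ 0x7a9b ∷ 0x62b7 ∷ 0xebdc ∷ 0xb1cf ∷ 0x248d ∷ 0xd54a ∷ 0x8fa3 ∷ 0x0 ∷ 0x48f2 ∷ 0xcd39 ∷ 0x1378 ∷ 0xf6e5 ∷ 0x3c6e ∷ [])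
  ∷ (0x47a2 ∷ 0xb9d7 ∷ 0x8f45 ∷ 0xf1b6 ∷ 0xcd5e ∷ 0x62c9 ∷ 0xd8ec ∷ 0x9361 ∷ 0x5a8b ∷ 0x1c3a ∷ 0x7ef3 ∷ 0x0 ∷ 0x3b24 ∷ 0xe59d ∷ 0x2478 ∷ 0xa61f ∷ [])
  ∷ (0xd547 ∷ 0x735e ∷ 0x81b5 ∷ 0x69a8 ∷ 0xeb3c ∷ 0x32c4 ∷ 0xa72b ∷ 0x48f2 ∷ 0x9a71 ∷ 0x0 ∷ 0xbcef ∷ 0x1f6a ∷ 0x5e16 ∷ 0x248d ∷ 0xfd93 ∷ 0xc6d9 ∷ [])
  ∷ (0xab94 ∷ 0x47a2 ∷ 0x8f31 ∷ 0x31eb ∷ 0x9cbd ∷ 0xf26a ∷ 0x6815 ∷ 0x59fe ∷ 0x2478 ∷ 0xd6cf ∷ 0xc543 ∷ 0xea29 ∷ 0x0 ∷ 0x1e5c ∷ 0xb3d7 ∷ 0x7d86 ∷ [])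
  ∷ (0x0 ∷ 0x8b75 ∷ 0x43a2 ∷ 0x924a ∷ 0xfa9e ∷ 0x39b6 ∷ 0xc1e7 ∷ 0x1d5f ∷ 0xaef3 ∷ 0xb58c ∷ 0x78db ∷ 0xdc69 ∷ 0x2438 ∷ 0x57cd ∷ 0x6f14 ∷ 0xe621 ∷ [])
  ∷ (0x5c3d ∷ 0x73be ∷ 0x0 ∷ 0xa2e5 ∷ 0x6a13 ∷ 0x3e81 ∷ 0x1b9f ∷ 0xfdcb ∷ 0x986a ∷ 0x47a2 ∷ 0x8f54 ∷ 0xd6fc ∷ 0xe149 ∷ 0x2478 ∷ 0xb526 ∷ 0xc9d7 ∷ [])
  ∷ (0xa6d4 ∷ 0x14a2 ∷ 0x9fb5 ∷ 0x695e ∷ 0xe713 ∷ 0x2148 ∷ 0xd5ca ∷ 0x3876 ∷ 0x0 ∷ 0x7dfc ∷ 0x8c61 ∷ 0xce9d ∷ 0xba2f ∷ 0x43eb ∷ 0xf239 ∷ 0x5b87 ∷ [])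
  ∷ (0x1ce9 ∷ 0x7e5a ∷ 0xcd7e ∷ 0xd637 ∷ 0x971c ∷ 0x4892 ∷ 0xe9d1 ∷ 0x3168 ∷ 0x62f5 ∷ 0xf5b3 ∷ 0x0 ∷ 0x8b46 ∷ 0x5a24 ∷ 0xafcd ∷ 0xb3af ∷ 0x248b ∷ [])
  ∷ (0x3bdf ∷ 0x4812 ∷ 0x2483 ∷ 0xfde4 ∷ 0x6758 ∷ 0xc63b ∷ 0x0 ∷ 0x8341 ∷ 0xd967 ∷ 0x7ea5 ∷ 0x9abc ∷ 0xe19d ∷ 0x52ca ∷ 0xaf2e ∷ 0x1c79 ∷ 0xb5f6 ∷ [])
  ∷ (0x248f ∷ 0x5bac ∷ 0x48d2 ∷ 0xe139 ∷ 0xa9eb ∷ 0x3e67 ∷ 0xf713 ∷ 0x0 ∷ 0x8f4a ∷ 0xd6c8 ∷ 0x9d21 ∷ 0x137e ∷ 0xba95 ∷ 0x6c5d ∷ 0x72f4 ∷ 0xc5b6 ∷ [])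
  ∷ (0xb357 ∷ 0x6c19 ∷ 0xfdae ∷ 0x163f ∷ 0x32b4 ∷ 0x4892 ∷ 0xafc1 ∷ 0x0 ∷ 0x5ae8 ∷ 0xd925 ∷ 0x97dc ∷ 0x248b ∷ 0xe57d ∷ 0x7e63 ∷ 0x8b4a ∷ 0xc1f6 ∷ [])
  ∷ (0xb1cf ∷ 0x721a ∷ 0xc3d5 ∷ 0xfd7e ∷ 0xe9b4 ∷ 0x8c53 ∷ 0x248d ∷ 0x5697 ∷ 0x1a26 ∷ 0x6f48 ∷ 0x48f2 ∷ 0xabe9 ∷ 0xd531 ∷ 0x976c ∷ 0x3eab ∷ 0x0 ∷ [])
  ∷ (0x0 ∷ 0xc79f ∷ 0xbea3 ∷ 0xab68 ∷ 0x314e ∷ 0x5db9 ∷ 0x793c ∷ 0x2485 ∷ 0x6cf7 ∷ 0x8fed ∷ 0xe31a ∷ 0x15cb ∷ 0x9a26 ∷ 0x4872 ∷ 0xf6d1 ∷ 0xd254 ∷ []) ∷ [])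

desarguesian : List M4
desarguesian = mapL mat (0x0 ∷ 0x8421 ∷ 0x4298 ∷ 0xc6b9 ∷ 0x29c4 ∷ 0xade5 ∷ 0x6b5c ∷ 0xef7d ∷ 0x9c62 ∷ 0x1843 ∷ 0xdefa ∷ 0x5adb ∷ 0xb5a6 ∷ 0x3187 ∷ 0xf73e ∷ 0x731f ∷ [])

spreads : List (List M4)
spreads = nonDesarguesian List.++ desarguesian ∷ []

-- For each orbit of spread sets containing 0, 1 and W: a fourth element, an order of the
-- remaining first rows for the search, and one certificate of equivalence per spread set found.
classData : List (ℕ × Vec ℕ 12 × List ℕ)
classData =
    (0x1f64 , (13 ∷ 14 ∷ 11 ∷ 3 ∷ 10 ∷ 9 ∷ 12 ∷ 6 ∷ 15 ∷ 2 ∷ 7 ∷ 5 ∷ []) ,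
      0x7f5879e36f ∷ 0x4563a2cd26 ∷ 0xaed38a47e2 ∷ 0x4e518fc39b ∷ [])
  ∷ (0x274f , (14 ∷ 6 ∷ 3 ∷ 11 ∷ 4 ∷ 12 ∷ 2 ∷ 10 ∷ 5 ∷ 7 ∷ 9 ∷ 13 ∷ []) ,
      0x30bfec4619 ∷ 0x482d76dc9f ∷ 0xfa297d84a ∷ 0x394f97fb32 ∷ 0x36b456c6f7 ∷ 0xfb7d21b75 ∷ 0x3efbc13dc5 ∷ 0x3ff4395b43 ∷ 0x3c6cb8d3c7 ∷ 0xbfe2715ed9
      ∷ 0x6fb8ca4ec9 ∷ 0x2f1639de2 ∷ 0x394bd51d5a ∷ 0x4745f8985f ∷ 0x35754aca15 ∷ 0xff7e55bc1 ∷ 0x3919f219d2 ∷ 0x412f5eb471 ∷ 0xf8f232d8e ∷ 0xfce7679cf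
      ∷ 0x2453bb736 ∷ 0xbf461ae37b ∷ 0xfcb53ed52 ∷ 0x6fe6a5c35b ∷ [])
  ∷ (0x3159 , (14 ∷ 3 ∷ 15 ∷ 10 ∷ 6 ∷ 11 ∷ 5 ∷ 7 ∷ 4 ∷ 2 ∷ 13 ∷ 12 ∷ []) ,
      0xf72c6457c ∷ 0xf29daa185 ∷ 0xf51789345 ∷ 0x8f853c8349 ∷ 0x9f86598349 ∷ 0x2edc78a729 ∷ 0x3d8324f6c7 ∷ 0xe8ecd36b7 ∷ 0xd4fdafad4 ∷ 0x4f7e58b5d9
      ∷ 0x4f9a2d9542 ∷ 0x4fb1d55ecf ∷ 0x4f1c5ea7b5 ∷ 0x4f1d477a64 ∷ 0x4f867332f7 ∷ 0x4f729f78d4 ∷ 0x4fc34a261b ∷ 0xe3e787f63 ∷ 0x117d3a78b ∷ 0x2a5487fc9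
      ∷ 0x5e823fb814 ∷ 0x363fae9576 ∷ 0x3b1a3478c9 ∷ 0x4f95d79482 ∷ 0x4f1f63ba79 ∷ 0x2ebac849af ∷ 0x2f2f39b1d2 ∷ 0x8f6b5ceb2f ∷ 0x4073813acb ∷ 0x2fe31931d4
      ∷ 0x2f3ca7da98 ∷ 0x9f3d69eb2f ∷ 0x2fc5b49c1b ∷ 0x34dc28936d ∷ 0x46e9dcfd63 ∷ 0x42738e36cb ∷ 0x3ce9a2f79c ∷ 0x4f8badf32a ∷ 0x48c25a9edf ∷ 0x4f94ce4953
      ∷ 0x2fea8d2dc9 ∷ 0x4e64854dec ∷ 0x2f6148152e ∷ 0x2f2b747c13 ∷ 0x327e5dc163 ∷ 0x3ee47ceb4c ∷ 0x39df1542ad ∷ 0x42cda593df ∷ 0x3c3b69a9e1 ∷ 0x2f5defcfb6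
      ∷ 0x2fc86d4dc7 ∷ 0x3e358a64f1 ∷ 0x488ec91da4 ∷ 0x30251c4f95 ∷ 0x3168b2a72e ∷ 0x5e96e5f6cb ∷ 0x24ec1b756 ∷ 0xf5d734eb7 ∷ 0xf2fb86158 ∷ 0xf524d4298
      ∷ 0x48d742a92e ∷ 0xf53f42ad4 ∷ 0x39f934e674 ∷ 0xf6fed79f2 ∷ 0x325ce3c3ab ∷ 0x4e8a412f4c ∷ 0x4e67f354bd ∷ 0xf689bb4e3 ∷ 0x30741ad93f ∷ 0x4ec937316d
      ∷ 0xf7e63f7d4 ∷ 0x34b6a4dc87 ∷ [])
  ∷ (0x3649 , (6 ∷ 15 ∷ 12 ∷ 10 ∷ 14 ∷ 2 ∷ 5 ∷ 3 ∷ 11 ∷ 4 ∷ 7 ∷ 13 ∷ []) ,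
      0x328e437598 ∷ 0x3e72a4ac12 ∷ 0xfc35ddb32 ∷ 0xbf5a342d7c ∷ 0x6f452ebdec ∷ 0x33a6d8beca ∷ 0x3cc164dce9 ∷ 0xfa67e78db ∷ 0xf932c2fe9 ∷ 0x3fc28d13a6
      ∷ 0x2fc1f951da ∷ 0x3136b7b531 ∷ 0x2f3bdfc758 ∷ 0x77b36c561 ∷ 0xbf583c26c3 ∷ 0x6ff5e9b8da ∷ [])
  ∷ (0xc85f , (2 ∷ 10 ∷ 14 ∷ 9 ∷ 7 ∷ 13 ∷ 4 ∷ 3 ∷ 11 ∷ 6 ∷ 5 ∷ 12 ∷ []) ,
      0x468d34b63c ∷ 0xe84399b1e ∷ 0x414f17a1e7 ∷ 0x3054285a8c ∷ 0x7e675fbcd4 ∷ 0x4f4e3f159f ∷ 0xb42f5ed24 ∷ 0x4a56e24a5d ∷ 0x3d564d1a58 ∷ 0x38b4e8be8a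
      ∷ 0x31d74c895b ∷ 0x48d279d59f ∷ 0x4b8943f92c ∷ 0x33adcf46e9 ∷ 0xbc5aece69 ∷ 0x2f1a3d6398 ∷ 0xef6e5afc8 ∷ 0x3116fd9cf8 ∷ 0x45f1344596 ∷ 0x23e28b8e2
      ∷ 0xa9c83815b ∷ 0x391927f863 ∷ 0x8f745f685 ∷ 0x35183d1865 ∷ 0x5de766c7f ∷ 0xaf83268c31 ∷ 0x7fa36489e4 ∷ 0xeff8245dae ∷ 0x7f435b9bf3 ∷ 0x7f2e8ba4f3
      ∷ 0xefef3862ab ∷ 0xaf273f576e ∷ 0xd0cd3429c4 ∷ 0x4fe5f7182f ∷ 0x43ce9fe9bd ∷ 0xe679acf623 ∷ 0x4bbe23ceba ∷ 0xaf4df752b4 ∷ 0xaf2bd7a94f ∷ 0x7f5879e36f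
      ∷ 0xce35df17b8 ∷ 0x5f834d95bd ∷ 0x5f5b748c9b ∷ 0x408234b53c ∷ 0x4595d77f13 ∷ 0x41845762d3 ∷ 0xbd567ecab ∷ 0x384d688acb ∷ 0x31f73163df ∷ 0x4c6bef18b7
      ∷ 0x3ac9b67649 ∷ 0x3221f558f3 ∷ 0x7fdafb24b7 ∷ 0xafa367e6b4 ∷ 0x4f2947d695 ∷ 0x4f27a31b85 ∷ 0xef23d81e34 ∷ 0xe113acfc79 ∷ 0x43a79f1348 ∷ 0x481b248942
      ∷ 0xbe94f8d3f ∷ 0x42db937d46 ∷ 0x33e8432eba ∷ 0x34b1654b63 ∷ 0x4f7293ebca ∷ 0x30923c6ed2 ∷ 0x3a16eb86c7 ∷ 0xb3c286194 ∷ 0x35ba59e914 ∷ 0x41f3e7afde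
      ∷ 0x5fb2f57b81 ∷ 0x3584d7e815 ∷ 0xf8cb67dfe ∷ 0x5fc63497b6 ∷ 0x33c92fbfe9 ∷ 0xff9122148 ∷ 0x4f6fc867b3 ∷ 0x31784af48a ∷ 0xf75a45cb6 ∷ 0x4f92376d2a
      ∷ 0x498d43ec9f ∷ 0x42d4b8d92e ∷ 0x4ff648d3b7 ∷ 0xcfb2af82c3 ∷ 0xaf1c5be1ad ∷ 0x5f84351b53 ∷ 0xf31f6e243 ∷ 0x36e567753c ∷ 0x44e71395b1 ∷ 0x2f54e8d25c
      ∷ 0x4413bf8b2c ∷ 0x326fc129e1 ∷ 0xe72dc34d6 ∷ 0x387382c156 ∷ 0x35bd141d28 ∷ 0x4f6af729d8 ∷ 0x4f8ef37ba8 ∷ 0x31ce96dc7e ∷ 0x4fbad821be ∷ 0x4eac237a64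
      ∷ 0x5f57b18a15 ∷ 0xc4427f236d ∷ 0xd6d38c4298 ∷ 0xccdb1fef7d ∷ 0xdc9f5bef7d ∷ 0x2f8f646a9e ∷ 0x4f2fa3ed41 ∷ 0x3793b731be ∷ 0x313be9736d ∷ 0x4e75efed42
      ∷ 0x3b854aad46 ∷ 0x4448d75b16 ∷ 0x4f9625c7a4 ∷ 0xa3d17d8ea ∷ 0x4f746e81bc ∷ 0xaf9f7d6d9c ∷ 0x7ffb1d6a8b ∷ 0x4253bfc23b ∷ 0xb46bcebac ∷ 0x30bf59de82
      ∷ 0xbc96d4e67 ∷ 0x4b81c617a4 ∷ 0x45dfa1b371 ∷ 0x3d7d8c4596 ∷ 0x39ec156291 ∷ 0x3aa764c6e7 ∷ 0xefa87c17ae ∷ 0xd6b53c2afe ∷ 0xcf36e4f9d8 ∷ 0xef93b59471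
      ∷ 0x4e2b68b673 ∷ 0x40a157c789 ∷ 0x5f174d3548 ∷ 0x5fb2f5c35b ∷ 0x4fe37fd623 ∷ 0x4f24788421 ∷ 0x5f8b91683 ∷ 0x4ffa12da83 ∷ 0x4f3dc6ef7d ∷ 0x4f19be6b5c
      ∷ 0x4fbc85c9ea ∷ 0x4f46971369 ∷ 0x8d3a26491 ∷ 0x4f3d849cb8 ∷ 0x333f2b52a1 ∷ 0xfea7267fa ∷ 0x4fa687926c ∷ 0x31da4c279d ∷ 0xfdb8485b9 ∷ 0x4eb164afde
      ∷ 0x2ff6c8c52d ∷ 0xef45689654 ∷ 0xef1e65f371 ∷ 0x7f76af2d17 ∷ 0xaff6c793b4 ∷ 0x4fab589eb1 ∷ 0x4fe8c33b5c ∷ 0xef6f4837ef ∷ 0xccb6571e2b ∷ 0x4f3248bc96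
      ∷ 0x7f613bd4bc ∷ 0xae673c931d ∷ 0x4fd81ad23b ∷ 0x4f5bcd6cfd ∷ 0x2951e8f3d ∷ 0x45a8bfd376 ∷ [])
  ∷ (0xc7e4 , (6 ∷ 13 ∷ 11 ∷ 15 ∷ 14 ∷ 5 ∷ 7 ∷ 10 ∷ 3 ∷ 12 ∷ 2 ∷ 9 ∷ []) ,
      0x2f9521b364 ∷ 0xbf92ef7c51 ∷ 0xaf428b37c2 ∷ 0x5fd687f23b ∷ [])
  ∷ (0x3da6 , (3 ∷ 11 ∷ 10 ∷ 9 ∷ 5 ∷ 13 ∷ 14 ∷ 2 ∷ 15 ∷ 4 ∷ 12 ∷ 7 ∷ []) ,
      0x9b39724da ∷ 0x229fa4528 ∷ 0x7e1c9bb21d ∷ 0xae954fd69e ∷ 0x5e14da4edf ∷ 0x37571c3258 ∷ 0xe5c828a63 ∷ [])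
  ∷ (0xc739 , (5 ∷ 7 ∷ 15 ∷ 2 ∷ 12 ∷ 4 ∷ 3 ∷ 10 ∷ 14 ∷ 11 ∷ 13 ∷ 6 ∷ []) ,
      0xfbfc25479 ∷ 0x39e8f41da3 ∷ 0x2f9dfaf192 ∷ 0xfb512978b ∷ 0xd6c81431b ∷ 0xf649ede51 ∷ 0xfcfd93bf6 ∷ 0x3dbae865c8 ∷ 0x5f29562eb1 ∷ 0x3c6e492adb
      ∷ 0x36d4a14f13 ∷ 0x4673bf27e ∷ 0x9542afe92 ∷ 0xf97f28a96 ∷ 0x2f4bda1b3d ∷ 0x39c89f4da8 ∷ 0x4f7e588497 ∷ 0x4fd5b1b67e ∷ 0x5dca8d54fc ∷ 0x4f5e1c5adb
      ∷ 0x3bc531531f ∷ 0x4ff4ec8ac7 ∷ 0x3df7c9e7d6 ∷ 0x4fa637731f ∷ 0x4f32f9fe28 ∷ 0x2f28c5cf91 ∷ 0x37c5b8afc2 ∷ 0x5fe8ad58fc ∷ 0x3e2b78aedf ∷ 0x3ecd787914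
      ∷ 0x4df8db29d5 ∷ 0x4f1d47b21e ∷ 0x3f45e8b815 ∷ 0x4fad8be915 ∷ 0x4da697631e ∷ 0x3fa36863d2 ∷ 0x4d5e4c4acb ∷ 0x35d2ebb136 ∷ 0x314da862cf ∷ 0x4ff82b29c4
      ∷ 0x2e7d35c281 ∷ 0x3969ab71ea ∷ 0x4fe7484856 ∷ 0x4f596763d2 ∷ 0x4d923c56c7 ∷ 0x4f95d77edf ∷ 0x5de84d48ed ∷ 0x3c32f8b4c9 ∷ 0x35372f5d69 ∷ 0xc7d215f16
      ∷ 0x2ee18a17ed ∷ 0xf8abed241 ∷ 0x4dad2bf914 ∷ 0x4d16eb2815 ∷ 0x4de7a85847 ∷ 0x4d593773c2 ∷ 0x43f1c43d82 ∷ 0x48b564ed9f ∷ 0xf56e9f63b ∷ 0x4d32c9ef28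
      ∷ 0x4df41c8ad6 ∷ 0xf9d8245a8 ∷ 0x2f37ba318e ∷ 0x35ac941d7f ∷ 0xadc9b2fb3 ∷ 0xf7d414f16 ∷ 0x352dc5786b ∷ 0x2f1e388b2c ∷ 0xf6ce1531b ∷ 0x397835a9b6
      ∷ 0x2f2d8c5adc ∷ 0x5fe9a238f ∷ [])
  ∷ (0x3186 , (7 ∷ 10 ∷ 14 ∷ 12 ∷ 4 ∷ 13 ∷ 5 ∷ 2 ∷ 3 ∷ 9 ∷ 11 ∷ 15 ∷ []) ,
      0xf1e948f2c ∷ 0xafeb1274ef ∷ 0x7fe9567853 ∷ 0xf684ba24d ∷ 0xfe2bf9461 ∷ 0x30ef6ccae5 ∷ 0x4f4b6117b5 ∷ [])
  ∷ (0xea7b , (15 ∷ 2 ∷ 3 ∷ 12 ∷ 13 ∷ 4 ∷ 9 ∷ 14 ∷ 5 ∷ 7 ∷ 10 ∷ 6 ∷ []) ,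
      0xfa6789d1b ∷ 0xfcf16ef7d ∷ 0x394bd51d5a ∷ 0x2f1639de2 ∷ 0x2453bb736 ∷ 0x452f5eb471 ∷ 0x2fb895427c ∷ 0xfeb9fe4d8 ∷ 0x5edb541a5d ∷ 0x2fa4fc5b43
      ∷ 0xf9de8c1af ∷ 0x371d3454fd ∷ 0x473e8fbd5a ∷ 0x5f4fed1e8b ∷ 0x35e69c2fbc ∷ 0x9f457c91ec ∷ 0x8f9b17abdf ∷ 0x2f17d3f751 ∷ [])
  ∷ (0x7d8c , (15 ∷ 10 ∷ 6 ∷ 14 ∷ 4 ∷ 11 ∷ 5 ∷ 2 ∷ 7 ∷ 9 ∷ 13 ∷ 3 ∷ []) ,
      0x32e4f645a6 ∷ 0xfb62a5817 ∷ 0x4dd21ae238 ∷ 0x4c91d3c976 ∷ 0xf519b2f16 ∷ 0x6f6f3b342f ∷ 0xfc9a1174e ∷ 0x9fa54625ae ∷ 0x7f7cd8af9d ∷ [])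
  ∷ (0xd639 , (4 ∷ 12 ∷ 5 ∷ 3 ∷ 2 ∷ 14 ∷ 10 ∷ 13 ∷ 7 ∷ 6 ∷ 15 ∷ 11 ∷ []) ,
      0xf97fc15bc ∷ 0xfd41a4e9f ∷ 0x4fd8b7719d ∷ 0x4eaf97b18d ∷ 0xea5474928 ∷ 0xec87515c7 ∷ 0xf9d6514cb ∷ 0xfd2c758f9 ∷ 0x4ff1345db9 ∷ 0x8f184347a2 ∷ [])
  ∷ (0xda63 , (6 ∷ 10 ∷ 4 ∷ 11 ∷ 12 ∷ 13 ∷ 14 ∷ 15 ∷ 5 ∷ 2 ∷ 9 ∷ 7 ∷ []) ,
      0xa673bf27e ∷ 0x3668b2a72e ∷ 0x2a5487fc9 ∷ 0x5e96e5f6cb ∷ 0xf82d9b5cf ∷ 0x2fc7a82d47 ∷ 0x42f3e7d7ef ∷ 0x4ac25a9edf ∷ 0x3ed1f68fbd ∷ 0x31e9a2f79c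
      ∷ 0x39c52dc1e5 ∷ 0x4f1c5ea7b5 ∷ 0xf417d8d2e ∷ 0x36bf391d8a ∷ 0xd16c92185 ∷ 0x4f8badf32a ∷ 0x17d215f16 ∷ 0x4fb1d55ecf ∷ [])
  ∷ (0x91c2 , (3 ∷ 12 ∷ 9 ∷ 11 ∷ 5 ∷ 15 ∷ 4 ∷ 6 ∷ 14 ∷ 10 ∷ 7 ∷ 13 ∷ []) ,
      0x37b36c561 ∷ 0xfb751db1e ∷ 0xcf9ead7ec ∷ 0x5fb179ebf2 ∷ 0x32823cfc5e ∷ 0x42d4b82fe9 ∷ 0xf23d6c8ba ∷ 0x33b5a7a71f ∷ 0xf864756d9 ∷ 0x4bfe365b8a
      ∷ 0x2f2d8c5adc ∷ 0xf391e9324 ∷ 0x35e153654a ∷ 0xd2f932148 ∷ 0x30f382956b ∷ 0xde47ba65b ∷ [])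
  ∷ (0xb1c5 , (9 ∷ 2 ∷ 7 ∷ 14 ∷ 15 ∷ 6 ∷ 10 ∷ 4 ∷ 3 ∷ 11 ∷ 13 ∷ 12 ∷ []) ,
      0xe4fe9e98a ∷ 0xe54da8241 ∷ 0x4e1d4629d3 ∷ 0xffe6a9f51 ∷ 0xfd6c93896 ∷ 0xf649ede51 ∷ 0xfcfd93bf6 ∷ 0x4f7be6f8de ∷ 0x9ffd74abdf ∷ 0x4fafb3346c ∷ [])
  ∷ (0x6582 , (10 ∷ 3 ∷ 13 ∷ 14 ∷ 5 ∷ 15 ∷ 4 ∷ 12 ∷ 9 ∷ 7 ∷ 6 ∷ 11 ∷ []) ,
      0x2f2b747c13 ∷ 0x4473813acb ∷ 0xf1d6213fb ∷ 0x3aea7bbe4d ∷ 0xbfe2715ed9 ∷ 0xfa7cecfe5 ∷ 0x37d1fb3a41 ∷ 0x6ff5e9b8da ∷ 0xfda818e13 ∷ 0xfdc38e519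
      ∷ 0x3af4695e4 ∷ 0x2fcfd4fcdb ∷ 0x4e7d1447d6 ∷ 0xe9c6d5b8a ∷ 0x7f7f1afe3a ∷ 0xeedbfa43b ∷ 0xafa796a517 ∷ 0x5fe21bb7a4 ∷ 0x4ffaec6f43 ∷ 0x3ff4395b43
      ∷ 0x30a6d8beca ∷ 0x31f37daebc ∷ 0x2eae1283fe ∷ 0x4463a2cd26 ∷ 0x397a6468ba ∷ 0xe92e1e7fd ∷ 0x35dc5f68fa ∷ 0x917d3a78b ∷ 0xf98245a67 ∷ 0x4e5a8bde46
      ∷ 0xf2863a4b8 ∷ 0xe3e787f63 ∷ [])
  ∷ (0xf814 , (11 ∷ 9 ∷ 12 ∷ 15 ∷ 3 ∷ 7 ∷ 6 ∷ 14 ∷ 2 ∷ 5 ∷ 13 ∷ 10 ∷ []) ,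
      0x2f195351b2 ∷ 0x7f562cc9b4 ∷ 0x6f178a26b8 ∷ 0x5f9f74164d ∷ [])
  ∷ (0x1ad2 , (6 ∷ 5 ∷ 4 ∷ 15 ∷ 7 ∷ 12 ∷ 9 ∷ 10 ∷ 11 ∷ 14 ∷ 13 ∷ 3 ∷ []) ,
      0x3db1ec548a ∷ 0x4f38641973 ∷ 0x4ff72634e2 ∷ 0x7fd3bffc14 ∷ 0xe1d8f85a1 ∷ 0xe25ca4db1 ∷ 0x39c57d19a4 ∷ 0xaf746f9542 ∷ 0xe37a696c2 ∷ [])
  ∷ (0x785c , (10 ∷ 9 ∷ 2 ∷ 4 ∷ 5 ∷ 7 ∷ 11 ∷ 15 ∷ 3 ∷ 13 ∷ 14 ∷ 6 ∷ []) ,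
      0x34e49c9ecf ∷ 0xfb28d4d23 ∷ 0xfaef9fc7a ∷ 0x44be23d8f3 ∷ 0x39c79ff7ca ∷ 0xda98e4c7a ∷ 0xfcb53ed52 ∷ 0x861591a9e ∷ 0x396ed729ae ∷ 0x6afe39147
      ∷ 0x48ce917eb1 ∷ 0x46b1d3d7f3 ∷ 0xddb525e91 ∷ 0xfe1366793 ∷ 0x4ac16e75b1 ∷ 0x344d252b76 ∷ [])
  ∷ (0x574e , (6 ∷ 15 ∷ 7 ∷ 9 ∷ 12 ∷ 2 ∷ 4 ∷ 11 ∷ 10 ∷ 13 ∷ 5 ∷ 3 ∷ []) ,
      0xf724fb3df ∷ 0x2f12be6158 ∷ 0x2f5b849d65 ∷ 0xf14fc928d ∷ 0xf25a38da4 ∷ 0x345e1c1d82 ∷ 0x3e12bde5ac ∷ 0x7f9c681fbc ∷ 0xaf513e24ab ∷ [])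
  ∷ (0xf6e2 , (4 ∷ 10 ∷ 7 ∷ 11 ∷ 6 ∷ 13 ∷ 14 ∷ 15 ∷ 9 ∷ 12 ∷ 5 ∷ 3 ∷ []) ,
      0x8f78a489d3 ∷ 0x45269a9165 ∷ 0x4d923c56c7 ∷ 0xbfd7486785 ∷ 0xaf32e81973 ∷ 0xee7b3fec7 ∷ 0xf7b4e2e8d ∷ 0x3df7c9e7d6 ∷ 0x37d215f16 ∷ [])
  ∷ (0xd6e9 , (4 ∷ 14 ∷ 13 ∷ 11 ∷ 2 ∷ 5 ∷ 12 ∷ 7 ∷ 3 ∷ 10 ∷ 6 ∷ 15 ∷ []) ,
      0x72bfc9741 ∷ 0x7e94f8d3f ∷ 0x9f9bdea314 ∷ 0x8f29cfe3ca ∷ 0x2f94cbef75 ∷ 0x36f73163df ∷ 0x3d4d21821e ∷ 0x3bab7879c4 ∷ 0x36e659fbda ∷ 0x5fc1fb764d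
      ∷ 0xfd98e8764 ∷ 0x7df5233aeb ∷ 0xad5e28aeb3 ∷ 0xfb4583c67 ∷ 0xf391e9324 ∷ 0x7dca72e659 ∷ 0xaddbc2659e ∷ 0xf6fe5b46c ∷ 0xf34187d23 ∷ 0x3b2bc838d4
      ∷ 0x3c5df1961b ∷ 0x5f834d95bd ∷ 0x367639aecf ∷ 0xf3f15e42d ∷ [])
  ∷ (0x73c2 , (10 ∷ 3 ∷ 9 ∷ 11 ∷ 13 ∷ 15 ∷ 4 ∷ 6 ∷ 14 ∷ 12 ∷ 5 ∷ 7 ∷ []) ,
      0xf5db79fc8 ∷ 0x8f516b6a19 ∷ 0x3ca67ffb6e ∷ 0x3a1b8f5e84 ∷ 0x3d4d21821e ∷ 0x4ddcf92ef5 ∷ 0x7dca72e659 ∷ 0x36d963cefa ∷ 0x9f726d6ef3 ∷ 0x4da1ec5a17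
      ∷ 0xad73968236 ∷ 0x42d48341a ∷ 0xf4e96985f ∷ 0xf8f1a5d71 ∷ 0xae46c5594a ∷ 0x7e9adcc875 ∷ [])
  ∷ (0x16a5 , (14 ∷ 3 ∷ 12 ∷ 13 ∷ 10 ∷ 6 ∷ 11 ∷ 4 ∷ 2 ∷ 7 ∷ 15 ∷ 9 ∷ []) ,
      0xe637ccb69 ∷ 0x5f52e83e51 ∷ 0xaf6b9c1c57 ∷ 0xf3c176c2f ∷ 0x7f5f73cf41 ∷ 0xef297de71a ∷ 0x7f675f139d ∷ 0x7fd723b394 ∷ 0xefde54bc82 ∷ 0x3d8324f6c7
      ∷ 0x4f5ca8821f ∷ 0x4f2c145e13 ∷ 0x7f894f3e8a ∷ 0xe2f93de4c9 ∷ 0x4245f8fa8c ∷ 0x5f2cf4bd7e ∷ 0xef4ed517ae ∷ 0xaf2fbc726e ∷ 0x3f29e4bd37 ∷ 0x5f468143e2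
      ∷ 0x308ab5143e ∷ 0x7fd3bf627e ∷ 0xef7d9541e7 ∷ 0x4f7e58b5d9 ∷ 0x5fe7359d8f ∷ 0xaf148f6e39 ∷ 0xef57dc28f3 ∷ 0x4f9baf2961 ∷ 0x5fcafdd8b2 ∷ 0x4fa687926c
      ∷ 0x4f1d477a64 ∷ 0x5f84351b53 ∷ 0xcf72f441a2 ∷ 0x4fb164d5ba ∷ 0x4fbad821be ∷ 0x5f57b18a15 ∷ 0x4da378f56d ∷ 0x41b95f589b ∷ 0xce35df17b8 ∷ 0x33b965af81
      ∷ 0x7f8af43689 ∷ 0x5fda1834c2 ∷ 0xaf4ceb931d ∷ 0xfd5bf817b ∷ 0xe2e89dfea ∷ 0x3ce5844987 ∷ 0x418d43a24d ∷ 0xcf4dcf8a45 ∷ 0xe06c153b16 ∷ 0x7f1c28e396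
      ∷ 0xaffe4c8ea9 ∷ 0xe3d24597d6 ∷ 0x4038d7d92e ∷ 0x498234b53c ∷ 0xafd59bb41d ∷ 0xe1f6c81a64 ∷ 0x7f5f734cdf ∷ 0x4e41f337c6 ∷ 0x486fc876af ∷ 0x4495d77f13
      ∷ 0x4c845762d3 ∷ 0xe556c4158b ∷ 0xe879acf623 ∷ 0xef6e5afc8 ∷ 0xe72dc34d6 ∷ 0xe84399b1e ∷ 0x46db937d46 ∷ 0x471b244c29 ∷ 0x423e8fafde ∷ 0xafe8146e25
      ∷ 0x4fd3c46a7f ∷ 0x4ff134613b ∷ 0x326485ebca ∷ 0xafabec8e1d ∷ 0xef7d953e41 ∷ 0xaf3d576e9a ∷ 0xef93b5eca5 ∷ 0x7fca14457f ∷ 0x4bc1afa674 ∷ 0xaf75c46852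
      ∷ 0xebcb542afe ∷ 0xee9a244a58 ∷ 0xe4df51483 ∷ 0x7ffd34b93f ∷ 0xfe9a8ed54 ∷ [])
  ∷ (0xc6b9 , (10 ∷ 11 ∷ 14 ∷ 15 ∷ 3 ∷ 12 ∷ 4 ∷ 2 ∷ 7 ∷ 6 ∷ 5 ∷ 13 ∷ []) ,
      0x1f36fdfed7 ∷ 0x1f69decbfd ∷ 0x4e59a73b5c ∷ 0xdf719b3f61 ∷ 0xfffd9c78d4 ∷ 0xffa164bd9e ∷ 0x4f493fcbe3 ∷ 0x4fbda3495e ∷ 0xcf248f8421 ∷ 0x4eb61fc73e
      ∷ 0x4eefb8b187 ∷ 0x1f7b1571c2 ∷ 0x1fa7484812 ∷ 0x1fd3627fe3 ∷ 0x1fca32ae83 ∷ 0x485fc4fa8c ∷ 0x1f8a7c2489 ∷ 0x41c1afdb32 ∷ 0x4fbda3cbe3 ∷ 0x4084573e2b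
      ∷ 0x1fa3ec5d17 ∷ 0x1f42d71378 ∷ 0x1f6fe3edaf ∷ 0x1f3e6aba3f ∷ 0x1fd8f92cd5 ∷ 0x1ffe56da5e ∷ 0x1f2ca1df41 ∷ 0x1f2d3437f1 ∷ 0x1f1bc96c9b ∷ 0x1f57b43869
      ∷ 0x1fc8ab924c ∷ 0x4f59a7e9c4 ∷ 0x1f9d8696ea ∷ 0x1f591e5b6a ∷ 0x44db9362d3 ∷ 0x4fefb89f7d ∷ 0x4f6728719b ∷ 0x4e8ef35843 ∷ 0x4ed7548adb ∷ 0xcfdb1f46d7
      ∷ 0x4fb61f4de5 ∷ 0x4f2e17e74c ∷ 0x1ff4588256 ∷ 0xff932de351 ∷ 0x1f12cbe728 ∷ 0x1fe693657e ∷ 0x4545f87d46 ∷ 0x1f91b5b6c5 ∷ 0x1f457f14bc ∷ 0x4f93b4ba78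
      ∷ 0x1f742a8134 ∷ 0x1fb127f394 ∷ 0x1fbc81c926 ∷ 0x4f672882bd ∷ 0x4f493f5d34 ∷ 0xff5cf812f9 ∷ 0xdd719b3f61 ∷ 0xffcfd534e2 ∷ 0xcfdb1f8caf ∷ 0x4f8ef3c73e
      ∷ 0x4fd75476b9 ∷ 0x4f93b496d7 ∷ 0x4f2e1738c5 ∷ 0x1f8f4d49ab ∷ 0x1fe59fa5bd ∷ 0x4f59a73b5c ∷ 0x4fb61fc73e ∷ 0xcfdb1f95f1 ∷ 0x4fefb8b187 ∷ 0x4ebda3495e
      ∷ 0x4e493fcbe3 ∷ 0xcf4dcf4d2a ∷ 0x48e8c3afde ∷ 0x41cd68bd5a ∷ 0x4e93b496d7 ∷ 0xce4dcffc79 ∷ 0x10f84218421 ∷ 0xcfb2af2cb8 ∷ 0x4e6728719b ∷ 0x4fd7548adb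
      ∷ 0x4f8ef35843 ∷ 0x4e2e17e74c ∷ 0x441b24269c ∷ 0xcf248f5adb ∷ 0x40f3e7e3f7 ∷ 0x453e8fd7ef ∷ [])
  ∷ (0xd769 , (4 ∷ 7 ∷ 3 ∷ 11 ∷ 5 ∷ 10 ∷ 13 ∷ 12 ∷ 2 ∷ 14 ∷ 15 ∷ 6 ∷ []) ,
      0xaf273f576e ∷ 0x3732c85946 ∷ 0x3e397cb9c8 ∷ 0x40c5e392e4 ∷ 0x3fec15c376 ∷ 0x2fb9fc4d1f ∷ 0xfc143c94e ∷ 0x42cd686ab5 ∷ 0x4dbda382bd ∷ 0xf5b2d13f6
      ∷ 0x42f3e7bd5a ∷ 0xefe59d6914 ∷ 0x4c1b243418 ∷ 0xcfb2af4961 ∷ 0xf9a6edab8 ∷ 0x4c5fc4e519 ∷ 0x4ce8c35ead ∷ 0x4384577d46 ∷ 0x4d93b42caf ∷ 0xf41c358ac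
      ∷ 0xf71e359ed ∷ 0x37ba58485a ∷ 0x46fa84e13b ∷ 0x3eb965ceba ∷ 0x3ff51c78c9 ∷ 0xaff27c72d1 ∷ 0x3bce45cf67 ∷ 0xefb8e45cea ∷ 0x7f9edbe4b6 ∷ 0x7f9c6863ae
      ∷ 0xafcf2bd157 ∷ 0xefd35c1482 ∷ 0x4f1a2778c9 ∷ 0x4f13bfc376 ∷ 0xe3b58c45ed ∷ 0x7f35f46728 ∷ 0x7ff89b1f4d ∷ 0xec87e516a5 ∷ 0x4f3f97f915 ∷ 0x4fa79f17f3
      ∷ 0xafd7bf523a ∷ 0xf7a2ecef9 ∷ 0xff163d84a ∷ 0xf8b4d16b3 ∷ 0x4d1f74a518 ∷ 0xef351d3814 ∷ 0x4d3d84adf6 ∷ 0x4c8d4397fc ∷ 0x4683a7fc5e ∷ 0xcf2f378354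
      ∷ 0x4d5bd46419 ∷ 0x46d4b82fe9 ∷ 0x4af4672c43 ∷ 0x4dd8735aec ∷ 0x2f79ac4c1b ∷ 0xf9ae6763d ∷ 0xf8bc57a81 ∷ 0xfdb252e91 ∷ 0xffa26236c ∷ 0x7da7ecdcb2
      ∷ 0xadbcfdcb2d ∷ 0xad3917147c ∷ 0x7d98bdc147 ∷ 0xefa87c83df ∷ 0x7fa47f8c16 ∷ 0xefe59d7bed ∷ 0xaf4df752b4 ∷ 0xef6f4837ef ∷ 0x4f8ef37ba8 ∷ 0xad85eadf51
      ∷ 0x7d3f511df5 ∷ 0xefe59dbc82 ∷ 0xc0b2af763c ∷ 0x4fbe232fe9 ∷ 0xee649c9ed2 ∷ 0x4f4d38bd37 ∷ 0xee38fd7c9f ∷ 0xef54e883df ∷ 0xef6c154961 ∷ 0x7f98bf7cd5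
      ∷ 0xafc2f739bf ∷ 0x7e675fbcd4 ∷ 0xae3a174f75 ∷ 0xafb2a768fb ∷ 0xefef3862ab ∷ 0xc9427f236d ∷ 0x4fcd68fc62 ∷ 0xef3c854831 ∷ 0x7f54cf9d13 ∷ 0xaf5394bf1c
      ∷ 0x4f6af729d8 ∷ 0x4f571f12b6 ∷ 0xedd7c513e5 ∷ 0x7f48ab1b4c ∷ 0x4f4f17b815 ∷ 0x3b9ef5db32 ∷ 0xef13ac1497 ∷ 0x7f1c2836ea ∷ 0x7f75e43279 ∷ 0x4fe37fd623
      ∷ 0xed21f45b98 ∷ 0xaf7f6bc152 ∷ 0xeff8245dae ∷ 0x7f2e8ba4f3 ∷ 0xaf13e4fb1d ∷ 0xaf329c27c1 ∷ []) ∷ []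

-- In search order, for every matrix that can join 0, 1 and W with the first row fixed in `top-ok`:
-- an equivalence carrying these four matrices onto one of the four-element frames of `classData`.
top : List ℕ
top = 0x162c8f94cf5 ∷ 0xd0691b2fe7 ∷ 0x301248d461 ∷ 0x129532f76 ∷ 0x504a7c153e ∷ 0xc01a3e6e9c ∷ 0x14329c43187 ∷ 0xd3b5a6defa ∷ 0x8357f96fc7 ∷ 0x907328de57
  ∷ 0x70cf29f9de ∷ 0x8291fcd78c ∷ 0x100e183da36 ∷ 0xd2d326d326 ∷ 0x120e19d9b53 ∷ 0xd2b23dc674 ∷ 0x152a9d536b7 ∷ 0xb059ba8637 ∷ 0xc0f46ea38c ∷ 0xa26b2adc39
  ∷ 0x110e2fb9f3b ∷ 0xf3b5a6defa ∷ 0xe0a89da5b3 ∷ 0x14149e2613e ∷ 0x1c8699d38 ∷ 0xf16fcbfba6 ∷ 0x131f1d72e58 ∷ 0xf3bf3d9ba5 ∷ 0x609fdce8bf ∷ 0x83c6b9f73e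
  ∷ 0xf0d51b523d ∷ 0xc2195eca78 ∷ 0x90fbe8d34b ∷ 0x3049325197 ∷ 0x835dbcdb9c ∷ 0x19285b185b1 ∷ 0x10e74fa6d8 ∷ 0xa2a74c32bd ∷ 0x15285a185a1 ∷ 0x11ad3f2ba
  ∷ 0xd3d57bf67c ∷ 0x1704a16516f ∷ 0xd26e4b2abc ∷ 0x60537c3972 ∷ 0x82ce49a2cb ∷ 0x3defab5a6 ∷ 0xc1f94e4d8a ∷ 0x1318647f349 ∷ 0x178ead9c7 ∷ 0x100d243d6ea
  ∷ 0x16351295c24 ∷ 0x40f291da62 ∷ 0x1522c74518b ∷ 0x22137948e1 ∷ 0x25f892be3 ∷ 0x50865c14e3 ∷ 0x1d2bad8cb ∷ 0x91dc365ba2 ∷ 0x918aef482f ∷ 0x63c6b9f73e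
  ∷ 0x90b5cd2986 ∷ 0x9156d9daec ∷ 0xa3c15adce8 ∷ 0x238ac95931 ∷ 0xb043e2d15b ∷ 0x1125d4bc27a ∷ 0x132fab8c9ae ∷ 0x112e19b6d34 ∷ 0x40e351d6af
  ∷ 0x1426d34e19b ∷ 0xa36b5cef7d ∷ 0xf1d4eb276a ∷ 0xc117ce5d96 ∷ 0x1328caf8caf ∷ 0x113e67bcfb6 ∷ 0x3c6b9f73e ∷ 0x91ba46476f ∷ 0xd0d25bf23b ∷ 0x90931595e8
  ∷ 0xf262ad8764 ∷ 0xb01a582581 ∷ 0x91cf79d63c ∷ 0x30fec736d9 ∷ 0x90c6e58439 ∷ 0x7084b18531 ∷ 0x1337268c863 ∷ 0x120ef7b7d35 ∷ 0x133731f9c62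
  ∷ 0x18084218421 ∷ 0x30b7f585f6 ∷ 0x12054dbbde4 ∷ 0xe0c4d6fed4 ∷ 0x30ec8f7ca2 ∷ 0x704b981b73 ∷ 0x305b7a4a7b ∷ 0x1203cbd874e ∷ 0x318434298 ∷ 0xf06e2b4fed
  ∷ 0x151b98de9 ∷ 0x91753f59f2 ∷ 0x30a5bd2d35 ∷ 0x9068fdf89a ∷ 0xc1e42fd842 ∷ 0x22be35f89 ∷ 0x110598b82e7 ∷ 0x42d326d326 ∷ 0x120d3c6432f ∷ 0xd36f7dcab5
  ∷ 0xc11b7fd95f ∷ 0xc3f73ec6b9 ∷ 0x219758e241 ∷ 0x625f892be3 ∷ 0x120b5465ef2 ∷ 0x1416b12a1e3 ∷ 0x825f892be3 ∷ 0x1707138bc35 ∷ 0xf2d326d326 ∷ 0x2746a746a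
  ∷ 0xe06c4b7fe2 ∷ 0x1135adbade5 ∷ []

ovalCerts : List ℕ
ovalCerts = 0x10765dc9 ∷ 0xa03a4ba9 ∷ 0x2160140019 ∷ 0x6015489a ∷ 0x26fdc0e108 ∷ 0x60aee32b ∷ 0x50313baa ∷ 0x80e33aba ∷ 0xc708502679 ∷ 0x1032a238
  ∷ 0x6a00900018 ∷ 0x95bee1a89a ∷ 0x708de238 ∷ 0x8b216ad45b ∷ 0x6ef4231cdb ∷ 0x216014001b ∷ 0xa03a4bab ∷ 0x10765dcb ∷ 0x3542aa988a ∷ 0xc0288328
  ∷ 0x907b7dc8 ∷ 0x30527899 ∷ 0x79cbfd6ab9 ∷ 0xbd43844549 ∷ 0xc093bfea ∷ 0x1afffd7328 ∷ 0x7800d0001b ∷ 0xe115ddc76b ∷ 0xe03cf458 ∷ 0xe01e6fea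
  ∷ 0x3542aa9888 ∷ 0xc028832a ∷ 0x26fdc0e10a ∷ 0x60154898 ∷ 0x6100100010 ∷ 0x7bbb996459 ∷ 0x255ddde89a ∷ 0x9c2ee1a23a ∷ 0xf80ad0bdca ∷ 0x74bbb56fe8
  ∷ 0xcff8bb2ba8 ∷ 0x4909c0fabb ∷ 0x4a0990f328 ∷ 0x3052789b ∷ 0x907b7dca ∷ 0x50313ba8 ∷ 0x60aee329 ∷ 0x107100014 ∷ 0x8b415bd45a ∷ 0x5686f08109
  ∷ 0xca60e40018 ∷ 0xf860b4001b ∷ 0x6454aa1ffb ∷ 0x793b186ab8 ∷ 0xe115ddc769 ∷ 0xe01e6fe8 ∷ 0xe03cf45a ∷ 0x8b216ad459 ∷ 0x6ef4231cd9 ∷ 0x4909c0fab9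
  ∷ 0x4a0990f32a ∷ 0x210010001b ∷ 0x40ded238 ∷ 0x80b6f328 ∷ 0x3f00e0001a ∷ 0xe67555c11a ∷ 0x70af4459 ∷ 0xe91585cabb ∷ 0xee60940018 ∷ 0x5946a18ab8
  ∷ 0x4056cfeb ∷ 0x793b186aba ∷ 0xd0a1afe8 ∷ 0x4c60d40019 ∷ 0x40cfe898 ∷ 0xa03acbaa ∷ 0x1076fdca ∷ 0x616014001a ∷ 0xb04c1679 ∷ 0xf8aa53bdc9
  ∷ 0xa05c2239 ∷ 0x70279679 ∷ 0x2060b109 ∷ 0x2060b10b ∷ 0x5946a18aba ∷ 0x4056cfe9 ∷ 0xee6094001a ∷ 0xc093bfe8 ∷ 0x7800d00019 ∷ 0x1afffd732a
  ∷ 0xcff8bb2baa ∷ 0x74bbb56fea ∷ 0xf860b40019 ∷ 0x6454aa1ff9 ∷ 0xcf78492ba9 ∷ 0xf0b56769 ∷ 0x10cd3769 ∷ 0x6037ffe9 ∷ 0x710010001a ∷ 0xb7a3924679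
  ∷ 0xb7a392467b ∷ 0xe67555c118 ∷ 0xe91585cab9 ∷ 0x70af445b ∷ 0x6a0090001a ∷ 0x708de23a ∷ 0x95bee1a898 ∷ 0x9c2ee1a238 ∷ 0xf80ad0bdc8 ∷ 0x5686f0810b
  ∷ 0xca60e4001a ∷ 0x4021aab9 ∷ 0xe61550c10a ∷ 0x3be2ec945b ∷ 0xf18a3fb76b ∷ 0xf18a3fb769 ∷ 0x7100100018 ∷ 0xb04c167b ∷ 0x7027967b ∷ 0xa05c223b
  ∷ 0xf8aa53bdcb ∷ 0x8b415bd458 ∷ 0x2bcd41e458 ∷ 0xdd00b0001b ∷ 0xc0f5723b ∷ 0x1033c999 ∷ 0x1033c99b ∷ 0xf0b5676b ∷ 0xcf78492bab ∷ 0x6037ffeb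
  ∷ 0x10cd376b ∷ 0xa03acba8 ∷ 0x1076fdc8 ∷ 0x6160140018 ∷ 0x80b6f32a ∷ 0x40ded23a ∷ 0x3f00e00018 ∷ 0xbd4384454b ∷ 0x79cbfd6abb ∷ 0x80e33ab8
  ∷ 0xc70850267b ∷ 0x1032a23a ∷ 0x7bbb99645b ∷ 0x255ddde898 ∷ 0x2bcd41e45a ∷ 0xc0f57239 ∷ 0xdd00b00019 ∷ 0xe61550c108 ∷ 0x3be2ec9459 ∷ 0x4021aabb
  ∷ 0xd0a1afea ∷ 0x40cfe89a ∷ 0x4c60d4001b ∷ 0x2100100019 ∷ 0xce584c2cd9 ∷ 0x7072edc9 ∷ 0xba133b432a ∷ 0x7babcd645a ∷ 0x309e676b ∷ 0x5046f989
  ∷ 0x60c8e67b ∷ 0xf079f678 ∷ 0x6c94df1238 ∷ 0x3b0280945b ∷ 0xfb1a7eb45b ∷ 0x10aaa448 ∷ 0x30cbecd9 ∷ 0x40746548 ∷ 0x8a51d3d328 ∷ 0x90a6167a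
  ∷ 0x609daef8 ∷ 0x70eb276a ∷ 0x4012476b ∷ 0x9c4e3ea23a ∷ 0x7abb676329 ∷ 0x897196dabb ∷ 0x4360640019 ∷ 0x20cac459 ∷ 0xd0d6989a ∷ 0x6040b10b
  ∷ 0x63649b1989 ∷ 0xc900c00018 ∷ 0xb02a4768 ∷ 0xa090d10a ∷ 0x10559bb8 ∷ 0xc338552988 ∷ 0xbf234f4baa ∷ 0xe096ecdb ∷ 0x269de0e109 ∷ 0x1c6f3a723a
  ∷ 0x3142029769 ∷ 0x6c14921238 ∷ 0x923effaee9 ∷ 0xc0a04108 ∷ 0x379296967a ∷ 0x209feba9 ∷ 0xef650ccba8 ∷ 0xf02c489b ∷ 0x6062dcda ∷ 0x58d68a8dc8
  ∷ 0x2035354b ∷ 0xb1338e476b ∷ 0x1099c889 ∷ 0x1c5f59723a ∷ 0x3df217954b ∷ 0xe460240018 ∷ 0x80a7c23a ∷ 0x4c09a0f23a ∷ 0x3872c29dc9 ∷ 0x20bd3feb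
  ∷ 0xc04e6efa ∷ 0xf1ea79b76b ∷ 0x70faecda ∷ 0xb07f8cd9 ∷ 0xf0d36cd9 ∷ 0x801c2efb ∷ 0xcdc811255a ∷ 0x3070a109 ∷ 0x5a664e832b ∷ 0xb07f5cda
  ∷ 0x620026325 ∷ 0x54e67e8feb ∷ 0xce380b2cda ∷ 0xa081576a ∷ 0xc2a8852efb ∷ 0x6384081989 ∷ 0x6404301fe9 ∷ 0x6d343c1548 ∷ 0xd01a6dc8 ∷ 0x20db2ef8
  ∷ 0xc8c8fc2dc9 ∷ 0xcaa844232b ∷ 0x90e21ef9 ∷ 0xafbc123ba8 ∷ 0xa04df45a ∷ 0xc3b80d2988 ∷ 0xc16836276b ∷ 0x754bef6898 ∷ 0xe078def8 ∷ 0xca78a12329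
  ∷ 0x50ce854a ∷ 0x39a29e9ab9 ∷ 0xe02d7baa ∷ 0xc0f5323a ∷ 0x3bc241945b ∷ 0xbd00b0001a ∷ 0x308f5fe9 ∷ 0xd8f7415dcb ∷ 0x16cf907108 ∷ 0xc07dfaba
  ∷ 0x5013532b ∷ 0x8c5159d239 ∷ 0x10991888 ∷ 0x1045cabb ∷ 0xb743ad4679 ∷ 0xc848282dc9 ∷ 0xd70050001b ∷ 0x15af5b789a ∷ 0xd06d1cd9 ∷ 0x5906c08aba
  ∷ 0x9a0e90a32b ∷ 0x20db4efb ∷ 0x9aae44a32a ∷ 0x58c6fc8dc8 ∷ 0x90e24ef8 ∷ 0x530670898b ∷ 0xa07ecab8 ∷ 0x4fa98afba8 ∷ 0xfefa11bcc9 ∷ 0x903fb23a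
  ∷ 0x208e1cd9 ∷ 0xd987555aa9 ∷ 0xb091a898 ∷ 0x9084c45b ∷ 0x90955329 ∷ 0x50df4ab8 ∷ 0xfb3ab6b45a ∷ 0xa20060001a ∷ 0x6b745f145a ∷ 0x919ee3a768
  ∷ 0x2017d989 ∷ 0xf05bcbab ∷ 0xb483394fe8 ∷ 0x906a3feb ∷ 0x5316f98989 ∷ 0xb0a24bab ∷ 0xcea8472cdb ∷ 0x1ccf557238 ∷ 0x10ef867a ∷ 0x765b70610a
  ∷ 0x3052e89a ∷ 0x907b8dc9 ∷ 0x1d0fb07548 ∷ 0x489988fddb ∷ 0xb0e69ef9 ∷ 0xf01f7efb ∷ 0xc2b8a62ef9 ∷ 0xa45cab3fe8 ∷ 0xe0f02109 ∷ 0x5064d678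
  ∷ 0xc0b1d45a ∷ 0x139f81798a ∷ 0xa4cce33fe8 ∷ 0xb080910b ∷ 0xb02ae76b ∷ 0x1900c0001b ∷ 0xa0903109 ∷ 0x10555bbb ∷ 0x941eecafe9 ∷ 0x30e9a32b
  ∷ 0xd0e5367b ∷ 0x60bf6dc8 ∷ 0x708d623b ∷ 0x65b4e11899 ∷ 0x9a0090001b ∷ 0xc5c8842898 ∷ 0x49b9dbfab8 ∷ 0x5da636854b ∷ 0x30346bab ∷ 0x90a61679
  ∷ 0x4012476a ∷ 0x609daefb ∷ 0x70eb2769 ∷ 0xe99577cab9 ∷ 0x243dafefea ∷ 0x10548cda ∷ 0xc05fd54b ∷ 0x45e9f7f89a ∷ 0x39224c9ab9 ∷ 0xd0b0b10a
  ∷ 0xf079f679 ∷ 0x5046f98a ∷ 0x309e6768 ∷ 0x60c8e678 ∷ 0xa59c39389b ∷ 0x749b1a6fe8 ∷ 0xeb35b6c459 ∷ 0x5200600019 ∷ 0x50dfdabb ∷ 0x90951328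
  ∷ 0x820160defa ∷ 0xd029d549 ∷ 0xd8375d5dc8 ∷ 0x5020b10a ∷ 0x10663cc8 ∷ 0x40edf67a ∷ 0x8b00800019 ∷ 0x10ff4779 ∷ 0x4269edfefb ∷ 0x4cd9fff22b
  ∷ 0xe46517cfe8 ∷ 0xa12c343768 ∷ 0x863120d10b ∷ 0x1088eaaa ∷ 0x24ad78efea ∷ 0x978e0ea67b ∷ 0x48690ffdca ∷ 0xb06e4dcb ∷ 0xf0e0810b ∷ 0xe47534cfe8
  ∷ 0x90484cd9 ∷ 0x4f49f7fbaa ∷ 0x47e9d1f679 ∷ 0xd04f8329 ∷ 0xb0b31548 ∷ 0x9560340018 ∷ 0x4e99d8fcd9 ∷ 0x906a4fe8 ∷ 0xa0f6654b ∷ 0xb7b36c4679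
  ∷ 0xf097d548 ∷ 0xa06f5988 ∷ 0x60ea5239 ∷ 0xdfc7165bab ∷ 0xd447665fe8 ∷ 0xa34cfa398b ∷ 0xdc37d3523a ∷ 0x1089d989 ∷ 0x1022633b ∷ 0xd07c876a
  ∷ 0xdcb714523a ∷ 0xd0926ab8 ∷ 0x10eeb559 ∷ 0xf2ca1ebef8 ∷ 0xc0932fe9 ∷ 0xcaf8fd232b ∷ 0xd800d0001a ∷ 0x902e9baa ∷ 0x8cf116d23b ∷ 0x802fa769
  ∷ 0x807a5899 ∷ 0x10667ccb ∷ 0x1b00800018 ∷ 0x50202109 ∷ 0x40edc679 ∷ 0xd0f47efb ∷ 0xa7dcc5367a ∷ 0x8094fdc9 ∷ 0xf9da12bab8 ∷ 0x80a75239
  ∷ 0xec755dc23a ∷ 0x62d4a41efb ∷ 0xdee7665cda ∷ 0x709c498b ∷ 0x3642609109 ∷ 0x60aef328 ∷ 0x5031fbab ∷ 0x60265768 ∷ 0x4fe944fbb8 ∷ 0xe40530cfea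
  ∷ 0x5d363c8549 ∷ 0xd01a5dc9 ∷ 0x90846458 ∷ 0xa98c553aaa ∷ 0xb091b899 ∷ 0x50b9f23b ∷ 0xbf33e44ba9 ∷ 0xf0e0f10a ∷ 0x947e34afeb ∷ 0x1f1f787bab
  ∷ 0x50759459 ∷ 0xf1aa91b76b ∷ 0x2bbd99e458 ∷ 0xd557dd5899 ∷ 0xd760540019 ∷ 0x10ba454b ∷ 0x2addafe328 ∷ 0xd507205898 ∷ 0x4fe9cdfbaa ∷ 0x409a698a
  ∷ 0x30256989 ∷ 0x6224bb1ef9 ∷ 0x408b945a ∷ 0x5896ab8dca ∷ 0xc6a8a0210b ∷ 0x3972969ab8 ∷ 0x20ca745a ∷ 0xd0d6b89b ∷ 0xc36064001a ∷ 0x36c290910b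
  ∷ 0xc07ddab9 ∷ 0x5013732a ∷ 0x70148fe8 ∷ 0x806b454b ∷ 0x185fc77dca ∷ 0x20ac3ab8 ∷ 0x821107defa ∷ 0x3025398a ∷ 0x1fefcd7bab ∷ 0x6504201899
  ∷ 0x409a898b ∷ 0x90d1298a ∷ 0x276d98e679 ∷ 0xea25f2c32a ∷ 0x65f45c189b ∷ 0xc0392cd8 ∷ 0xe945a1cab9 ∷ 0x40561fe8 ∷ 0x9e60940019 ∷ 0x40b82dc8
  ∷ 0xfbfab8b45b ∷ 0xc0823989 ∷ 0x10cc6eeb ∷ 0x901db54b ∷ 0xd6b7b05108 ∷ 0xb563254899 ∷ 0xa0f67548 ∷ 0xaccc55323b ∷ 0xb0a29baa ∷ 0x8ea147dcda
  ∷ 0xa3ccc23989 ∷ 0x423901fefb ∷ 0x30da8678 ∷ 0x5d160a8548 ∷ 0xfcda98b239 ∷ 0x490093897 ∷ 0x30346ba8 ∷ 0x5da6368548 ∷ 0x4ae99af328 ∷ 0x9059c898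
  ∷ 0x46d980f10b ∷ 0x4f09e0fba9 ∷ 0xe04b4239 ∷ 0xbfd3534ba9 ∷ 0xb1b33a4769 ∷ 0xd0b08109 ∷ 0x49294cfab8 ∷ 0x50647679 ∷ 0xe0f0710a ∷ 0x1c8f477238
  ∷ 0xe05a232b ∷ 0xba133b432b ∷ 0x7babcd645b ∷ 0x3d120a954b ∷ 0x3cd2989238 ∷ 0x490094896 ∷ 0x1c60d4001a ∷ 0xd0a15fe9 ∷ 0x40cf7899 ∷ 0x80c14cd9
  ∷ 0x70412329 ∷ 0xd0384239 ∷ 0xded7ad5cda ∷ 0x60bf2dcb ∷ 0xa3dc1e398a ∷ 0xf0f14dcb ∷ 0xa0d41329 ∷ 0xa0e72cd9 ∷ 0xf0a41989 ∷ 0x97fe49a67b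
  ∷ 0x826074001a ∷ 0x4ab944f338 ∷ 0xa0b22679 ∷ 0x10672ef8 ∷ 0xf04a5aba ∷ 0x70c98ba9 ∷ 0x4809d0fdcb ∷ 0x3c22e1923b ∷ 0xe0c36988 ∷ 0x92ee28aefb
  ∷ 0x1045aab8 ∷ 0x3742ad967a ∷ 0x884128ddca ∷ 0x30ad2dc8 ∷ 0xe0a57dcb ∷ 0xf05b3ba8 ∷ 0x719be36769 ∷ 0x3b725f945b ∷ 0x2017698a ∷ 0x464960f10a
  ∷ 0x709ca988 ∷ 0xaeec663cdb ∷ 0xdb475b545b ∷ 0x5e16a48cd8 ∷ 0xbf53814bab ∷ 0xd0c7945a ∷ 0x70d89549 ∷ 0x29ed14eaba ∷ 0xd317f95988 ∷ 0xb0c4123b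
  ∷ 0xc1d86c276a ∷ 0x33e283998b ∷ 0x6964791abb ∷ 0xb03baaba ∷ 0x10982bab ∷ 0xc0e4d898 ∷ 0x40a98ef9 ∷ 0xf086c23b ∷ 0xf10a10b768 ∷ 0x80f2945a
  ∷ 0xfc0aa0b23b ∷ 0xa87cc23dca ∷ 0x7014afeb ∷ 0x806b654a ∷ 0x8541efd89b ∷ 0xe078cefb ∷ 0x716b36676a ∷ 0xb05db988 ∷ 0x6d849b1549 ∷ 0xbf83054ba9
  ∷ 0x40fc3329 ∷ 0x60d92ab9 ∷ 0x3b82529459 ∷ 0x50ec4cd8 ∷ 0x8811a6ddca ∷ 0x567610810b ∷ 0xc01bf67a ∷ 0xf0685458 ∷ 0x8d513ed549 ∷ 0xfe4ac5bcd9
  ∷ 0xb019f45a ∷ 0x22fd4feef8 ∷ 0xc039bcd9 ∷ 0x55f65c8898 ∷ 0x44a978ffe9 ∷ 0x278d0ee67a ∷ 0x1023f89b ∷ 0x4e00f0001a ∷ 0xd50020001a ∷ 0xe0d2654a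
  ∷ 0xf15ab8b768 ∷ 0xa0c59efa ∷ 0x9048fcda ∷ 0xf7ead1b67a ∷ 0xbf43f74bab ∷ 0xc0a0c10b ∷ 0xb233ff4ee8 ∷ 0x6794961679 ∷ 0x3260740019 ∷ 0xfaba67b328
  ∷ 0x8c413ed239 ∷ 0xe60040001b ∷ 0x76db80610a ∷ 0x9059b89b ∷ 0x8ae19ad32b ∷ 0xca38592329 ∷ 0x30bc6549 ∷ 0x10dd466a ∷ 0xf02cf898 ∷ 0x60628cdb
  ∷ 0xca88062328 ∷ 0xc1f8a5276a ∷ 0xf0c2afea ∷ 0x10fe9459 ∷ 0xbb6383445a ∷ 0x10984baa ∷ 0xc0e4189b ∷ 0x2b60f4001b ∷ 0xd092babb ∷ 0x92ce1eaefb
  ∷ 0x10eee558 ∷ 0xccb8142239 ∷ 0xc082d98a ∷ 0x10cceee8 ∷ 0x76bbb06109 ∷ 0x901dd548 ∷ 0xe03c6459 ∷ 0x111fdd7768 ∷ 0xe01ebfeb ∷ 0x462930f10a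
  ∷ 0x10bbc22b ∷ 0x5eb6df8cda ∷ 0x10dc8fe8 ∷ 0x4e19a4fcdb ∷ 0x50a81769 ∷ 0x10448ddb ∷ 0x132f887999 ∷ 0xad7c183549 ∷ 0x90c0810a ∷ 0xa06f498b
  ∷ 0x60eae238 ∷ 0xf0975549 ∷ 0xf7ba6cb67a ∷ 0x666400110a ∷ 0xf0f1cdc8 ∷ 0xe685f0c108 ∷ 0x1a60e4001b ∷ 0xc5c8842899 ∷ 0x49b9dbfab9 ∷ 0x14ef7e7fea
  ∷ 0x620028324 ∷ 0x4e390bfcd9 ∷ 0x80b6e32b ∷ 0x1f00e00019 ∷ 0x40def23b ∷ 0xa018dfeb ∷ 0xa02b189b ∷ 0x6051354b ∷ 0x1dcfef7548 ∷ 0x902e7ba9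
  ∷ 0xc0c6eba9 ∷ 0xc258fa2ef8 ∷ 0xce584c2cda ∷ 0x7072edca ∷ 0x10abb32a ∷ 0x3ba2669449 ∷ 0x252dd8e89a ∷ 0xb0d5dfeb ∷ 0xd8b79e5dcb ∷ 0x47399af67b
  ∷ 0x5886448dcb ∷ 0x10aa644b ∷ 0x7b1b7e645a ∷ 0xe4d5d1cfea ∷ 0x70be1899 ∷ 0x10229338 ∷ 0xd07c176b ∷ 0x50fd989b ∷ 0xf30070001a ∷ 0x3152b89769
  ∷ 0xe0d2854b ∷ 0xa0c5fefb ∷ 0x20f9adcb ∷ 0x60732458 ∷ 0x90f3c76b ∷ 0x8058398a ∷ 0xd6e7d0510a ∷ 0x14bfb57fe9 ∷ 0xeff5bbcba9 ∷ 0x43a93ff989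
  ∷ 0x508a4efa ∷ 0xa1ac913768 ∷ 0x5075445a ∷ 0xff1a78bba8 ∷ 0x608c3ba9 ∷ 0xd0837baa ∷ 0xb0e6cefa ∷ 0xed05b0c549 ∷ 0x189f887dd8 ∷ 0x80947dca
  ∷ 0xe9d512cab9 ∷ 0x67d4c5167b ∷ 0xd0f44ef8 ∷ 0x6934181ab9 ∷ 0x72dba46efa ∷ 0x50ecfcdb ∷ 0xd817a65dc9 ∷ 0xab8c523458 ∷ 0x60d9cab8 ∷ 0x7d9bed654a
  ∷ 0x3043b23a ∷ 0x3d92ed9549 ∷ 0x10bb3228 ∷ 0xbeb3df4cdb ∷ 0x262d30e10b ∷ 0x40306109 ∷ 0x803e767b ∷ 0xc04e9ef9 ∷ 0x20bdbfea ∷ 0x41e979f768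
  ∷ 0x70faccdb ∷ 0x5456aa8ffa ∷ 0x1860b4001a ∷ 0xc0c61baa ∷ 0x110f007778 ∷ 0xb0f72329 ∷ 0xc06c5dc8 ∷ 0x439981f989 ∷ 0xb080810a ∷ 0x44c9e3ffeb
  ∷ 0xc0b11459 ∷ 0x4960a4001a ∷ 0x7d7b186548 ∷ 0x90c06109 ∷ 0x232d88e998 ∷ 0x770b50667a ∷ 0x1032e239 ∷ 0x80e3fabb ∷ 0x801c7ef8 ∷ 0x8dc111d55b
  ∷ 0x3070110a ∷ 0xf0d3ecda ∷ 0xe59539c89a ∷ 0x949e1aafeb ∷ 0xe660440019 ∷ 0x65d4b6189b ∷ 0x40658cdb ∷ 0x7050f108 ∷ 0x4529d8f899 ∷ 0xfbaa66b448
  ∷ 0x10ab5329 ∷ 0xb0b36549 ∷ 0xd04fd32a ∷ 0x651403189a ∷ 0x27cd3be678 ∷ 0x2071d238 ∷ 0xb03bcabb ∷ 0x996e79aab8 ∷ 0xcc1892223b ∷ 0xc148022768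
  ∷ 0x2042d329 ∷ 0xb7f349467a ∷ 0xa0e78cd8 ∷ 0xf0a44988 ∷ 0x2d60c4001b ∷ 0xb40030001a ∷ 0x20359548 ∷ 0xd8d78a5dc9 ∷ 0x41398ef768 ∷ 0x2300700019
  ∷ 0x10881aa9 ∷ 0x712b34676b ∷ 0xe63520c10a ∷ 0x8ec1f9dcdb ∷ 0xd827095dcb ∷ 0x30613efa ∷ 0x20e8889b ∷ 0x90d1a989 ∷ 0x6764981678 ∷ 0x3a22f29329
  ∷ 0xe9e514cabb ∷ 0xff5a81bba8 ∷ 0xd0c7a45b ∷ 0x70d8354a ∷ 0x50cea54b ∷ 0xaa7ca1332a ∷ 0x9dee52a54b ∷ 0x90b73ab8 ∷ 0x332267998a ∷ 0x30f81aba
  ∷ 0x2e2d4eecdb ∷ 0xd767665669 ∷ 0xe0694768 ∷ 0x272d13e678 ∷ 0x8049efe9 ∷ 0x227d13eef9 ∷ 0xdb67835459 ∷ 0x10fe4458 ∷ 0x509b4fe9 ∷ 0x60fbc98b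
  ∷ 0x7036cab8 ∷ 0xb77377467a ∷ 0xb0f7932a ∷ 0xc06cbdc9 ∷ 0x8fc116dba8 ∷ 0x5446668fe9 ∷ 0x208e8cd8 ∷ 0x903fd239 ∷ 0xd0837ba9 ∷ 0x608c3ba8
  ∷ 0xe0a57dca ∷ 0x30ad2dcb ∷ 0xe46024001b ∷ 0x3df217954a ∷ 0x4e99d8fcd8 ∷ 0x956034001b ∷ 0x480083985 ∷ 0x4c8947f239 ∷ 0xe05a4328 ∷ 0x70be289a
  ∷ 0xd4d7d15feb ∷ 0xe99577caba ∷ 0x243dafefeb ∷ 0x4a3959f32a ∷ 0x30bc254a ∷ 0x10dda66b ∷ 0xe02dcba9 ∷ 0x49a99efab8 ∷ 0x3f72499ba8 ∷ 0xf0b58768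
  ∷ 0x10cd4768 ∷ 0x60377fe8 ∷ 0x30167458 ∷ 0x5a463c832b ∷ 0x8085fbab ∷ 0x4379fcf988 ∷ 0x2e6df2ecdb ∷ 0x4ce9dbf23b ∷ 0x3b02809458 ∷ 0x6c94df1239
  ∷ 0x7bfbb8645a ∷ 0x40b8fdcb ∷ 0x70503109 ∷ 0x25ddb6e898 ∷ 0x40659cd8 ∷ 0xa05c923a ∷ 0x7027f67a ∷ 0x78ab536dca ∷ 0xb04cd67a ∷ 0xb5738e4899
  ∷ 0xe0b44aba ∷ 0x8d6191d549 ∷ 0xd4f7a25fe9 ∷ 0x929ea2aefa ∷ 0xa0a38dc9 ∷ 0x480089984 ∷ 0x1d60c40018 ∷ 0x940030001b ∷ 0x1e00f0001b ∷ 0xe50020001b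
  ∷ 0xe087789a ∷ 0xf03de328 ∷ 0x50b9a238 ∷ 0x7f3be46baa ∷ 0x308f6fea ∷ 0x28fd41edc8 ∷ 0xa65c70310b ∷ 0x10ef467b ∷ 0x2fed44ebb9 ∷ 0x6026b769
  ∷ 0xf86a0fbdc9 ∷ 0xb06ebdca ∷ 0xe0c3198b ∷ 0x32e2289efa ∷ 0x508afef9 ∷ 0xb3a33f4988 ∷ 0xcf680c2bab ∷ 0x209f2ba8 ∷ 0x4030c108 ∷ 0x803e967a
  ∷ 0xfa6a4eb32a ∷ 0x5057ddc9 ∷ 0x80f22459 ∷ 0x610410176b ∷ 0xf086723a ∷ 0x40a93ef8 ∷ 0xcef8232cd8 ∷ 0x3b226a9458 ∷ 0xdd27b5554b ∷ 0x80d09109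
  ∷ 0xf21a07befb ∷ 0x20ac7ab9 ∷ 0xa85cc73dcb ∷ 0x1faf8a7ba9 ∷ 0x65841a1899 ∷ 0x575624867a ∷ 0xc0d77768 ∷ 0x2d5d3ee54a ∷ 0x167f107108 ∷ 0xc01b567b
  ∷ 0xf068b459 ∷ 0x50fda898 ∷ 0x8ce1dbd238 ∷ 0x4e69f2fcd8 ∷ 0x2024d76a ∷ 0xfc7a5db239 ∷ 0x5057cdc8 ∷ 0x8960a40019 ∷ 0xfcdaffb228 ∷ 0x246d17efe9
  ∷ 0x5336558989 ∷ 0xe096fcd8 ∷ 0x1f2f4f7bab ∷ 0x40fcf328 ∷ 0xb05de98b ∷ 0x1f8f057ba8 ∷ 0xdd879b5548 ∷ 0x2053967b ∷ 0x31c2c79769 ∷ 0xaa9c253328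
  ∷ 0x2053667a ∷ 0xd1c7c75768 ∷ 0xca9825232b ∷ 0xc898ab2dcb ∷ 0x9e2e4eacd8 ∷ 0x30f89abb ∷ 0x676466166a ∷ 0xe069d769 ∷ 0xa0d4732a ∷ 0xe0e15678
  ∷ 0x3d6291954a ∷ 0x94fea2afea ∷ 0x5486398feb ∷ 0xab60f4001a ∷ 0x40471baa ∷ 0x6c643a123b ∷ 0xe695e0c10a ∷ 0x55861a889a ∷ 0x975e24a67b ∷ 0xc0d73769
  ∷ 0xeec5f9ccda ∷ 0x30615ef9 ∷ 0x20e8e89a ∷ 0xc828092dca ∷ 0xc8385d2dc9 ∷ 0xd029954a ∷ 0x6204601efb ∷ 0x10443dda ∷ 0x50a83768 ∷ 0x4047bbab
  ∷ 0xe56525c898 ∷ 0x13bf0d7989 ∷ 0x8fb112dba9 ∷ 0xa04d845b ∷ 0xee756accd9 ∷ 0x1077effb ∷ 0xe9c5fdcaba ∷ 0x5d4684854a ∷ 0x509bcfe8 ∷ 0x70365abb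
  ∷ 0x177f777679 ∷ 0x60fbb98a ∷ 0x50fd989a ∷ 0xa0d41328 ∷ 0x269de0e108 ∷ 0x1c6f3a7239 ∷ 0x4cd9fff22a ∷ 0xe46517cfeb ∷ 0x480089987 ∷ 0x3016145a
  ∷ 0x8a413cd329 ∷ 0xe0b4bab8 ∷ 0x45798ef89b ∷ 0x480083986 ∷ 0x848139dfe9 ∷ 0xbc735d423b ∷ 0xe435afcfe9 ∷ 0x299d77eab8 ∷ 0x50a8a76a ∷ 0x1044add8
  ∷ 0x4030e10a ∷ 0x803e3678 ∷ 0x1c9fdf723b ∷ 0xab0c80345a ∷ 0xe0871898 ∷ 0xe069576b ∷ 0x776b666668 ∷ 0x3e224e9cda ∷ 0x30f8aab9 ∷ 0x9b60f40018
  ∷ 0x5057edca ∷ 0x10eff679 ∷ 0x3652709109 ∷ 0xc460240019 ∷ 0xadfc173548 ∷ 0x10cdb76a ∷ 0x60371fea ∷ 0xaf7c493baa ∷ 0xf0b5576a ∷ 0x6d60c4001a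
  ∷ 0xa400300019 ∷ 0x7fab8a6bab ∷ 0x2a9d25e329 ∷ 0x81c1c7d76a ∷ 0x20537678 ∷ 0xd0836bab ∷ 0x608cabaa ∷ 0x30bcc548 ∷ 0xba33594328 ∷ 0x10dd3669
  ∷ 0x40474ba9 ∷ 0x4a694ef328 ∷ 0x40b8bdc9 ∷ 0x1bffb87458 ∷ 0x34f2a29fe8 ∷ 0xad6c913548 ∷ 0x120f607ef9 ∷ 0x283d5dedcb ∷ 0xd0293548 ∷ 0xb05dc989
  ∷ 0x40fc432a ∷ 0x6f84051baa ∷ 0x8d819bd54a ∷ 0xf3aa3fb98a ∷ 0x508abefb ∷ 0x70bec898 ∷ 0x54d6d18fe9 ∷ 0xdd47845548 ∷ 0x29cdfdeab8 ∷ 0x80d0a10b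
  ∷ 0x5d26b58549 ∷ 0xa0a3ddcb ∷ 0x3292a29ef8 ∷ 0x1f3fe47ba8 ∷ 0x50b9923a ∷ 0xe0e1d67a ∷ 0xc0d7976b ∷ 0xd5871a5898 ∷ 0xa75c243679 ∷ 0xb06efdc8
  ∷ 0xb8630f4dcb ∷ 0xdfb7125bab ∷ 0xa04dd459 ∷ 0x73bb0d698b ∷ 0x110f107769 ∷ 0xf0861238 ∷ 0x40a9aefa ∷ 0x80f2e45b ∷ 0x54f6a28feb ∷ 0xdd6791554b
  ∷ 0x5ce6db823a ∷ 0xbe63f24cda ∷ 0x30618efb ∷ 0x2ecdf9ecd8 ∷ 0x20e82898 ∷ 0xe82509cdc8 ∷ 0x833155d98b ∷ 0xe0964cda ∷ 0x7f2b4f6ba9 ∷ 0xa2ec283ef8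
  ∷ 0xe0c37989 ∷ 0xfc8a47b23b ∷ 0xe05ab32a ∷ 0xb373fc498a ∷ 0x8085bba9 ∷ 0x1077cff9 ∷ 0xce786a2cdb ∷ 0xeef523ccda ∷ 0xab2c6a345a ∷ 0x308f7fe8
  ∷ 0xc8f8412dca ∷ 0x20248768 ∷ 0x9a9e25a32a ∷ 0x2053a679 ∷ 0x91cec7a76b ∷ 0x2f6d0ceba9 ∷ 0x209fcbaa ∷ 0xfceadbb239 ∷ 0xee65f2ccd9 ∷ 0x70368ab9
  ∷ 0x509befea ∷ 0x777b77667b ∷ 0x60fbf988 ∷ 0xb213074ef9 ∷ 0x20ac6abb ∷ 0x3852c79dc9 ∷ 0xc500200019 ∷ 0x7e00f00019 ∷ 0x158f1a789b ∷ 0xc0d7176a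
  ∷ 0xd757245678 ∷ 0x289dabedc9 ∷ 0xe0a51dc8 ∷ 0x30adedc9 ∷ 0xb9a39e4aba ∷ 0xe02d2bab ∷ 0x256d25e89a ∷ 0x50575dcb ∷ 0x40653cda ∷ 0x7050910b
  ∷ 0xc5d8b6289a ∷ 0xf03d232a ∷ 0xcd583e2548 ∷ 0xc01b8679 ∷ 0x667410110a ∷ 0xf068445b ∷ 0x40476ba8 ∷ 0xd960a4001b ∷ 0x6026476b ∷ 0xefe544cbbb
  ∷ 0xbe93d84cda ∷ 0xa560340019 ∷ 0x18af537dc8 ∷ 0xa05c3238 ∷ 0x70274678 ∷ 0xb04c8678 ∷ 0xe59539c899 ∷ 0x949e1aafea ∷ 0x278d0ee679 ∷ 0x44a978ffe8
  ∷ 0x30256988 ∷ 0x409a6989 ∷ 0x4fe9cdfba9 ∷ 0xd50720589b ∷ 0x50b99239 ∷ 0x1f3fe47bab ∷ 0xfc7a5db238 ∷ 0x7dab366549 ∷ 0x3034bba9 ∷ 0xd07c3768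
  ∷ 0x1022b339 ∷ 0xd227bb5efb ∷ 0x408b1458 ∷ 0x40edd678 ∷ 0xeb0080001b ∷ 0x10665cca ∷ 0x50205108 ∷ 0xd04fe32b ∷ 0xb0b3354a ∷ 0x40563fea
  ∷ 0xbe6094001b ∷ 0x3942a19abb ∷ 0xc76054001b ∷ 0x10ba3549 ∷ 0x6ad4af132a ∷ 0xf40a30bfe8 ∷ 0xd01a2dcb ∷ 0x2d3d3ce54b ∷ 0x6cf4161239 ∷ 0x802f476b
  ∷ 0x807a289b ∷ 0x806b3549 ∷ 0x7014bfea ∷ 0x8f41f7dba8 ∷ 0x77ebd1667b ∷ 0x90487cdb ∷ 0x3232019ef9 ∷ 0x43c9c2f98b ∷ 0x30dab67a ∷ 0x6bb499145a
  ∷ 0xc558dd289b ∷ 0x6026f76a ∷ 0xcfe8442bba ∷ 0xa06ff98a ∷ 0x60ea223b ∷ 0xc6c8902109 ∷ 0x5013e328 ∷ 0xc07dcabb ∷ 0x3ea2479cd8 ∷ 0xecc555c239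
  ∷ 0xb0a21ba8 ∷ 0x60ae232a ∷ 0x50319ba9 ∷ 0xf92a4cbabb ∷ 0xd0b05108 ∷ 0x17bf6c767b ∷ 0xf097454a ∷ 0x902e1ba8 ∷ 0xd0d6a899 ∷ 0x5976968aba
  ∷ 0x20cae458 ∷ 0xb360640018 ∷ 0xd12734576a ∷ 0x6634201109 ∷ 0x1088faa8 ∷ 0xc082f98b ∷ 0x10ccbee9 ∷ 0x46b9b0f10a ∷ 0x901da549 ∷ 0x20ac5aba
  ∷ 0x285dc7edc8 ∷ 0x3212079ef8 ∷ 0x9084a45a ∷ 0xb091189b ∷ 0x798b556aa8 ∷ 0x80a7223b ∷ 0x75cb84689a ∷ 0xc9b8db2aba ∷ 0x60c8167a ∷ 0x5046d988
  ∷ 0xf079667b ∷ 0x309ea76a ∷ 0x146f177fea ∷ 0x3cd2ff9229 ∷ 0xd0f4fef9 ∷ 0x29dd12eaba ∷ 0x77dbc56678 ∷ 0x80946dcb ∷ 0x7e9bd86cdb ∷ 0x856034001a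
  ∷ 0x9c3ed3a238 ∷ 0xe345fac989 ∷ 0x1089c98b ∷ 0x450920f89a ∷ 0x8fe1cddba8 ∷ 0x3025d98b ∷ 0x409ac988 ∷ 0x9095332a ∷ 0x50df1ab9 ∷ 0x3b32b6945b
  ∷ 0x220060001b ∷ 0xb06e3dc9 ∷ 0x88610fddc8 ∷ 0xa0f6954a ∷ 0xb5f35c4899 ∷ 0xc0396cda ∷ 0x4f1978fba9 ∷ 0x91ae91a769 ∷ 0x5075b45b ∷ 0xb2d3a44ef9
  ∷ 0x4439afffe8 ∷ 0x3992779abb ∷ 0x56a6a08109 ∷ 0x156f25789b ∷ 0xa76c98367b ∷ 0x90d14988 ∷ 0xfa2af2b328 ∷ 0xf0e0d108 ∷ 0x247d34efe9 ∷ 0x609deef9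
  ∷ 0x40128768 ∷ 0x70eba76b ∷ 0x90a6567b ∷ 0x906acfea ∷ 0xd092aaba ∷ 0x9cbe14a238 ∷ 0x22cd1eeefa ∷ 0x10ee155b ∷ 0xa89cab3dc8 ∷ 0x3262ed9ef9
  ∷ 0x10ff777b ∷ 0x6cd498123b ∷ 0xfd1a0ab54a ∷ 0x49009c895 ∷ 0x40b86dca ∷ 0x9bfeb8a459 ∷ 0x444966ffea ∷ 0x1fcf167ba9 ∷ 0x5020a10b ∷ 0x1066fcc9
  ∷ 0x40ed967b ∷ 0x3b0080001a ∷ 0x3202609ef8 ∷ 0xd029c54b ∷ 0x48395dfdca ∷ 0xf0e06109 ∷ 0x147f347fea ∷ 0xf64a60b10b ∷ 0x709c3989 ∷ 0x9eee66acd8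
  ∷ 0x10543cd8 ∷ 0xc05f1549 ∷ 0x85e1f7d898 ∷ 0xa0f6b549 ∷ 0xc093afeb ∷ 0x5af6fd8329 ∷ 0x9800d00018 ∷ 0x8049efe8 ∷ 0x227d13eef8 ∷ 0x272d13e67b
  ∷ 0x10dc8feb ∷ 0xc2b8a62ef8 ∷ 0xf01f7efa ∷ 0xa45cab3feb ∷ 0xf03d2329 ∷ 0xee05f0ccd8 ∷ 0x70635efb ∷ 0xfc00a0001a ∷ 0xcf08e02baa ∷ 0xe04bc23a
  ∷ 0xe1b53ac76a ∷ 0xefd553cbaa ∷ 0x6984231ab8 ∷ 0xc05fd548 ∷ 0x10548cdb ∷ 0x45e9f7f89b ∷ 0x7600400018 ∷ 0x1033d99a ∷ 0x10333998 ∷ 0x90b78abb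
  ∷ 0x132f677989 ∷ 0xcde852254a ∷ 0x1011e119 ∷ 0xf01f2ef8 ∷ 0x12bfa67efa ∷ 0xc458ab2fe9 ∷ 0x10778ffa ∷ 0xae7c6a3cd8 ∷ 0x126fed7efa ∷ 0x10ffa778
  ∷ 0x851103d89b ∷ 0x57c63b8679 ∷ 0x20716239 ∷ 0x1010a10a ∷ 0xa0a37dc8 ∷ 0xd297a25ef9 ∷ 0x807a989a ∷ 0xfcfa16b238 ∷ 0x802f176a ∷ 0x83f1e4d988
  ∷ 0xe3f5e4c989 ∷ 0x93fee4a98b ∷ 0xf3fae4b98a ∷ 0x53d61e8989 ∷ 0x3016145b ∷ 0x8a413cd32a ∷ 0x2042a32a ∷ 0x1011911b ∷ 0xc6f8c0210b ∷ 0x6015b899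
  ∷ 0xe04bf238 ∷ 0x41b93af768 ∷ 0xff0ae0bba8 ∷ 0x4fd953fba8 ∷ 0x6dc4ef154b ∷ 0xa02b789a ∷ 0x6051954a ∷ 0xa0185fea ∷ 0xd06dfcda ∷ 0x2700500018
  ∷ 0xa5ac5b389b ∷ 0xe6a5a0c10a ∷ 0x10dc1fe9 ∷ 0x810100d779 ∷ 0x2071523b ∷ 0xe7c53bc67b ∷ 0x151f037899 ∷ 0xdb57a5545b ∷ 0xc10800277b ∷ 0x438908f988
  ∷ 0xa0814769 ∷ 0xa2ac853efa ∷ 0x6674551119 ∷ 0x991e85aaba ∷ 0x70af9458 ∷ 0xa0189fe8 ∷ 0x4dc9eff549 ∷ 0x60516548 ∷ 0xa02b2898 ∷ 0x2b9d24e45b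
  ∷ 0x3b9224945a ∷ 0xdb97245459 ∷ 0x7b9b246458 ∷ 0x802fc768 ∷ 0x807a6898 ∷ 0xccf816223a ∷ 0x6073a45b ∷ 0x8058c989 ∷ 0x16efd07109 ∷ 0x90f3776a
  ∷ 0x70c93ba8 ∷ 0x6015789b ∷ 0x86f1c0d109 ∷ 0xf03d332b ∷ 0x12af857ef8 ∷ 0xe38508c98a ∷ 0xa081676b ∷ 0x10101108 ∷ 0xa07e3ab9 ∷ 0xb303704988
  ∷ 0x95eef7a899 ∷ 0x10541cd9 ∷ 0xc05fb54a ∷ 0x86e1d0d10b ∷ 0x90f32768 ∷ 0x6073c459 ∷ 0x8058a98b ∷ 0xaa4c3c3328 ∷ 0x3016f459 ∷ 0x7b5ba56459
  ∷ 0x9e0ef0acdb ∷ 0x70634efa ∷ 0xac00a00019 ∷ 0x20242769 ∷ 0x46a9a0f108 ∷ 0xfdea52b548 ∷ 0x90b71ab9 ∷ 0x832167d98b ∷ 0x70c9dbaa ∷ 0x16006d764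
  ∷ 0x8c00a00018 ∷ 0x6e04f01cda ∷ 0x70636ef9 ∷ 0x70af545a ∷ 0x6914851ab8 ∷ 0x567655811b ∷ 0x229da2eefb ∷ 0xa0a33dca ∷ 0xa07ebabb ∷ 0x230d70e98a
  ∷ 0x11001d114 ∷ 0x360040001a ∷ 0x2024376b ∷ 0x20421328 ∷ 0xd727135679 ∷ 0x727b136efa ∷ 0x80496fea ∷ 0xc268ed2ef8 ∷ 0x10ff877a ∷ 0xfc00a0001b
  ∷ 0xee05f0ccd9 ∷ 0x70635ef8 ∷ 0x1077aff8 ∷ 0x8e716adcda ∷ 0x770050001a ∷ 0xc5a85b2899 ∷ 0xd06d8cd8 ∷ 0x998e23aaba ∷ 0xe3d51ec98b ∷ 0xa18c3f376a
  ∷ 0x118f3f7768 ∷ 0xc0e4189a ∷ 0x10984ba9 ∷ 0x2017d988 ∷ 0x6b745f1459 ∷ 0x919ee3a76b ∷ 0xf05bcbaa ∷ 0x7e00f00018 ∷ 0xc500200018 ∷ 0x10443dd9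
  ∷ 0x50a8376b ∷ 0x3ae29a9329 ∷ 0x90595899 ∷ 0x86d180d108 ∷ 0xf04a2ab8 ∷ 0x10678efa ∷ 0x3ab244933a ∷ 0xa0b2667b ∷ 0xd0b0b10b ∷ 0x39224c9aba
  ∷ 0xdc07a05239 ∷ 0x4879c2fdc8 ∷ 0x9b4e5ba459 ∷ 0x67b46c1678 ∷ 0xf097f54b ∷ 0xe815a6cdc8 ∷ 0x50ec3cda ∷ 0x5b8652845b ∷ 0x60d96abb ∷ 0x5a8606832a
  ∷ 0x91fea5a768 ∷ 0xf0c24fe8 ∷ 0x60bf4dc9 ∷ 0xe0c3b98a ∷ 0x12ef287ef9 ∷ 0xb03b4ab8 ∷ 0xc968792ab9 ∷ 0x1023d899 ∷ 0xad8c9b354b ∷ 0xef8505cbab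
  ∷ 0x40fc532b ∷ 0xb05da98a ∷ 0x12cf1e7ef9 ∷ 0xd0925ab9 ∷ 0x10eed55a ∷ 0x7cbb14623b ∷ 0xe260740018 ∷ 0xe05a4329 ∷ 0x4c8947f23a ∷ 0x131ff9798a
  ∷ 0xd687f0510a ∷ 0x2a60e40019 ∷ 0xc039ecdb ∷ 0x75fb5c689a ∷ 0xf0f18dc9 ∷ 0x10bbb229 ∷ 0x2ebddfecd8 ∷ 0x762b306108 ∷ 0xf74aadb678 ∷ 0xe84528cdc8
  ∷ 0x1045eaba ∷ 0x40a9befb ∷ 0x910e10a76a ∷ 0x80f2b458 ∷ 0xf086b239 ∷ 0x709ce98a ∷ 0x7eeb666cd9 ∷ 0x764b606108 ∷ 0xa0c5bef8 ∷ 0x915eb8a76a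
  ∷ 0xe0d2d548 ∷ 0x90c0e108 ∷ 0x332288999b ∷ 0xdd7718554b ∷ 0x7a3b59632b ∷ 0x30bca54b ∷ 0x10dd7668 ∷ 0x40cf989b ∷ 0x5c60d40018 ∷ 0xd0a1ffeb
  ∷ 0x70c9bbab ∷ 0x3034bbaa ∷ 0x7dab36654a ∷ 0xb0c42239 ∷ 0x91de6ca768 ∷ 0x63e4831989 ∷ 0x30ad8dca ∷ 0xe0a5edc9 ∷ 0xc4a8782feb ∷ 0xa78c0e3678
  ∷ 0x10dc6fea ∷ 0xbc433e423b ∷ 0x9abe67a32a ∷ 0xeba5cdc459 ∷ 0x5a163b8329 ∷ 0x10987ba8 ∷ 0xc0e42899 ∷ 0xa0d4332b ∷ 0x70147fe9 ∷ 0x806bd548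
  ∷ 0x5f56818ba9 ∷ 0xd0c7b458 ∷ 0xa9ec143ab8 ∷ 0x70d8854b ∷ 0x526074001b ∷ 0xf0f15dca ∷ 0x82f14fdefa ∷ 0x2e4dc5ecdb ∷ 0xb0196458 ∷ 0x43d91ef988
  ∷ 0xe03ca45b ∷ 0xe01e5fe9 ∷ 0x4119ddf76a ∷ 0x5064967b ∷ 0xe0f08108 ∷ 0x7e1ba46cda ∷ 0xa79c96367b ∷ 0xa23cff3eea ∷ 0xc0a0b109 ∷ 0xd667005108
  ∷ 0xc01b6678 ∷ 0xbd533e454b ∷ 0xf068745a ∷ 0xa67c103109 ∷ 0x10fe845b ∷ 0x1b6f837458 ∷ 0x901d154a ∷ 0x96beb0a10b ∷ 0xc082c988 ∷ 0x10ccdeea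
  ∷ 0x86d180d109 ∷ 0x9059589a ∷ 0x3ae29a932a ∷ 0x8e11a4dcd9 ∷ 0x816136d768 ∷ 0xe078bef9 ∷ 0x3542ef9899 ∷ 0xf600400019 ∷ 0x6d140a1549 ∷ 0xccd898223a
  ∷ 0x490097894 ∷ 0x4b60f40019 ∷ 0xa0e76cdb ∷ 0xf0a4398b ∷ 0x17ff497679 ∷ 0xefd553cbab ∷ 0xe1b53ac76b ∷ 0xe04bc23b ∷ 0xcf08e02bab ∷ 0x5f46f78ba9
  ∷ 0x67e4d11678 ∷ 0x90486cd8 ∷ 0x60ead23a ∷ 0xa06f8989 ∷ 0x60623cd9 ∷ 0xf02c989a ∷ 0x80c1ccdb ∷ 0x7041632b ∷ 0xced8ad2cd8 ∷ 0xd038c23b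
  ∷ 0x6c24e11239 ∷ 0x8801d0ddc9 ∷ 0x3043b239 ∷ 0xc1d86c2769 ∷ 0xb0c4123a ∷ 0x33e283998a ∷ 0x1089d988 ∷ 0xa34cfa398a ∷ 0xdc37d35239 ∷ 0xe087189b
  ∷ 0xdb57a5545a ∷ 0xc7389a2678 ∷ 0x48b99efdc8 ∷ 0xb0d54fe8 ∷ 0xf88a44bdc8 ∷ 0xaf60840019 ∷ 0xd05ee989 ∷ 0xddd799554a ∷ 0x3a82069329 ∷ 0xd1f7a5576b
  ∷ 0xf0c22feb ∷ 0x83619bd988 ∷ 0x6040910a ∷ 0x1011a118 ∷ 0x6254fa1efb ∷ 0x52865c8efb ∷ 0xa28c5c3ef8 ∷ 0x128f5c7efa ∷ 0xe2855ccef9 ∷ 0x30e91328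
  ∷ 0x5416ec8fea ∷ 0xd0e57678 ∷ 0x80853baa ∷ 0x237dfce98b ∷ 0x40746549 ∷ 0x30cbecda ∷ 0x8a51d3d329 ∷ 0x766044001a ∷ 0x2060610a ∷ 0x20609108
  ∷ 0xed25b5c54a ∷ 0x80d0c108 ∷ 0x1089398a ∷ 0x7c3bd3623b ∷ 0x8341fad988 ∷ 0x1010e10b ∷ 0xf2fa4fbefb ∷ 0x3e42c59cd8 ∷ 0xb019e459 ∷ 0x45798ef898
  ∷ 0xe0b4bab9 ∷ 0x10235898 ∷ 0x10109109 ∷ 0xc028532b ∷ 0xa54caa3889 ∷ 0x10ba9548 ∷ 0x7adbaf6329 ∷ 0x276054001a ∷ 0xd038f238 ∷ 0x8ed1addcd9
  ∷ 0x80c1fcd8 ∷ 0x7041e328 ∷ 0x58b69e8dca ∷ 0xb0d55fea ∷ 0x888144ddca ∷ 0xf73a9ab67a ∷ 0xf0c23fe9 ∷ 0x2a8d06e32b ∷ 0x21fda5e769 ∷ 0x566600810b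
  ∷ 0x3043323b ∷ 0x4ef911fcc8 ∷ 0xd05ee98a ∷ 0xddd799554b ∷ 0xaf6084001a ∷ 0x6d24b51548 ∷ 0x80d0f10a ∷ 0x77ab92667a ∷ 0x37a2929678 ∷ 0x5256fa8ef9
  ∷ 0xbb53a54458 ∷ 0x7760540018 ∷ 0xbad3af432b ∷ 0x10ba654a ∷ 0x5ef6118cca ∷ 0xe0e1e67b ∷ 0x7e4bc56cda ∷ 0x12ff4f7ef9 ∷ 0xb019545b ∷ 0x20f93dc8
  ∷ 0x8085dba8 ∷ 0x3372fc9989 ∷ 0x40211ab8 ∷ 0xdbe7ec545a ∷ 0x5616508109 ∷ 0xcf6084001b ∷ 0xbdd3994548 ∷ 0xd05e598b ∷ 0x160062767 ∷ 0x408b1459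
  ∷ 0xd227bb5ef8 ∷ 0x10001b104 ∷ 0x3660440018 ∷ 0x60405108 ∷ 0xa36c9b398a ∷ 0x81d16cd76b ∷ 0xd3e7835988 ∷ 0xb0c4a238 ∷ 0x1023989a ∷ 0xe0e19679
  ∷ 0x408bf45b ∷ 0x3222bb9efa ∷ 0x1a5fd3732b ∷ 0x30cb6cd8 ∷ 0x4074454b ∷ 0xa0b2e67a ∷ 0x1067cef9 ∷ 0xf04adabb ∷ 0xbab3444339 ∷ 0x8f60840018
  ∷ 0xd05e6988 ∷ 0x2ddd99e549 ∷ 0x498923fabb ∷ 0x55768e889a ∷ 0xe0b43abb ∷ 0xf04a2ab9 ∷ 0x10678efb ∷ 0xa0b26678 ∷ 0x3ab244933b ∷ 0x1011111a
  ∷ 0x5236018ef8 ∷ 0x30da1679 ∷ 0x83c1c2d98a ∷ 0xe0878899 ∷ 0xc028e329 ∷ 0xc548aa288b ∷ 0x20f97dca ∷ 0x6984231ab9 ∷ 0xe66500c109 ∷ 0x923e01aefa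
  ∷ 0xf3cac2b988 ∷ 0x30daf67b ∷ 0x30e9c32a ∷ 0xd0e5267a ∷ 0x4419ecffe8 ∷ 0x69545f1abb ∷ 0x49595ffaba ∷ 0x59565f8ab9 ∷ 0xe9555fcab8 ∷ 0x1edfad7cdb
  ∷ 0x80c18cda ∷ 0x7041432a ∷ 0xd038823a ∷ 0x661450110b ∷ 0x4021caba ∷ 0xbbe3ec4458 ∷ 0xc06c5dcb ∷ 0xb0f72328 ∷ 0xf9da12babb ∷ 0xa7dcc53679
  ∷ 0x8094fdc8 ∷ 0xd0f47efa ∷ 0xa400300018 ∷ 0x6d60c40019 ∷ 0x4030c10b ∷ 0x803e9679 ∷ 0x6073a45a ∷ 0x8058c988 ∷ 0x90f37769 ∷ 0x16efd07108
  ∷ 0x6ba466144a ∷ 0x8521d8d89b ∷ 0x10aba32b ∷ 0x9b6e83a45b ∷ 0x10fe745a ∷ 0x2042932b ∷ 0x9300700018 ∷ 0xc4c8e32fe9 ∷ 0xb0806108 ∷ 0x839181d98b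
  ∷ 0xc0b1245b ∷ 0xbec3f94cd9 ∷ 0x482909fdc9 ∷ 0x3061cef8 ∷ 0x20e8b899 ∷ 0xfb1a7eb458 ∷ 0x10aaa449 ∷ 0xefc516cbaa ∷ 0xa44c663feb ∷ 0xc938182abb
  ∷ 0x71eb79676a ∷ 0x70fa7cd9 ∷ 0x508a3ef8 ∷ 0x83a13fd98b ∷ 0x902eebab ∷ 0xa7cc3b367a ∷ 0x2071c23a ∷ 0xb513034898 ∷ 0xd0c7d459 ∷ 0x70d8c548
  ∷ 0x19ef147ab9 ∷ 0x6f54811baa ∷ 0xd4d7d15fe8 ∷ 0x70be289b ∷ 0xf2daa4bef8 ∷ 0x745baa6ff8 ∷ 0x4860b40018 ∷ 0x6f14781baa ∷ 0x50753458 ∷ 0x41a991f76a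
  ∷ 0xa32c88399a ∷ 0x8d7118d54a ∷ 0x90c0c10b ∷ 0xc0c6fbab ∷ 0x50ced549 ∷ 0xea75a1c328 ∷ 0xf88a44bdc9 ∷ 0xb0d54fe9 ∷ 0x48b99efdc9 ∷ 0xc7389a2679
  ∷ 0x2035b54a ∷ 0x98de8aadcb ∷ 0x713b8e676a ∷ 0xc04e1efb ∷ 0x20bdafe8 ∷ 0xfffabbbbab ∷ 0x24bdb5efeb ∷ 0x5dc6ef854a ∷ 0x60515549 ∷ 0xa02b3899
  ∷ 0xa0184fe9 ∷ 0xb0b3c54b ∷ 0xd04f1328 ∷ 0x8521d8d898 ∷ 0x10aba328 ∷ 0x6ba466144b ∷ 0x6d94ed154b ∷ 0xe0d2b549 ∷ 0xa0c52ef9 ∷ 0x6154b8176b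
  ∷ 0x3960a40018 ∷ 0x62002e326 ∷ 0x44e97effe8 ∷ 0x8e310bdcdb ∷ 0xf66044001b ∷ 0x90d1798b ∷ 0x6a24f2132b ∷ 0xd76798567a ∷ 0x903f923b ∷ 0x208eecda
  ∷ 0x981ea6adcb ∷ 0x4b8952f45a ∷ 0x60d99aba ∷ 0x50ec2cd9 ∷ 0x430070001b ∷ 0xc0c64ba8 ∷ 0x1032f23b ∷ 0x80e32ab9 ∷ 0xf70a50b678 ∷ 0x925efaaefa
  ∷ 0x90b7faba ∷ 0xc328672988 ∷ 0x8de152d549 ∷ 0xd07c3769 ∷ 0x1022b33a ∷ 0xfd9aedb548 ∷ 0x10882aab ∷ 0xd637205108 ∷ 0x912e34a769 ∷ 0x510600877a
  ∷ 0xf0d3dcd8 ∷ 0xbdc3114559 ∷ 0x801c8efa ∷ 0x30704108 ∷ 0xb03b7ab9 ∷ 0xb963794aba ∷ 0xe069776a ∷ 0x976e66a66b ∷ 0x30f84ab8 ∷ 0x6e244e1cd9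
  ∷ 0xa77c773678 ∷ 0x70369aba ∷ 0x60fb7989 ∷ 0x509b8feb ∷ 0xb0e65ef8 ∷ 0xfd0ab0b54b ∷ 0x5896888dda ∷ 0xa7fc493678 ∷ 0xf0a4798a ∷ 0xa0e7ecda
  ∷ 0xeeb5dfccd9 ∷ 0x10bbf22a ∷ 0x6624301109 ∷ 0x20f9ddc9 ∷ 0x2f00e0001b ∷ 0x40de2239 ∷ 0x80b61329 ∷ 0x4065bcd9 ∷ 0xa5dcb63899 ∷ 0x7050610a
  ∷ 0x5e564c8cd8 ∷ 0x7072ddc8 ∷ 0xa72c13367a ∷ 0x8049ffeb ∷ 0x427913fefb ∷ 0x608c6bab ∷ 0xd083fba8 ∷ 0x7c1b926239 ∷ 0x914e02a76a ∷ 0x3043a238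
  ∷ 0x50fd8899 ∷ 0xb0f7432b ∷ 0xc06c2dca ∷ 0x89b1dbdabb ∷ 0xb5c384489b ∷ 0x84911adfe9 ∷ 0xd597395898 ∷ 0xcc1892223a ∷ 0xc14802276b ∷ 0xfaba67b32b
  ∷ 0x8c413ed238 ∷ 0x58c6fc8dcb ∷ 0x9aae44a329 ∷ 0x90e24efb ∷ 0x20db4efa ∷ 0xc8f8412dc9 ∷ 0x308f7feb ∷ 0x5486398fea ∷ 0x230d70e989 ∷ 0xa07ebaba
  ∷ 0x5064967a ∷ 0xe0f0810b ∷ 0x7072ddcb ∷ 0x5e564c8cdb ∷ 0x60624cd8 ∷ 0xf02c7899 ∷ 0xb02a876a ∷ 0x10551bba ∷ 0xa0904108 ∷ 0xb900c0001a
  ∷ 0xc0f55238 ∷ 0xfbca41b459 ∷ 0xed00b00018 ∷ 0xd06d4cdb ∷ 0xc700500019 ∷ 0x35a25b9898 ∷ 0xb0a27ba9 ∷ 0x2ccd55e23a ∷ 0x9eae47acd9 ∷ 0x208e4cdb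
  ∷ 0x903fe238 ∷ 0x241decefeb ∷ 0x30e94329 ∷ 0xd0e5f679 ∷ 0xa8dc8a3dca ∷ 0x2035f549 ∷ 0x113f8e7769 ∷ 0x92ae85aef9 ∷ 0xb38308498b ∷ 0xa081f768
  ∷ 0xf90ac0bab8 ∷ 0xba03904329 ∷ 0x965e70a108 ∷ 0x10efb678 ∷ 0x198f557aab ∷ 0xb091789a ∷ 0x90849459 ∷ 0x20bdffe9 ∷ 0xc04eaef8 ∷ 0xd01acdca
  ∷ 0xcd383c254a ∷ 0xb403304feb ∷ 0x30521898 ∷ 0x907b6dcb ∷ 0x9095732b ∷ 0x50df8aba ∷ 0xd200600018 ∷ 0x2b3db6e458 ∷ 0x60bfcdca ∷ 0x61e4791769
  ∷ 0x70fa1cd8 ∷ 0x10aa744a ∷ 0x6b147e1459 ∷ 0x3c52599238 ∷ 0x1099588b ∷ 0xb33355498a ∷ 0xe0963cd9 ∷ 0xef254fcba8 ∷ 0x2d0db0e54a ∷ 0x789b886dd9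
  ∷ 0xb0e62efb ∷ 0x708dd239 ∷ 0xba00900019 ∷ 0xb5b3e1489b ∷ 0xb07f6cdb ∷ 0x30cbdcdb ∷ 0x3a52d3932a ∷ 0x4074c54a ∷ 0xb3639b498b ∷ 0x60401109
  ∷ 0xe02d9ba8 ∷ 0xc9a89e2abb ∷ 0x24ed7eefe9 ∷ 0x7e3b0b6cd8 ∷ 0x62002b327 ∷ 0xb02a3769 ∷ 0x5900c00019 ∷ 0x10552bb9 ∷ 0xa090c10b ∷ 0xc878c22dcb
  ∷ 0xcc08a02238 ∷ 0xff6a0cbbaa ∷ 0x209fdbab ∷ 0xd0d68898 ∷ 0x20ca545b ∷ 0x336064001b ∷ 0xe97596cab9 ∷ 0x50ceb548 ∷ 0x5a76a1832b ∷ 0xb07ffcd8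
  ∷ 0xa74cad367b ∷ 0x5846288dcb ∷ 0x10459ab9 ∷ 0x731bf9698b ∷ 0x9efe11accb ∷ 0xcc98df223a ∷ 0xfb0a80b459 ∷ 0xe0789efa ∷ 0x916e36a769 ∷ 0xe545efc89a
  ∷ 0x2a6d4ee329 ∷ 0x1099288a ∷ 0x6c5459123b ∷ 0x8fa18adbaa ∷ 0x3392819988 ∷ 0xb080b109 ∷ 0x74cbe36fea ∷ 0xc0b14458 ∷ 0x80a77238 ∷ 0x5046998b
  ∷ 0x60c83679 ∷ 0xf079d67a ∷ 0x309ed769 ∷ 0x8691e0d10b ∷ 0x3c623a9238 ∷ 0x90a63678 ∷ 0x70eb6768 ∷ 0x609d7efa ∷ 0x40127769 ∷ 0xab7c5f3458
  ∷ 0x119fe3776a ∷ 0x2017198b ∷ 0xf05b9ba9 ∷ 0x20db7ef9 ∷ 0x90e28efa ∷ 0xa8ccfc3dca ∷ 0x8aa144d328 ∷ 0xf01f8ef9 ∷ 0x52b6a68efb ∷ 0x745bab6fea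
  ∷ 0xfdfa17b549 ∷ 0xf46024001a ∷ 0xc0a0810a ∷ 0x5796968678 ∷ 0x223dffeeeb ∷ 0xa04d2458 ∷ 0xb3b30d498a ∷ 0x7fbb126baa ∷ 0x801caef9 ∷ 0x3070e10b
  ∷ 0x7dcb116558 ∷ 0xf0d3bcdb ∷ 0x50132329 ∷ 0xc07d2ab8 ∷ 0x26cd90e10a ∷ 0x906affe9 ∷ 0xea153bc328 ∷ 0x9baecda458 ∷ []

-- These represent, under conjugation by powers of x, the non-scalar values at x² that the
-- normalised values at 0, 1 and x do not already exclude.
scalarReps : List ℕ
scalarReps = 0x134a ∷ 0x134f ∷ 0x135b ∷ 0x135e ∷ 0x137a ∷ 0x137b ∷ 0x137e ∷ 0x137f ∷ 0x13a6 ∷ 0x13a7 ∷ 0x13f6 ∷ 0x13f7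
  ∷ 0x142a ∷ 0x142c ∷ 0x143a ∷ 0x143f ∷ 0x147c ∷ 0x1482 ∷ 0x1483 ∷ 0x14d3 ∷ 0x14d7 ∷ 0x14e2 ∷ 0x14e7 ∷ 0x152b
  ∷ 0x152c ∷ 0x153b ∷ 0x153e ∷ 0x157c ∷ 0x15a2 ∷ 0x15d6 ∷ 0x15f2 ∷ 0x15f6 ∷ 0x18db ∷ 0x18de ∷ 0x18f5 ∷ 0x18fc
  ∷ 0x193f ∷ 0x195e ∷ 0x19af ∷ 0x19de ∷ 0x19e2 ∷ 0x19e5 ∷ 0x19fa ∷ 0x19fc ∷ 0x1a2f ∷ 0x1a3e ∷ 0x1a52 ∷ 0x1a8e
  ∷ 0x1ae6 ∷ 0x1af2 ∷ 0x1af7 ∷ 0x1c35 ∷ 0x1c3a ∷ 0x1c4a ∷ 0x1c5b ∷ 0x1ce5 ∷ 0x1d25 ∷ 0x1d2a ∷ 0x1d8b ∷ 0x1d8e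
  ∷ 0x1deb ∷ 0x1df5 ∷ 0x1dfa ∷ 0x1e2b ∷ 0x1e72 ∷ 0x1e7b ∷ 0x1e8b ∷ 0x1ea6 ∷ 0x1ed6 ∷ 0x1edb ∷ 0x1f36 ∷ 0x1f56
  ∷ 0x1f72 ∷ 0x1f7a ∷ 0x1f82 ∷ 0x1f8b ∷ 0x1fa2 ∷ 0x1fa7 ∷ 0x1fd7 ∷ 0x216c ∷ 0x216f ∷ 0x236d ∷ 0x23a4 ∷ 0x23d6
  ∷ 0x251c ∷ 0x253b ∷ 0x25c1 ∷ 0x25d6 ∷ 0x27d4 ∷ 0x27e1 ∷ 0x27e4 ∷ 0x2aed ∷ 0x2caf ∷ 0x2d8b ∷ 0x2e8b ∷ 0x2e8d
  ∷ 0x2f81 ∷ 0x2fac ∷ 0x342c ∷ 0x3b1d ∷ 0x3b2c ∷ 0x3b2e ∷ 0x3c5b ∷ 0x3cae ∷ 0x3d7c ∷ 0x3e1a ∷ 0x3e7c ∷ 0x3efb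
  ∷ 0x3f7d ∷ 0x543d ∷ 0x547a ∷ 0x5dae ∷ 0x746a ∷ []

-- The finite checks

classFrame : ℕ × Vec ℕ 12 × List ℕ → List M4
classFrame (M , _) = mat M ∷ W ∷ 1M ∷ 0M ∷ []

-- The trie is an argument so that `GL` is shared by all searches of one evaluation.
classCheck : Trie → ℕ × Vec ℕ 12 × List ℕ → Bool
classCheck gl (M , as , cs) = spreadCheck never (certified spreads) (map (binary 4) as) (mat M ∷ W ∷ 1M ∷ 0M ∷ []) cs gl

classes-ok : allL (classCheck GL) classData ≡ true
classes-ok = refl

spreads-refuted : allL noOval nonDesarguesian ≡ true
spreads-refuted = refl

-- The elements 0, 1 and W have first rows 0000, 1000 and 0001. The row 1001 is still free, and
-- exactly one further element of the spread set has it, so one level of search reaches every case.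
top-ok : spreadCheck never (certified (mapL classFrame classData)) (binary 4 9 ∷ []) (W ∷ 1M ∷ 0M ∷ []) top GL ≡ true
top-ok = refl

-- No leaf is accepted: within six further elements a pair with irreducible quotient always appears
-- or the candidates run out. In this way `W₆` leads back to W, and `W₃` likewise below.
W₆-ok : spreadCheck irreducible failing (map (binary 4) (14 ∷ 3 ∷ 11 ∷ 13 ∷ 10 ∷ 7 ∷ [])) (W₆ ∷ 1M ∷ 0M ∷ []) [] GL ≡ true
W₆-ok = refl

W₃-ok : spreadCheck irreducible failing (map (binary 4) (2 ∷ 7 ∷ 13 ∷ 14 ∷ 12 ∷ 3 ∷ [])) (W₃ ∷ 1M ∷ 0M ∷ []) [] GL ≡ true
W₃-ok = refl

-- The element with first row 0100 already decides which of the three types occurs.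
root-ok : spreadCheck normalisable failing (binary 4 2 ∷ []) (1M ∷ 0M ∷ []) [] GL ≡ true
root-ok = refl

scalarOrder : Vec F16 8
scalarOrder = map (binary 4) (3 ∷ 6 ∷ 5 ∷ 9 ∷ 14 ∷ 7 ∷ 13 ∷ 8 ∷ [])

ovalOrder : Vec F16 13
ovalOrder = map (binary 4) (3 ∷ 4 ∷ 5 ∷ 6 ∷ 7 ∷ 8 ∷ 9 ∷ 10 ∷ 11 ∷ 12 ∷ 13 ∷ 14 ∷ 15 ∷ [])

scalars-ok : scalarCheck GL quotients (mapL mat scalarReps) scalarOrder ≡ true
scalars-ok = refl

ovals-ok : ovalSearch products quotients (table 4 hLS) ovalOrder ovalCerts ≡ true
ovals-ok = refl

-- Linear algebra over GF(2)

Mat : ℕ → ℕ → Set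
Mat m n = Vec (Vec Bool n) m

𝟎 : ∀ {n} → Vec Bool n
𝟎 {n} = zeroV n

+ᵥ≡⊕ : ∀ {n} (u v : Vec Bool n) → u +ᵥ v ≡ u ⊕ v
+ᵥ≡⊕ [] [] = refl
+ᵥ≡⊕ (false ∷ u) (b ∷ v) = cong (b ∷_) (+ᵥ≡⊕ u v)
+ᵥ≡⊕ (true ∷ u) (b ∷ v) = cong (not b ∷_) (+ᵥ≡⊕ u v)

+-assoc : ∀ {n} (u v w : Vec Bool n) → (u +ᵥ v) +ᵥ w ≡ u +ᵥ (v +ᵥ w)
+-assoc u v w rewrite +ᵥ≡⊕ u v | +ᵥ≡⊕ v w | +ᵥ≡⊕ (u ⊕ v) w | +ᵥ≡⊕ u (v ⊕ w) = zipWith-assoc xor-assoc u v w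

+-comm : ∀ {n} (u v : Vec Bool n) → u +ᵥ v ≡ v +ᵥ u
+-comm u v rewrite +ᵥ≡⊕ u v | +ᵥ≡⊕ v u = zipWith-comm xor-comm u v

+-idˡ : ∀ {n} (u : Vec Bool n) → 𝟎 +ᵥ u ≡ u
+-idˡ [] = refl
+-idˡ (b ∷ u) = cong (b ∷_) (+-idˡ u)

+-idʳ : ∀ {n} (u : Vec Bool n) → u +ᵥ 𝟎 ≡ u
+-idʳ u = trans (+-comm u 𝟎) (+-idˡ u)

+-self : ∀ {n} (u : Vec Bool n) → u +ᵥ u ≡ 𝟎
+-self [] = refl
+-self (false ∷ u) = cong (false ∷_) (+-self u)
+-self (true ∷ u) = cong (false ∷_) (+-self u)

+-cancelˡ : ∀ {n} (u v : Vec Bool n) → u +ᵥ (u +ᵥ v) ≡ v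
+-cancelˡ u v = trans (sym (+-assoc u u v)) (trans (cong (_+ᵥ v) (+-self u)) (+-idˡ v))

+-cancelʳ : ∀ {n} (u v : Vec Bool n) → (u +ᵥ v) +ᵥ v ≡ u
+-cancelʳ u v = trans (+-assoc u v v) (trans (cong (u +ᵥ_) (+-self v)) (+-idʳ u))

≡⇒+≡𝟎 : ∀ {n} {u v : Vec Bool n} → u ≡ v → u +ᵥ v ≡ 𝟎
≡⇒+≡𝟎 {u = u} refl = +-self u

+≡𝟎⇒≡ : ∀ {n} {u v : Vec Bool n} → u +ᵥ v ≡ 𝟎 → u ≡ v
+≡𝟎⇒≡ {u = u} {v} e = trans (sym (+-cancelʳ u v)) (trans (cong (_+ᵥ v) e) (+-idˡ v))

+-swap : ∀ {n} (a b c d : Vec Bool n) → a +ᵥ b ≡ c +ᵥ d → a +ᵥ c ≡ b +ᵥ d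
+-swap a b c d e = trans (sym (+-cancelˡ b (a +ᵥ c)))
  (cong (b +ᵥ_) (trans (sym (+-assoc b a c)) (trans (cong (_+ᵥ c) (trans (+-comm b a) e))
    (trans (+-assoc c d c) (trans (cong (c +ᵥ_) (+-comm d c)) (+-cancelˡ c d))))))

+-interchange : ∀ {n} (a b c d : Vec Bool n) → (a +ᵥ b) +ᵥ (c +ᵥ d) ≡ (a +ᵥ c) +ᵥ (b +ᵥ d)
+-interchange a b c d = trans (+-assoc a b (c +ᵥ d)) (trans (cong (a +ᵥ_)
  (trans (sym (+-assoc b c d)) (trans (cong (_+ᵥ d) (+-comm b c)) (+-assoc c b d)))) (sym (+-assoc a c (b +ᵥ d))))

lc-𝟎 : ∀ {m n} (B : Mat m n) → lc 𝟎 B ≡ 𝟎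
lc-𝟎 [] = refl
lc-𝟎 (v ∷ B) = lc-𝟎 B

lc-+ : ∀ {m n} (c d : Vec Bool m) (B : Mat m n) → lc (c +ᵥ d) B ≡ lc c B +ᵥ lc d B
lc-+ [] [] [] = sym (+-self _)
lc-+ (false ∷ c) (false ∷ d) (v ∷ B) = lc-+ c d B
lc-+ (false ∷ c) (true ∷ d) (v ∷ B) = trans (cong (v +ᵥ_) (lc-+ c d B))
  (trans (sym (+-assoc v _ _)) (trans (cong (_+ᵥ lc d B) (+-comm v (lc c B))) (+-assoc _ v _)))
lc-+ (true ∷ c) (false ∷ d) (v ∷ B) = trans (cong (v +ᵥ_) (lc-+ c d B)) (sym (+-assoc v _ _))
lc-+ (true ∷ c) (true ∷ d) (v ∷ B) = trans (lc-+ c d B)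
  (trans (sym (+-idˡ _)) (trans (cong (_+ᵥ _) (sym (+-self v))) (+-interchange v v (lc c B) (lc d B))))

lc-⊞ : ∀ {m n} (c : Vec Bool m) (A B : Mat m n) → lc c (A ⊞ B) ≡ lc c A +ᵥ lc c B
lc-⊞ [] [] [] = sym (+-self _)
lc-⊞ (false ∷ c) (u ∷ A) (v ∷ B) = lc-⊞ c A B
lc-⊞ (true ∷ c) (u ∷ A) (v ∷ B) = trans (cong ((u +ᵥ v) +ᵥ_) (lc-⊞ c A B)) (+-interchange u v _ _)

lc-⊗ : ∀ {l m n} (c : Vec Bool l) (A : Mat l m) (B : Mat m n) → lc c (A ⊗ B) ≡ lc (lc c A) B
lc-⊗ [] [] B = sym (lc-𝟎 B)
lc-⊗ (false ∷ c) (u ∷ A) B = lc-⊗ c A B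
lc-⊗ (true ∷ c) (u ∷ A) B = trans (cong (lc u B +ᵥ_) (lc-⊗ c A B)) (sym (lc-+ u (lc c A) B))

lc-++ : ∀ {l m n} (c : Vec Bool l) (d : Vec Bool m) (A : Mat l n) (B : Mat m n) →
        lc (c ++ d) (A ++ B) ≡ lc c A +ᵥ lc d B
lc-++ [] d [] B = sym (+-idˡ _)
lc-++ (false ∷ c) d (u ∷ A) B = lc-++ c d A B
lc-++ (true ∷ c) d (u ∷ A) B = trans (cong (u +ᵥ_) (lc-++ c d A B)) (sym (+-assoc u _ _))

lc≡lincomb : ∀ {m n} (c : Vec Bool m) (B : Mat m n) → lc c B ≡ lincomb c B
lc≡lincomb [] [] = refl
lc≡lincomb (false ∷ c) (v ∷ B) = trans (lc≡lincomb c B) (trans (sym (+-idˡ _)) (trans (+ᵥ≡⊕ 𝟎 _) (cong (_⊕ lincomb c B) (sym (zeros v)))))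
  where
  zeros : ∀ {n} (v : Vec Bool n) → map (false ∧_) v ≡ 𝟎
  zeros [] = refl
  zeros (_ ∷ v) = cong (false ∷_) (zeros v)
lc≡lincomb (true ∷ c) (v ∷ B) = trans (+ᵥ≡⊕ v _) (cong₂ _⊕_ (sym (same v)) (lc≡lincomb c B))
  where
  same : ∀ {n} (v : Vec Bool n) → map (true ∧_) v ≡ v
  same [] = refl
  same (b ∷ v) = cong (b ∷_) (same v)

⊗≡mul2 : ∀ {l m n} (A : Mat l m) (B : Mat m n) → A ⊗ B ≡ map (λ r → lincomb r B) A
⊗≡mul2 [] B = refl
⊗≡mul2 (u ∷ A) B = cong₂ _∷_ (lc≡lincomb u B) (⊗≡mul2 A B)

one : ∀ n → Mat n n
one zero = []
one (suc n) = (true ∷ 𝟎) ∷ map (false ∷_) (one n)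

lc-shift : ∀ {m n} (c : Vec Bool m) (A : Mat m n) → lc c (map (false ∷_) A) ≡ false ∷ lc c A
lc-shift [] [] = refl
lc-shift (false ∷ c) (u ∷ A) = lc-shift c A
lc-shift (true ∷ c) (u ∷ A) = cong ((false ∷ u) +ᵥ_) (lc-shift c A)

lc-one : ∀ {n} (c : Vec Bool n) → lc c (one n) ≡ c
lc-one [] = refl
lc-one (false ∷ c) = trans (lc-shift c (one _)) (cong (false ∷_) (lc-one c))
lc-one (true ∷ c) = trans (cong ((true ∷ 𝟎) +ᵥ_) (trans (lc-shift c (one _)) (cong (false ∷_) (lc-one c)))) (cong (true ∷_) (+-idˡ c))

one≡id2 : ∀ n → one n ≡ id2 n
one≡id2 zero = refl
one≡id2 (suc n) = cong₂ _∷_ (cong (true ∷_) (zeros n)) (trans (cong (map (false ∷_)) (one≡id2 n))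
  (trans (sym (tabulate-∘ (false ∷_) _)) (tabulate-cong (λ i → cong (false ∷_) (tabulate-cong (λ j → same i j))))))
  where
  zeros : ∀ n → 𝟎 {n} ≡ tabulate (λ (j : Fin n) → ⌊ zero Fin.≟ suc j ⌋)
  zeros zero = refl
  zeros (suc n) = cong (false ∷_) (zeros n)
  same : ∀ {n} (i j : Fin n) → ⌊ i Fin.≟ j ⌋ ≡ ⌊ suc i Fin.≟ suc j ⌋
  same i j with i Fin.≟ j
  ... | yes _ = refl
  ... | no _ = refl

one-⊗ : ∀ {m n} (A : Mat m n) → one m ⊗ A ≡ A
one-⊗ [] = refl
one-⊗ {suc m} (u ∷ A) = cong₂ _∷_ (trans (cong (u +ᵥ_) (lc-𝟎 A)) (+-idʳ u)) (trans (drop (one m)) (one-⊗ A))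
  where
  drop : ∀ {l} (B : Mat l m) → map (false ∷_) B ⊗ (u ∷ A) ≡ B ⊗ A
  drop [] = refl
  drop (v ∷ B) = cong (lc v A ∷_) (drop B)

lc-ext : ∀ {m n} {A B : Mat m n} → (∀ c → lc c A ≡ lc c B) → A ≡ B
lc-ext {A = A} {B} h = trans (sym (one-⊗ A)) (trans (pointwise (one _)) (one-⊗ B))
  where
  pointwise : ∀ {l} (C : Mat l _) → C ⊗ A ≡ C ⊗ B
  pointwise [] = refl
  pointwise (c ∷ C) = cong₂ _∷_ (h c) (pointwise C)

⊗-assoc : ∀ {k l m n} (A : Mat k l) (B : Mat l m) (C : Mat m n) → (A ⊗ B) ⊗ C ≡ A ⊗ (B ⊗ C)
⊗-assoc A B C = lc-ext λ c → trans (lc-⊗ c (A ⊗ B) C) (trans (cong (λ x → lc x C) (lc-⊗ c A B))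
  (trans (sym (lc-⊗ (lc c A) B C)) (sym (lc-⊗ c A (B ⊗ C)))))

⊗-one : ∀ {m n} (A : Mat m n) → A ⊗ one n ≡ A
⊗-one [] = refl
⊗-one (u ∷ A) = cong₂ _∷_ (lc-one u) (⊗-one A)

-- The working form of invertibility for square matrices: it passes easily through products and
-- blocks, and counting supplies surjectivity and an inverse without elimination.
Inj : ∀ {m n} → Mat m n → Set
Inj A = ∀ c → lc c A ≡ 𝟎 → c ≡ 𝟎

inj-cancel : ∀ {m n} {A : Mat m n} → Inj A → ∀ {c d} → lc c A ≡ lc d A → c ≡ d
inj-cancel {A = A} inj {c} {d} e = +≡𝟎⇒≡ (inj (c +ᵥ d) (trans (lc-+ c d A) (≡⇒+≡𝟎 e)))

inj-⊗ : ∀ {l m n} {A : Mat l m} {B : Mat m n} → Inj A → Inj B → Inj (A ⊗ B)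
inj-⊗ {A = A} {B} p q c e = p c (q (lc c A) (trans (sym (lc-⊗ c A B)) e))

-- Bit vectors as elements of Fin (2 ^ n)

bit : Bool → Fin 2
bit false = zero
bit true = suc zero

unbit : Fin 2 → Bool
unbit zero = false
unbit (suc zero) = true

unbit-bit : ∀ b → unbit (bit b) ≡ b
unbit-bit false = refl
unbit-bit true = refl

bit-unbit : ∀ b → bit (unbit b) ≡ b
bit-unbit zero = refl
bit-unbit (suc zero) = refl

encode : ∀ {n} → Vec Bool n → Fin (2 ^ n)
encode [] = zero
encode (b ∷ v) = combine (bit b) (encode v)

decodeᵥ : ∀ n → Fin (2 ^ n) → Vec Bool n
decodeᵥ zero _ = []
decodeᵥ (suc n) i = unbit (proj₁ (remQuot {2} (2 ^ n) i)) ∷ decodeᵥ n (proj₂ (remQuot {2} (2 ^ n) i))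

decode-encode : ∀ {n} (v : Vec Bool n) → decodeᵥ n (encode v) ≡ v
decode-encode [] = refl
decode-encode {suc n} (b ∷ v) = cong₂ _∷_ (trans (cong (unbit ∘ proj₁) split) (unbit-bit b)) (trans (cong (decodeᵥ n ∘ proj₂) split) (decode-encode v))
  where
  split : remQuot {2} (2 ^ n) (combine (bit b) (encode v)) ≡ (bit b , encode v)
  split = remQuot-combine (bit b) (encode v)

encode-decode : ∀ n (i : Fin (2 ^ n)) → encode (decodeᵥ n i) ≡ i
encode-decode zero zero = refl
encode-decode (suc n) i = trans
  (cong₂ combine (bit-unbit (proj₁ (remQuot {2} (2 ^ n) i))) (encode-decode n (proj₂ (remQuot {2} (2 ^ n) i))))
  (combine-remQuot {2} (2 ^ n) i)

encode-injective : ∀ {n} {u v : Vec Bool n} → encode u ≡ encode v → u ≡ v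
encode-injective {n} {u} {v} e = trans (sym (decode-encode u)) (trans (cong (decodeᵥ n) e) (decode-encode v))

-- Put y in front of the values of f. By the pigeonhole principle two of these n + 1 values agree;
-- two values of f cannot, so y is one of them.
injective⇒surjective : ∀ {n} (f : Fin n → Fin n) → (∀ i j → f i ≡ f j → i ≡ j) → ∀ y → Σ (Fin n) λ i → f i ≡ y
injective⇒surjective {n} f inj y with pigeonhole (ℕₚ.n<1+n n) g
  where
  g : Fin (suc n) → Fin n
  g zero = y
  g (suc i) = f i
... | zero , suc j , _ , e = j , sym e
... | suc i , suc j , lt , e = ⊥-elim (ℕₚ.<⇒≢ (ℕ.s≤s⁻¹ lt) (cong Fin.toℕ (inj i j e)))

fin-surjective : ∀ n (f : Fin (2 ^ n) → Vec Bool n) → (∀ i j → f i ≡ f j → i ≡ j) → ∀ v → Σ (Fin (2 ^ n)) λ i → f i ≡ v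
fin-surjective n f inj v with injective⇒surjective (encode ∘ f) (λ i j e → inj i j (encode-injective e)) (encode v)
... | i , e = i , encode-injective e

surjective : ∀ {n} {A : Mat n n} → Inj A → ∀ v → Σ (Vec Bool n) λ c → lc c A ≡ v
surjective {n} {A} inj v with fin-surjective n (λ i → lc (decodeᵥ n i) A) (λ i j e → trans (sym (encode-decode n i))
    (trans (cong encode (inj-cancel inj {decodeᵥ n i} {decodeᵥ n j} e)) (encode-decode n j))) v
... | i , e = decodeᵥ n i , e

Inverse : ∀ {n} → Mat n n → Set
Inverse {n} A = Σ (Mat n n) λ H → (H ⊗ A ≡ one n) × (A ⊗ H ≡ one n)

abstract
  -- The rows of H solve cA = eᵢ, which gives HA = 1; then (AH)A = A, and cancelling the injective A
  -- gives AH = 1. It is abstract because unfolding the pigeonhole argument in later types would be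
  -- costly.
  inj⇒inverse : ∀ {n} {A : Mat n n} → Inj A → Inverse A
  inj⇒inverse {n} {A} inj = H , left , lc-ext λ c → trans (inj-cancel inj (trans (sym (lc-⊗ c (A ⊗ H) A))
      (trans (cong (lc c) (trans (⊗-assoc A H A) (trans (cong (A ⊗_) left) (⊗-one A)))) refl))) (sym (lc-one c))
    where
    rowsOf : ∀ {l} → Mat l n → Mat l n
    rowsOf [] = []
    rowsOf (v ∷ B) = proj₁ (surjective inj v) ∷ rowsOf B
    H : Mat n n
    H = rowsOf (one n)
    solved : ∀ {l} (B : Mat l n) → rowsOf B ⊗ A ≡ B
    solved [] = refl
    solved (v ∷ B) = cong₂ _∷_ (proj₂ (surjective inj v)) (solved B)
    left : H ⊗ A ≡ one n
    left = solved (one n)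

left-inj : ∀ {m n} {A : Mat m n} {B : Mat n m} → A ⊗ B ≡ one m → Inj A
left-inj {A = A} {B} e c z = trans (sym (lc-one c)) (trans (cong (lc c) (sym e)) (trans (lc-⊗ c A B) (trans (cong (λ x → lc x B) z) (lc-𝟎 B))))

inj⇒Invertible2 : ∀ {n} {A : Mat n n} → Inj A → Invertible2 A
inj⇒Invertible2 {n} {A} inj with inj⇒inverse inj
... | H , l , r = H , trans (sym (⊗≡mul2 H A)) (trans l (one≡id2 n)) , trans (sym (⊗≡mul2 A H)) (trans r (one≡id2 n))

-- Transposition

_ᵀ : ∀ {m n} → Mat m n → Mat n m
_ᵀ {n = n} [] = replicate n []
(u ∷ A) ᵀ = zipWith _∷_ u (A ᵀ)

infix 9 _ᵀ

lc-nil : ∀ {n} (f : Vec Bool n) → lc f (replicate n []) ≡ []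
lc-nil [] = refl
lc-nil (false ∷ f) = lc-nil f
lc-nil (true ∷ f) = cong ([] +ᵥ_) (lc-nil f)

dot-cons : ∀ {m n} (u f : Vec Bool n) (B : Mat n m) → lc f (zipWith _∷_ u B) ≡ dot2 u f ∷ lc f B
dot-cons [] [] [] = refl
dot-cons (a ∷ u) (false ∷ f) (v ∷ B) rewrite ∧-zeroʳ a = dot-cons u f B
dot-cons (false ∷ u) (true ∷ f) (v ∷ B) = cong ((false ∷ v) +ᵥ_) (dot-cons u f B)
dot-cons (true ∷ u) (true ∷ f) (v ∷ B) = cong ((true ∷ v) +ᵥ_) (dot-cons u f B)

lc-ᵀ : ∀ {m n} (f : Vec Bool n) (A : Mat m n) → lc f (A ᵀ) ≡ map (λ r → dot2 r f) A
lc-ᵀ f [] = lc-nil f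
lc-ᵀ f (u ∷ A) = trans (dot-cons u f (A ᵀ)) (cong (dot2 u f ∷_) (lc-ᵀ f A))

dot-𝟎 : ∀ {n} (f : Vec Bool n) → dot2 𝟎 f ≡ false
dot-𝟎 [] = refl
dot-𝟎 (b ∷ f) = dot-𝟎 f

dot-+ : ∀ {n} (u v f : Vec Bool n) → dot2 (u +ᵥ v) f ≡ dot2 u f xor dot2 v f
dot-+ [] [] [] = refl
dot-+ (false ∷ u) (false ∷ v) (c ∷ f) = dot-+ u v f
dot-+ (false ∷ u) (true ∷ v) (false ∷ f) = dot-+ u v f
dot-+ (false ∷ u) (true ∷ v) (true ∷ f) rewrite dot-+ u v f with dot2 u f | dot2 v f
... | false | _ = refl
... | true | false = refl
... | true | true = refl
dot-+ (true ∷ u) (false ∷ v) (false ∷ f) = dot-+ u v f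
dot-+ (true ∷ u) (false ∷ v) (true ∷ f) rewrite dot-+ u v f with dot2 u f | dot2 v f
... | false | _ = refl
... | true | false = refl
... | true | true = refl
dot-+ (true ∷ u) (true ∷ v) (false ∷ f) = dot-+ u v f
dot-+ (true ∷ u) (true ∷ v) (true ∷ f) rewrite dot-+ u v f with dot2 u f | dot2 v f
... | false | false = refl
... | false | true = refl
... | true | false = refl
... | true | true = refl

dot-comm : ∀ {n} (u v : Vec Bool n) → dot2 u v ≡ dot2 v u
dot-comm [] [] = refl
dot-comm (a ∷ u) (b ∷ v) = cong₂ _xor_ (∧-comm a b) (dot-comm u v)

dot-lc : ∀ {m n} (c : Vec Bool m) (A : Mat m n) (f : Vec Bool n) → dot2 (lc c A) f ≡ dot2 c (lc f (A ᵀ))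
dot-lc c A f rewrite lc-ᵀ f A = go c A
  where
  go : ∀ {m} (c : Vec Bool m) (A : Mat m _) → dot2 (lc c A) f ≡ dot2 c (map (λ r → dot2 r f) A)
  go [] [] = dot-𝟎 f
  go (false ∷ c) (u ∷ A) = go c A
  go (true ∷ c) (u ∷ A) = trans (dot-+ u (lc c A) f) (cong (dot2 u f xor_) (go c A))

dot-ext : ∀ {n} {u v : Vec Bool n} → (∀ f → dot2 u f ≡ dot2 v f) → u ≡ v
dot-ext {u = []} {[]} h = refl
dot-ext {u = a ∷ u} {b ∷ v} h = cong₂ _∷_ (first a b u v (h (true ∷ 𝟎))) (dot-ext (λ f → rest a b u v f (h (false ∷ f))))
  where
  first : ∀ {n} a b (u v : Vec Bool n) → dot2 (a ∷ u) (true ∷ 𝟎) ≡ dot2 (b ∷ v) (true ∷ 𝟎) → a ≡ b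
  first a b u v e rewrite trans (dot-comm u 𝟎) (dot-𝟎 u) | trans (dot-comm v 𝟎) (dot-𝟎 v) with a | b
  ... | false | false = refl
  ... | true | true = refl
  rest : ∀ {n} a b (u v f : Vec Bool n) → dot2 (a ∷ u) (false ∷ f) ≡ dot2 (b ∷ v) (false ∷ f) → dot2 u f ≡ dot2 v f
  rest a b u v f e rewrite ∧-zeroʳ a | ∧-zeroʳ b = e

apply2-⊗ : ∀ {n} (Θ : Mat2 n) {m} (A : Mat m n) → map (apply2 Θ) A ᵀ ≡ Θ ⊗ A ᵀ
apply2-⊗ Θ A = lc-ext λ f → trans (lc-ᵀ f (map (apply2 Θ) A)) (trans (go f A) (sym (trans (lc-⊗ f Θ (A ᵀ)) (lc-ᵀ (lc f Θ) A))))
  where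
  go : ∀ f {m} (A : Mat m _) → map (λ r → dot2 r f) (map (apply2 Θ) A) ≡ map (λ r → dot2 r (lc f Θ)) A
  go f [] = refl
  go f (u ∷ A) = cong₂ _∷_ (trans (dot-comm (apply2 Θ u) f) (trans (cong (dot2 f) (sym (lc-ᵀ u Θ)))
    (trans (sym (dot-lc f Θ u)) (dot-comm (lc f Θ) u)))) (go f A)

ᵀ-injective : ∀ {m n} {A B : Mat m n} → A ᵀ ≡ B ᵀ → A ≡ B
ᵀ-injective {A = A} {B} e = lc-ext λ c → dot-ext λ f → trans (dot-lc c A f) (trans (cong (λ C → dot2 c (lc f C)) e) (sym (dot-lc c B f)))

ᵀ-⊗ : ∀ {l m n} (A : Mat l m) (B : Mat m n) → (A ⊗ B) ᵀ ≡ B ᵀ ⊗ A ᵀ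
ᵀ-⊗ A B = lc-ext λ f → trans (lc-ᵀ f (A ⊗ B)) (trans (go f A) (sym (trans (lc-⊗ f (B ᵀ) (A ᵀ)) (lc-ᵀ (lc f (B ᵀ)) A))))
  where
  go : ∀ f {l} (A : Mat l _) → map (λ r → dot2 r f) (A ⊗ B) ≡ map (λ r → dot2 r (lc f (B ᵀ))) A
  go f [] = refl
  go f (u ∷ A) = cong₂ _∷_ (dot-lc u B f) (go f A)

zipWith-ᵀ : ∀ {m n} (u : Vec Bool n) (B : Mat n m) → zipWith _∷_ u B ᵀ ≡ u ∷ B ᵀ
zipWith-ᵀ [] [] = refl
zipWith-ᵀ (a ∷ u) (v ∷ B) = cong (zipWith _∷_ (a ∷ v)) (zipWith-ᵀ u B)

ᵀ-ᵀ : ∀ {m n} (A : Mat m n) → A ᵀ ᵀ ≡ A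
ᵀ-ᵀ {n = n} [] = nil n
  where
  nil : ∀ n → replicate n [] ᵀ ≡ []
  nil zero = refl
  nil (suc n) rewrite nil n = refl
ᵀ-ᵀ (u ∷ A) = trans (zipWith-ᵀ u (A ᵀ)) (cong (u ∷_) (ᵀ-ᵀ A))

one-ᵀ : ∀ n → one n ᵀ ≡ one n
one-ᵀ n = lc-ext λ f → dot-ext λ g → trans (dot-lc f (one n ᵀ) g) (trans (cong (λ A → dot2 f (lc g A)) (ᵀ-ᵀ (one n)))
  (trans (cong (dot2 f) (lc-one g)) (cong (λ v → dot2 v g) (sym (lc-one f)))))

apply2≡lc : ∀ {n} (g : Mat2 n) (v : Vec Bool n) → apply2 g v ≡ lc v (g ᵀ)
apply2≡lc g v = sym (lc-ᵀ v g)

map-apply2 : ∀ {m n} (g : Mat2 n) (B : Mat m n) → map (apply2 g) B ≡ B ⊗ g ᵀ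
map-apply2 g [] = refl
map-apply2 g (u ∷ B) = cong₂ _∷_ (apply2≡lc g u) (map-apply2 g B)

-- Spans and equivalence of families

inSpan-⊗ : ∀ {l m n} {v : Vec Bool n} (U : Mat l m) (B : Mat m n) → InSpan v (U ⊗ B) → InSpan v B
inSpan-⊗ U B (c , e) = lc c U , trans (sym (lc≡lincomb (lc c U) B))
  (trans (sym (lc-⊗ c U B)) (trans (lc≡lincomb c (U ⊗ B)) e))

sameSpan : ∀ {l m n} {P : Mat l n} {B : Mat m n} {U : Mat l m} {U′ : Mat m l} →
           P ≡ U ⊗ B → B ≡ U′ ⊗ P → SameSpan P B
sameSpan {P = P} {B} {U} {U′} p q v =
  (λ s → inSpan-⊗ U B (subst (InSpan v) p s)) , (λ s → inSpan-⊗ U′ P (subst (InSpan v) q s))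

sameSpan-sym : ∀ {l m n} {A : Mat l n} {B : Mat m n} → SameSpan A B → SameSpan B A
sameSpan-sym h v = proj₂ (h v) , proj₁ (h v)

sameSpan-trans : ∀ {k l m n} {A : Mat k n} {B : Mat l n} {C : Mat m n} → SameSpan A B → SameSpan B C → SameSpan A C
sameSpan-trans h k v = (λ s → proj₁ (k v) (proj₁ (h v) s)) , (λ s → proj₂ (h v) (proj₂ (k v) s))

inSpan-apply : ∀ {m n} (g : Mat2 n) {B : Mat m n} {v : Vec Bool n} → InSpan v B → InSpan (apply2 g v) (map (apply2 g) B)
inSpan-apply g {B} {v} (c , e) = c , (begin
  lincomb c (map (apply2 g) B) ≡⟨ lc≡lincomb c _ ⟨
  lc c (map (apply2 g) B)      ≡⟨ cong (lc c) (map-apply2 g B) ⟩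
  lc c (B ⊗ g ᵀ)               ≡⟨ lc-⊗ c B (g ᵀ) ⟩
  lc (lc c B) (g ᵀ)            ≡⟨ cong (λ u → lc u (g ᵀ)) (trans (lc≡lincomb c B) e) ⟩
  lc v (g ᵀ)                   ≡⟨ apply2≡lc g v ⟨
  apply2 g v                   ∎)
  where open ≡-Reasoning

unapply : ∀ {m n} (g : Mat2 n) {B : Mat m n} {v : Vec Bool n} → InSpan v (map (apply2 g) B) →
          Σ (Vec Bool n) λ u → InSpan u B × v ≡ apply2 g u
unapply g {B} {v} (c , e) = lc c B , (c , sym (lc≡lincomb c B)) , (begin
  v                            ≡⟨ e ⟨
  lincomb c (map (apply2 g) B) ≡⟨ lc≡lincomb c _ ⟨
  lc c (map (apply2 g) B)      ≡⟨ cong (lc c) (map-apply2 g B) ⟩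
  lc c (B ⊗ g ᵀ)               ≡⟨ lc-⊗ c B (g ᵀ) ⟩
  lc (lc c B) (g ᵀ)            ≡⟨ apply2≡lc g _ ⟨
  apply2 g (lc c B)            ∎)
  where open ≡-Reasoning

sameSpan-apply : ∀ {l m n} (g : Mat2 n) {A : Mat l n} {B : Mat m n} → SameSpan A B → SameSpan (map (apply2 g) A) (map (apply2 g) B)
sameSpan-apply g {A} {B} h v = one-way A B (λ u → proj₁ (h u)) , one-way B A (λ u → proj₂ (h u))
  where
  one-way : ∀ {l m} (A : Mat l _) (B : Mat m _) → (∀ u → InSpan u A → InSpan u B) → InSpan v (map (apply2 g) A) → InSpan v (map (apply2 g) B)
  one-way A B k s with unapply g {A} s
  ... | u , t , refl = inSpan-apply g {B} (k u t)

apply2-mul2 : ∀ {n} (g h : Mat2 n) v → apply2 (mul2 g h) v ≡ apply2 g (apply2 h v)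
apply2-mul2 g h v = trans (apply2≡lc (mul2 g h) v) (trans (cong (λ M → lc v (M ᵀ)) (sym (⊗≡mul2 g h)))
  (trans (cong (lc v) (ᵀ-⊗ g h)) (trans (lc-⊗ v (h ᵀ) (g ᵀ)) (trans (cong (λ u → lc u (g ᵀ)) (sym (apply2≡lc h v))) (sym (apply2≡lc g _))))))

apply2-id : ∀ {n} (v : Vec Bool n) → apply2 (id2 n) v ≡ v
apply2-id {n} v = trans (apply2≡lc (id2 n) v) (trans (cong (λ M → lc v (M ᵀ)) (sym (one≡id2 n))) (trans (cong (lc v) (one-ᵀ n)) (lc-one v)))

map-mul2 : ∀ {m n} (g h : Mat2 n) (B : Mat m n) → map (apply2 g) (map (apply2 h) B) ≡ map (apply2 (mul2 g h)) B
map-mul2 g h B = trans (sym (map-∘ (apply2 g) (apply2 h) B)) (map-cong (λ v → sym (apply2-mul2 g h v)) B)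

map-inverse : ∀ {m n} (g h : Mat2 n) (B : Mat m n) → mul2 g h ≡ id2 n → map (apply2 g) (map (apply2 h) B) ≡ B
map-inverse g h B e = trans (map-mul2 g h B) (trans (map-cong (λ v → trans (cong (λ M → apply2 M v) e) (apply2-id v)) B) (map-id B))

invertible2⇒inj : ∀ {n} {g : Mat2 n} → Invertible2 g → Inj g
invertible2⇒inj {n} {g} (h , _ , e) = left-inj (trans (⊗≡mul2 g h) (trans e (sym (one≡id2 n))))

PE-sym : ∀ {O O′} → PseudoOvalEquiv O O′ → PseudoOvalEquiv O′ O
PE-sym {O} {O′} (g , (h , hg , gh) , fwd , bwd) = h , (g , gh , hg) ,
  (λ j → proj₁ (bwd j) , back (proj₂ (bwd j))) , (λ i → proj₁ (fwd i) , back (proj₂ (fwd i)))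
  where
  back : ∀ {i j} → SameSpan (map (apply2 g) (O i)) (O′ j) → SameSpan (map (apply2 h) (O′ j)) (O i)
  back {i} s = sameSpan-sym (subst (λ B → SameSpan B _) (map-inverse h g (O i) hg) (sameSpan-apply h s))

PE-trans : ∀ {O O′ O″} → PseudoOvalEquiv O O′ → PseudoOvalEquiv O′ O″ → PseudoOvalEquiv O O″
PE-trans {O} {O′} {O″} (g , ig , fwd , bwd) (g′ , ig′ , fwd′ , bwd′) =
  g′ ⊗ g , inj⇒Invertible2 (inj-⊗ (invertible2⇒inj ig′) (invertible2⇒inj ig)) ,
  (λ i → let j , s = fwd i ; k , t = fwd′ j in k , glue s t) ,
  (λ k → let j , t = bwd′ k ; i , s = bwd j in i , glue s t)
  where
  glue : ∀ {i j k} → SameSpan (map (apply2 g) (O i)) (O′ j) → SameSpan (map (apply2 g′) (O′ j)) (O″ k) →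
         SameSpan (map (apply2 (g′ ⊗ g)) (O i)) (O″ k)
  glue {i} s t = subst (λ M → SameSpan (map (apply2 M) (O i)) _) (sym (⊗≡mul2 g′ g))
    (sameSpan-trans (subst (λ B → SameSpan B _) (map-mul2 g′ g (O i)) (sameSpan-apply g′ s)) t)

-- Dual description: columns of Oᵢ, up to column operations

record _≅_ (D D′ : Fin 17 → Mat 12 4) : Set where
  field
    Θ     : Mat2 12
    Θ-inj : Inj Θ
    T     : Fin 17 → Mat2 4
    T-inj : ∀ i → Inj (T i)
    eq    : ∀ i → Θ ⊗ D i ≡ D′ i ⊗ T i

-- Transposing the hypothesis, the image of P is `T ᵀ` times P′. Since T is invertible, this is only
-- a change of basis of the subspace.
dual⇒sameSpan : ∀ {m n} (Θ : Mat2 n) (P P′ : Mat m n) (T : Mat2 m) → Inj T →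
                Θ ⊗ P ᵀ ≡ P′ ᵀ ⊗ T → SameSpan (map (apply2 Θ) P) P′
dual⇒sameSpan {m} Θ P P′ T inj eq with inj⇒inverse inj
... | H , _ , TH = sameSpan {U = T ᵀ} {U′ = H ᵀ} forth (begin
    P′                     ≡⟨ one-⊗ P′ ⟨
    one m ⊗ P′             ≡⟨ cong (_⊗ P′) (trans (sym (one-ᵀ m)) (cong _ᵀ (sym TH))) ⟩
    (T ⊗ H) ᵀ ⊗ P′         ≡⟨ cong (_⊗ P′) (ᵀ-⊗ T H) ⟩
    (H ᵀ ⊗ T ᵀ) ⊗ P′       ≡⟨ ⊗-assoc (H ᵀ) (T ᵀ) P′ ⟩
    H ᵀ ⊗ (T ᵀ ⊗ P′)       ≡⟨ cong (H ᵀ ⊗_) (sym forth) ⟩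
    H ᵀ ⊗ map (apply2 Θ) P ∎)
  where
  open ≡-Reasoning
  forth : map (apply2 Θ) P ≡ T ᵀ ⊗ P′
  forth = ᵀ-injective (trans (apply2-⊗ Θ P) (trans eq (sym (trans (ᵀ-⊗ (T ᵀ) P′) (cong (P′ ᵀ ⊗_) (ᵀ-ᵀ T))))))

≅⇒PE : ∀ {O O′ : Family17} → (λ i → O i ᵀ) ≅ (λ i → O′ i ᵀ) → PseudoOvalEquiv O O′
≅⇒PE {O} {O′} r = Θ , inj⇒Invertible2 Θ-inj , (λ i → i , same i) , (λ i → i , same i)
  where
  open _≅_ r
  same : ∀ i → SameSpan (map (apply2 Θ) (O i)) (O′ i)
  same i = dual⇒sameSpan Θ (O i) (O′ i) (T i) (T-inj i) (eq i)

≅-ᵀᵀ : ∀ {D D′} → D ≅ D′ → D ≅ (λ i → D′ i ᵀ ᵀ)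
≅-ᵀᵀ {D} {D′} r = record { Θ = Θ ; Θ-inj = Θ-inj ; T = T ; T-inj = T-inj ; eq = λ i → trans (eq i) (cong (_⊗ T i) (sym (ᵀ-ᵀ (D′ i)))) }
  where open _≅_ r

Triples : (Fin 17 → Mat 12 4) → Set
Triples D = ∀ i j k → Distinct3 i j k → ∀ f → lc f (D i) ≡ 𝟎 → lc f (D j) ≡ 𝟎 → lc f (D k) ≡ 𝟎 → f ≡ 𝟎

≅-triples : ∀ {D D′} → D ≅ D′ → Triples D → Triples D′
≅-triples {D} {D′} r h i j k d f p q s = Θ-inj f (h i j k d (lc f Θ) (vanish i p) (vanish j q) (vanish k s))
  where
  open _≅_ r
  vanish : ∀ i → lc f (D′ i) ≡ 𝟎 → lc (lc f Θ) (D i) ≡ 𝟎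
  vanish i e = trans (sym (lc-⊗ f Θ (D i))) (trans (cong (lc f) (eq i)) (trans (lc-⊗ f (D′ i) (T i)) (trans (cong (λ u → lc u (T i)) e) (lc-𝟎 (T i)))))

-- A functional that vanishes on three members vanishes on their span, which is the whole space.
pseudoOval⇒triples : ∀ {O} → IsPseudoOval O → Triples (λ i → O i ᵀ)
pseudoOval⇒triples {O} (_ , spans) i j k d f p q s = dot-ext λ v → trans (dot-comm f v) (trans (kills v) (sym (dot-𝟎 v)))
  where
  S = O i ++ O j ++ O k
  zero-map : ∀ {m} (A : Mat m 12) → lc f (A ᵀ) ≡ 𝟎 → map (λ r → dot2 r f) A ≡ 𝟎
  zero-map A e = trans (sym (lc-ᵀ f A)) e
  app : ∀ {l m} (A : Mat l 12) (B : Mat m 12) → map (λ r → dot2 r f) A ≡ 𝟎 → map (λ r → dot2 r f) B ≡ 𝟎 → map (λ r → dot2 r f) (A ++ B) ≡ 𝟎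
  app [] B _ e = e
  app (u ∷ A) B e e′ = cong₂ _∷_ (∷-injectiveˡ e) (app A B (∷-injectiveʳ e) e′)
  kills : ∀ v → dot2 v f ≡ false
  kills v with spans i j k d v
  ... | c , refl = trans (cong (λ u → dot2 u f) (sym (lc≡lincomb c S))) (trans (dot-lc c S f) (trans (cong (dot2 c)
      (trans (lc-ᵀ f S) (app (O i) _ (zero-map (O i) p) (app (O j) _ (zero-map (O j) q) (zero-map (O k) s)))))
      (trans (dot-comm c 𝟎) (dot-𝟎 c))))

-- Sums over GF(2)⁴ and the missing element

+-commutativeMonoid : ℕ → CommutativeMonoid _ _
+-commutativeMonoid n = record
  { Carrier = Vec Bool n ; _≈_ = _≡_ ; _∙_ = _+ᵥ_ ; ε = 𝟎
  ; isCommutativeMonoid = record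
    { isMonoid = record
      { isSemigroup = record
        { isMagma = record { isEquivalence = isEquivalence ; ∙-cong = cong₂ _+ᵥ_ }
        ; assoc = +-assoc }
      ; identity = +-idˡ , +-idʳ }
    ; comm = +-comm } }

∑ : ∀ {m n} → (Fin m → Vec Bool n) → Vec Bool n
∑ {n = n} = Sum.sum (+-commutativeMonoid n)

-- An injective f is a permutation of the 16 vectors, so the sum may be taken over the standard
-- enumeration, where it evaluates to 0.
∑-all : ∀ (f : Fin 16 → Vec Bool 4) → (∀ i j → f i ≡ f j → i ≡ j) → ∑ f ≡ 𝟎
∑-all f inj = trans (Sum.sum-cong-≗ (+-commutativeMonoid 4) {_} {f} {λ i → decodeᵥ 4 (encode (f i))} (λ i → sym (decode-encode (f i))))
  (sym (Sum.sum-permute (+-commutativeMonoid 4) (decodeᵥ 4) π))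
  where
  back : ∀ y → Σ (Fin 16) λ i → encode (f i) ≡ y
  back = injective⇒surjective (encode ∘ f) (λ i j e → inj i j (encode-injective e))
  π : Permutation 16 16
  π = permutation (encode ∘ f) (proj₁ ∘ back) (proj₂ ∘ back)
    (λ i → inj _ _ (encode-injective (proj₂ (back (encode (f i))))))

-- the missing element is the sum of the others
∑-missing : ∀ (f : Fin 15 → Vec Bool 4) → (∀ i j → f i ≡ f j → i ≡ j) → ∀ k → ∑ f ≢ f k
∑-missing f inj k e with ¬∀⟶∃¬ 16 (λ y → ∃ λ i → encode (f i) ≡ y) (λ y → any? (λ i → encode (f i) Fin.≟ y)) notOnto
  where
  notOnto : ¬ (∀ y → ∃ λ i → encode (f i) ≡ y)
  notOnto onto with pigeonhole (ℕₚ.n<1+n 15) (proj₁ ∘ onto)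
  ... | i , j , lt , eq = ℕₚ.<⇒≢ lt (cong Fin.toℕ (trans (sym (proj₂ (onto i))) (trans (cong (encode ∘ f) eq) (proj₂ (onto j)))))
... | y , missing = missing (k , trans (cong encode (sym (trans missed e))) (encode-decode 4 y))
  where
  g : Fin 16 → Vec Bool 4
  g zero = decodeᵥ 4 y
  g (suc i) = f i
  hits : ∀ i → decodeᵥ 4 y ≡ f i → ⊥
  hits i q = missing (i , trans (cong encode (sym q)) (encode-decode 4 y))
  g-inj : ∀ i j → g i ≡ g j → i ≡ j
  g-inj zero zero _ = refl
  g-inj zero (suc j) q = ⊥-elim (hits j q)
  g-inj (suc i) zero q = ⊥-elim (hits i (sym q))
  g-inj (suc i) (suc j) q = cong suc (inj i j q)
  missed : decodeᵥ 4 y ≡ ∑ f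
  missed = +≡𝟎⇒≡ (∑-all g g-inj)

lc-zeros : ∀ {m n} (c : Vec Bool m) → lc c (replicate m (𝟎 {n})) ≡ 𝟎
lc-zeros [] = refl
lc-zeros (false ∷ c) = lc-zeros c
lc-zeros (true ∷ c) = trans (+-idˡ _) (lc-zeros c)

-- The additional 0 belongs to the member that serves as first coordinate block: it is annihilated
-- by the functionals with first coordinate 0. With l = 14 there are 15 values in GF(2)⁴. The
-- missing one is their sum, hence linear in b, and this is why the left-over vectors form a
-- subspace.
values : ∀ {l m n} → (Fin l → Mat m n) → Vec Bool m → Fin (suc l) → Vec Bool n
values A b zero = 𝟎
values A b (suc j) = lc b (A j)

abstract
  ∑ₘ : ∀ {l m n} → (Fin l → Mat m n) → Mat m n
  ∑ₘ {zero} {m} f = replicate m 𝟎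
  ∑ₘ {suc l} f = f zero ⊞ ∑ₘ (f ∘ suc)

  lc-∑ : ∀ {l m n} (c : Vec Bool m) (f : Fin l → Mat m n) → lc c (∑ₘ f) ≡ ∑ (λ i → lc c (f i))
  lc-∑ {zero} c f = lc-zeros c
  lc-∑ {suc l} c f = trans (lc-⊞ c (f zero) _) (cong (lc c (f zero) +ᵥ_) (lc-∑ c (f ∘ suc)))

  ∑-values : ∀ {l m n} (A : Fin l → Mat m n) b → ∑ (values A b) ≡ lc b (∑ₘ A)
  ∑-values A b = trans (+-idˡ _) (sym (lc-∑ b A))

-- Block matrices

zeros : ∀ {m n} → Mat m n
zeros {m} = replicate m 𝟎

hcat : ∀ {m n p} → Mat m n → Mat m p → Mat m (n ℕ.+ p)
hcat = zipWith _++_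

+-++ : ∀ {m n} (a c : Vec Bool m) (b d : Vec Bool n) → (a ++ b) +ᵥ (c ++ d) ≡ (a +ᵥ c) ++ (b +ᵥ d)
+-++ [] [] b d = refl
+-++ (false ∷ a) (x ∷ c) b d = cong (x ∷_) (+-++ a c b d)
+-++ (true ∷ a) (x ∷ c) b d = cong (_ ∷_) (+-++ a c b d)

𝟎-++ : ∀ m {n} → 𝟎 {m ℕ.+ n} ≡ 𝟎 {m} ++ 𝟎 {n}
𝟎-++ zero = refl
𝟎-++ (suc m) = cong (false ∷_) (𝟎-++ m)

lc-hcat : ∀ {m n p} (c : Vec Bool m) (A : Mat m n) (B : Mat m p) → lc c (hcat A B) ≡ lc c A ++ lc c B
lc-hcat {n = n} [] [] [] = 𝟎-++ n
lc-hcat (false ∷ c) (u ∷ A) (v ∷ B) = lc-hcat c A B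
lc-hcat (true ∷ c) (u ∷ A) (v ∷ B) = trans (cong ((u ++ v) +ᵥ_) (lc-hcat c A B)) (+-++ u _ v _)

⊗-++ : ∀ {k l m n} (A : Mat k m) (B : Mat l m) (C : Mat m n) → (A ++ B) ⊗ C ≡ (A ⊗ C) ++ (B ⊗ C)
⊗-++ [] B C = refl
⊗-++ (u ∷ A) B C = cong (lc u C ∷_) (⊗-++ A B C)

lc-stack : ∀ {k l m n} (a : Vec Bool k) (b : Vec Bool l) (c : Vec Bool m) (X : Mat k n) (Y : Mat l n) (Z : Mat m n) →
           lc (a ++ (b ++ c)) (X ++ (Y ++ Z)) ≡ lc a X +ᵥ (lc b Y +ᵥ lc c Z)
lc-stack a b c X Y Z = trans (lc-++ a (b ++ c) X (Y ++ Z)) (cong (lc a X +ᵥ_) (lc-++ b c Y Z))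

split₃ : ∀ {m} (f : Vec Bool (m ℕ.+ (m ℕ.+ m))) → Σ (Vec Bool m) λ a → Σ (Vec Bool m) λ b → Σ (Vec Bool m) λ c → f ≡ a ++ (b ++ c)
split₃ {m} f with splitAt m f
... | a , g , refl with splitAt m g
...   | b , c , refl = a , b , c , refl

lc-ext₃ : ∀ {m n} {A B : Mat (m ℕ.+ (m ℕ.+ m)) n} → (∀ a b c → lc (a ++ (b ++ c)) A ≡ lc (a ++ (b ++ c)) B) → A ≡ B
lc-ext₃ {m} {n} {A} {B} h = lc-ext go
  where
  go : ∀ f → lc f A ≡ lc f B
  go f with split₃ {m} f
  ... | a , b , c , refl = h a b c

splitM : ∀ {m n} (D : Mat (m ℕ.+ (m ℕ.+ m)) n) → Σ (Mat m n) λ X → Σ (Mat m n) λ Y → Σ (Mat m n) λ Z → D ≡ X ++ (Y ++ Z)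
splitM {m} D with splitAt m D
... | X , E , refl with splitAt m E
...   | Y , Z , refl = X , Y , Z , refl

𝟎-injective : ∀ {m} {a b c : Vec Bool m} → a ++ (b ++ c) ≡ 𝟎 → (a ≡ 𝟎) × (b ≡ 𝟎) × (c ≡ 𝟎)
𝟎-injective {m} {a} {b} {c} e = ++-injectiveˡ a 𝟎 e₁ , ++-injectiveˡ b 𝟎 e₂ , ++-injectiveʳ b 𝟎 e₂
  where
  e₁ : a ++ (b ++ c) ≡ 𝟎 {m} ++ 𝟎 {m ℕ.+ m}
  e₁ = trans e (𝟎-++ m)
  e₂ : b ++ c ≡ 𝟎 {m} ++ 𝟎 {m}
  e₂ = trans (++-injectiveʳ a 𝟎 e₁) (𝟎-++ m)

module _ {m : ℕ} (X₁₁ X₂₁ X₂₂ X₃₁ X₃₂ X₃₃ : Mat m m) where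
  private
    O : Mat m m
    O = zeros {m} {m}
    R₁ R₂ R₃ : Mat m (m ℕ.+ (m ℕ.+ m))
    R₁ = hcat X₁₁ (hcat O O)
    R₂ = hcat X₂₁ (hcat X₂₂ O)
    R₃ = hcat X₃₁ (hcat X₃₂ X₃₃)

  lower : Mat (m ℕ.+ (m ℕ.+ m)) (m ℕ.+ (m ℕ.+ m))
  lower = R₁ ++ (R₂ ++ R₃)

  lc-lower : ∀ a b c → lc (a ++ (b ++ c)) lower ≡
    (lc a X₁₁ +ᵥ (lc b X₂₁ +ᵥ lc c X₃₁)) ++ ((lc b X₂₂ +ᵥ lc c X₃₂) ++ lc c X₃₃)
  lc-lower a b c = begin
    lc (a ++ (b ++ c)) lower
      ≡⟨ lc-stack a b c R₁ R₂ R₃ ⟩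
    lc a R₁ +ᵥ (lc b R₂ +ᵥ lc c R₃)
      ≡⟨ cong₂ _+ᵥ_ (row a X₁₁ O O) (cong₂ _+ᵥ_ (row b X₂₁ X₂₂ O) (row c X₃₁ X₃₂ X₃₃)) ⟩
    (lc a X₁₁ ++ (lc a O ++ lc a O)) +ᵥ ((lc b X₂₁ ++ (lc b X₂₂ ++ lc b O)) +ᵥ (lc c X₃₁ ++ (lc c X₃₂ ++ lc c X₃₃)))
      ≡⟨ cong₂ _+ᵥ_ (cong (λ z → lc a X₁₁ ++ (z ++ z)) (lc-zeros a)) (add (lc b X₂₁) (lc b X₂₂) (lc b O) (lc c X₃₁) (lc c X₃₂) (lc c X₃₃)) ⟩
    (lc a X₁₁ ++ (𝟎 {m} ++ 𝟎 {m})) +ᵥ ((lc b X₂₁ +ᵥ lc c X₃₁) ++ ((lc b X₂₂ +ᵥ lc c X₃₂) ++ (lc b O +ᵥ lc c X₃₃)))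
      ≡⟨ add (lc a X₁₁) (𝟎 {m}) (𝟎 {m}) (lc b X₂₁ +ᵥ lc c X₃₁) (lc b X₂₂ +ᵥ lc c X₃₂) (lc b O +ᵥ lc c X₃₃) ⟩
    (lc a X₁₁ +ᵥ (lc b X₂₁ +ᵥ lc c X₃₁)) ++ ((𝟎 {m} +ᵥ (lc b X₂₂ +ᵥ lc c X₃₂)) ++ (𝟎 {m} +ᵥ (lc b O +ᵥ lc c X₃₃)))
      ≡⟨ cong₂ (λ y z → (lc a X₁₁ +ᵥ (lc b X₂₁ +ᵥ lc c X₃₁)) ++ (y ++ z)) (+-idˡ _)
           (trans (+-idˡ _) (trans (cong (_+ᵥ lc c X₃₃) (lc-zeros b)) (+-idˡ _))) ⟩
    (lc a X₁₁ +ᵥ (lc b X₂₁ +ᵥ lc c X₃₁)) ++ ((lc b X₂₂ +ᵥ lc c X₃₂) ++ lc c X₃₃) ∎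
    where
    open ≡-Reasoning
    row : ∀ a (X Y Z : Mat m m) → lc a (hcat X (hcat Y Z)) ≡ lc a X ++ (lc a Y ++ lc a Z)
    row a X Y Z = trans (lc-hcat a X (hcat Y Z)) (cong (lc a X ++_) (lc-hcat a Y Z))
    add : ∀ (a b c d e f : Vec Bool m) → (a ++ (b ++ c)) +ᵥ (d ++ (e ++ f)) ≡ (a +ᵥ d) ++ ((b +ᵥ e) ++ (c +ᵥ f))
    add a b c d e f = trans (+-++ a d (b ++ c) (e ++ f)) (cong ((a +ᵥ d) ++_) (+-++ b e c f))

  lower-inj : Inj X₁₁ → Inj X₂₂ → Inj X₃₃ → Inj lower
  lower-inj i₁ i₂ i₃ f e with split₃ {m} f
  ... | a , b , c , refl with 𝟎-injective {m} {lc a X₁₁ +ᵥ (lc b X₂₁ +ᵥ lc c X₃₁)} {lc b X₂₂ +ᵥ lc c X₃₂} {lc c X₃₃} (trans (sym (lc-lower a b c)) e)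
  ...   | p , q , r with i₃ c r
  ...     | refl with i₂ b (trans (sym (+-idʳ (lc b X₂₂))) (trans (cong (lc b X₂₂ +ᵥ_) (sym (lc-𝟎 X₃₂))) q))
  ...       | refl with i₁ a (trans (sym (+-idʳ (lc a X₁₁))) (trans (cong (lc a X₁₁ +ᵥ_) (sym (trans (cong₂ _+ᵥ_ (lc-𝟎 X₂₁) (lc-𝟎 X₃₁)) (+-idˡ 𝟎)))) p))
  ...         | refl = trans (cong (𝟎 {m} ++_) (sym (𝟎-++ m {m}))) (sym (𝟎-++ m {m ℕ.+ m}))

-- Normalised families

-- The conditions on triples of members: `s₁` comes from the triples containing the member at
-- infinity and makes the Aᵢ a spread set; `s₂` comes from the other triples, a functional (v, b, c)
-- vanishing on three members having c = 0.
record Sys (A B : Fin 16 → M4) : Set where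
  field
    s₁ : ∀ i j → i ≢ j → ∀ b → lc b (A i) ≡ lc b (A j) → b ≡ 𝟎
    s₂ : ∀ i j k → i ≢ j → j ≢ k → i ≢ k → ∀ b c →
         lc b (A i) +ᵥ lc c (B i) ≡ lc b (A j) +ᵥ lc c (B j) →
         lc b (A j) +ᵥ lc c (B j) ≡ lc b (A k) +ᵥ lc c (B k) → c ≡ 𝟎

dual : (A B : Fin 16 → M4) → Fin 17 → Mat 12 4
dual A B zero = zeros {4} ++ (zeros {4} ++ one 4)
dual A B (suc i) = one 4 ++ (A i ++ B i)

family : (A B : Fin 16 → M4) → Family17
family A B i = dual A B i ᵀ

-- the functional (bAᵢ + cBᵢ, b, c) vanishes on the i-th member
functional : ∀ {A B : Fin 16 → M4} i {v} b c → v ≡ lc b (A i) +ᵥ lc c (B i) → lc (v ++ (b ++ c)) (dual A B (suc i)) ≡ 𝟎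
functional {A} {B} i {v} b c e = trans (lc-stack v b c (one 4) (A i) (B i)) (trans (cong (_+ᵥ _) (lc-one v)) (≡⇒+≡𝟎 e))

triples⇒sys : ∀ {A B} → Triples (dual A B) → Sys A B
triples⇒sys {A} {B} h = record
  { s₁ = λ i j i≢j b e → proj₁ (proj₂ (𝟎-injective {4} {a = lc b (A i)} {b} {𝟎}
      (h zero (suc i) (suc j) ((λ ()) , (λ p → i≢j (suc-injective p)) , (λ ())) _
        (trans (lc-stack (lc b (A i)) b 𝟎 zeros zeros (one 4)) (trans (cong₂ _+ᵥ_ (lc-zeros (lc b (A i))) (cong₂ _+ᵥ_ (lc-zeros b) (lc-𝟎 (one 4)))) (trans (+-idˡ _) (+-idˡ _))))
        (functional {A} {B} i b 𝟎 (sym (trans (cong (lc b (A i) +ᵥ_) (lc-𝟎 (B i))) (+-idʳ _))))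
        (functional {A} {B} j b 𝟎 (trans e (sym (trans (cong (lc b (A j) +ᵥ_) (lc-𝟎 (B j))) (+-idʳ _))))))))
  ; s₂ = λ i j k p q r b c e e′ → proj₂ (proj₂ (𝟎-injective {4} {a = lc b (A i) +ᵥ lc c (B i)} {b} {c}
      (h (suc i) (suc j) (suc k) ((λ x → p (suc-injective x)) , (λ x → q (suc-injective x)) , (λ x → r (suc-injective x))) _
        (functional {A} {B} i b c refl) (functional {A} {B} j b c e) (functional {A} {B} k b c (trans e e′))))) }

-- Multiplying the blocks X, Y, Z on the right by X⁻¹ changes only the basis of the member and
-- leaves the graph 1, YX⁻¹, ZX⁻¹.
graphs : ∀ {D : Fin 17 → Mat 12 4} (Θ : Mat2 12) → Inj Θ →
         (X Y Z : Fin 16 → M4) (Z₀ : M4) → Inj Z₀ → (∀ i → Inj (X i)) →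
         Θ ⊗ D zero ≡ zeros {4} ++ (zeros {4} ++ Z₀) → (∀ i → Θ ⊗ D (suc i) ≡ X i ++ (Y i ++ Z i)) →
         Σ (Fin 16 → M4) λ A → Σ (Fin 16 → M4) λ B → D ≅ dual A B
graphs {D} Θ Θ-inj X Y Z Z₀ iZ iX e₀ e = A , B , record { Θ = Θ ; Θ-inj = Θ-inj ; T = T ; T-inj = T-inj ; eq = eq }
  where
  N : ∀ i → M4
  N i = proj₁ (inj⇒inverse (iX i))
  NX : ∀ i → N i ⊗ X i ≡ one 4
  NX i = proj₁ (proj₂ (inj⇒inverse (iX i)))
  A B : Fin 16 → M4
  A i = Y i ⊗ N i
  B i = Z i ⊗ N i
  T : Fin 17 → M4
  T zero = Z₀
  T (suc i) = X i
  T-inj : ∀ i → Inj (T i)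
  T-inj zero = iZ
  T-inj (suc i) = iX i
  zeros-⊗ : ∀ {l m n} (C : Mat m n) → zeros {l} {m} ⊗ C ≡ zeros {l} {n}
  zeros-⊗ {zero} C = refl
  zeros-⊗ {suc l} C = cong₂ _∷_ (lc-𝟎 C) (zeros-⊗ {l} C)
  three : ∀ {k l m} (P : Mat k 4) (Q : Mat l 4) (R : Mat m 4) (C : M4) → (P ++ (Q ++ R)) ⊗ C ≡ (P ⊗ C) ++ ((Q ⊗ C) ++ (R ⊗ C))
  three P Q R C = trans (⊗-++ P (Q ++ R) C) (cong ((P ⊗ C) ++_) (⊗-++ Q R C))
  undo : ∀ i (C : M4) → (C ⊗ N i) ⊗ X i ≡ C
  undo i C = trans (⊗-assoc C (N i) (X i)) (trans (cong (C ⊗_) (NX i)) (⊗-one C))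
  eq : ∀ i → Θ ⊗ D i ≡ dual A B i ⊗ T i
  eq zero = trans e₀ (sym (trans (three (zeros {4} {4}) (zeros {4} {4}) (one 4) Z₀) (cong₂ _++_ (zeros-⊗ {4} {4} Z₀) (cong₂ _++_ (zeros-⊗ {4} {4} Z₀) (one-⊗ Z₀)))))
  eq (suc i) = trans (e i) (sym (trans (three (one 4) (A i) (B i) (X i)) (cong₂ _++_ (one-⊗ (X i)) (cong₂ _++_ (undo i (Y i)) (undo i (Z i))))))

_≟ᵥ_ : ∀ {n} (u v : Vec Bool n) → Dec (u ≡ v)
_≟ᵥ_ = ≡-dec Bool._≟_

-- a 12 × 12 matrix made of three members, and the corresponding coordinates
module Coordinates (P Q R : Mat 12 4) (inj : Inj (hcat P (hcat Q R))) where
  S H : Mat2 12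
  S = hcat P (hcat Q R)
  H = proj₁ (inj⇒inverse inj)

  H-inj : Inj H
  H-inj = left-inj {A = H} {S} (proj₁ (proj₂ (inj⇒inverse inj)))

  vec : (a b c : Vec Bool 4) → Vec Bool 12
  vec a b c = lc (a ++ (b ++ c)) H

  private
    S-vec : ∀ a b c → lc (vec a b c) P ++ (lc (vec a b c) Q ++ lc (vec a b c) R) ≡ a ++ (b ++ c)
    S-vec a b c = trans (sym (trans (lc-hcat (vec a b c) P (hcat Q R)) (cong (lc (vec a b c) P ++_) (lc-hcat (vec a b c) Q R))))
      (trans (sym (lc-⊗ (a ++ (b ++ c)) H S)) (trans (cong (lc (a ++ (b ++ c))) (proj₁ (proj₂ (inj⇒inverse inj)))) (lc-one (a ++ (b ++ c)))))

  P-vec : ∀ a b c → lc (vec a b c) P ≡ a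
  P-vec a b c = ++-injectiveˡ (lc (vec a b c) P) a (S-vec a b c)

  Q-vec : ∀ a b c → lc (vec a b c) Q ≡ b
  Q-vec a b c = ++-injectiveˡ (lc (vec a b c) Q) b (++-injectiveʳ (lc (vec a b c) P) a (S-vec a b c))

  R-vec : ∀ a b c → lc (vec a b c) R ≡ c
  R-vec a b c = ++-injectiveʳ (lc (vec a b c) Q) b (++-injectiveʳ (lc (vec a b c) P) a (S-vec a b c))

  coords : ∀ f → f ≡ vec (lc f P) (lc f Q) (lc f R)
  coords f = sym (inj-cancel inj (trans (sym (lc-⊗ g H S)) (trans (cong (lc g) (proj₁ (proj₂ (inj⇒inverse inj)))) (trans (lc-one g)
      (sym (trans (lc-hcat f P (hcat Q R)) (cong (lc f P ++_) (lc-hcat f Q R))))))))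
    where
    g : Vec Bool 12
    g = lc f P ++ (lc f Q ++ lc f R)

  module Parts (D : Mat 12 4) where
    X Y Z : M4
    X = proj₁ (splitM {4} (H ⊗ D))
    Y = proj₁ (proj₂ (splitM {4} (H ⊗ D)))
    Z = proj₁ (proj₂ (proj₂ (splitM {4} (H ⊗ D))))
    parts : H ⊗ D ≡ X ++ (Y ++ Z)
    parts = proj₂ (proj₂ (proj₂ (splitM {4} (H ⊗ D))))
    D-vec : ∀ a b c → lc (vec a b c) D ≡ lc a X +ᵥ (lc b Y +ᵥ lc c Z)
    D-vec a b c = trans (sym (lc-⊗ (a ++ (b ++ c)) H D)) (trans (cong (lc (a ++ (b ++ c))) parts) (lc-stack a b c X Y Z))

hcat-inj : ∀ (P Q R : Mat 12 4) → (∀ f → lc f P ≡ 𝟎 → lc f Q ≡ 𝟎 → lc f R ≡ 𝟎 → f ≡ 𝟎) → Inj (hcat P (hcat Q R))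
hcat-inj P Q R h f e with 𝟎-injective {4} {lc f P} {lc f Q} {lc f R}
  (trans (sym (trans (lc-hcat f P (hcat Q R)) (cong (lc f P ++_) (lc-hcat f Q R)))) e)
... | p , q , r = h f p q r

tangent-lc : ∀ {l m n} (P : Mat l n) (Q : Mat l m) (M : Mat m n) f → lc f (P ⊞ (Q ⊗ M)) ≡ lc f P +ᵥ lc (lc f Q) M
tangent-lc P Q M f = trans (lc-⊞ f P (Q ⊗ M)) (cong (lc f P +ᵥ_) (lc-⊗ f Q M))

tangent-zero : ∀ {l m n} (P : Mat l n) (Q : Mat l m) (M : Mat m n) f → lc f Q ≡ 𝟎 → lc f (P ⊞ (Q ⊗ M)) ≡ 𝟎 → lc f P ≡ 𝟎
tangent-zero P Q M f p q = trans (sym (+-idʳ _)) (trans (cong (lc f P +ᵥ_) (sym (trans (cong (λ v → lc v M) p) (lc-𝟎 M)))) (trans (sym (tangent-lc P Q M f)) q))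

module Normalise (D : Fin 17 → Mat 12 4) (tr : Triples D) where
  private
    ∞ 𝟙 𝟚 : Fin 17
    ∞ = zero
    𝟙 = suc zero
    𝟚 = suc (suc zero)
    𝟛+ : Fin 14 → Fin 17
    𝟛+ j = suc (suc (suc j))

    open Coordinates (D 𝟙) (D 𝟚) (D ∞) (hcat-inj _ _ _ (tr 𝟙 𝟚 ∞ ((λ ()) , (λ ()) , (λ ()))))
    module E (j : Fin 14) = Parts (D (𝟛+ j))

    zero+ : ∀ {u v w : Vec Bool 4} → v ≡ 𝟎 → w ≡ 𝟎 → u +ᵥ (v +ᵥ w) ≡ u
    zero+ {u} refl refl = trans (cong (u +ᵥ_) (+-idˡ 𝟎)) (+-idʳ u)

    first : ∀ {a b c} → vec a b c ≡ 𝟎 → a ≡ 𝟎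
    first {a} {b} {c} e = trans (sym (P-vec a b c)) (trans (cong (λ f → lc f (D 𝟙)) e) (lc-𝟎 (D 𝟙)))

    second : ∀ {a b c} → vec a b c ≡ 𝟎 → b ≡ 𝟎
    second {a} {b} {c} e = trans (sym (Q-vec a b c)) (trans (cong (λ f → lc f (D 𝟚)) e) (lc-𝟎 (D 𝟚)))

    X-inj : ∀ j → Inj (E.X j)
    X-inj j a e = first {a} {𝟎} {𝟎} (tr 𝟚 ∞ (𝟛+ j) ((λ ()) , (λ ()) , (λ ())) _ (Q-vec a 𝟎 𝟎) (R-vec a 𝟎 𝟎)
      (trans (E.D-vec j a 𝟎 𝟎) (trans (zero+ (lc-𝟎 (E.Y j)) (lc-𝟎 (E.Z j))) e)))

    A : Fin 14 → M4
    A j = E.Y j ⊗ proj₁ (inj⇒inverse (X-inj j))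

    AX : ∀ j → A j ⊗ E.X j ≡ E.Y j
    AX j = trans (⊗-assoc (E.Y j) _ (E.X j)) (trans (cong (E.Y j ⊗_) (proj₁ (proj₂ (inj⇒inverse (X-inj j))))) (⊗-one (E.Y j)))

    -- the functional (bAⱼ, b, 0) vanishes on member j
    vanishes : ∀ j a b → a ≡ lc b (A j) → lc (vec a b 𝟎) (D (𝟛+ j)) ≡ 𝟎
    vanishes j a b refl = trans (E.D-vec j a b 𝟎) (trans (cong₂ _+ᵥ_
      (trans (sym (lc-⊗ b (A j) (E.X j))) (cong (lc b) (AX j))) (trans (cong (lc b (E.Y j) +ᵥ_) (lc-𝟎 (E.Z j))) (+-idʳ _))) (+-self _))

    vanishes⁻¹ : ∀ j a b → lc (vec a b 𝟎) (D (𝟛+ j)) ≡ 𝟎 → a ≡ lc b (A j)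
    vanishes⁻¹ j a b e = inj-cancel (X-inj j) (+≡𝟎⇒≡ (trans (sym (trans (E.D-vec j a b 𝟎) (cong (lc a (E.X j) +ᵥ_)
      (trans (cong (lc b (E.Y j) +ᵥ_) (lc-𝟎 (E.Z j))) (trans (+-idʳ _) (trans (cong (lc b) (sym (AX j))) (lc-⊗ b (A j) (E.X j)))))))) e))

    -- A coincidence produces a functional vanishing on ∞ and on two further members, whose middle
    -- coordinate b must then be 0.
    values-inj : ∀ b → b ≢ 𝟎 → ∀ i j → values A b i ≡ values A b j → i ≡ j
    values-inj b b≢ zero zero e = refl
    values-inj b b≢ zero (suc j) e = ⊥-elim (b≢ (second {𝟎} {b} {𝟎}
      (tr ∞ 𝟙 (𝟛+ j) ((λ ()) , (λ ()) , (λ ())) _ (R-vec 𝟎 b 𝟎) (P-vec 𝟎 b 𝟎) (vanishes j 𝟎 b e))))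
    values-inj b b≢ (suc i) zero e = ⊥-elim (b≢ (second {𝟎} {b} {𝟎}
      (tr ∞ 𝟙 (𝟛+ i) ((λ ()) , (λ ()) , (λ ())) _ (R-vec 𝟎 b 𝟎) (P-vec 𝟎 b 𝟎) (vanishes i 𝟎 b (sym e)))))
    values-inj b b≢ (suc i) (suc j) e = cong suc (decide (i Fin.≟ j))
      where
      decide : Dec (i ≡ j) → i ≡ j
      decide (yes p) = p
      decide (no i≢j) = ⊥-elim (b≢ (second {lc b (A i)} {b} {𝟎}
        (tr ∞ (𝟛+ i) (𝟛+ j) ((λ ()) , (λ p → i≢j (suc-injective (suc-injective (suc-injective p)))) , (λ ())) _
          (R-vec (lc b (A i)) b 𝟎) (vanishes i _ b refl) (vanishes j _ b e))))

    M : M4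
    M = ∑ₘ A

    -- M is the missing element of the spread at ∞
    M≢ : ∀ b → b ≢ 𝟎 → ∀ i → lc b M ≢ values A b i
    M≢ b b≢ i e = ∑-missing (values A b) (values-inj b b≢) i (trans (∑-values A b) e)

    M-avoids : ∀ i b → lc b M ≡ values A b i → b ≡ 𝟎
    M-avoids i b e = decide (b ≟ᵥ 𝟎)
      where
      decide : Dec (b ≡ 𝟎) → b ≡ 𝟎
      decide (yes p) = p
      decide (no p) = ⊥-elim (M≢ b p i e)

    -- On a functional with coordinates (a, b, c) it takes the value a + bM. Hence the functionals
    -- vanishing on it and on ∞ are the (bM, b, 0), those left over by the other 16 members.
    tangent : Mat 12 4
    tangent = D 𝟙 ⊞ (D 𝟚 ⊗ M)

    tangent-inj : ∀ f → lc f (D 𝟚) ≡ 𝟎 → lc f tangent ≡ 𝟎 → lc f (D ∞) ≡ 𝟎 → f ≡ 𝟎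
    tangent-inj f p q r = tr 𝟙 𝟚 ∞ ((λ ()) , (λ ()) , (λ ())) f (tangent-zero (D 𝟙) (D 𝟚) M f p q) p r

    -- In these coordinates the left-over subspace consists of the functionals (u, 0, 0). None of
    -- them except 0 vanishes on a member other than ∞, so the first block of each of the 16 members
    -- is invertible.
    module C = Coordinates (D 𝟚) tangent (D ∞) (hcat-inj _ _ _ tangent-inj)
    module F (i : Fin 16) = C.Parts (D (suc i))

    C-vec : ∀ u → C.vec u 𝟎 𝟎 ≡ vec (lc u M) u 𝟎
    C-vec u = trans (coords f) (cong₂ (λ a g → g a) p (cong₂ (λ b c a → vec a b c) (C.P-vec u 𝟎 𝟎) (C.R-vec u 𝟎 𝟎)))
      where
      f : Vec Bool 12
      f = C.vec u 𝟎 𝟎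
      p : lc f (D 𝟙) ≡ lc u M
      p = trans (+≡𝟎⇒≡ (trans (sym (tangent-lc (D 𝟙) (D 𝟚) M f)) (C.Q-vec u 𝟎 𝟎))) (cong (λ v → lc v M) (C.P-vec u 𝟎 𝟎))

    F-inj : ∀ i → Inj (F.X i)
    F-inj i u e = avoid i (trans (cong (λ f → lc f (D (suc i))) (sym (C-vec u)))
        (trans (F.D-vec i u 𝟎 𝟎) (trans (zero+ (lc-𝟎 (F.Y i)) (lc-𝟎 (F.Z i))) e)))
      where
      avoid : ∀ i → lc (vec (lc u M) u 𝟎) (D (suc i)) ≡ 𝟎 → u ≡ 𝟎
      avoid zero e = M-avoids zero u (trans (sym (P-vec (lc u M) u 𝟎)) e)
      avoid (suc zero) e = trans (sym (Q-vec (lc u M) u 𝟎)) e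
      avoid (suc (suc j)) e = M-avoids (suc j) u (vanishes⁻¹ j (lc u M) u e)

    at-∞ : C.H ⊗ D ∞ ≡ zeros {4} ++ (zeros {4} ++ one 4)
    at-∞ = lc-ext₃ {4} λ a b c → trans (lc-⊗ (a ++ (b ++ c)) C.H (D ∞)) (trans (C.R-vec a b c)
      (sym (trans (lc-stack a b c (zeros {4}) (zeros {4}) (one 4)) (trans (cong₂ _+ᵥ_ (lc-zeros a) (cong₂ _+ᵥ_ (lc-zeros b) (lc-one c)))
        (trans (+-idˡ _) (+-idˡ c))))))

  normalised : Σ (Fin 16 → M4) λ A → Σ (Fin 16 → M4) λ B → D ≅ dual A B
  normalised = graphs {D} C.H C.H-inj F.X F.Y F.Z (one 4) (left-inj {B = one 4} (one-⊗ (one 4))) F-inj at-∞ F.parts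

normalise : ∀ O → IsPseudoOval O → Σ (Fin 16 → M4) λ A → Σ (Fin 16 → M4) λ B → Sys A B × PseudoOvalEquiv O (family A B)
normalise O po = A , B , triples⇒sys (≅-triples r tr) , ≅⇒PE (≅-ᵀᵀ r)
  where
  tr : Triples (λ i → O i ᵀ)
  tr = pseudoOval⇒triples po
  nf : Σ (Fin 16 → M4) λ A → Σ (Fin 16 → M4) λ B → (λ i → O i ᵀ) ≅ dual A B
  nf = Normalise.normalised (λ i → O i ᵀ) tr
  A B : Fin 16 → M4
  A = proj₁ nf
  B = proj₁ (proj₂ nf)
  r : (λ i → O i ᵀ) ≅ dual A B
  r = proj₂ (proj₂ nf)

-- Soundness of the boolean tests

∧-split : ∀ a {b} → a ∧ b ≡ true → a ≡ true × b ≡ true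
∧-split true e = refl , e

∨-split : ∀ a {b} → a ∨ b ≡ true → a ≡ true ⊎ b ≡ true
∨-split true e = inj₁ refl
∨-split false e = inj₂ e

if-just : ∀ {A : Set} b {x y : A} → (if b then just x else nothing) ≡ just y → b ≡ true
if-just true e = refl

eqV-sound : ∀ {n} (u v : Vec Bool n) → eqV u v ≡ true → u ≡ v
eqV-sound [] [] e = refl
eqV-sound (false ∷ u) (false ∷ v) e = cong (false ∷_) (eqV-sound u v e)
eqV-sound (true ∷ u) (true ∷ v) e = cong (true ∷_) (eqV-sound u v e)

eqM-sound : ∀ {m n} (A B : Mat m n) → eqM A B ≡ true → A ≡ B
eqM-sound [] [] e = refl
eqM-sound (u ∷ A) (v ∷ B) e with ∧-split (eqV u v) e
... | p , q = cong₂ _∷_ (eqV-sound u v p) (eqM-sound A B q)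

nonzero-complete : ∀ {n} (v : Vec Bool n) → nonzero v ≡ false → v ≡ 𝟎
nonzero-complete [] e = refl
nonzero-complete (false ∷ v) e = cong (false ∷_) (nonzero-complete v e)

nonzero-𝟎 : ∀ n → nonzero (𝟎 {n}) ≡ false
nonzero-𝟎 zero = refl
nonzero-𝟎 (suc n) = nonzero-𝟎 n

nonzero-sound : ∀ {n} {v : Vec Bool n} → nonzero v ≡ true → v ≢ 𝟎
nonzero-sound {n} p refl with trans (sym p) (nonzero-𝟎 n)
... | ()

anyL-sound : ∀ {A : Set} (p : A → Bool) xs → anyL p xs ≡ true → Any (λ x → p x ≡ true) xs
anyL-sound p (x ∷ xs) e with ∨-split (p x) e
... | inj₁ h = here h
... | inj₂ h = there (anyL-sound p xs h)

allL-sound : ∀ {A : Set} (p : A → Bool) xs → allL p xs ≡ true → All (λ x → p x ≡ true) xs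
allL-sound p [] e = []
allL-sound p (x ∷ xs) e with ∧-split (p x) e
... | h , t = h ∷ allL-sound p xs t

-- Tries

mem-⋈ : ∀ {n} a b (v : Vec Bool (suc n)) → mem (a ⋈ b) v ≡ mem (a ∣ b) v
mem-⋈ ∅ ∅ (false ∷ v) = refl
mem-⋈ ∅ ∅ (true ∷ v) = refl
mem-⋈ ∅ ● v = refl
mem-⋈ ∅ (_ ∣ _) v = refl
mem-⋈ ● b v = refl
mem-⋈ (_ ∣ _) b v = refl

-- For an exhaustive search this is the critical inclusion: no candidate that satisfies the
-- constraint is lost.
mem-meet : ∀ {n} s t (v x : Vec Bool n) → mem s x ≡ true → mem t (x +ᵥ v) ≡ true → mem (meet s t v) x ≡ true
mem-meet ● ● v x p q = refl
mem-meet ● (c ∣ d) (false ∷ v) (false ∷ x) p q = trans (mem-⋈ (meet ● c v) _ (false ∷ x)) (mem-meet ● c v x refl q)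
mem-meet ● (c ∣ d) (false ∷ v) (true ∷ x) p q = trans (mem-⋈ (meet ● c v) _ (true ∷ x)) (mem-meet ● d v x refl q)
mem-meet ● (c ∣ d) (true ∷ v) (false ∷ x) p q = trans (mem-⋈ (meet ● d v) _ (false ∷ x)) (mem-meet ● d v x refl q)
mem-meet ● (c ∣ d) (true ∷ v) (true ∷ x) p q = trans (mem-⋈ (meet ● d v) _ (true ∷ x)) (mem-meet ● c v x refl q)
mem-meet ● (c ∣ d) [] [] p ()
mem-meet (a ∣ b) ● v x p q = p
mem-meet (a ∣ b) (c ∣ d) (false ∷ v) (false ∷ x) p q = trans (mem-⋈ (meet a c v) _ (false ∷ x)) (mem-meet a c v x p q)
mem-meet (a ∣ b) (c ∣ d) (false ∷ v) (true ∷ x) p q = trans (mem-⋈ (meet a c v) _ (true ∷ x)) (mem-meet b d v x p q)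
mem-meet (a ∣ b) (c ∣ d) (true ∷ v) (false ∷ x) p q = trans (mem-⋈ (meet a d v) _ (false ∷ x)) (mem-meet a d v x p q)
mem-meet (a ∣ b) (c ∣ d) (true ∷ v) (true ∷ x) p q = trans (mem-⋈ (meet a d v) _ (true ∷ x)) (mem-meet b c v x p q)

-- The inclusion runs the other way than for `mem-meet`, because `frames` discards the members of a
-- join, and only dependent vectors may be discarded.
mem-join : ∀ {n} s t (v x : Vec Bool n) → mem (join s t v) x ≡ true → mem s x ≡ true ⊎ mem t (x +ᵥ v) ≡ true
mem-join ● t v x e = inj₁ refl
mem-join ∅ ● v x e = inj₂ refl
mem-join ∅ (c ∣ d) (false ∷ v) (false ∷ x) e = mem-join ∅ c v x e
mem-join ∅ (c ∣ d) (false ∷ v) (true ∷ x) e = mem-join ∅ d v x e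
mem-join ∅ (c ∣ d) (true ∷ v) (false ∷ x) e = mem-join ∅ d v x e
mem-join ∅ (c ∣ d) (true ∷ v) (true ∷ x) e = mem-join ∅ c v x e
mem-join (a ∣ b) ∅ v x e = inj₁ e
mem-join (a ∣ b) ● v x e = inj₂ refl
mem-join (a ∣ b) (c ∣ d) (false ∷ v) (false ∷ x) e = mem-join a c v x e
mem-join (a ∣ b) (c ∣ d) (false ∷ v) (true ∷ x) e = mem-join b d v x e
mem-join (a ∣ b) (c ∣ d) (true ∷ v) (false ∷ x) e = mem-join a d v x e
mem-join (a ∣ b) (c ∣ d) (true ∷ v) (true ∷ x) e = mem-join b c v x e

mem-prefix : ∀ {m n} (u : Vec Bool m) (v : Vec Bool n) → mem (prefix u) (u ++ v) ≡ true
mem-prefix [] v = refl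
mem-prefix (false ∷ u) v = mem-prefix u v
mem-prefix (true ∷ u) v = mem-prefix u v

prefix-sound : ∀ {n} (u v : Vec Bool n) → mem (prefix u) v ≡ true → u ≡ v
prefix-sound [] [] e = refl
prefix-sound (false ∷ u) (false ∷ v) e = cong (false ∷_) (prefix-sound u v e)
prefix-sound (true ∷ u) (true ∷ v) e = cong (true ∷_) (prefix-sound u v e)

mem-insert : ∀ {n} (u : Vec Bool n) t v → mem (insert u t) v ≡ true → v ≡ u ⊎ mem t v ≡ true
mem-insert u ● v e = inj₂ refl
mem-insert [] ∅ [] e = inj₁ refl
mem-insert [] (a ∣ b) [] e = inj₁ refl
mem-insert (false ∷ u) ∅ (false ∷ v) e with mem-insert u ∅ v e
... | inj₁ p = inj₁ (cong (false ∷_) p)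
mem-insert (true ∷ u) ∅ (true ∷ v) e with mem-insert u ∅ v e
... | inj₁ p = inj₁ (cong (true ∷_) p)
mem-insert (false ∷ u) (a ∣ b) (false ∷ v) e with mem-insert u a v e
... | inj₁ p = inj₁ (cong (false ∷_) p)
... | inj₂ p = inj₂ p
mem-insert (false ∷ u) (a ∣ b) (true ∷ v) e = inj₂ e
mem-insert (true ∷ u) (a ∣ b) (false ∷ v) e = inj₂ e
mem-insert (true ∷ u) (a ∣ b) (true ∷ v) e with mem-insert u b v e
... | inj₁ p = inj₁ (cong (true ∷_) p)
... | inj₂ p = inj₂ p

mem-lo : ∀ {n} s (v : Vec Bool n) → mem (lo s) v ≡ mem s (false ∷ v)
mem-lo ∅ v = refl
mem-lo ● v = refl
mem-lo (a ∣ b) v = refl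

mem-hi : ∀ {n} s (v : Vec Bool n) → mem (hi s) v ≡ mem s (true ∷ v)
mem-hi ∅ v = refl
mem-hi ● v = refl
mem-hi (a ∣ b) v = refl

mem-graft : ∀ n s f (u : Vec Bool n) {m} (v : Vec Bool m) → mem s u ≡ false → mem (graft n s f) (u ++ v) ≡ mem (f u) v
mem-graft zero ∅ f [] v e = refl
mem-graft zero (a ∣ b) f [] v e = refl
mem-graft (suc n) s f (false ∷ u) v e = trans (mem-⋈ (graft n (lo s) _) _ (false ∷ (u ++ v))) (mem-graft n (lo s) _ u v (trans (mem-lo s u) e))
mem-graft (suc n) s f (true ∷ u) v e = trans (mem-⋈ (graft n (lo s) _) _ (true ∷ (u ++ v))) (mem-graft n (hi s) _ u v (trans (mem-hi s u) e))

Independent : ∀ {k} → Trie → Mat k 4 → Set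
Independent S A = ∀ c u → mem S u ≡ true → lc c A ≡ u → c ≡ 𝟎

-- A combination of the later rows that falls into S ∪ (v + S) gives, with coefficient 0 or 1 at v,
-- a combination of all rows that falls into S.
mem-frames : ∀ {k} S (A : Mat k 4) → Independent S A → mem (frames k S) (concat A) ≡ true
mem-frames S [] ind = refl
mem-frames {suc k} S (v ∷ A) ind = trans (mem-graft 4 S (λ v → frames k (join S S v)) v (concat A) v∉S) (mem-frames (join S S v) A ind′)
  where
  v∉S : mem S v ≡ false
  v∉S = go (mem S v) refl
    where
    go : ∀ b → mem S v ≡ b → b ≡ false
    go false _ = refl
    go true e with ind (true ∷ 𝟎) v e (trans (cong (v +ᵥ_) (lc-𝟎 A)) (+-idʳ v))
    ... | ()
  ind′ : Independent (join S S v) A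
  ind′ c u e p with mem-join S S v u e
  ... | inj₁ q = ∷-injectiveʳ (ind (false ∷ c) u q p)
  ... | inj₂ q = ∷-injectiveʳ (ind (true ∷ c) (u +ᵥ v) q (trans (cong (v +ᵥ_) p) (+-comm v u)))

mem-GL : ∀ (A : M4) → Inj A → mem GL (concat A) ≡ true
mem-GL A inj = mem-frames (prefix 0F) A (λ c u e p → inj c (trans p (sym (prefix-sound 0F u e))))

every-sound : ∀ n t f → every n t f ≡ true → ∀ v → mem t v ≡ true → f v ≡ true
every-sound zero ● f e [] p = e
every-sound (suc n) ● f e (false ∷ v) p = every-sound n ● _ (proj₁ (∧-split (every n ● _) e)) v refl
every-sound (suc n) ● f e (true ∷ v) p = every-sound n ● _ (proj₂ (∧-split (every n ● (λ v → f (false ∷ v))) e)) v refl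
every-sound (suc n) (a ∣ b) f e (false ∷ v) p = every-sound n a _ (proj₁ (∧-split (every n a _) e)) v p
every-sound (suc n) (a ∣ b) f e (true ∷ v) p = every-sound n b _ (proj₂ (∧-split (every n a (λ v → f (false ∷ v))) e)) v p

-- Soundness of checks, tables and packed matrices

Succeeds : Check → Set
Succeeds f = Σ (List ℕ) λ c → Σ (List ℕ) λ d → f c ≡ just d

▷-sound : ∀ m f {d} → (m ▷ f) ≡ just d → Σ (List ℕ) λ c → (m ≡ just c) × (f c ≡ just d)
▷-sound (just c) f e = c , refl , e

run-sound : ∀ n t f → Succeeds (run n t f) → ∀ v → mem t v ≡ true → Succeeds (f v)
run-sound zero ● f h [] p = h
run-sound (suc n) ● f (c , d , e) v p with ▷-sound (run n ● (λ v → f (false ∷ v)) c) _ e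
run-sound (suc n) ● f (c , d , e) (false ∷ v) p | c′ , e₁ , e₂ = run-sound n ● _ (c , c′ , e₁) v refl
run-sound (suc n) ● f (c , d , e) (true ∷ v) p | c′ , e₁ , e₂ = run-sound n ● _ (c′ , d , e₂) v refl
run-sound (suc n) (a ∣ b) f (c , d , e) v p with ▷-sound (run n a (λ v → f (false ∷ v)) c) _ e
run-sound (suc n) (a ∣ b) f (c , d , e) (false ∷ v) p | c′ , e₁ , e₂ = run-sound n a _ (c , c′ , e₁) v p
run-sound (suc n) (a ∣ b) f (c , d , e) (true ∷ v) p | c′ , e₁ , e₂ = run-sound n b _ (c′ , d , e₂) v p

passes-sound : ∀ f c → passes (f c) ≡ true → Succeeds f
passes-sound f c e = go (f c) refl e
  where
  go : ∀ m → f c ≡ m → passes m ≡ true → Succeeds f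
  go (just []) p _ = c , [] , p

regular-sound : ∀ A → regular A ≡ true → Inj A
regular-sound A e c p = go (nonzero c) refl
  where
  h : not (nonzero c) ∨ nonzero (lc c A) ≡ true
  h = every-sound 4 ● (λ c → not (nonzero c) ∨ nonzero (lc c A)) e c refl
  go : ∀ b → nonzero c ≡ b → c ≡ 𝟎
  go false q = nonzero-complete c q
  go true q with ∨-split (not (nonzero c)) h
  ... | inj₁ r rewrite q with r
  ...   | ()
  go true q | inj₂ r = ⊥-elim (nonzero-sound r p)

concat-⊞ : ∀ {m n} (A B : Mat m n) → concat (A ⊞ B) ≡ concat A +ᵥ concat B
concat-⊞ [] [] = refl
concat-⊞ (u ∷ A) (v ∷ B) = trans (cong ((u +ᵥ v) ++_) (concat-⊞ A B)) (sym (plus u v (concat A) (concat B)))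
  where
  plus : ∀ {m n} (a c : Vec Bool m) (b d : Vec Bool n) → (a ++ b) +ᵥ (c ++ d) ≡ (a +ᵥ c) ++ (b +ᵥ d)
  plus [] [] b d = refl
  plus (false ∷ a) (x ∷ c) b d = cong (x ∷_) (plus a c b d)
  plus (true ∷ a) (x ∷ c) b d = cong (_ ∷_) (plus a c b d)

rows-concat : ∀ (A : M4) → rows (concat A) ≡ A
rows-concat ((_ ∷ _ ∷ _ ∷ _ ∷ []) ∷ (_ ∷ _ ∷ _ ∷ _ ∷ []) ∷ (_ ∷ _ ∷ _ ∷ _ ∷ []) ∷ (_ ∷ _ ∷ _ ∷ _ ∷ []) ∷ []) = refl

get-table : ∀ {A : Set} (d : A) n f (v : Vec Bool n) → get d (table n f) v ≡ f v
get-table d zero f [] = refl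
get-table d (suc n) f (false ∷ v) = get-table d n _ v
get-table d (suc n) f (true ∷ v) = get-table d n _ v

at-table : ∀ n f (u v : Vec Bool n) → at (table n f) u v ≡ f (u +ᵥ v)
at-table zero f [] [] = refl
at-table (suc n) f (false ∷ u) (false ∷ v) = at-table n _ u v
at-table (suc n) f (false ∷ u) (true ∷ v) = at-table n _ u v
at-table (suc n) f (true ∷ u) (false ∷ v) = at-table n _ u v
at-table (suc n) f (true ∷ u) (true ∷ v) = at-table n _ u v

-- Transformations of normalised systems

Has : (Fin 16 → M4) → List M4 → Set
Has A = All (λ M → Σ (Fin 16) λ i → A i ≡ M)

-- These are the block triangular changes of coordinates; they preserve the member at infinity and
-- the subspace of functionals (a, 0, 0). On the spread set they act by A ↦ P(A + R)Q, and to the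
-- second component they may add a multiple LA of the first and a constant.
module Move (A B : Fin 16 → M4) (P Q S R L K : M4) (iP : Inj P) (iQ : Inj Q) (iS : Inj S) where
  A′ B′ : Fin 16 → M4
  A′ i = (P ⊗ (A i ⊞ R)) ⊗ Q
  B′ i = (S ⊗ ((B i ⊞ (L ⊗ A i)) ⊞ K)) ⊗ Q

  private
    inA inB : Fin 16 → Vec Bool 4 → Vec Bool 4
    inA i b = lc (lc b P) (A i) +ᵥ lc (lc b P) R
    inB i c = (lc (lc c S) (B i) +ᵥ lc (lc (lc c S) L) (A i)) +ᵥ lc (lc c S) K

    lc-A′ : ∀ i b → lc b (A′ i) ≡ lc (inA i b) Q
    lc-A′ i b = trans (lc-⊗ b (P ⊗ (A i ⊞ R)) Q) (cong (λ v → lc v Q) (trans (lc-⊗ b P (A i ⊞ R)) (lc-⊞ (lc b P) (A i) R)))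

    lc-B′ : ∀ i c → lc c (B′ i) ≡ lc (inB i c) Q
    lc-B′ i c = trans (lc-⊗ c (S ⊗ _) Q) (cong (λ v → lc v Q) (trans (lc-⊗ c S _) (trans (lc-⊞ (lc c S) (B i ⊞ (L ⊗ A i)) K)
      (cong (_+ᵥ lc (lc c S) K) (trans (lc-⊞ (lc c S) (B i) (L ⊗ A i)) (cong (lc (lc c S) (B i) +ᵥ_) (lc-⊗ (lc c S) L (A i))))))))

    rearrange : ∀ {n} (x r y z k : Vec Bool n) → (x +ᵥ r) +ᵥ ((y +ᵥ z) +ᵥ k) ≡ ((x +ᵥ z) +ᵥ y) +ᵥ (r +ᵥ k)
    rearrange x r y z k = trans (+-interchange x r (y +ᵥ z) k) (cong (_+ᵥ (r +ᵥ k)) (trans (cong (x +ᵥ_) (+-comm y z)) (sym (+-assoc x z y))))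

    slope : Vec Bool 4 → Vec Bool 4 → Vec Bool 4
    slope b c = lc b P +ᵥ lc (lc c S) L

    constant : Vec Bool 4 → Vec Bool 4 → Vec Bool 4
    constant b c = lc (lc b P) R +ᵥ lc (lc c S) K

    -- The functional of the new system with coefficients b, c becomes one of the old system with
    -- coefficients `slope b c` and cS, up to a term that is the same for all members and cancels in
    -- every comparison.
    both : ∀ i b c → lc b (A′ i) +ᵥ lc c (B′ i) ≡ lc ((lc (slope b c) (A i) +ᵥ lc (lc c S) (B i)) +ᵥ constant b c) Q
    both i b c = trans (cong₂ _+ᵥ_ (lc-A′ i b) (lc-B′ i c)) (trans (sym (lc-+ (inA i b) (inB i c) Q)) (cong (λ v → lc v Q)
      (trans (rearrange (lc (lc b P) (A i)) _ _ _ _) (cong (λ v → (v +ᵥ lc (lc c S) (B i)) +ᵥ constant b c) (sym (lc-+ (lc b P) (lc (lc c S) L) (A i)))))))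

    strip : ∀ {u v} k → lc (u +ᵥ k) Q ≡ lc (v +ᵥ k) Q → u ≡ v
    strip {u} {v} k e = trans (sym (+-cancelʳ u k)) (trans (cong (_+ᵥ k) (inj-cancel iQ e)) (+-cancelʳ v k))

  sys : Sys A B → Sys A′ B′
  sys h = record
    { s₁ = λ i j i≢j b e → iP b (s₁ i j i≢j (lc b P) (strip (lc (lc b P) R) (trans (sym (lc-A′ i b)) (trans e (lc-A′ j b)))))
    ; s₂ = λ i j k p q r b c e e′ → iS c (s₂ i j k p q r (slope b c) (lc c S)
        (strip (constant b c) (trans (sym (both i b c)) (trans e (both j b c))))
        (strip (constant b c) (trans (sym (both j b c)) (trans e′ (both k b c))))) }
    where open Sys h

  private
    Q⁻¹ : M4
    Q⁻¹ = proj₁ (inj⇒inverse iQ)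
    undo : ∀ v → lc (lc v Q) Q⁻¹ ≡ v
    undo v = trans (sym (lc-⊗ v Q Q⁻¹)) (trans (cong (lc v) (proj₂ (proj₂ (inj⇒inverse iQ)))) (lc-one v))
    Θ : Mat2 12
    -- On functionals this is (a, b, c) ↦ (aQ⁻¹ + `constant b c`, `slope b c`, cS), which carries
    -- the computation in `both` to the whole 12-dimensional space.
    Θ = lower Q⁻¹ (P ⊗ R) P (S ⊗ K) (S ⊗ L) S
    T : Fin 17 → M4
    T zero = S
    T (suc i) = Q⁻¹
    iQ⁻¹ : Inj Q⁻¹
    iQ⁻¹ = left-inj {A = Q⁻¹} {Q} (proj₁ (proj₂ (inj⇒inverse iQ)))
    T-inj : ∀ i → Inj (T i)
    T-inj zero = iS
    T-inj (suc i) = iQ⁻¹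

    lc-Θ : ∀ a b c (D : Mat 12 4) → lc (a ++ (b ++ c)) (Θ ⊗ D) ≡
           lc ((lc a Q⁻¹ +ᵥ constant b c) ++ (slope b c ++ lc c S)) D
    lc-Θ a b c D = trans (lc-⊗ (a ++ (b ++ c)) Θ D) (cong (λ f → lc f D) (trans (lc-lower Q⁻¹ (P ⊗ R) P (S ⊗ K) (S ⊗ L) S a b c)
      (cong₂ (λ x y → (lc a Q⁻¹ +ᵥ x) ++ (y ++ lc c S)) (cong₂ _+ᵥ_ (lc-⊗ b P R) (lc-⊗ c S K)) (cong (lc b P +ᵥ_) (lc-⊗ c S L)))))

    eq : ∀ i → Θ ⊗ dual A B i ≡ dual A′ B′ i ⊗ T i
    eq zero = lc-ext₃ {4} λ a b c → trans (lc-Θ a b c _) (trans (only (lc a Q⁻¹ +ᵥ constant b c) (slope b c) (lc c S))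
        (sym (trans (lc-⊗ (a ++ (b ++ c)) (zeros {4} ++ (zeros {4} ++ one 4)) S) (cong (λ v → lc v S) (only a b c)))))
      where
      only : ∀ a b c → lc (a ++ (b ++ c)) (zeros {4} ++ (zeros {4} ++ one 4)) ≡ c
      only a b c = trans (lc-stack a b c (zeros {4}) (zeros {4}) (one 4)) (trans (cong₂ _+ᵥ_ (lc-zeros a) (cong₂ _+ᵥ_ (lc-zeros b) (lc-one c)))
        (trans (+-idˡ _) (+-idˡ c)))
    eq (suc i) = lc-ext₃ {4} λ a b c → trans (lc-Θ a b c _) (trans (graph A B (lc a Q⁻¹ +ᵥ constant b c) (slope b c) (lc c S))
        (trans (+-assoc (lc a Q⁻¹) (constant b c) _) (trans (cong (lc a Q⁻¹ +ᵥ_) (trans (+-comm (constant b c) _)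
          (trans (sym (undo _)) (cong (λ v → lc v Q⁻¹) (sym (both i b c))))))
        (trans (sym (lc-+ a _ Q⁻¹)) (sym (trans (lc-⊗ (a ++ (b ++ c)) (dual A′ B′ (suc i)) Q⁻¹) (cong (λ v → lc v Q⁻¹) (graph A′ B′ a b c))))))))
      where
      graph : ∀ A B a b c → lc (a ++ (b ++ c)) (dual A B (suc i)) ≡ a +ᵥ (lc b (A i) +ᵥ lc c (B i))
      graph A B a b c = trans (lc-stack a b c (one 4) (A i) (B i)) (cong (_+ᵥ _) (lc-one a))

  equiv : PseudoOvalEquiv (family A B) (family A′ B′)
  equiv = ≅⇒PE (≅-ᵀᵀ (record { Θ = Θ ; Θ-inj = lower-inj Q⁻¹ (P ⊗ R) P (S ⊗ K) (S ⊗ L) S iQ⁻¹ iP iS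
    ; T = T ; T-inj = T-inj ; eq = λ i → trans (cong (Θ ⊗_) (ᵀ-ᵀ (dual A B i))) (eq i) }))

one-inj : ∀ n → Inj (one n)
one-inj n c e = trans (sym (lc-one c)) e

-- By `s₁` the 16 vectors bAᵢ are distinct, and GF(2)⁴ has just 16 vectors. For b the first unit
-- vector this says that every first row occurs.
onto : ∀ {A B} → Sys A B → ∀ b → b ≢ 𝟎 → ∀ v → Σ (Fin 16) λ i → lc b (A i) ≡ v
onto {A} h b b≢ = fin-surjective 4 (λ i → lc b (A i)) (λ i j e → decide i j e (i Fin.≟ j))
  where
  decide : ∀ i j → lc b (A i) ≡ lc b (A j) → Dec (i ≡ j) → i ≡ j
  decide i j e (yes p) = p
  decide i j e (no p) = ⊥-elim (b≢ (Sys.s₁ h i j p b e))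

if-elim : ∀ {C : Set} b {x y : Bool} → (x ≡ true → C) → (y ≡ true → C) → (if b then x else y) ≡ true → C
if-elim true f g e = f e
if-elim false f g e = g e

∨-elim : ∀ {C : Set} a {b} → (a ≡ true → C) → (b ≡ true → C) → a ∨ b ≡ true → C
∨-elim true f g e = f refl
∨-elim false f g e = g e

Any-elim : ∀ {A C : Set} (p : A → Bool) xs → (∀ x → p x ≡ true → C) → anyL p xs ≡ true → C
Any-elim p (x ∷ xs) f = ∨-elim (p x) (f x) (Any-elim p xs f)

-- Soundness of the searches for spread sets

data Fits (A : Fin 16 → M4) : ∀ {k} → Vec Trie k → Vec (Fin 16) k → Set where
  [] : Fits A [] []
  _∷_ : ∀ {k t i} {ts : Vec Trie k} {is} → mem t (concat (A i)) ≡ true → Fits A ts is → Fits A (t ∷ ts) (i ∷ is)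

data Avoids (i : Fin 16) : ∀ {k} → Vec (Fin 16) k → Set where
  [] : Avoids i []
  _∷_ : ∀ {k j} {js : Vec (Fin 16) k} → j ≢ i → Avoids i js → Avoids i (j ∷ js)

data Distinct : ∀ {k} → Vec (Fin 16) k → Set where
  [] : Distinct []
  _∷_ : ∀ {k i} {is : Vec (Fin 16) k} → Avoids i is → Distinct is → Distinct (i ∷ is)

difference-inj : ∀ {A B} → Sys A B → ∀ i j → i ≢ j → Inj (A i ⊞ A j)
difference-inj {A} h i j p c e = Sys.s₁ h i j p c (+≡𝟎⇒≡ (trans (sym (lc-⊞ c (A i) (A j))) e))

≢-bool : ∀ {n} (u v : Vec Bool n) → not (eqV u v) ≡ true → u ≢ v
≢-bool u .u e refl with trans (sym e) (cong not (eqV-refl u))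
  where
  eqV-refl : ∀ {n} (u : Vec Bool n) → eqV u u ≡ true
  eqV-refl [] = refl
  eqV-refl (false ∷ u) = eqV-refl u
  eqV-refl (true ∷ u) = eqV-refl u
... | ()

1F≢𝟎 : 1F ≢ 𝟎
1F≢𝟎 ()

first-row : ∀ (A : M4) a → lc 1F A ≡ a → Σ (Vec Bool 12) λ v → concat A ≡ a ++ v
first-row (u ∷ A) a e = concat A , cong (_++ concat A) (trans (sym (trans (cong (u +ᵥ_) (lc-𝟎 A)) (+-idʳ u))) e)

-- All that enters about the trie is that it contains the invertible matrices; keeping it a variable
-- prevents its unfolding during type checking.
module Searches (gl : Trie) (gl-ok : ∀ (A : M4) → Inj A → mem gl (concat A) ≡ true) where

  mem-difference : ∀ {A B} → Sys A B → ∀ i j → i ≢ j → mem gl (concat (A i) +ᵥ concat (A j)) ≡ true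
  mem-difference {A} h i j p = trans (cong (mem gl) (sym (concat-⊞ (A i) (A j)))) (gl-ok (A i ⊞ A j) (difference-inj h i j p))

  fits-meets : ∀ {A B} → Sys A B → ∀ i {k} {ts : Vec Trie k} {is} → Avoids i is → Fits A ts is → Fits A (meets gl (concat (A i)) ts) is
  fits-meets h i [] [] = []
  fits-meets {A} h i {ts = t ∷ ts} {j ∷ is} (p ∷ ps) (m ∷ ms) = mem-meet t gl (concat (A i)) (concat (A j)) m (mem-difference h j i p) ∷ fits-meets h i ps ms

  module _ {A B : Fin 16 → M4} (h : Sys A B) where
    rowIndex : F16 → Fin 16
    rowIndex a = proj₁ (onto h 1F 1F≢𝟎 a)

    rowIndex-row : ∀ a → lc 1F (A (rowIndex a)) ≡ a
    rowIndex-row a = proj₂ (onto h 1F 1F≢𝟎 a)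

    indices : ∀ {k} → Vec F16 k → Vec (Fin 16) k
    indices [] = []
    indices (a ∷ as) = rowIndex a ∷ indices as

    fits-compatible : ∀ a X → Has A X → All (λ M → not (eqV a (lc 1F M)) ≡ true) X →
                      mem (compatible gl X (prefix a)) (concat (A (rowIndex a))) ≡ true
    fits-compatible a [] [] [] = trans (cong (mem (prefix a)) (proj₂ (first-row (A (rowIndex a)) a (rowIndex-row a)))) (mem-prefix a _)
    fits-compatible a (M ∷ X) ((i , refl) ∷ hs) (f ∷ fs) = mem-meet (compatible gl X (prefix a)) gl (concat M) (concat (A (rowIndex a)))
      (fits-compatible a X hs fs) (mem-difference h (rowIndex a) i
        (λ e → ≢-bool a (lc 1F M) f (trans (sym (rowIndex-row a)) (cong (λ j → lc 1F (A j)) e))))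

    avoids-indices : ∀ a {k} (as : Vec F16 k) → differs a as ≡ true → Avoids (rowIndex a) (indices as)
    avoids-indices a [] e = []
    avoids-indices a (b ∷ bs) e = (λ r → ≢-bool a b (proj₁ es) (trans (sym (rowIndex-row a)) (trans (cong (λ j → lc 1F (A j)) (sym r)) (rowIndex-row b)))) ∷ avoids-indices a bs (proj₂ es)
      where
      es : not (eqV a b) ≡ true × differs a bs ≡ true
      es = ∧-split (not (eqV a b)) e

    start : ∀ X → Has A X → ∀ {k} (as : Vec F16 k) → admissible X as ≡ true →
            Distinct (indices as) × Fits A (rowsFrom gl X as) (indices as)
    start X hs [] e = [] , []
    start X hs (a ∷ as) e = (avoids-indices a as (proj₁ e₂) ∷ proj₁ rest) , (fits-compatible a X hs (allL-sound (λ M → not (eqV a (lc 1F M))) X (proj₁ e₁)) ∷ proj₂ rest)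
      where
      e₁ : fresh a X ≡ true × (differs a as ∧ admissible X as) ≡ true
      e₁ = ∧-split (fresh a X) e
      e₂ : differs a as ≡ true × admissible X as ≡ true
      e₂ = ∧-split (differs a as) (proj₂ e₁)
      rest : Distinct (indices as) × Fits A (rowsFrom gl X as) (indices as)
      rest = start X hs as (proj₂ e₂)

  module Goodness (G : Family17 → Set) (G-PE : ∀ {O O′} → PseudoOvalEquiv O O′ → G O′ → G O) where

    Good : List M4 → Set
    Good X = ∀ A B → Sys A B → Has A X → G (family A B)

    -- After the transformation the spread set contains `Y`, and the property `G` is carried back
    -- along the equivalence.
    iso-good : ∀ P Q R X Y → iso P Q R X Y ≡ true → Good Y → Good X
    iso-good P Q R X Y e good A B h hs with ∧-split (covers (mapL (λ A → (P ⊗ (A ⊞ R)) ⊗ Q) X) Y) e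
    ... | cov , e′ with ∧-split (regular P) e′
    ...   | rP , rQ = G-PE M.equiv (good M.A′ M.B′ (M.sys h) (All.map hit (allL-sound _ Y cov)))
      where
      module M = Move A B P Q (one 4) R (zeros {4}) (zeros {4}) (regular-sound P rP) (regular-sound Q rQ) (one-inj 4)
      hit : ∀ {N} → anyL (eqM N) (mapL (λ A → (P ⊗ (A ⊞ R)) ⊗ Q) X) ≡ true → Σ (Fin 16) λ i → M.A′ i ≡ N
      hit {N} e = go X hs (anyL-sound (eqM N) _ e)
        where
        go : ∀ X → Has A X → Any (λ M → eqM N M ≡ true) (mapL (λ A → (P ⊗ (A ⊞ R)) ⊗ Q) X) → Σ (Fin 16) λ i → M.A′ i ≡ N
        go (M ∷ X) ((i , refl) ∷ hs) (here p) = i , sym (eqM-sound N _ p)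
        go (M ∷ X) (_ ∷ hs) (there p) = go X hs p

    nth-good : ∀ {env} → All Good env → ∀ n {Y} → nth env n ≡ just Y → Good Y
    nth-good (g ∷ gs) zero refl = g
    nth-good (g ∷ gs) (suc n) e = nth-good gs n e

    isoTo-good : ∀ {env} → All Good env → ∀ n P Q R X → isoTo P Q R X (nth env n) ≡ true → Good X
    isoTo-good {env} gs n P Q (just R) X e = go (nth env n) refl e
      where
      go : ∀ m → nth env n ≡ m → isoTo P Q (just R) X m ≡ true → Good X
      go (just Y) p e = iso-good P Q R X Y e (nth-good gs n p)

    certified-good : ∀ {env} → All Good env → ∀ X → Succeeds (certified env X) → Good X
    certified-good {env} gs X (c ∷ cs , d , e) = isoTo-good gs (c / 68719476736) (mat (c % 65536)) (mat (c / 65536 % 65536)) (nth X (c / 4294967296 % 16)) X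
      (if-just (isoTo (mat (c % 65536)) (mat (c / 65536 % 65536)) (nth X (c / 4294967296 % 16)) X (nth env (c / 68719476736))) e)

    -- A given system selects one branch of the search tree: at every level its own element with the
    -- requested first row is among the candidates. The branch can therefore end only at an accepted
    -- early test or at an accepted leaf.
    spread-good : ∀ early leaf → (∀ X → early X ≡ true → Good X) → (∀ X → Succeeds (leaf X) → Good X) →
                  ∀ {k} (ts : Vec Trie k) X → Succeeds (spread gl early leaf ts X) →
                  ∀ A B → Sys A B → Has A X → ∀ is → Distinct is → Fits A ts is → G (family A B)
    spread-good early leaf early-good leaf-good ts X s A B h hs is ds fs = go (early X) refl ts s is ds fs
      where
      go : ∀ b → early X ≡ b → ∀ {k} (ts : Vec Trie k) → Succeeds (visit gl early leaf ts X b) → ∀ is → Distinct is → Fits A ts is → G (family A B)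
      go true e ts s is ds fs = early-good X e A B h hs
      go false e [] s [] [] [] = leaf-good X s A B h hs
      go false e (t ∷ ts) s (i ∷ is) (d ∷ ds) (f ∷ fs) =
        spread-good early leaf early-good leaf-good (meets gl (concat (A i)) ts) (rows (concat (A i)) ∷ X)
          (run-sound 16 t (λ p → spread gl early leaf (meets gl p ts) (rows p ∷ X)) s (concat (A i)) f)
          A B h ((i , sym (rows-concat (A i))) ∷ hs) is ds (fits-meets h i d fs)

    spreadCheck-good : ∀ early leaf → (∀ X → early X ≡ true → Good X) → (∀ X → Succeeds (leaf X) → Good X) →
                       ∀ {k} (as : Vec F16 k) X c → spreadCheck early leaf as X c gl ≡ true → Good X
    spreadCheck-good early leaf early-good leaf-good as X c e A B h hs with ∧-split (admissible X as) e
    ... | adm , ok with start h X hs as adm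
    ...   | ds , fs = spread-good early leaf early-good leaf-good (rowsFrom gl X as) X (passes-sound (spread gl early leaf (rowsFrom gl X as) X) c ok)
                        A B h hs (indices h as) ds fs

    conjugates-good : ∀ X Y → Good Y → ∀ P R T → conjugates X Y P R T ≡ true → Good X
    conjugates-good X Y g P R (just T) e = iso-good (T ⊗ P) (inverse T) R X Y e g

    frame-good : ∀ X Y → Good Y → ∀ f xs A C P → frame X Y f xs A C P ≡ true → Good X
    frame-good X Y g f xs A C P = Any-elim (λ x → conjugates X Y P A (companion f (P ⊗ (C ⊞ A)) x)) xs
      (λ x → conjugates-good X Y g P A (companion f (P ⊗ (C ⊞ A)) x))

    irreducible-good : Good normalFrame → ∀ X → irreducible X ≡ true → Good X
    irreducible-good g (B ∷ X) = Any-elim (λ A → crossRatio (B ∷ X) A B (inverse B) (inverse B ⊗ A)) X (λ A →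
        if-elim (eqV (y A) (x₁ A)) (try 0M A (inverse B)) (
        if-elim (eqV (y A) (x₃ A)) (try 0M B (inverse A)) (
        if-elim (eqV (y A) (x₁ A +ᵥ x₂ A +ᵥ x₃ A)) (try A 0M (inverse (B ⊞ A))) (λ ()))))
      where
      x₁ x₂ x₃ y : M4 → F16
      x₁ A = lc (binary 4 1) (inverse B ⊗ A)
      x₂ A = lc (x₁ A) (inverse B ⊗ A)
      x₃ A = lc (x₂ A) (inverse B ⊗ A)
      y A = binary 4 1 +ᵥ lc (x₃ A) (inverse B ⊗ A)
      try : ∀ A C P → frame (B ∷ X) normalFrame lc (binary 4 1 ∷ []) A C P ≡ true → Good (B ∷ X)
      try = frame-good (B ∷ X) normalFrame g lc (binary 4 1 ∷ [])

    normalisable-good : Good normalFrame → Good (0M ∷ 1M ∷ W₆ ∷ []) → Good (0M ∷ 1M ∷ W₃ ∷ []) →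
                        ∀ X → normalisable X ≡ true → Good X
    normalisable-good g g₆ g₃ (B ∷ X) = ∨-elim (irreducible (B ∷ X)) (irreducible-good g (B ∷ X)) (
      ∨-elim (frame (B ∷ X) (0M ∷ 1M ∷ W₆ ∷ []) (λ x N → lc (lc x N) N) vectors 0M B 1M)
        (frame-good (B ∷ X) (0M ∷ 1M ∷ W₆ ∷ []) g₆ (λ x N → lc (lc x N) N) vectors 0M B 1M)
        (Any-elim (λ x → anyL (λ u → conjugates (B ∷ X) (0M ∷ 1M ∷ W₃ ∷ []) 1M 0M (T x u)) vectors) vectors
          (λ x → Any-elim (λ u → conjugates (B ∷ X) (0M ∷ 1M ∷ W₃ ∷ []) 1M 0M (T x u)) vectors
            (λ u → conjugates-good (B ∷ X) (0M ∷ 1M ∷ W₃ ∷ []) g₃ 1M 0M (T x u)))))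
      where
      T : F16 → F16 → Maybe M4
      T x u = just (x ∷ lc u B ∷ u ∷ lc x B ∷ [])

    -- any two elements of a spread set can be moved to 0 and 1
    all-good : Good (1M ∷ 0M ∷ []) → ∀ A B → Sys A B → G (family A B)
    all-good g A B h = G-PE M.equiv (g M.A′ M.B′ (M.sys h) ((suc zero , one-at) ∷ (zero , zero-at) ∷ []))
      where
      D : M4
      D = A (suc zero) ⊞ A zero
      inj : Inj D
      inj = difference-inj h (suc zero) zero (λ ())
      D⁻¹ : M4
      D⁻¹ = proj₁ (inj⇒inverse inj)
      inj⁻¹ : Inj D⁻¹
      inj⁻¹ = left-inj {A = D⁻¹} {D} (proj₁ (proj₂ (inj⇒inverse inj)))
      module M = Move A B D⁻¹ (one 4) (one 4) (A zero) (zeros {4}) (zeros {4}) inj⁻¹ (one-inj 4) (one-inj 4)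
      one-at : M.A′ (suc zero) ≡ 1M
      one-at = trans (⊗-one (D⁻¹ ⊗ D)) (proj₁ (proj₂ (inj⇒inverse inj)))
      ⊞-self : ∀ {m n} (C : Mat m n) → C ⊞ C ≡ zeros
      ⊞-self [] = refl
      ⊞-self (u ∷ C) = cong₂ _∷_ (+-self u) (⊞-self C)
      zero-at : M.A′ zero ≡ 0M
      zero-at = trans (⊗-one (D⁻¹ ⊗ (A zero ⊞ A zero))) (trans (cong (D⁻¹ ⊗_) (⊞-self (A zero)))
        (lc-ext {B = zeros {4}} λ c → trans (lc-⊗ c D⁻¹ zeros) (trans (lc-zeros (lc c D⁻¹)) (sym (lc-zeros c)))))

-- Solving linear systems by exhaustion

search-sound : ∀ n p {v} → search n p ≡ just v → p v ≡ true
search-sound zero p {[]} e = if-just (p []) e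
search-sound (suc n) p e with search n (λ v → p (false ∷ v)) in q
search-sound (suc n) p refl | just v = search-sound n _ q
search-sound (suc n) p e | nothing with search n (λ v → p (true ∷ v)) in r
search-sound (suc n) p refl | nothing | just v = search-sound n _ r

search-complete : ∀ n p v → p v ≡ true → search n p ≢ nothing
search-complete zero p [] h e with p []
search-complete zero p [] refl () | true
search-complete (suc n) p (b ∷ v) h e with search n (λ v → p (false ∷ v)) in q
search-complete (suc n) p (false ∷ v) h e | nothing = search-complete n _ v h q
search-complete (suc n) p (true ∷ v) h e | nothing with search n (λ v → p (true ∷ v)) in r
... | nothing = search-complete n _ v h r

eqV-refl : ∀ {n} (u : Vec Bool n) → eqV u u ≡ true
eqV-refl [] = refl
eqV-refl (false ∷ u) = eqV-refl u
eqV-refl (true ∷ u) = eqV-refl u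

solve-sound : ∀ {A} → Inj A → ∀ v → lc (solve A v) A ≡ v
solve-sound {A} inj v with search 4 (λ c → eqV (lc c A) v) in q
... | just c = eqV-sound (lc c A) v (search-sound 4 (λ c → eqV (lc c A) v) q)
... | nothing = ⊥-elim (search-complete 4 (λ c → eqV (lc c A) v) (proj₁ (surjective inj v))
                  (subst (λ u → eqV u v ≡ true) (sym (proj₂ (surjective inj v))) (eqV-refl v)) q)

inverse-sound : ∀ {A} → Inj A → inverse A ⊗ A ≡ one 4
inverse-sound inj = cong₂ _∷_ (solve-sound inj _) (cong₂ _∷_ (solve-sound inj _) (cong₂ _∷_ (solve-sound inj _) (cong₂ _∷_ (solve-sound inj _) refl)))

-- Functions with distinct slopes

data Member (u : F16) (m : Trie) : Cand → Set where
  here  : ∀ {l} → Member u m (cand u m l)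
  there : ∀ {v n l} → Member u m l → Member u m (cand v n l)

member-extend : ∀ T v {u m l} → mem m (at T u v) ≡ false → Member u m l → Member u (insert (at T u v) m) (extend T v l)
member-extend T v {u} {m} {cand _ _ l} e here rewrite e = here
member-extend T v {l = cand u′ m′ l} e (there p) with mem m′ (at T u′ v)
... | true = member-extend T v e p
... | false = there (member-extend T v e p)

member-all : ∀ u us → anyL (eqV u) us ≡ true → Member u ∅ (allCands us)
member-all u (x ∷ us) e with ∨-split (eqV u x) e
... | inj₁ p rewrite eqV-sound u x p = here
... | inj₂ p = there (member-all u us p)

vectors-complete : ∀ u → anyL (eqV u) (0F ∷ vectors) ≡ true
vectors-complete u = every-sound 4 ● (λ u → anyL (eqV u) (0F ∷ vectors)) refl u refl

module Values (β : Fin 16 → F16) (Slope : Fin 16 → Fin 16 → F16 → Set)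
              (noThree : ∀ i j k b → i ≢ j → j ≢ k → i ≢ k → Slope k i b → Slope k j b → ⊥) where

  data Linked (k : Fin 16) : List (Table F16) → List (Fin 16) → Set where
    [] : Linked k [] []
    link : ∀ {T Ts j js} → j ≢ k → Slope k j (at T (β k) (β j)) → Linked k Ts js → Linked k (T ∷ Ts) (j ∷ js)

  -- Why the true value β k is never removed: its mask contains only slopes realised from k towards
  -- members already processed, so a repetition would be a slope shared with two members, against
  -- `noThree`.
  record CandOK (js : List (Fin 16)) (k : Fin 16) (l : Cand) : Set where
    field
      others  : All (_≢ k) js
      mask    : Trie
      member  : Member (β k) mask l
      sound   : ∀ b → mem mask b ≡ true → Any (λ j → Slope k j b) js

  data Items (js : List (Fin 16)) : List (Fin 16) → ∀ {n} → Vec Item n → Vec (Fin 16) n → Set where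
    [] : ∀ {pre} → Items js pre [] []
    cons : ∀ {pre Ts l k n} {is : Vec Item n} {ks} → CandOK js k l → Linked k Ts pre →
           Items js (snoc pre k) is ks → Items js pre (item Ts l ∷ is) (k ∷ ks)

  candOK-extend : ∀ {js i k T l} → All (_≢ i) js → i ≢ k → Slope k i (at T (β k) (β i)) → CandOK js k l → CandOK (i ∷ js) k (extend T (β i) l)
  candOK-extend {js} {i} {k} {T} {l} fresh i≢k sl c = record
    { others = i≢k ∷ others ; mask = insert b mask
    ; member = member-extend T (β i) (go (mem mask b) refl) member
    ; sound = λ b′ e → old b′ (mem-insert b mask b′ e) }
    where
    open CandOK c
    b : F16
    b = at T (β k) (β i)
    clash : ∀ js → All (_≢ i) js → All (_≢ k) js → Any (λ j → Slope k j b) js → ⊥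
    clash (j ∷ js) (p ∷ ps) (q ∷ qs) (here s) = noThree i j k b (≢-sym p) q i≢k sl s
    clash (j ∷ js) (p ∷ ps) (q ∷ qs) (there s) = clash js ps qs s
    go : ∀ x → mem mask b ≡ x → x ≡ false
    go false e = refl
    go true e = ⊥-elim (clash js fresh others (sound b e))
    old : ∀ b′ → b′ ≡ b ⊎ mem mask b′ ≡ true → Any (λ j → Slope k j b′) (i ∷ js)
    old b′ (inj₁ refl) = here sl
    old b′ (inj₂ e) = there (sound b′ e)

  steps-ok : ∀ {js i pre n} {is : Vec Item n} {ks} → All (_≢ i) js → Items js (i ∷ pre) is ks → Items (i ∷ js) pre (steps (β i) is) ks
  steps-ok fresh [] = []
  steps-ok fresh (cons c (link i≢k sl ls) is) = cons (candOK-extend fresh i≢k sl c) ls (steps-ok fresh is)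

  final : ∀ {n} → Vec (Fin 16) n → List F16 → List F16
  final [] vs = vs
  final (k ∷ ks) vs = final ks (β k ∷ vs)

  choose-sound : ∀ leaf {n} (is : Vec Item n) vs {u m} l → Member u m l → Succeeds (choose leaf l is vs) → Succeeds (assign leaf (steps u is) (u ∷ vs))
  choose-sound leaf is vs (cand u _ l) here (c , d , e) with ▷-sound (assign leaf (steps u is) (u ∷ vs) c) _ e
  ... | c′ , e₁ , e₂ = c , c′ , e₁
  choose-sound leaf is vs (cand u _ l) (there p) (c , d , e) with ▷-sound (assign leaf (steps u is) (u ∷ vs) c) _ e
  ... | c′ , e₁ , e₂ = choose-sound leaf is vs l p (c′ , d , e₂)

  -- The branch that chooses the true values survives to the end, and a run that succeeds as a whole
  -- succeeds in particular at its leaf.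
  assign-sound : ∀ leaf {js n} {is : Vec Item n} {ks} → Items js [] is ks → ∀ vs → Succeeds (assign leaf is vs) → Succeeds (leaf (final ks vs))
  assign-sound leaf [] vs s = s
  assign-sound leaf (cons {k = k} {is = is} c [] rest) vs s =
    assign-sound leaf (steps-ok (CandOK.others c) rest) (β k ∷ vs) (choose-sound leaf is vs _ (CandOK.member c) s)

  module Initial {P : Set} (label : Fin 16 → P) (slope : P → P → Table F16)
                 (slope-ok : ∀ k j → k ≢ j → Slope k j (at (slope (label k) (label j)) (β k) (β j))) where

    labels : List (Fin 16) → List P
    labels = mapL label

    labelsV : ∀ {n} → Vec (Fin 16) n → Vec P n
    labelsV [] = []
    labelsV (k ∷ ks) = label k ∷ labelsV ks

    data Fresh : List (Fin 16) → ∀ {n} → Vec (Fin 16) n → Set where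
      [] : ∀ {pre} → Fresh pre []
      _∷_ : ∀ {pre k n} {ks : Vec (Fin 16) n} → All (_≢ k) pre → Fresh (snoc pre k) ks → Fresh pre (k ∷ ks)

    linked : ∀ k pre → All (_≢ k) pre → Linked k (mapL (slope (label k)) (labels pre)) pre
    linked k [] [] = []
    linked k (j ∷ pre) (p ∷ ps) = link p (slope-ok k j (≢-sym p)) (linked k pre ps)

    labels-snoc : ∀ pre k → snoc (labels pre) (label k) ≡ labels (snoc pre k)
    labels-snoc [] k = refl
    labels-snoc (j ∷ pre) k = cong (label j ∷_) (labels-snoc pre k)

    initial : ∀ {pre n} {ks : Vec (Fin 16) n} → Fresh pre ks → Items [] pre (items slope (labels pre) (labelsV ks)) ks
    initial [] = []
    initial {pre} {ks = k ∷ ks} (p ∷ ps) rewrite labels-snoc pre k =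
      cons (record { others = [] ; mask = ∅ ; member = member-all (β k) _ (vectors-complete (β k)) ; sound = λ b () }) (linked k pre p) (initial ps)

    three : ∀ {i j k n} {ks : Vec (Fin 16) n} → β i ≡ 0F → β j ≡ 0F → β k ≡ 1F → i ≢ j → i ≢ k → j ≢ k → Fresh (i ∷ j ∷ k ∷ []) ks →
            Items (k ∷ j ∷ i ∷ []) [] (steps 1F (steps 0F (steps 0F (items slope (labels (i ∷ j ∷ k ∷ [])) (labelsV ks))))) ks
    three {i} {j} {k} {ks = ks} ei ej ek p q r fr =
      subst (λ v → Items (k ∷ j ∷ i ∷ []) [] (steps v (steps 0F (steps 0F its))) ks) ek (steps-ok (r ∷ q ∷ [])
      (subst (λ v → Items (j ∷ i ∷ []) (k ∷ []) (steps v (steps 0F its)) ks) ej (steps-ok (p ∷ [])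
      (subst (λ v → Items (i ∷ []) (j ∷ k ∷ []) (steps v its) ks) ei (steps-ok [] (initial fr))))))
      where
      its : Vec Item _
      its = items slope (labels (i ∷ j ∷ k ∷ [])) (labelsV ks)

-- Normalising B, and refuting the non-Desarguesian spread sets

module NormaliseB {A B : Fin 16 → M4} (h : Sys A B) (i j k : Fin 16) (i≢j : i ≢ j) (j≢k : j ≢ k) (i≢k : i ≢ k) where
  open Sys h
  private
    D : M4
    D = A j ⊞ A i
    D-inj : Inj D
    D-inj = difference-inj h j i (≢-sym i≢j)
    -- LA + K agrees with B at i and j, so subtracting it makes B vanish there. What remains at k is
    -- C, which is invertible by `s₂`; multiplication by its inverse makes the value 1. The spread
    -- set is untouched.
    D⁻¹ L K C : M4
    D⁻¹ = proj₁ (inj⇒inverse D-inj)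
    L = (B j ⊞ B i) ⊗ D⁻¹
    K = B i ⊞ (L ⊗ A i)
    C = (B k ⊞ (L ⊗ A k)) ⊞ K

    LD : L ⊗ D ≡ B j ⊞ B i
    LD = trans (⊗-assoc (B j ⊞ B i) D⁻¹ D) (trans (cong ((B j ⊞ B i) ⊗_) (proj₁ (proj₂ (inj⇒inverse D-inj)))) (⊗-one _))

    shifted : ∀ m c → lc c ((B m ⊞ (L ⊗ A m)) ⊞ K) ≡ (lc (lc c L) (A m) +ᵥ lc c (B m)) +ᵥ lc c K
    shifted m c = trans (lc-⊞ c (B m ⊞ (L ⊗ A m)) K) (cong (_+ᵥ lc c K) (trans (lc-⊞ c (B m) (L ⊗ A m))
      (trans (cong (lc c (B m) +ᵥ_) (lc-⊗ c L (A m))) (+-comm _ _))))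

    at-i : ∀ c → lc c ((B i ⊞ (L ⊗ A i)) ⊞ K) ≡ 𝟎
    at-i c = trans (lc-⊞ c (B i ⊞ (L ⊗ A i)) K) (+-self _)

    at-j : ∀ c → lc c ((B j ⊞ (L ⊗ A j)) ⊞ K) ≡ 𝟎
    at-j c = trans (shifted j c) (trans (cong (_+ᵥ lc c K) (trans (+-comm _ _) agree)) (+-self _))
      where
      bA : ∀ m → Vec Bool 4
      bA m = lc (lc c L) (A m)
      key : bA j +ᵥ bA i ≡ lc c (B j) +ᵥ lc c (B i)
      key = trans (sym (lc-⊞ (lc c L) (A j) (A i))) (trans (sym (lc-⊗ c L D)) (trans (cong (lc c) LD) (lc-⊞ c (B j) (B i))))
      agree : lc c (B j) +ᵥ bA j ≡ lc c K
      agree = trans (+-comm _ _) (trans (+-swap (bA j) (bA i) (lc c (B j)) (lc c (B i)) key)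
        (trans (+-comm _ _) (sym (trans (lc-⊞ c (B i) (L ⊗ A i)) (cong (lc c (B i) +ᵥ_) (lc-⊗ c L (A i)))))))

    unshift : ∀ m c → lc c ((B m ⊞ (L ⊗ A m)) ⊞ K) ≡ 𝟎 → lc (lc c L) (A m) +ᵥ lc c (B m) ≡ lc c K
    unshift m c e = +≡𝟎⇒≡ (trans (sym (shifted m c)) e)

    C-inj : Inj C
    C-inj c e = s₂ i j k i≢j j≢k i≢k (lc c L) c (trans (unshift i c (at-i c)) (sym (unshift j c (at-j c))))
      (trans (unshift j c (at-j c)) (sym (unshift k c e)))

    S : M4
    S = proj₁ (inj⇒inverse C-inj)
    S-inj : Inj S
    S-inj = left-inj {A = S} {C} (proj₁ (proj₂ (inj⇒inverse C-inj)))

    module M = Move A B (one 4) (one 4) S (zeros {4}) L K (one-inj 4) (one-inj 4) S-inj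

    zero-row : ∀ m → (∀ c → lc c ((B m ⊞ (L ⊗ A m)) ⊞ K) ≡ 𝟎) → M.B′ m ≡ 0M
    zero-row m z = trans (⊗-one _) (lc-ext {B = zeros {4}} λ c → trans (lc-⊗ c S _) (trans (z (lc c S)) (sym (lc-zeros c))))

  A′ B′ : Fin 16 → M4
  A′ = M.A′
  B′ = M.B′

  same-A : ∀ m → A′ m ≡ A m
  same-A m = trans (⊗-one _) (trans (one-⊗ _) (lc-ext λ c → trans (lc-⊞ c (A m) (zeros {4})) (trans (cong (lc c (A m) +ᵥ_) (lc-zeros c)) (+-idʳ _))))

  B′-i : B′ i ≡ 0M
  B′-i = zero-row i at-i

  B′-j : B′ j ≡ 0M
  B′-j = zero-row j at-j

  B′-k : B′ k ≡ one 4
  B′-k = trans (⊗-one _) (proj₁ (proj₂ (inj⇒inverse C-inj)))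

  sys′ : Sys A′ B′
  sys′ = M.sys h

  equiv′ : PseudoOvalEquiv (family A B) (family A′ B′)
  equiv′ = M.equiv

eqM-refl : ∀ {m n} (A : Mat m n) → eqM A A ≡ true
eqM-refl [] = refl
eqM-refl (u ∷ A) rewrite eqV-refl u = eqM-refl A

distinct-indices : ∀ {A : Fin 16 → M4} {i j} → not (eqM (A i) (A j)) ≡ true → i ≢ j
distinct-indices {A} {i} e refl with trans (sym e) (cong not (eqM-refl (A i)))
... | ()

-- the lines i and k meet where the first coordinate is b
module SlopeSystem {A B : Fin 16 → M4} (h : Sys A B) (c : F16) (c≢𝟎 : c ≢ 𝟎) where
  β : Fin 16 → F16
  β i = lc c (B i)

  Slope : Fin 16 → Fin 16 → F16 → Set
  Slope i j b = lc b (A i) +ᵥ β i ≡ lc b (A j) +ᵥ β j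

  noThree : ∀ i j k b → i ≢ j → j ≢ k → i ≢ k → Slope k i b → Slope k j b → ⊥
  noThree i j k b p q r s t = c≢𝟎 (Sys.s₂ h i j k p q r b c (trans (sym s) t) (sym t))

  difference⇒slope : ∀ i j b → lc b (A i ⊞ A j) ≡ β i +ᵥ β j → Slope i j b
  difference⇒slope i j b e = +-swap (lc b (A i)) (lc b (A j)) (β i) (β j) (trans (sym (lc-⊞ b (A i) (A j))) e)

-- Fixing c as the first unit vector leaves only the first rows of the Bᵢ, and `s₂` says that no
-- three of the lines b ↦ bAᵢ + cBᵢ meet in a point. So the lines through which member k is met have
-- distinct parameters b, which is the condition the search tests.
module Refute {A B : Fin 16 → M4} (h : Sys A B) (i j k : Fin 16) (≢ij : i ≢ j) (≢jk : j ≢ k) (≢ik : i ≢ k) where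
  module NB = NormaliseB h i j k ≢ij ≢jk ≢ik
  open SlopeSystem NB.sys′ 1F 1F≢𝟎
  open Values β Slope noThree

  slope-ok : ∀ k j → k ≢ j → Slope k j (at (matrixSlope (A k) (A j)) (β k) (β j))
  slope-ok k j k≢j = difference⇒slope k j b (trans (cong₂ (λ M N → lc b (M ⊞ N)) (NB.same-A k) (NB.same-A j))
      (trans (cong (λ u → lc u D) (at-table 4 (λ w → lc w (inverse D)) (β k) (β j)))
      (trans (sym (lc-⊗ (β k +ᵥ β j) (inverse D) D)) (trans (cong (lc (β k +ᵥ β j)) (inverse-sound (difference-inj h k j k≢j))) (lc-one _)))))
    where
    D : M4
    D = A k ⊞ A j
    b : F16
    b = at (matrixSlope (A k) (A j)) (β k) (β j)

  open Initial A matrixSlope slope-ok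

  indices : ∀ X → Has A X → Vec (Fin 16) (length X)
  indices [] [] = []
  indices (_ ∷ X) ((i , _) ∷ hs) = i ∷ indices X hs

  labels-indices : ∀ X (hs : Has A X) → labelsV (indices X hs) ≡ fromList X
  labels-indices [] [] = refl
  labels-indices (_ ∷ X) ((i , e) ∷ hs) = cong₂ _∷_ e (labels-indices X hs)

  snoc-All : ∀ {P : Fin 16 → Set} pre {i} → All P pre → P i → All P (snoc pre i)
  snoc-All [] [] p = p ∷ []
  snoc-All (_ ∷ pre) (q ∷ qs) p = q ∷ snoc-All pre qs p

  Apart : List (Fin 16) → List M4 → Set
  Apart pre X = All (λ j → All (λ M → not (eqM (A j) M) ≡ true) X) pre

  freshness : ∀ pre X (hs : Has A X) → distinct X ≡ true → Apart pre X → Fresh pre (indices X hs)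
  freshness pre [] [] d ap = []
  freshness pre (_ ∷ X) ((i , refl) ∷ hs) d ap = All.map (λ { (p ∷ _) → distinct-indices {A} p }) ap ∷
    freshness (snoc pre i) X hs (proj₂ ds) (snoc-All pre (All.map (λ { (_ ∷ ps) → ps }) ap) (allL-sound (λ M → not (eqM (A i) M)) X (proj₁ ds)))
    where
    ds : allL (λ M → not (eqM (A i) M)) X ≡ true × distinct X ≡ true
    ds = ∧-split (allL (λ M → not (eqM (A i) M)) X) d

  all-items : ∀ X (hs : Has A X) → distinct X ≡ true → Apart (i ∷ j ∷ k ∷ []) X →
              Items (k ∷ j ∷ i ∷ []) [] (steps 1F (steps 0F (steps 0F (items matrixSlope (A i ∷ A j ∷ A k ∷ []) (fromList X))))) (indices X hs)
  all-items X hs dX ap = subst (λ As → Items (k ∷ j ∷ i ∷ []) [] (steps 1F (steps 0F (steps 0F (items matrixSlope (A i ∷ A j ∷ A k ∷ []) As)))) (indices X hs))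
    (labels-indices X hs)
    (three (cong (lc 1F) NB.B′-i) (cong (lc 1F) NB.B′-j) (cong (lc 1F) NB.B′-k) ≢ij ≢ik ≢jk (freshness (i ∷ j ∷ k ∷ []) X hs dX ap))

  refuted : ∀ X (hs : Has A X) → distinct X ≡ true → Apart (i ∷ j ∷ k ∷ []) X →
            Succeeds (assign (λ _ _ → nothing) (steps 1F (steps 0F (steps 0F (items matrixSlope (A i ∷ A j ∷ A k ∷ []) (fromList X))))) []) → ⊥
  refuted X hs d ap s = impossible (assign-sound (λ _ _ → nothing) (all-items X hs d ap) [] s)
    where
    impossible : Succeeds (λ _ → nothing) → ⊥
    impossible (_ , _ , ())

noOval-refutes : ∀ X → noOval X ≡ true → ∀ A B → Sys A B → Has A X → ⊥
noOval-refutes (_ ∷ _ ∷ _ ∷ X) e A B h ((i , refl) ∷ (j , refl) ∷ (k , refl) ∷ hs) =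
  Refute.refuted h i j k (distinct-indices {A} (All.head pi)) (distinct-indices {A} (All.head pj)) (distinct-indices {A} (All.head (All.tail pi)))
    X hs (proj₂ dk) (All.tail (All.tail pi) ∷ All.tail pj ∷ allL-sound (λ M → not (eqM (A k) M)) X (proj₁ dk) ∷ [])
    (passes-sound _ [] (proj₂ d))
  where
  d : distinct (A i ∷ A j ∷ A k ∷ X) ≡ true × _ ≡ true
  d = ∧-split (distinct (A i ∷ A j ∷ A k ∷ X)) e
  di : allL (λ M → not (eqM (A i) M)) (A j ∷ A k ∷ X) ≡ true × distinct (A j ∷ A k ∷ X) ≡ true
  di = ∧-split (allL (λ M → not (eqM (A i) M)) (A j ∷ A k ∷ X)) (proj₁ d)
  dj : allL (λ M → not (eqM (A j) M)) (A k ∷ X) ≡ true × distinct (A k ∷ X) ≡ true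
  dj = ∧-split (allL (λ M → not (eqM (A j) M)) (A k ∷ X)) (proj₂ di)
  dk : allL (λ M → not (eqM (A k) M)) X ≡ true × distinct X ≡ true
  dk = ∧-split (allL (λ M → not (eqM (A k) M)) X) (proj₂ dj)
  pi : All (λ M → not (eqM (A i) M) ≡ true) (A j ∷ A k ∷ X)
  pi = allL-sound (λ M → not (eqM (A i) M)) (A j ∷ A k ∷ X) (proj₁ di)
  pj : All (λ M → not (eqM (A j) M) ≡ true) (A k ∷ X)
  pj = allL-sound (λ M → not (eqM (A j) M)) (A k ∷ X) (proj₁ dj)

-- The field GF(16), by exhaustion

all₁ : (F16 → Bool) → Bool
all₁ p = every 4 ● p

all₁-sound : ∀ p → all₁ p ≡ true → ∀ a → p a ≡ true
all₁-sound p e a = every-sound 4 ● p e a refl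

all₂-sound : ∀ (p : F16 → F16 → Bool) → all₁ (λ a → all₁ (p a)) ≡ true → ∀ a b → p a b ≡ true
all₂-sound p e a = all₁-sound (p a) (all₁-sound (λ a → all₁ (p a)) e a)

all₃-sound : ∀ (p : F16 → F16 → F16 → Bool) → all₁ (λ a → all₁ (λ b → all₁ (p a b))) ≡ true → ∀ a b c → p a b c ≡ true
all₃-sound p e a = all₂-sound (p a) (all₁-sound (λ a → all₁ (λ b → all₁ (p a b))) e a)

+F≡+ᵥ : ∀ (a b : F16) → a +F b ≡ a +ᵥ b
+F≡+ᵥ a b = sym (+ᵥ≡⊕ a b)

*-comm : ∀ a b → a *F b ≡ b *F a
*-comm a b = eqV-sound _ _ (all₂-sound (λ a b → eqV (a *F b) (b *F a)) refl a b)

*-assoc : ∀ a b c → (a *F b) *F c ≡ a *F (b *F c)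
*-assoc a b c = eqV-sound _ _ (all₃-sound (λ a b c → eqV ((a *F b) *F c) (a *F (b *F c))) refl a b c)

*-distribˡ : ∀ a b c → a *F (b +F c) ≡ (a *F b) +F (a *F c)
*-distribˡ a b c = eqV-sound _ _ (all₃-sound (λ a b c → eqV (a *F (b +F c)) ((a *F b) +F (a *F c))) refl a b c)

*-identityˡ : ∀ a → 1F *F a ≡ a
*-identityˡ a = eqV-sound _ _ (all₁-sound (λ a → eqV (1F *F a) a) refl a)

*-zeroˡ : ∀ a → 0F *F a ≡ 0F
*-zeroˡ a = eqV-sound _ _ (all₁-sound (λ a → eqV (0F *F a) 0F) refl a)

*-distribʳ : ∀ a b c → (b +F c) *F a ≡ (b *F a) +F (c *F a)
*-distribʳ a b c = trans (*-comm (b +F c) a) (trans (*-distribˡ a b c) (cong₂ _+F_ (*-comm a b) (*-comm a c)))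

*-identityʳ : ∀ a → a *F 1F ≡ a
*-identityʳ a = trans (*-comm a 1F) (*-identityˡ a)

*-zeroʳ : ∀ a → a *F 0F ≡ 0F
*-zeroʳ a = trans (*-comm a 0F) (*-zeroˡ a)

+F-assoc : ∀ a b c → (a +F b) +F c ≡ a +F (b +F c)
+F-assoc a b c = trans (cong (_+F c) (+F≡+ᵥ a b)) (trans (+F≡+ᵥ (a +ᵥ b) c) (trans (+-assoc a b c) (trans (sym (+F≡+ᵥ a (b +ᵥ c))) (cong (a +F_) (sym (+F≡+ᵥ b c))))))

+F-comm : ∀ a b → a +F b ≡ b +F a
+F-comm a b = trans (+F≡+ᵥ a b) (trans (+-comm a b) (sym (+F≡+ᵥ b a)))

+F-identityˡ : ∀ a → 0F +F a ≡ a
+F-identityˡ a = trans (+F≡+ᵥ 0F a) (+-idˡ a)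

+F-self : ∀ a → a +F a ≡ 0F
+F-self a = trans (+F≡+ᵥ a a) (+-self a)

F16-ring : CommutativeRing 0ℓ 0ℓ
F16-ring = record
  { Carrier = F16 ; _≈_ = _≡_ ; _+_ = _+F_ ; _*_ = _*F_ ; -_ = λ a → a ; 0# = 0F ; 1# = 1F
  ; isCommutativeRing = record
    { isRing = record
      { +-isAbelianGroup = record
        { isGroup = record
          { isMonoid = record
            { isSemigroup = record
              { isMagma = record { isEquivalence = isEquivalence ; ∙-cong = cong₂ _+F_ }
              ; assoc = +F-assoc }
            ; identity = +F-identityˡ , λ a → trans (+F-comm a 0F) (+F-identityˡ a) }
          ; inverse = +F-self , +F-self
          ; ⁻¹-cong = λ e → e }
        ; comm = +F-comm }
      ; *-cong = cong₂ _*F_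
      ; *-assoc = *-assoc
      ; *-identity = *-identityˡ , *-identityʳ
      ; distrib = *-distribˡ , *-distribʳ }
    ; *-comm = *-comm } }

inv-right : ∀ a → a ≢ 0F → a *F inv a ≡ 1F
inv-right a a≢0 with ∨-split (eqV a 0F) (all₁-sound (λ a → eqV a 0F ∨ eqV (a *F inv a) 1F) refl a)
... | inj₁ p = ⊥-elim (a≢0 (eqV-sound a 0F p))
... | inj₂ p = eqV-sound _ _ p

inv-left : ∀ a → a ≢ 0F → inv a *F a ≡ 1F
inv-left a p = trans (*-comm (inv a) a) (inv-right a p)

1F≢0F : 1F ≢ 0F
1F≢0F ()

no-zero-divisors : ∀ a b → a *F b ≡ 0F → a ≢ 0F → b ≡ 0F
no-zero-divisors a b e p = trans (sym (*-identityˡ b)) (trans (cong (_*F b) (sym (inv-left a p)))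
  (trans (*-assoc (inv a) a b) (trans (cong (inv a *F_) e) (*-zeroʳ (inv a)))))

*-≢0 : ∀ {a b} → a ≢ 0F → b ≢ 0F → a *F b ≢ 0F
*-≢0 p q e = q (no-zero-divisors _ _ e p)

inv-≢0 : ∀ {a} → a ≢ 0F → inv a ≢ 0F
inv-≢0 {a} p e = 1F≢0F (trans (sym (inv-right a p)) (trans (cong (a *F_) e) (*-zeroʳ a)))

-- Multiplication matrices

scal-+ : ∀ a b → scal (a +ᵥ b) ≡ scal a ⊞ scal b
scal-+ a b = eqM-sound _ _ (all₂-sound (λ a b → eqM (scal (a +ᵥ b)) (scal a ⊞ scal b)) refl a b)

scal-* : ∀ a b → scal (a *F b) ≡ scal a ⊗ scal b
scal-* a b = eqM-sound _ _ (all₂-sound (λ a b → eqM (scal (a *F b)) (scal a ⊗ scal b)) refl a b)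

unscal-scal : ∀ a → unscal (scal a) ≡ a
unscal-scal (_ ∷ _ ∷ _ ∷ _ ∷ []) = refl

scal-injective : ∀ {a b} → scal a ≡ scal b → a ≡ b
scal-injective {a} {b} e = trans (sym (unscal-scal a)) (trans (cong unscal e) (unscal-scal b))

scal-inj : ∀ {a} → a ≢ 0F → Inj (scal a)
scal-inj {a} p = left-inj {A = scal a} {scal (inv a)} (trans (sym (scal-* a (inv a))) (cong scal (inv-right a p)))

isScalar-sound : ∀ B → isScalar B ≡ true → Σ F16 λ q → B ≡ scal q
isScalar-sound B e = unscal B , eqM-sound B _ e

-- The dual of an elementary member

private
  x³ : F16
  x³ = (xF *F xF) *F xF

  -- Closed formulas for the coordinates of a, xa, x²a and x³a; with them the transposition in
  -- `weave-ᵀ` holds by reduction.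
  cols : F16 → Vec F16 4
  cols (a ∷ b ∷ c ∷ d ∷ []) =
    (a ∷ b ∷ c ∷ d ∷ []) ∷ (d ∷ (a xor d) ∷ b ∷ c ∷ []) ∷
    (c ∷ (d xor c) ∷ (a xor d) ∷ b ∷ []) ∷ (b ∷ (c xor b) ∷ (d xor c) ∷ (a xor d) ∷ []) ∷ []

  cols-ok : ∀ a → 1F *F a ∷ xF *F a ∷ x² *F a ∷ x³ *F a ∷ [] ≡ cols a
  cols-ok a = eqM-sound _ _ (all₁-sound (λ a → eqM (1F *F a ∷ xF *F a ∷ x² *F a ∷ x³ *F a ∷ []) (cols a)) refl a)

  weave : Vec F16 4 → Vec F16 4 → Vec F16 4 → Mat 4 12
  weave (a ∷ b ∷ c ∷ d ∷ []) (e ∷ f ∷ g ∷ h ∷ []) (i ∷ j ∷ k ∷ l ∷ []) =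
    concat (a ∷ e ∷ i ∷ []) ∷ concat (b ∷ f ∷ j ∷ []) ∷ concat (c ∷ g ∷ k ∷ []) ∷ concat (d ∷ h ∷ l ∷ []) ∷ []

  weave-ᵀ : ∀ x y z → weave (cols x) (cols y) (cols z) ᵀ ≡ scal x ++ (scal y ++ scal z)
  weave-ᵀ (_ ∷ _ ∷ _ ∷ _ ∷ []) (_ ∷ _ ∷ _ ∷ _ ∷ []) (_ ∷ _ ∷ _ ∷ _ ∷ []) = refl

member : V3 → Mat 4 12
member P = map (λ μ → toGF2 (scale μ P)) basisF16

member-ᵀ : ∀ x y z → member (x ∷ y ∷ z ∷ []) ᵀ ≡ scal x ++ (scal y ++ scal z)
member-ᵀ x y z = trans (cong _ᵀ (trans (cong₂ (λ u v → weave u v (1F *F z ∷ xF *F z ∷ x² *F z ∷ x³ *F z ∷ [])) (cols-ok x) (cols-ok y))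
  (cong (weave (cols x) (cols y)) (cols-ok z)))) (weave-ᵀ x y z)

-- The Desarguesian spread set: all values of B are scalar

record Normal (A B : Fin 16 → M4) : Set where
  field
    sys   : Sys A B
    idx   : F16 → Fin 16
    A-idx : ∀ t → A (idx t) ≡ scal t
    B-0   : B (idx 0F) ≡ 0M
    B-1   : B (idx 1F) ≡ 0M
    B-x   : B (idx xF) ≡ 1M

  idx-injective : ∀ {a b} → idx a ≡ idx b → a ≡ b
  idx-injective {a} {b} e = scal-injective (trans (sym (A-idx a)) (trans (cong A e) (A-idx b)))

+-≢0 : ∀ {a b : F16} → a ≢ b → a +ᵥ b ≢ 0F
+-≢0 p e = p (+≡𝟎⇒≡ e)

coord : Point → F16
coord (pt q _) = q

data Away (r : F16) : ∀ {k} → Vec Open k → Set where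
  [] : Away r []
  _∷_ : ∀ {s t k} {os : Vec Open k} → r ≢ s → Away r os → Away r (op s t ∷ os)

module Scalars (gl : Trie) (gl-ok : ∀ (A : M4) → Inj A → mem gl (concat A) ≡ true)
               (quot : Table₂) (quot-ok : ∀ a b → get₂ quot a b ≡ a *F inv b) where

  module _ {A B : Fin 16 → M4} (nor : Normal A B) where
    open Normal nor
    open Sys sys

    Bᵥ : F16 → M4
    Bᵥ t = B (idx t)

    -- Let c be in the kernel and put b = c(Bₚ + B_q)(p + q)⁻¹. Then bA + cB takes equal values at p
    -- and q, by the choice of b, and at r, because cB there agrees with the interpolated value. Now
    -- `s₂` gives c = 0.
    forbidden-inj : ∀ p q r → p ≢ q → q ≢ r → p ≢ r → Inj (Bᵥ r ⊞ forbidden gl quot p (Bᵥ p) q (Bᵥ q) r)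
    forbidden-inj p q r p≢q q≢r p≢r c e =
      s₂ (idx p) (idx q) (idx r) (λ x → p≢q (idx-injective x)) (λ x → q≢r (idx-injective x)) (λ x → p≢r (idx-injective x)) b c pq (trans (sym pq) pr)
      where
      t d : F16
      d = inv (p +ᵥ q)
      t = get₂ quot (r +ᵥ p) (p +ᵥ q)
      v b : F16
      v = lc c (Bᵥ p ⊞ Bᵥ q)
      b = lc v (scal d)
      times : ∀ u w → lc (lc u (scal d)) (scal w) ≡ lc u (scal (d *F w))
      times u w = trans (sym (lc-⊗ u (scal d) (scal w))) (cong (lc u) (sym (scal-* d w)))
      lcA : ∀ u w → lc b (scal (u +ᵥ w)) ≡ lc b (A (idx u)) +ᵥ lc b (A (idx w))
      lcA u w = trans (cong (lc b) (scal-+ u w)) (trans (lc-⊞ b (scal u) (scal w)) (cong₂ (λ M N → lc b M +ᵥ lc b N) (sym (A-idx u)) (sym (A-idx w))))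
      pq : lc b (A (idx p)) +ᵥ lc c (Bᵥ p) ≡ lc b (A (idx q)) +ᵥ lc c (Bᵥ q)
      pq = +-swap _ _ _ _ (trans (sym (lcA p q)) (trans (times v (p +ᵥ q))
        (trans (cong (λ s → lc v (scal s)) (inv-left (p +ᵥ q) (+-≢0 p≢q))) (trans (lc-one v) (lc-⊞ c (Bᵥ p) (Bᵥ q))))))
      t-eq : d *F (r +ᵥ p) ≡ t
      t-eq = trans (*-comm d (r +ᵥ p)) (sym (quot-ok (r +ᵥ p) (p +ᵥ q)))
      e′ : lc c (Bᵥ r) +ᵥ (lc c (Bᵥ p) +ᵥ lc v (scal t)) ≡ 𝟎
      e′ = trans (sym (trans (lc-⊞ c (Bᵥ r) _) (cong (lc c (Bᵥ r) +ᵥ_) (trans (lc-⊞ c (Bᵥ p) _) (cong (lc c (Bᵥ p) +ᵥ_) (lc-⊗ c (Bᵥ p ⊞ Bᵥ q) (scal t))))))) e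
      rp : lc b (A (idx r)) +ᵥ lc b (A (idx p)) ≡ lc c (Bᵥ r) +ᵥ lc c (Bᵥ p)
      rp = trans (sym (lcA r p)) (trans (times v (r +ᵥ p)) (trans (cong (λ s → lc v (scal s)) t-eq)
        (sym (+≡𝟎⇒≡ (trans (+-assoc _ _ _) e′)))))
      pr : lc b (A (idx p)) +ᵥ lc c (Bᵥ p) ≡ lc b (A (idx r)) +ᵥ lc c (Bᵥ r)
      pr = sym (+-swap _ _ _ _ rp)

    PointOK : Point → Set
    PointOK (pt q C) = Bᵥ q ≡ C

    refine-ok : ∀ p r → p ≢ r → ∀ ps → All PointOK ps → All (λ x → coord x ≢ p) ps → All (λ x → coord x ≢ r) ps →
                ∀ t → mem t (concat (Bᵥ r)) ≡ true → mem (refine gl quot p (Bᵥ p) r ps t) (concat (Bᵥ r)) ≡ true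
    refine-ok p r p≢r [] [] [] [] t m = m
    refine-ok p r p≢r (pt q _ ∷ ps) (refl ∷ oks) (q≢p ∷ aps) (q≢r ∷ ars) t m = refine-ok p r p≢r ps oks aps ars _
      (mem-meet t gl (concat F) (concat (Bᵥ r)) m (trans (cong (mem gl) (sym (concat-⊞ (Bᵥ r) F)))
        (gl-ok (Bᵥ r ⊞ F) (forbidden-inj p q r (≢-sym q≢p) q≢r p≢r))))
      where
      F : M4
      F = forbidden gl quot p (Bᵥ p) q (Bᵥ q) r

    data Opens (ps : List Point) : ∀ {k} → Vec Open k → Set where
      [] : Opens ps []
      cons : ∀ {r t k} {os : Vec Open k} → mem t (concat (Bᵥ r)) ≡ true → All (λ x → coord x ≢ r) ps → Away r os → Opens ps os → Opens ps (op r t ∷ os)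

    away-refines : ∀ {r p M ps k} {os : Vec Open k} → Away r os → Away r (refines gl quot p M ps os)
    away-refines [] = []
    away-refines (p ∷ a) = p ∷ away-refines a

    refines-ok : ∀ {p ps k} {os : Vec Open k} → All PointOK ps → All (λ x → coord x ≢ p) ps → Away p os → Opens ps os →
                 Opens (pt p (Bᵥ p) ∷ ps) (refines gl quot p (Bᵥ p) ps os)
    refines-ok oks aps [] [] = []
    refines-ok {p} {ps} oks aps (p≢r ∷ aw) (cons {r} {t} m ars ar os) =
      cons (refine-ok p r p≢r ps oks aps ars t m) (p≢r ∷ ars) (away-refines ar) (refines-ok oks aps aw os)

    refute-sound : ∀ {ps k} {os : Vec Open k} → All PointOK ps → Opens ps os → refute gl quot ps os ≡ true → ⊥
    refute-sound {ps} oks (cons {r} {t} {os = os} m ars aw ops) e =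
      refute-sound (refl ∷ oks) (refines-ok oks ars aw ops)
        (subst (λ M → refute gl quot (pt r M ∷ ps) (refines gl quot r M ps os) ≡ true) (rows-concat (Bᵥ r))
          (every-sound 16 t (λ x → refute gl quot (pt r (rows x) ∷ ps) (refines gl quot r (rows x) ps os)) e (concat (Bᵥ r)) m))

    differs-away : ∀ r {k} (rs : Vec F16 k) → differs r rs ≡ true → Away r (openAll rs)
    differs-away r [] e = []
    differs-away r (s ∷ rs) e = ≢-bool r s (proj₁ (∧-split (not (eqV r s)) e)) ∷ differs-away r rs (proj₂ (∧-split (not (eqV r s)) e))

    Apart : ∀ {k} → Vec F16 k → Set
    Apart rs = Away 0F (openAll rs) × Away 1F (openAll rs) × Away xF (openAll rs)

    open₀ : ∀ {k} (rs : Vec F16 k) → allDiffer rs ≡ true → Away 0F (openAll rs) → Opens (pt 0F 0M ∷ []) (openAll rs)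
    open₀ [] e [] = []
    open₀ (r ∷ rs) e (p ∷ aw) = cons refl (p ∷ []) (differs-away r rs (proj₁ (∧-split (differs r rs) e))) (open₀ rs (proj₂ (∧-split (differs r rs) e)) aw)

    base-ok : All PointOK (basePoints)
    base-ok = B-x ∷ B-1 ∷ B-0 ∷ []

    initially-ok : ∀ {k} (rs : Vec F16 k) → allDiffer rs ≡ true → Apart rs → Opens (basePoints) (initially gl quot rs)
    initially-ok rs d (a₀ , a₁ , aₓ) = subst (λ M → Opens (pt xF M ∷ pt 1F 0M ∷ pt 0F 0M ∷ []) (refines gl quot xF M (pt 1F 0M ∷ pt 0F 0M ∷ []) (refines gl quot 1F 0M (pt 0F 0M ∷ []) (openAll rs)))) B-x
      (refines-ok (B-1 ∷ B-0 ∷ []) ((λ ()) ∷ (λ ()) ∷ []) (away-refines aₓ)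
        (subst (λ M → Opens (pt 1F M ∷ pt 0F 0M ∷ []) (refines gl quot 1F M (pt 0F 0M ∷ []) (openAll rs))) B-1
          (refines-ok (B-0 ∷ []) ((λ ()) ∷ []) a₁ (open₀ rs d a₀))))

  away-tail : ∀ r s {k} (rs : Vec F16 k) → differs r (s ∷ rs) ≡ true → differs r rs ≡ true
  away-tail r s rs e = proj₂ (∧-split (not (eqV r s)) e)

  Refuted : M4 → Set
  Refuted M = ∀ {A B} (nor : Normal A B) → B (Normal.idx nor x²) ≡ M → ⊥

  module _ {k} (Ms : List M4) (rs : Vec F16 k) (ok : scalarCheck gl quot Ms rs ≡ true) where
    private
      dif : allDiffer (0F ∷ 1F ∷ xF ∷ x² ∷ rs) ≡ true
      dif = proj₁ (∧-split (allDiffer (0F ∷ 1F ∷ xF ∷ x² ∷ rs)) ok)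
      ok′ : refuteAll gl quot Ms (initially gl quot rs) ∧ conjugates-refuted (scal (inv xF)) W (collect Ms) (initially gl quot (x² ∷ [])) ≡ true
      ok′ = proj₂ (∧-split (allDiffer (0F ∷ 1F ∷ xF ∷ x² ∷ rs)) ok)
      d₀ : differs 0F (1F ∷ xF ∷ x² ∷ rs) ≡ true
      d₀ = proj₁ (∧-split (differs 0F (1F ∷ xF ∷ x² ∷ rs)) dif)
      dif₁ : allDiffer (1F ∷ xF ∷ x² ∷ rs) ≡ true
      dif₁ = proj₂ (∧-split (differs 0F (1F ∷ xF ∷ x² ∷ rs)) dif)
      d₁ : differs 1F (xF ∷ x² ∷ rs) ≡ true
      d₁ = proj₁ (∧-split (differs 1F (xF ∷ x² ∷ rs)) dif₁)
      dif₂ : allDiffer (xF ∷ x² ∷ rs) ≡ true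
      dif₂ = proj₂ (∧-split (differs 1F (xF ∷ x² ∷ rs)) dif₁)
      dₓ : differs xF (x² ∷ rs) ≡ true
      dₓ = proj₁ (∧-split (differs xF (x² ∷ rs)) dif₂)
      dif₃ : allDiffer (x² ∷ rs) ≡ true
      dif₃ = proj₂ (∧-split (differs xF (x² ∷ rs)) dif₂)
      d₂ : differs x² rs ≡ true
      d₂ = proj₁ (∧-split (differs x² rs) dif₃)
      dif₄ : allDiffer rs ≡ true
      dif₄ = proj₂ (∧-split (differs x² rs) dif₃)

    listed-refuted : All Refuted Ms
    listed-refuted = All.map refuted (allL-sound _ Ms (proj₁ (∧-split (refuteAll gl quot Ms (initially gl quot rs)) ok′)))
      where
      refuted : ∀ {M} → refute gl quot (pt x² M ∷ basePoints) (refines gl quot x² M (basePoints) (initially gl quot rs)) ≡ true → Refuted M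
      refuted e nor refl = refute-sound nor (refl ∷ base-ok nor)
        (refines-ok nor (base-ok nor) ((λ ()) ∷ (λ ()) ∷ (λ ()) ∷ []) (away-refines nor (away-refines nor (differs-away nor x² rs d₂)))
          (initially-ok nor rs dif₄ (differs-away nor 0F rs (away-tail 0F x² rs (away-tail 0F xF (x² ∷ rs) (away-tail 0F 1F (xF ∷ x² ∷ rs) d₀)))
            , differs-away nor 1F rs (away-tail 1F x² rs (away-tail 1F xF (x² ∷ rs) d₁)) , differs-away nor xF rs (away-tail xF x² rs dₓ)))) e

    collect-refuted : ∀ Ms → All Refuted Ms → ∀ M → mem (collect Ms) (concat M) ≡ true → Refuted M
    collect-refuted (N ∷ Ms) (r ∷ rs) M e = go (mem-insert (concat N) (collect Ms) (concat M) e)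
      where
      go : concat M ≡ concat N ⊎ mem (collect Ms) (concat M) ≡ true → Refuted M
      go (inj₁ p) = subst Refuted (trans (sym (rows-concat N)) (trans (cong rows (sym p)) (rows-concat M))) r
      go (inj₂ p) = collect-refuted Ms rs M p

    -- conjugation by x fixes all scalars
    conjugate-refuted : ∀ M → Refuted ((scal (inv xF) ⊗ M) ⊗ W) → Refuted M
    conjugate-refuted M r {A} {B} nor refl = r nor′ (B′-eq (idx x²))
      where
      open Normal nor
      y : F16
      y = inv xF
      y≢0 : y ≢ 0F
      y≢0 ()
      module M′ = Move A B (scal y) W (scal y) (zeros {4}) (zeros {4}) (zeros {4}) (scal-inj {y} (λ ())) (scal-inj {xF} (λ ())) (scal-inj {y} (λ ()))
      ⊞-zeros : ∀ (C : M4) → C ⊞ zeros {4} ≡ C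
      ⊞-zeros C = lc-ext λ c → trans (lc-⊞ c C (zeros {4})) (trans (cong (lc c C +ᵥ_) (lc-zeros c)) (+-idʳ _))
      zeros-⊗ : ∀ (C : M4) → zeros {4} ⊗ C ≡ zeros {4}
      zeros-⊗ C = lc-ext {B = zeros {4}} λ c → trans (lc-⊗ c (zeros {4}) C) (trans (cong (λ v → lc v C) (lc-zeros c)) (trans (lc-𝟎 C) (sym (lc-zeros c))))
      B′-eq : ∀ i → M′.B′ i ≡ (scal y ⊗ B i) ⊗ W
      B′-eq i = cong (λ C → (scal y ⊗ C) ⊗ W) (trans (⊞-zeros _) (trans (cong (B i ⊞_) (zeros-⊗ (A i))) (⊞-zeros (B i))))
      A′-eq : ∀ t → M′.A′ (idx t) ≡ scal t
      A′-eq t = trans (cong (λ C → (scal y ⊗ C) ⊗ W) (trans (⊞-zeros _) (A-idx t)))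
        (trans (cong (_⊗ W) (sym (scal-* y t))) (trans (sym (scal-* (y *F t) xF))
          (cong scal (trans (cong (_*F xF) (*-comm y t)) (trans (*-assoc t y xF) (trans (cong (t *F_) refl) (*-identityʳ t)))))))
      nor′ : Normal M′.A′ M′.B′
      nor′ = record { sys = M′.sys sys ; idx = idx ; A-idx = A′-eq
        ; B-0 = trans (B′-eq (idx 0F)) (cong (λ C → (scal y ⊗ C) ⊗ W) B-0)
        ; B-1 = trans (B′-eq (idx 1F)) (cong (λ C → (scal y ⊗ C) ⊗ W) B-1)
        ; B-x = trans (B′-eq (idx xF)) (cong (λ C → (scal y ⊗ C) ⊗ W) B-x) }

    conjugateIn-refuted : ∀ n M → conjugateIn (scal (inv xF)) W n (collect Ms) M ≡ true → Refuted M
    conjugateIn-refuted (suc n) M = ∨-elim (mem (collect Ms) (concat M)) (collect-refuted Ms listed-refuted M)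
      (λ e → conjugate-refuted M (conjugateIn-refuted n _ e))

    x²-scalar : ∀ {A B} (nor : Normal A B) → Σ F16 λ q → B (Normal.idx nor x²) ≡ scal q
    x²-scalar {A} {B} nor = go (initially-ok nor (x² ∷ []) refl (((λ ()) ∷ []) , ((λ ()) ∷ []) , ((λ ()) ∷ [])))
      where
      M : M4
      M = B (Normal.idx nor x²)
      go : Opens nor (basePoints) (initially gl quot (x² ∷ [])) → Σ F16 λ q → M ≡ scal q
      go (cons {t = t} m _ _ _) = subst (λ N → Σ F16 λ q → N ≡ scal q) (rows-concat M)
        (∨-elim (isScalar (rows (concat M))) (isScalar-sound _)
          (λ e → ⊥-elim (conjugateIn-refuted 15 (rows (concat M)) e nor (sym (rows-concat M))))
          (every-sound 16 t (λ y → isScalar (rows y) ∨ conjugateIn (scal (inv xF)) W 15 (collect Ms) (rows y))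
            (proj₂ (∧-split (refuteAll gl quot Ms (initially gl quot rs)) ok′)) (concat M) m))

⊞-zeros : ∀ (C : M4) → C ⊞ zeros {4} ≡ C
⊞-zeros C = lc-ext λ c → trans (lc-⊞ c C (zeros {4})) (trans (cong (lc c C +ᵥ_) (lc-zeros c)) (+-idʳ _))

*-distribˡ-+ᵥ : ∀ a b c → a *F (b +ᵥ c) ≡ (a *F b) +ᵥ (a *F c)
*-distribˡ-+ᵥ a b c = trans (cong (a *F_) (sym (+F≡+ᵥ b c))) (trans (*-distribˡ a b c) (+F≡+ᵥ _ _))

-- The value of B at x²t is scalar if those at t and xt are.
module Rescale {A B : Fin 16 → M4} (nor : Normal A B)
               (x²-scalar : ∀ {A B} (nor : Normal A B) → Σ F16 λ q → B (Normal.idx nor x²) ≡ scal q)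
               (t q q′ : F16) (t≢0 : t ≢ 0F) (et : B (Normal.idx nor t) ≡ scal q) (ext : B (Normal.idx nor (xF *F t)) ≡ scal q′) where
  open Normal nor
  open Sys sys

  private
    -- Subtracting lA with l = q/t makes the value at t vanish, and u is what then remains at xt; it
    -- is nonzero by `s₂`. Dividing A by t and B by u yields a normalised system in which x²t plays
    -- the role of x².
    l u : F16
    l = q *F inv t
    u = q′ +ᵥ (l *F (xF *F t))

    lt : l *F t ≡ q
    lt = trans (*-assoc q (inv t) t) (trans (cong (q *F_) (inv-left t t≢0)) (*-identityʳ q))

    valueAt : ∀ s r → B (idx s) ≡ scal r → lc (lc 1F (scal l)) (A (idx s)) +ᵥ lc 1F (B (idx s)) ≡ lc 1F (scal ((l *F s) +ᵥ r))
    valueAt s r e = trans (cong₂ _+ᵥ_ (trans (cong (lc (lc 1F (scal l))) (A-idx s)) (trans (sym (lc-⊗ 1F (scal l) (scal s))) (cong (lc 1F) (sym (scal-* l s))))) (cong (lc 1F) e))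
      (trans (sym (lc-⊞ 1F (scal (l *F s)) (scal r))) (cong (lc 1F) (sym (scal-+ (l *F s) r))))

    vanish : ∀ s r → B (idx s) ≡ scal r → l *F s ≡ r → lc (lc 1F (scal l)) (A (idx s)) +ᵥ lc 1F (B (idx s)) ≡ 𝟎
    vanish s r e p = trans (valueAt s r e) (cong (λ v → lc 1F (scal v)) (≡⇒+≡𝟎 p))

    xt≢0 : xF *F t ≢ 0F
    xt≢0 = *-≢0 (λ ()) t≢0

    xt≢t : t ≢ xF *F t
    xt≢t e = x≢1 (trans (sym (*-identityʳ xF)) (trans (cong (xF *F_) (sym (inv-right t t≢0))) (trans (sym (*-assoc xF t (inv t))) (trans (cong (_*F inv t) (sym e)) (inv-right t t≢0)))))
      where
      x≢1 : xF ≢ 1F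
      x≢1 ()

    u≢0 : u ≢ 0F
    u≢0 e = 1F≢𝟎 (s₂ (idx 0F) (idx t) (idx (xF *F t)) (λ p → t≢0 (sym (idx-injective p))) (λ p → xt≢t (idx-injective p)) (λ p → xt≢0 (sym (idx-injective p)))
      (lc 1F (scal l)) 1F (trans v₀ (sym v₁)) (trans v₁ (sym v₂)))
      where
      v₀ : lc (lc 1F (scal l)) (A (idx 0F)) +ᵥ lc 1F (B (idx 0F)) ≡ 𝟎
      v₀ = vanish 0F 0F B-0 (*-zeroʳ l)
      v₁ : lc (lc 1F (scal l)) (A (idx t)) +ᵥ lc 1F (B (idx t)) ≡ 𝟎
      v₁ = vanish t q et lt
      v₂ : lc (lc 1F (scal l)) (A (idx (xF *F t))) +ᵥ lc 1F (B (idx (xF *F t))) ≡ 𝟎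
      v₂ = vanish (xF *F t) q′ ext (sym (+≡𝟎⇒≡ e))

    module M = Move A B (scal (inv t)) (one 4) (scal (inv u)) (zeros {4}) (scal l) (zeros {4}) (scal-inj (inv-≢0 t≢0)) (one-inj 4) (scal-inj (inv-≢0 u≢0))

    A′-eq : ∀ s → M.A′ (idx (s *F t)) ≡ scal s
    A′-eq s = trans (⊗-one _) (trans (cong (scal (inv t) ⊗_) (trans (⊞-zeros _) (A-idx (s *F t)))) (trans (sym (scal-* (inv t) (s *F t)))
      (cong scal (trans (*-comm (inv t) (s *F t)) (trans (*-assoc s t (inv t)) (trans (cong (s *F_) (inv-right t t≢0)) (*-identityʳ s)))))))

    B′-eq : ∀ s → M.B′ (idx s) ≡ scal (inv u) ⊗ (B (idx s) ⊞ scal (l *F s))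
    B′-eq s = trans (⊗-one _) (cong (scal (inv u) ⊗_) (trans (⊞-zeros _) (cong (B (idx s) ⊞_) (trans (cong (scal l ⊗_) (A-idx s)) (sym (scal-* l s))))))

    B′-scal : ∀ s r → B (idx s) ≡ scal r → M.B′ (idx s) ≡ scal (inv u *F (r +ᵥ (l *F s)))
    B′-scal s r e = trans (B′-eq s) (trans (cong (λ C → scal (inv u) ⊗ (C ⊞ scal (l *F s))) e) (trans (cong (scal (inv u) ⊗_) (sym (scal-+ r (l *F s)))) (sym (scal-* (inv u) (r +ᵥ (l *F s))))))

    nor′ : Normal M.A′ M.B′
    nor′ = record { sys = M.sys sys ; idx = λ s → idx (s *F t) ; A-idx = A′-eq
      ; B-0 = trans (cong (M.B′ ∘ idx) (*-zeroˡ t)) (trans (B′-scal 0F 0F B-0) (cong scal (trans (cong (λ v → inv u *F (0F +ᵥ v)) (*-zeroʳ l)) (*-zeroʳ (inv u)))))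
      ; B-1 = trans (cong (M.B′ ∘ idx) (*-identityˡ t)) (trans (B′-scal t q et) (cong scal (trans (cong (inv u *F_) (≡⇒+≡𝟎 (sym lt))) (*-zeroʳ (inv u)))))
      ; B-x = trans (B′-scal (xF *F t) q′ ext) (cong scal (inv-left u u≢0)) }

    s² : F16
    s² = x² *F t

    r : Σ F16 λ r → M.B′ (idx s²) ≡ scal r
    r = x²-scalar nor′

  next : Σ F16 λ r → B (idx (x² *F t)) ≡ scal r
  next = (u *F proj₁ r) +ᵥ (l *F s²) , (begin
    B (idx s²)                                              ≡⟨ cancel ⟨
    (B (idx s²) ⊞ scal (l *F s²)) ⊞ scal (l *F s²)          ≡⟨ cong (_⊞ scal (l *F s²)) (one-⊗ _) ⟨
    (one 4 ⊗ (B (idx s²) ⊞ scal (l *F s²))) ⊞ scal (l *F s²) ≡⟨ cong (λ C → (C ⊗ (B (idx s²) ⊞ scal (l *F s²))) ⊞ scal (l *F s²)) (trans (sym (scal-* u (inv u))) (cong scal (inv-right u u≢0))) ⟨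
    ((scal u ⊗ scal (inv u)) ⊗ (B (idx s²) ⊞ scal (l *F s²))) ⊞ scal (l *F s²) ≡⟨ cong (_⊞ scal (l *F s²)) (⊗-assoc (scal u) (scal (inv u)) _) ⟩
    (scal u ⊗ (scal (inv u) ⊗ (B (idx s²) ⊞ scal (l *F s²)))) ⊞ scal (l *F s²) ≡⟨ cong (λ C → (scal u ⊗ C) ⊞ scal (l *F s²)) (trans (sym (B′-eq s²)) (proj₂ r)) ⟩
    (scal u ⊗ scal (proj₁ r)) ⊞ scal (l *F s²)              ≡⟨ cong (_⊞ scal (l *F s²)) (scal-* u (proj₁ r)) ⟨
    scal (u *F proj₁ r) ⊞ scal (l *F s²)                    ≡⟨ scal-+ _ _ ⟨
    scal ((u *F proj₁ r) +ᵥ (l *F s²)) ∎)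
    where
    open ≡-Reasoning
    cancel : (B (idx s²) ⊞ scal (l *F s²)) ⊞ scal (l *F s²) ≡ B (idx s²)
    cancel = lc-ext λ c → trans (lc-⊞ c (B (idx s²) ⊞ scal (l *F s²)) (scal (l *F s²))) (trans (cong (_+ᵥ lc c (scal (l *F s²))) (lc-⊞ c (B (idx s²)) (scal (l *F s²)))) (+-cancelʳ _ _))

power : ℕ → F16
power zero = 1F
power (suc n) = xF *F power n

power≢0 : ∀ n → power n ≢ 0F
power≢0 zero = λ ()
power≢0 (suc n) = *-≢0 (λ ()) (power≢0 n)

logs : List ℕ
logs = 0 ∷ 1 ∷ 2 ∷ 3 ∷ 4 ∷ 5 ∷ 6 ∷ 7 ∷ 8 ∷ 9 ∷ 10 ∷ 11 ∷ 12 ∷ 13 ∷ 14 ∷ []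

zero-or-power : ∀ t → t ≡ 0F ⊎ Σ ℕ λ n → t ≡ power n
zero-or-power t = ∨-elim (eqV t 0F) (λ e → inj₁ (eqV-sound t 0F e))
  (Any-elim (λ n → eqV t (power n)) logs (λ n e → inj₂ (n , eqV-sound t (power n) e)))
  (all₁-sound (λ t → eqV t 0F ∨ anyL (λ n → eqV t (power n)) logs) refl t)

-- Two consecutive powers are carried through the induction, since the value at x²t is reached from
-- those at t and xt; the normalised values at 1 and x start it.
all-scalar : (∀ {A B} (nor : Normal A B) → Σ F16 λ q → B (Normal.idx nor x²) ≡ scal q) →
             ∀ {A B} (nor : Normal A B) t → Σ F16 λ q → B (Normal.idx nor t) ≡ scal q
all-scalar x²-scalar {A} {B} nor t = go (zero-or-power t)
  where
  open Normal nor
  Scalar : F16 → Set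
  Scalar t = Σ F16 λ q → B (idx t) ≡ scal q
  powers : ∀ n → Scalar (power n) × Scalar (power (suc n))
  powers zero = (0F , B-1) , (1F , B-x)
  powers (suc n) = proj₂ (powers n) , subst Scalar (*-assoc xF xF (power n))
    (Rescale.next nor x²-scalar (power n) (proj₁ p) (proj₁ p′) (power≢0 n) (proj₂ p) (proj₂ p′))
    where
    p : Scalar (power n)
    p = proj₁ (powers n)
    p′ : Scalar (power (suc n))
    p′ = proj₂ (powers n)
  go : t ≡ 0F ⊎ (Σ ℕ λ n → t ≡ power n) → Scalar t
  go (inj₁ refl) = 0F , B-0
  go (inj₂ (n , refl)) = proj₁ (powers n)

-- From scalar values to functions on GF(16)

module Labels {A B : Fin 16 → M4} (nor : Normal A B) where
  open Normal nor

  private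
    onto-idx : ∀ i → Σ (Fin 16) λ j → idx (decodeᵥ 4 j) ≡ i
    onto-idx = injective⇒surjective (idx ∘ decodeᵥ 4) (λ i j e → trans (sym (encode-decode 4 i))
      (trans (cong encode (idx-injective {decodeᵥ 4 i} {decodeᵥ 4 j} e)) (encode-decode 4 j)))

  label : Fin 16 → F16
  label i = decodeᵥ 4 (proj₁ (onto-idx i))

  idx-label : ∀ i → idx (label i) ≡ i
  idx-label i = proj₂ (onto-idx i)

  label-idx : ∀ t → label (idx t) ≡ t
  label-idx t = idx-injective (idx-label (idx t))

  label-injective : ∀ {i j} → label i ≡ label j → i ≡ j
  label-injective {i} {j} e = trans (sym (idx-label i)) (trans (cong idx e) (idx-label j))

-- A certificate for the oval {(0, 0, 1)} ∪ {(1, t, f t)}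
record Maps (mul quo : F16 → F16 → F16) (h : Table F16) (f : F16 → F16) : Set where
  field
    K      : Kind
    k      : Fin 4
    M      : Mat16
    affine-ok   : ∀ t → onImage mul quo h K M 1F (frobm mul quo h (toℕ k) t) (frobm mul quo h (toℕ k) (f t)) ≡ true
    infinite-ok : onImage mul quo h K M 0F 0F 1F ≡ true
    det-ok      : nonzero (detM M) ≡ true

module OvalStage (pr qu : Table₂) (h : Table F16) (qu-ok : ∀ a b → get₂ qu a b ≡ a *F inv b)
                 {n} (ps : Vec F16 n) (dif : allDiffer (0F ∷ 1F ∷ xF ∷ ps) ≡ true)
                 (cov : ∀ t → anyL (eqV t) (reverseOnto ps (xF ∷ 1F ∷ 0F ∷ [])) ≡ true)
                 (cs : List ℕ) (ok : ovalSearch pr qu h ps cs ≡ true)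
                 {A B : Fin 16 → M4} (nor : Normal A B)
                 (f : F16 → F16) (B-f : ∀ t → B (Normal.idx nor t) ≡ scal (f t)) where
  open Normal nor
  open Sys sys
  open Labels nor

  private
    β : Fin 16 → F16
    β i = f (label i)

    β-idx : ∀ t → β (idx t) ≡ f t
    β-idx t = cong f (label-idx t)

    Slope : Fin 16 → Fin 16 → F16 → Set
    Slope i j b = (b *F label i) +ᵥ β i ≡ (b *F label j) +ᵥ β j

    -- With b and 1 entering as first rows of scalar matrices, `s₂` becomes a statement about the
    -- field elements bt + f(t), which says that no three points (t, f(t)) are collinear.
    line : ∀ b i → lc (lc 1F (scal b)) (A i) +ᵥ lc 1F (B i) ≡ lc 1F (scal ((b *F label i) +ᵥ β i))
    line b i = trans (cong₂ _+ᵥ_ (trans (cong (lc (lc 1F (scal b))) (trans (cong A (sym (idx-label i))) (A-idx (label i))))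
        (trans (sym (lc-⊗ 1F (scal b) (scal (label i)))) (cong (lc 1F) (sym (scal-* b (label i))))))
        (cong (lc 1F) (trans (cong B (sym (idx-label i))) (B-f (label i)))))
      (trans (sym (lc-⊞ 1F (scal (b *F label i)) (scal (β i)))) (cong (lc 1F) (sym (scal-+ (b *F label i) (β i)))))

    same-line : ∀ b i j → Slope i j b → lc (lc 1F (scal b)) (A i) +ᵥ lc 1F (B i) ≡ lc (lc 1F (scal b)) (A j) +ᵥ lc 1F (B j)
    same-line b i j e = trans (line b i) (trans (cong (λ v → lc 1F (scal v)) e) (sym (line b j)))

    noThree : ∀ i j k b → i ≢ j → j ≢ k → i ≢ k → Slope k i b → Slope k j b → ⊥
    noThree i j k b p q r s t = 1F≢𝟎 (s₂ i j k p q r (lc 1F (scal b)) 1F (same-line b i j (trans (sym s) t)) (same-line b j k (sym t)))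

    slope-ok : ∀ k j → k ≢ j → Slope k j (at (fieldSlope qu (label k) (label j)) (β k) (β j))
    slope-ok k j k≢j = +-swap (b *F label k) (b *F label j) (β k) (β j) (trans (sym (*-distribˡ-+ᵥ b (label k) (label j)))
        (trans (cong (_*F (label k +ᵥ label j)) (trans (at-table 4 (λ w → get₂ qu w (label k +ᵥ label j)) (β k) (β j)) (qu-ok _ _)))
        (trans (*-assoc (β k +ᵥ β j) (inv (label k +ᵥ label j)) (label k +ᵥ label j)) (trans (cong ((β k +ᵥ β j) *F_) (inv-left (label k +ᵥ label j) (+-≢0 (λ e → k≢j (label-injective e))))) (*-identityʳ _)))))
      where
      b : F16
      b = at (fieldSlope qu (label k) (label j)) (β k) (β j)

    open Values β Slope noThree
    open Initial label (fieldSlope qu) slope-ok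

    indices : ∀ {m} → Vec F16 m → Vec (Fin 16) m
    indices [] = []
    indices (t ∷ ts) = idx t ∷ indices ts

    labels-indices : ∀ {m} (ts : Vec F16 m) → labelsV (indices ts) ≡ ts
    labels-indices [] = refl
    labels-indices (t ∷ ts) = cong₂ _∷_ (label-idx t) (labels-indices ts)

    data AwayV (a : F16) : ∀ {m} → Vec F16 m → Set where
      [] : AwayV a []
      _∷_ : ∀ {b m} {bs : Vec F16 m} → a ≢ b → AwayV a bs → AwayV a (b ∷ bs)

    awayV : ∀ a {m} (bs : Vec F16 m) → differs a bs ≡ true → AwayV a bs
    awayV a [] e = []
    awayV a (b ∷ bs) e = ≢-bool a b (proj₁ (∧-split (not (eqV a b)) e)) ∷ awayV a bs (proj₂ (∧-split (not (eqV a b)) e))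

    snocL : ∀ {P : Fin 16 → Set} pre {i} → All P pre → P i → All P (snoc pre i)
    snocL [] [] p = p ∷ []
    snocL (_ ∷ pre) (q ∷ qs) p = q ∷ snocL pre qs p

    freshness : ∀ {m} pre (ts : Vec F16 m) → allDiffer ts ≡ true → All (λ i → AwayV (label i) ts) pre → Fresh pre (indices ts)
    freshness pre [] d aw = []
    freshness pre (t ∷ ts) d aw = All.map (λ { (p ∷ _) e → p (trans (cong label e) (label-idx t)) }) aw ∷
      freshness (snoc pre (idx t)) ts (proj₂ ds) (snocL pre (All.map (λ { (_ ∷ a) → a }) aw) (subst (λ a → AwayV a ts) (sym (label-idx t)) (awayV t ts (proj₁ ds))))
      where
      ds : differs t ts ≡ true × allDiffer ts ≡ true
      ds = ∧-split (differs t ts) d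

    d₀ : differs 0F (1F ∷ xF ∷ ps) ≡ true × allDiffer (1F ∷ xF ∷ ps) ≡ true
    d₀ = ∧-split (differs 0F (1F ∷ xF ∷ ps)) dif
    d₁ : differs 1F (xF ∷ ps) ≡ true × allDiffer (xF ∷ ps) ≡ true
    d₁ = ∧-split (differs 1F (xF ∷ ps)) (proj₂ d₀)
    dₓ : differs xF ps ≡ true × allDiffer ps ≡ true
    dₓ = ∧-split (differs xF ps) (proj₂ d₁)

    tailV : ∀ {a b m} {bs : Vec F16 m} → AwayV a (b ∷ bs) → AwayV a bs
    tailV (_ ∷ a) = a

    at-idx : ∀ {t m} {ts : Vec F16 m} → AwayV t ts → AwayV (label (idx t)) ts
    at-idx {t} {ts = ts} = subst (λ a → AwayV a ts) (sym (label-idx t))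

    fresh-ps : Fresh (idx 0F ∷ idx 1F ∷ idx xF ∷ []) (indices ps)
    fresh-ps = freshness (idx 0F ∷ idx 1F ∷ idx xF ∷ []) ps (proj₂ dₓ) (at-idx {0F} (tailV {b = xF} (tailV {b = 1F} {bs = xF ∷ ps} (awayV 0F (1F ∷ xF ∷ ps) (proj₁ d₀)))) ∷ at-idx {1F} (tailV {b = xF} (awayV 1F (xF ∷ ps) (proj₁ d₁))) ∷ at-idx {xF} (awayV xF ps (proj₁ dₓ)) ∷ [])

    β₀ : β (idx 0F) ≡ 0F
    β₀ = trans (β-idx 0F) (scal-injective (trans (sym (B-f 0F)) B-0))
    β₁ : β (idx 1F) ≡ 0F
    β₁ = trans (β-idx 1F) (scal-injective (trans (sym (B-f 1F)) B-1))
    βₓ : β (idx xF) ≡ 1F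
    βₓ = trans (β-idx xF) (scal-injective (trans (sym (B-f xF)) B-x))

    its : List F16 → ∀ {m} → Vec F16 m → Vec Item m
    its X ts = steps 1F (steps 0F (steps 0F (items (fieldSlope qu) X ts)))

    all-items : Items (idx xF ∷ idx 1F ∷ idx 0F ∷ []) [] (its (0F ∷ 1F ∷ xF ∷ []) ps) (indices ps)
    all-items = subst₂ (λ X ts → Items (idx xF ∷ idx 1F ∷ idx 0F ∷ []) [] (its X ts) (indices ps))
      (cong₂ (λ a X → a ∷ X) (label-idx 0F) (cong₂ (λ a b → a ∷ b ∷ []) (label-idx 1F) (label-idx xF))) (labels-indices ps)
      (three β₀ β₁ βₓ (λ e → 0≢1 (idx-injective e)) (λ e → 0≢x (idx-injective e)) (λ e → 1≢x (idx-injective e)) fresh-ps)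
      where
      0≢1 : 0F ≢ 1F
      0≢1 ()
      0≢x : 0F ≢ xF
      0≢x ()
      1≢x : 1F ≢ xF
      1≢x ()

    order : List F16
    order = reverseOnto ps (xF ∷ 1F ∷ 0F ∷ [])

    final-values : ∀ {m} (ts : Vec F16 m) X → final (indices ts) (mapL f X) ≡ mapL f (reverseOnto ts X)
    final-values [] X = refl
    final-values (t ∷ ts) X = trans (cong (λ v → final (indices ts) (v ∷ mapL f X)) (β-idx t)) (final-values ts (t ∷ X))

    start-values : mapL f (xF ∷ 1F ∷ 0F ∷ []) ≡ 1F ∷ 0F ∷ 0F ∷ []
    start-values = cong₂ (λ a X → a ∷ X) (trans (sym (β-idx xF)) βₓ) (cong₂ (λ a b → a ∷ b ∷ []) (trans (sym (β-idx 1F)) β₁) (trans (sym (β-idx 0F)) β₀))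

    leaf : Succeeds (ovalLeaf pr qu h order (mapL f order))
    leaf = subst (λ vs → Succeeds (ovalLeaf pr qu h order vs)) (trans (cong (final (indices ps)) (sym start-values)) (final-values ps (xF ∷ 1F ∷ 0F ∷ [])))
      (assign-sound (ovalLeaf pr qu h order) all-items (1F ∷ 0F ∷ 0F ∷ [])
        (passes-sound (assign (ovalLeaf pr qu h order) (its (0F ∷ 1F ∷ xF ∷ []) ps) (1F ∷ 0F ∷ 0F ∷ [])) cs ok))

    mul quo : F16 → F16 → F16
    mul = get₂ pr
    quo = get₂ qu

    affine-sound : ∀ K k M X → affine mul quo h K k M X (mapL f X) ≡ true → ∀ t → anyL (eqV t) X ≡ true →
                   onImage mul quo h K M 1F (frobm mul quo h k t) (frobm mul quo h k (f t)) ≡ true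
    affine-sound K k M (p ∷ X) e t = ∨-elim (eqV t p) (λ q → subst (λ s → onImage mul quo h K M 1F (frobm mul quo h k s) (frobm mul quo h k (f s)) ≡ true)
        (sym (eqV-sound t p q)) (proj₁ es)) (affine-sound K k M X (proj₂ es) t)
      where
      es : onImage mul quo h K M 1F (frobm mul quo h k p) (frobm mul quo h k (f p)) ≡ true × affine mul quo h K k M X (mapL f X) ≡ true
      es = ∧-split (onImage mul quo h K M 1F (frobm mul quo h k p) (frobm mul quo h k (f p))) e

    from-cert : ∀ c → maps mul quo h order (mapL f order) c ≡ true → Maps mul quo h f
    from-cert (cert K k M) e = record { K = K ; k = k ; M = M
        ; affine-ok = λ t → affine-sound K (toℕ k) M order (proj₁ e₁) t (cov t)
        ; infinite-ok = proj₁ e₂ ; det-ok = proj₂ e₂ }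
      where
      e₁ : affine mul quo h K (toℕ k) M order (mapL f order) ≡ true × _ ≡ true
      e₁ = ∧-split (affine mul quo h K (toℕ k) M order (mapL f order)) e
      e₂ : onImage mul quo h K M 0F 0F 1F ≡ true × nonzero (detM M) ≡ true
      e₂ = ∧-split (onImage mul quo h K M 0F 0F 1F) (proj₂ e₁)

    from-leaf : Succeeds (ovalLeaf pr qu h order (mapL f order)) → Maps mul quo h f
    from-leaf (c ∷ cs , d , e) = from-cert (decode c) (if-just (maps mul quo h order (mapL f order) (decode c)) e)

  mapped : Maps (get₂ pr) (get₂ qu) h f
  mapped = from-leaf leaf

-- Coordinates of PG(2,16)

fromGF2 : Vec Bool 12 → V3
fromGF2 (a ∷ b ∷ c ∷ d ∷ e ∷ f ∷ g ∷ h ∷ i ∷ j ∷ k ∷ l ∷ []) =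
  (a ∷ b ∷ c ∷ d ∷ []) ∷ (e ∷ f ∷ g ∷ h ∷ []) ∷ (i ∷ j ∷ k ∷ l ∷ []) ∷ []

to-from : ∀ v → toGF2 (fromGF2 v) ≡ v
to-from (_ ∷ _ ∷ _ ∷ _ ∷ _ ∷ _ ∷ _ ∷ _ ∷ _ ∷ _ ∷ _ ∷ _ ∷ []) = refl

from-to : ∀ P → fromGF2 (toGF2 P) ≡ P
from-to ((_ ∷ _ ∷ _ ∷ _ ∷ []) ∷ (_ ∷ _ ∷ _ ∷ _ ∷ []) ∷ (_ ∷ _ ∷ _ ∷ _ ∷ []) ∷ []) = refl

toGF2-injective : ∀ {P Q} → toGF2 P ≡ toGF2 Q → P ≡ Q
toGF2-injective {P} {Q} e = trans (sym (from-to P)) (trans (cong fromGF2 e) (from-to Q))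

𝟘 : V3
𝟘 = 0F ∷ 0F ∷ 0F ∷ []

toGF2-⊞ : ∀ P Q → toGF2 (P ⊞ Q) ≡ toGF2 P +ᵥ toGF2 Q
toGF2-⊞ = concat-⊞

fromGF2-+ : ∀ u v → fromGF2 (u +ᵥ v) ≡ fromGF2 u ⊞ fromGF2 v
fromGF2-+ u v = toGF2-injective (trans (to-from (u +ᵥ v)) (sym (trans (toGF2-⊞ (fromGF2 u) (fromGF2 v)) (cong₂ _+ᵥ_ (to-from u) (to-from v)))))

*-distribʳ-+ᵥ : ∀ a b c → (b +ᵥ c) *F a ≡ (b *F a) +ᵥ (c *F a)
*-distribʳ-+ᵥ a b c = trans (*-comm (b +ᵥ c) a) (trans (*-distribˡ-+ᵥ a b c) (cong₂ _+ᵥ_ (*-comm a b) (*-comm a c)))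

scale-+ : ∀ μ ν P → scale (μ +ᵥ ν) P ≡ scale μ P ⊞ scale ν P
scale-+ μ ν (x ∷ y ∷ z ∷ []) = cong₂ _∷_ (*-distribʳ-+ᵥ x μ ν) (cong₂ _∷_ (*-distribʳ-+ᵥ y μ ν) (cong (_∷ []) (*-distribʳ-+ᵥ z μ ν)))

scale-⊞ : ∀ μ P Q → scale μ (P ⊞ Q) ≡ scale μ P ⊞ scale μ Q
scale-⊞ μ (x ∷ y ∷ z ∷ []) (x′ ∷ y′ ∷ z′ ∷ []) = cong₂ _∷_ (*-distribˡ-+ᵥ μ x x′) (cong₂ _∷_ (*-distribˡ-+ᵥ μ y y′) (cong (_∷ []) (*-distribˡ-+ᵥ μ z z′)))

scale-* : ∀ μ ν P → scale (μ *F ν) P ≡ scale μ (scale ν P)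
scale-* μ ν (x ∷ y ∷ z ∷ []) = cong₂ _∷_ (*-assoc μ ν x) (cong₂ _∷_ (*-assoc μ ν y) (cong (_∷ []) (*-assoc μ ν z)))

scale-1 : ∀ P → scale 1F P ≡ P
scale-1 (x ∷ y ∷ z ∷ []) = cong₂ _∷_ (*-identityˡ x) (cong₂ _∷_ (*-identityˡ y) (cong (_∷ []) (*-identityˡ z)))

scale-0 : ∀ P → scale 0F P ≡ 𝟘
scale-0 (x ∷ y ∷ z ∷ []) = cong₂ _∷_ (*-zeroˡ x) (cong₂ _∷_ (*-zeroˡ y) (cong (_∷ []) (*-zeroˡ z)))

scale-𝟘 : ∀ μ → scale μ 𝟘 ≡ 𝟘
scale-𝟘 μ = cong₂ _∷_ (*-zeroʳ μ) (cong₂ _∷_ (*-zeroʳ μ) (cong (_∷ []) (*-zeroʳ μ)))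

lc-map : ∀ {m n p} (g : Vec Bool n → Vec Bool p) → (∀ u v → g (u +ᵥ v) ≡ g u +ᵥ g v) → ∀ c (B : Mat m n) → lc c (map g B) ≡ g (lc c B)
lc-map g add [] [] = sym g𝟎
  where
  g𝟎 : g 𝟎 ≡ 𝟎
  g𝟎 = trans (cong g (sym (+-self 𝟎))) (trans (add 𝟎 𝟎) (+-self _))
lc-map g add (false ∷ c) (v ∷ B) = lc-map g add c B
lc-map g add (true ∷ c) (v ∷ B) = trans (cong (g v +ᵥ_) (lc-map g add c B)) (sym (add v (lc c B)))

lc-basisF16 : ∀ c → lc c basisF16 ≡ c
lc-basisF16 c = eqV-sound _ _ (all₁-sound (λ c → eqV (lc c basisF16) c) refl c)

lc-member : ∀ c P → lc c (member P) ≡ toGF2 (scale c P)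
lc-member c P = trans (lc-map (λ μ → toGF2 (scale μ P)) (λ μ ν → trans (cong toGF2 (scale-+ μ ν P)) (toGF2-⊞ (scale μ P) (scale ν P))) c basisF16)
  (cong (λ μ → toGF2 (scale μ P)) (lc-basisF16 c))

inMember : ∀ {v P} → InSpan v (member P) → Σ F16 λ μ → v ≡ toGF2 (scale μ P)
inMember {v} {P} (c , e) = c , trans (sym e) (trans (sym (lc≡lincomb c (member P))) (lc-member c P))

member-in : ∀ μ P → InSpan (toGF2 (scale μ P)) (member P)
member-in μ P = μ , trans (sym (lc≡lincomb μ (member P))) (lc-member μ P)

-- Determinants, and the pseudo-oval of an oval

zero? : ∀ a → Maybe (0F ≡ a)
zero? a = go (eqV 0F a) refl
  where
  go : ∀ b → eqV 0F a ≡ b → Maybe (0F ≡ a)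
  go true e = just (eqV-sound 0F a e)
  go false e = nothing

ring : AlmostCommutativeRing 0ℓ 0ℓ
ring = fromCommutativeRing F16-ring zero?

module Identities where
  open AlmostCommutativeRing ring using (_+_; _*_; _≈_; 0#)

  det-linear : ∀ x y z a b c d e f g h i →
    ((((x * a) + ((y * d) + (z * g))) * ((e * i) + (f * h))) + ((((x * b) + ((y * e) + (z * h))) * ((d * i) + (f * g))) + (((x * c) + ((y * f) + (z * i))) * ((d * h) + (e * g))))) ≈ x * ((a * ((e * i) + (f * h))) + ((b * ((d * i) + (f * g))) + (c * ((d * h) + (e * g)))))
  det-linear = solve-∀ ring

  det-swap₁ : ∀ a b c d e f g h i → ((a * ((e * i) + (f * h))) + ((b * ((d * i) + (f * g))) + (c * ((d * h) + (e * g))))) ≈ ((d * ((b * i) + (c * h))) + ((e * ((a * i) + (c * g))) + (f * ((a * h) + (b * g)))))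
  det-swap₁ = solve-∀ ring

  det-swap₂ : ∀ a b c d e f g h i → ((a * ((e * i) + (f * h))) + ((b * ((d * i) + (f * g))) + (c * ((d * h) + (e * g))))) ≈ ((a * ((h * f) + (i * e))) + ((b * ((g * f) + (i * d))) + (c * ((g * e) + (h * d)))))
  det-swap₂ = solve-∀ ring

  det-transpose : ∀ a b c d e f g h i → ((a * ((e * i) + (f * h))) + ((b * ((d * i) + (f * g))) + (c * ((d * h) + (e * g))))) ≈ ((a * ((e * i) + (h * f))) + ((d * ((b * i) + (h * c))) + (g * ((b * f) + (e * c)))))
  det-transpose = solve-∀ ring

  det-product : ∀ m n o p q r s t u a b c d e f g h i →
    ((((m * a) + ((n * b) + ((o * c) + 0#))) * ((((p * d) + ((q * e) + ((r * f) + 0#))) * ((s * g) + ((t * h) + ((u * i) + 0#)))) + (((s * d) + ((t * e) + ((u * f) + 0#))) * ((p * g) + ((q * h) + ((r * i) + 0#)))))) + ((((p * a) + ((q * b) + ((r * c) + 0#))) * ((((m * d) + ((n * e) + ((o * f) + 0#))) * ((s * g) + ((t * h) + ((u * i) + 0#)))) + (((s * d) + ((t * e) + ((u * f) + 0#))) * ((m * g) + ((n * h) + ((o * i) + 0#)))))) + (((s * a) + ((t * b) + ((u * c) + 0#))) * ((((m * d) + ((n * e) + ((o * f) + 0#))) * ((p * g) + ((q * h) + ((r * i) + 0#)))) + (((p * d) + ((q * e) + ((r * f) + 0#))) * ((m * g) + ((n * h) + ((o * i) + 0#)))))))) ≈ ((m * ((q * u) + (r * t))) + ((n * ((p * u)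 + (r * s))) + (o * ((p * t) + (q * s))))) * ((a * ((e * i) + (f * h))) + ((b * ((d * i) + (f * g))) + (c * ((d * h) + (e * g)))))
  det-product = solve-∀ ring

  det-scale : ∀ x y z a b c d e f g h i → (((x * a) * (((y * e) * (z * i)) + ((y * f) * (z * h)))) + (((x * b) * (((y * d) * (z * i)) + ((y * f) * (z * g)))) + ((x * c) * (((y * d) * (z * h)) + ((y * e) * (z * g)))))) ≈ (x * (y * z)) * ((a * ((e * i) + (f * h))) + ((b * ((d * i) + (f * g))) + (c * ((d * h) + (e * g)))))
  det-scale = solve-∀ ring

combo : F16 → F16 → F16 → V3 → V3 → V3 → V3
combo α β γ P Q R = scale α P ⊞ (scale β Q ⊞ scale γ R)

det3-linear : ∀ α P Q R β γ → det3 (combo α β γ P Q R) Q R ≡ α *F det3 P Q R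
det3-linear α (a ∷ b ∷ c ∷ []) (d ∷ e ∷ f ∷ []) (g ∷ h ∷ i ∷ []) β γ = trans
  (cong₂ (λ X Y → det3 (X ∷ Y) (d ∷ e ∷ f ∷ []) (g ∷ h ∷ i ∷ [])) (plus _ _ _) (cong₂ (λ X Y → X ∷ Y ∷ []) (plus _ _ _) (plus _ _ _)))
  (Identities.det-linear α β γ a b c d e f g h i)
  where
  plus : ∀ (a b c : F16) → a +ᵥ (b +ᵥ c) ≡ a +F (b +F c)
  plus a b c = trans (cong (a +ᵥ_) (+ᵥ≡⊕ b c)) (+ᵥ≡⊕ a _)

det3-𝟘 : ∀ Q R → det3 𝟘 Q R ≡ 0F
det3-𝟘 (d ∷ e ∷ f ∷ []) (g ∷ h ∷ i ∷ []) = cong₂ _+F_ (*-zeroˡ ((e *F i) +F (f *F h))) (cong₂ _+F_ (*-zeroˡ ((d *F i) +F (f *F g))) (*-zeroˡ ((d *F h) +F (e *F g))))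

det3-swap₁ : ∀ P Q R → det3 P Q R ≡ det3 Q P R
det3-swap₁ (a ∷ b ∷ c ∷ []) (d ∷ e ∷ f ∷ []) (g ∷ h ∷ i ∷ []) = Identities.det-swap₁ a b c d e f g h i

det3-swap₂ : ∀ P Q R → det3 P Q R ≡ det3 P R Q
det3-swap₂ (a ∷ b ∷ c ∷ []) (d ∷ e ∷ f ∷ []) (g ∷ h ∷ i ∷ []) = Identities.det-swap₂ a b c d e f g h i

det3-scale : ∀ x y z P Q R → det3 (scale x P) (scale y Q) (scale z R) ≡ (x *F (y *F z)) *F det3 P Q R
det3-scale x y z (a ∷ b ∷ c ∷ []) (d ∷ e ∷ f ∷ []) (g ∷ h ∷ i ∷ []) = Identities.det-scale x y z a b c d e f g h i

first-zero : ∀ α β γ P Q R → det3 P Q R ≢ 0F → combo α β γ P Q R ≡ 𝟘 → α ≡ 0F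
first-zero α β γ P Q R d e = no-zero-divisors (det3 P Q R) α (trans (*-comm (det3 P Q R) α) (trans (sym (det3-linear α P Q R β γ)) (trans (cong (λ X → det3 X Q R) e) (det3-𝟘 Q R)))) d

⊞-comm : ∀ (P Q : V3) → P ⊞ Q ≡ Q ⊞ P
⊞-comm (a ∷ b ∷ c ∷ []) (d ∷ e ∷ f ∷ []) = cong₂ _∷_ (+-comm a d) (cong₂ _∷_ (+-comm b e) (cong (_∷ []) (+-comm c f)))

⊞-assoc : ∀ (P Q R : V3) → (P ⊞ Q) ⊞ R ≡ P ⊞ (Q ⊞ R)
⊞-assoc (a ∷ b ∷ c ∷ []) (d ∷ e ∷ f ∷ []) (g ∷ h ∷ i ∷ []) = cong₂ _∷_ (+-assoc a d g) (cong₂ _∷_ (+-assoc b e h) (cong (_∷ []) (+-assoc c f i)))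

combo-rotate : ∀ α β γ P Q R → combo α β γ P Q R ≡ combo β γ α Q R P
combo-rotate α β γ P Q R = trans (⊞-comm (scale α P) _) (⊞-assoc (scale β Q) (scale γ R) (scale α P))

-- Replacing the first vector by the combination multiplies the determinant by its coefficient.
-- Rotating the three vectors brings each coefficient to the front in turn.
independent : ∀ α β γ P Q R → det3 P Q R ≢ 0F → combo α β γ P Q R ≡ 𝟘 → α ≡ 0F × β ≡ 0F × γ ≡ 0F
independent α β γ P Q R d e = first-zero α β γ P Q R d e ,
  first-zero β γ α Q R P (λ z → d (trans (trans (det3-swap₁ P Q R) (det3-swap₂ Q P R)) z)) (trans (sym (combo-rotate α β γ P Q R)) e) ,
  first-zero γ α β R P Q (λ z → d (trans (trans (det3-swap₂ P Q R) (det3-swap₁ P R Q)) z))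
    (trans (sym (trans (combo-rotate α β γ P Q R) (combo-rotate β γ α Q R P))) e)

two-others : ∀ (i : Fin 17) → Σ (Fin 17) λ j → Σ (Fin 17) λ k → Distinct3 i j k
two-others zero = suc zero , suc (suc zero) , (λ ()) , (λ ()) , (λ ())
two-others (suc zero) = zero , suc (suc zero) , (λ ()) , (λ ()) , (λ ())
two-others (suc (suc i)) = zero , suc zero , (λ ()) , (λ ()) , (λ ())

oval-point : ∀ {Ω} → IsOval Ω → ∀ i → Ω i ≢ 𝟘
oval-point {Ω} o i e with two-others i
... | j , k , d = o i j k d (trans (cong (λ P → det3 P (Ω j) (Ω k)) e) (det3-𝟘 (Ω j) (Ω k)))

scale≡𝟘 : ∀ {μ P} → P ≢ 𝟘 → scale μ P ≡ 𝟘 → μ ≡ 0F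
scale≡𝟘 {μ} {P} p e = go (eqV μ 0F) refl
  where
  go : ∀ b → eqV μ 0F ≡ b → μ ≡ 0F
  go true q = eqV-sound μ 0F q
  go false q = ⊥-elim (p (trans (sym (scale-1 P)) (trans (cong (λ ν → scale ν P) (sym (inv-left μ (λ { refl → contra q }))))
      (trans (scale-* (inv μ) μ P) (trans (cong (scale (inv μ)) e) (scale-𝟘 (inv μ)))))))
    where
    contra : eqV 0F 0F ≡ false → ⊥
    contra ()

lc-members : ∀ α β γ P Q R → lc (α ++ (β ++ γ)) (member P ++ (member Q ++ member R)) ≡ toGF2 (combo α β γ P Q R)
lc-members α β γ P Q R = trans (lc-stack α β γ (member P) (member Q) (member R))
  (trans (cong₂ _+ᵥ_ (lc-member α P) (trans (cong₂ _+ᵥ_ (lc-member β Q) (lc-member γ R)) (sym (toGF2-⊞ (scale β Q) (scale γ R)))))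
    (sym (toGF2-⊞ (scale α P) (scale β Q ⊞ scale γ R))))

members-inj : ∀ P Q R → det3 P Q R ≢ 0F → Inj (member P ++ (member Q ++ member R))
members-inj P Q R d f e = go (split₃ {4} f)
  where
  go : (Σ F16 λ a → Σ F16 λ b → Σ F16 λ c → f ≡ a ++ (b ++ c)) → f ≡ 𝟎
  go (a , b , c , refl) = zero³ (independent a b c P Q R d (toGF2-injective (trans (sym (lc-members a b c P Q R)) e)))
    where
    zero³ : a ≡ 0F × b ≡ 0F × c ≡ 0F → a ++ (b ++ c) ≡ 𝟎
    zero³ (refl , refl , refl) = refl

-- Three points with nonzero determinant are independent over GF(16), so the twelve vectors of their
-- members are independent over GF(2), and counting makes them span.
oval⇒pseudoOval : ∀ Ω → IsOval Ω → IsPseudoOval (elementary Ω)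
oval⇒pseudoOval Ω o = independent-members , spanning
  where
  independent-members : ∀ i → LinIndep (elementary Ω i)
  independent-members i c e = scale≡𝟘 {c} {Ω i} (oval-point {Ω} o i) (toGF2-injective {scale c (Ω i)} {𝟘} (trans (sym (lc-member c (Ω i))) (trans (lc≡lincomb c (member (Ω i))) e)))
  spanning : ∀ i j k → Distinct3 i j k → SpansAll (elementary Ω i ++ elementary Ω j ++ elementary Ω k)
  spanning i j k d v = proj₁ s , trans (sym (lc≡lincomb (proj₁ s) S)) (proj₂ s)
    where
    S : Mat2 12
    S = member (Ω i) ++ (member (Ω j) ++ member (Ω k))
    s : Σ (Vec Bool 12) λ c → lc c S ≡ v
    s = surjective (members-inj (Ω i) (Ω j) (Ω k) (o i j k d)) v

-- Semilinear maps

frob-+ : ∀ k a b → frob k (a +ᵥ b) ≡ frob k a +ᵥ frob k b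
frob-+ zero a b = refl
frob-+ (suc k) a b = trans (cong (frob k) (eqV-sound _ _ (all₂-sound (λ a b → eqV ((a +ᵥ b) *F (a +ᵥ b)) ((a *F a) +ᵥ (b *F b))) refl a b))) (frob-+ k (a *F a) (b *F b))

frob-* : ∀ k a b → frob k (a *F b) ≡ frob k a *F frob k b
frob-* zero a b = refl
frob-* (suc k) a b = trans (cong (frob k) (square-* a b)) (frob-* k (a *F a) (b *F b))
  where
  open AlmostCommutativeRing ring using (_*_; _≈_)
  square-* : ∀ a b → (a * b) * (a * b) ≈ (a * a) * (b * b)
  square-* = solve-∀ ring

frob-≢0 : ∀ k {a} → frob k a ≡ 0F → a ≡ 0F
frob-≢0 zero e = e
frob-≢0 (suc k) {a} e = go (eqV a 0F) refl
  where
  go : ∀ b → eqV a 0F ≡ b → a ≡ 0F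
  go true q = eqV-sound a 0F q
  go false q = no-zero-divisors a a (frob-≢0 k e) (λ { refl → contra q })
    where
    contra : eqV 0F 0F ≡ false → ⊥
    contra ()

-- The Frobenius map has order 4, so its k-th power is inverted by the (4 - k)-th.
frob-onto : ∀ (k : Fin 4) b → Σ F16 λ a → frob (toℕ k) a ≡ b
frob-onto zero b = b , refl
frob-onto (suc zero) b = frob 3 b , eqV-sound _ _ (all₁-sound (λ b → eqV (frob 1 (frob 3 b)) b) refl b)
frob-onto (suc (suc zero)) b = frob 2 b , eqV-sound _ _ (all₁-sound (λ b → eqV (frob 2 (frob 2 b)) b) refl b)
frob-onto (suc (suc (suc zero))) b = frob 1 b , eqV-sound _ _ (all₁-sound (λ b → eqV (frob 3 (frob 1 b)) b) refl b)

dot16-+ : ∀ r P Q → dot16 r (P ⊞ Q) ≡ dot16 r P +ᵥ dot16 r Q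
dot16-+ (a ∷ b ∷ c ∷ []) (x ∷ y ∷ z ∷ []) (x′ ∷ y′ ∷ z′ ∷ []) = trans
  (cong₂ (λ X Y → (a *F X) +F Y) (+ᵥ≡⊕ x x′) (cong₂ (λ X Y → (b *F X) +F ((c *F Y) +F 0F)) (+ᵥ≡⊕ y y′) (+ᵥ≡⊕ z z′)))
  (trans (identity a b c x y z x′ y′ z′) (+F≡+ᵥ _ _))
  where
  open AlmostCommutativeRing ring using (_+_; _*_; _≈_; 0#)
  identity : ∀ a b c x y z x′ y′ z′ → ((a * (x + x′)) + ((b * (y + y′)) + ((c * (z + z′)) + 0#))) ≈
    (((a * x) + ((b * y) + ((c * z) + 0#))) + ((a * x′) + ((b * y′) + ((c * z′) + 0#))))
  identity = solve-∀ ring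

dot16-scale : ∀ r μ P → dot16 r (scale μ P) ≡ μ *F dot16 r P
dot16-scale (a ∷ b ∷ c ∷ []) μ (x ∷ y ∷ z ∷ []) = identity a b c μ x y z
  where
  open AlmostCommutativeRing ring using (_+_; _*_; _≈_; 0#)
  identity : ∀ a b c μ x y z → ((a * (μ * x)) + ((b * (μ * y)) + ((c * (μ * z)) + 0#))) ≈ (μ * ((a * x) + ((b * y) + ((c * z) + 0#))))
  identity = solve-∀ ring

apply16-+ : ∀ M P Q → apply16 M (P ⊞ Q) ≡ apply16 M P ⊞ apply16 M Q
apply16-+ (r ∷ s ∷ t ∷ []) P Q = cong₂ _∷_ (dot16-+ r P Q) (cong₂ _∷_ (dot16-+ s P Q) (cong (_∷ []) (dot16-+ t P Q)))

apply16-scale : ∀ M μ P → apply16 M (scale μ P) ≡ scale μ (apply16 M P)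
apply16-scale (r ∷ s ∷ t ∷ []) μ P = cong₂ _∷_ (dot16-scale r μ P) (cong₂ _∷_ (dot16-scale s μ P) (cong (_∷ []) (dot16-scale t μ P)))

det3-product : ∀ M P Q R → det3 (apply16 M P) (apply16 M Q) (apply16 M R) ≡ detM M *F det3 P Q R
det3-product ((m ∷ n ∷ o ∷ []) ∷ (p ∷ q ∷ r ∷ []) ∷ (s ∷ t ∷ u ∷ []) ∷ []) (a ∷ b ∷ c ∷ []) (d ∷ e ∷ f ∷ []) (g ∷ h ∷ i ∷ []) =
  (Identities.det-product m n o p q r s t u a b c d e f g h i)

column : Mat16 → V3 × V3 × V3
column ((m ∷ n ∷ o ∷ []) ∷ (p ∷ q ∷ r ∷ []) ∷ (s ∷ t ∷ u ∷ []) ∷ []) = (m ∷ p ∷ s ∷ []) , (n ∷ q ∷ t ∷ []) , (o ∷ r ∷ u ∷ [])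

apply16-columns : ∀ M x y z → apply16 M (x ∷ y ∷ z ∷ []) ≡ combo x y z (proj₁ (column M)) (proj₁ (proj₂ (column M))) (proj₂ (proj₂ (column M)))
apply16-columns ((m ∷ n ∷ o ∷ []) ∷ (p ∷ q ∷ r ∷ []) ∷ (s ∷ t ∷ u ∷ []) ∷ []) x y z =
  cong₂ _∷_ (entry m n o) (cong₂ _∷_ (entry p q r) (cong (_∷ []) (entry s t u)))
  where
  entry : ∀ a b c → dot16 (a ∷ b ∷ c ∷ []) (x ∷ y ∷ z ∷ []) ≡ (x *F a) +ᵥ ((y *F b) +ᵥ (z *F c))
  entry a b c = trans (cong₂ _+F_ (*-comm a x) (cong₂ _+F_ (*-comm b y) (trans (+F-comm (c *F z) 0F) (trans (+F-identityˡ (c *F z)) (*-comm c z)))))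
    (trans (+F≡+ᵥ _ _) (cong ((x *F a) +ᵥ_) (+F≡+ᵥ _ _)))

det-columns : ∀ M → detM M ≡ det3 (proj₁ (column M)) (proj₁ (proj₂ (column M))) (proj₂ (proj₂ (column M)))
det-columns ((m ∷ n ∷ o ∷ []) ∷ (p ∷ q ∷ r ∷ []) ∷ (s ∷ t ∷ u ∷ []) ∷ []) = Identities.det-transpose m n o p q r s t u

apply16-injective : ∀ M P → detM M ≢ 0F → apply16 M P ≡ 𝟘 → P ≡ 𝟘
apply16-injective M (x ∷ y ∷ z ∷ []) d e = zero³ (independent x y z (proj₁ (column M)) (proj₁ (proj₂ (column M))) (proj₂ (proj₂ (column M)))
    (λ p → d (trans (det-columns M) p)) (trans (sym (apply16-columns M x y z)) e))
  where
  zero³ : x ≡ 0F × y ≡ 0F × z ≡ 0F → x ∷ y ∷ z ∷ [] ≡ 𝟘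
  zero³ (refl , refl , refl) = refl

-- An additive map of GF(2)¹² as a matrix acting by apply2

matrixOf : (Vec Bool 12 → Vec Bool 12) → Mat2 12
matrixOf F = map F (one 12) ᵀ

apply2-matrixOf : ∀ F → (∀ u v → F (u +ᵥ v) ≡ F u +ᵥ F v) → ∀ v → apply2 (matrixOf F) v ≡ F v
apply2-matrixOf F add v = trans (apply2≡lc (matrixOf F) v) (trans (cong (lc v) (ᵀ-ᵀ (map F (one 12)))) (trans (lc-map F add v (one 12)) (cong F (lc-one v))))

ᵀ-inj : ∀ {n} {A : Mat2 n} → Inj A → Inj (A ᵀ)
ᵀ-inj {n} {A} inj = left-inj {A = A ᵀ} {B = proj₁ (inj⇒inverse inj) ᵀ}
  (trans (sym (ᵀ-⊗ (proj₁ (inj⇒inverse inj)) A)) (trans (cong _ᵀ (proj₁ (proj₂ (inj⇒inverse inj)))) (one-ᵀ n)))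

matrixOf-invertible : ∀ F → (∀ u v → F (u +ᵥ v) ≡ F u +ᵥ F v) → (∀ v → F v ≡ 𝟎 → v ≡ 𝟎) → Invertible2 (matrixOf F)
matrixOf-invertible F add inj = inj⇒Invertible2 (ᵀ-inj {A = map F (one 12)} (λ c e → inj c (trans (sym (trans (lc-map F add c (one 12)) (cong F (lc-one c)))) e)))

module Semilinear (M : Mat16) (d : detM M ≢ 0F) (k : Fin 4) where
  σ : F16 → F16
  σ = frob (toℕ k)

  act : V3 → V3
  act P = apply16 M (map σ P)

  F : Vec Bool 12 → Vec Bool 12
  F v = toGF2 (act (fromGF2 v))

  map-σ-+ : ∀ (P Q : V3) → map σ (P ⊞ Q) ≡ map σ P ⊞ map σ Q
  map-σ-+ (x ∷ y ∷ z ∷ []) (x′ ∷ y′ ∷ z′ ∷ []) = cong₂ _∷_ (frob-+ (toℕ k) x x′) (cong₂ _∷_ (frob-+ (toℕ k) y y′) (cong (_∷ []) (frob-+ (toℕ k) z z′)))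

  map-σ-scale : ∀ μ P → map σ (scale μ P) ≡ scale (σ μ) (map σ P)
  map-σ-scale μ (x ∷ y ∷ z ∷ []) = cong₂ _∷_ (frob-* (toℕ k) μ x) (cong₂ _∷_ (frob-* (toℕ k) μ y) (cong (_∷ []) (frob-* (toℕ k) μ z)))

  map-σ-𝟘 : ∀ P → map σ P ≡ 𝟘 → P ≡ 𝟘
  map-σ-𝟘 (x ∷ y ∷ z ∷ []) e = cong₂ _∷_ (frob-≢0 (toℕ k) (∷-injectiveˡ e)) (cong₂ _∷_ (frob-≢0 (toℕ k) (∷-injectiveˡ (∷-injectiveʳ e)))
    (cong (_∷ []) (frob-≢0 (toℕ k) (∷-injectiveˡ (∷-injectiveʳ (∷-injectiveʳ e))))))

  act-scale : ∀ μ P → act (scale μ P) ≡ scale (σ μ) (act P)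
  act-scale μ P = trans (cong (apply16 M) (map-σ-scale μ P)) (apply16-scale M (σ μ) (map σ P))

  F-+ : ∀ u v → F (u +ᵥ v) ≡ F u +ᵥ F v
  F-+ u v = trans (cong (λ P → toGF2 (act P)) (fromGF2-+ u v)) (trans (cong (λ P → toGF2 (apply16 M P)) (map-σ-+ (fromGF2 u) (fromGF2 v)))
    (trans (cong toGF2 (apply16-+ M (map σ (fromGF2 u)) (map σ (fromGF2 v)))) (toGF2-⊞ (act (fromGF2 u)) (act (fromGF2 v)))))

  F-injective : ∀ v → F v ≡ 𝟎 → v ≡ 𝟎
  F-injective v e = trans (sym (to-from v)) (cong toGF2 (map-σ-𝟘 (fromGF2 v) (apply16-injective M (map σ (fromGF2 v)) d (toGF2-injective {act (fromGF2 v)} {𝟘} e))))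

  g : Mat2 12
  g = matrixOf F

  g-line : ∀ {P Q λ₀} → act P ≡ scale λ₀ Q → ∀ μ → apply2 g (toGF2 (scale μ P)) ≡ toGF2 (scale (σ μ *F λ₀) Q)
  g-line {P} {Q} {λ₀} e μ = trans (apply2-matrixOf F F-+ (toGF2 (scale μ P))) (cong toGF2 (trans (cong act (from-to (scale μ P)))
    (trans (act-scale μ P) (trans (cong (scale (σ μ)) e) (sym (scale-* (σ μ) λ₀ Q))))))

  g-member : ∀ P Q → SamePoint (act P) Q → SameSpan (map (apply2 g) (member P)) (member Q)
  g-member P Q (λ₀ , λ≢0 , e) v = forth , back
    where
    forth : InSpan v (map (apply2 g) (member P)) → InSpan v (member Q)
    forth s = go (unapply g {member P} s)
      where
      go : (Σ (Vec Bool 12) λ u → InSpan u (member P) × v ≡ apply2 g u) → InSpan v (member Q)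
      go (u , t , refl) = subst (λ w → InSpan w (member Q)) (sym (trans (cong (apply2 g) (proj₂ (inMember {P = P} t))) (g-line {P} {Q} e (proj₁ (inMember {P = P} t)))))
        (member-in (σ (proj₁ (inMember {P = P} t)) *F λ₀) Q)
    back : InSpan v (member Q) → InSpan v (map (apply2 g) (member P))
    back s = subst (λ w → InSpan w (map (apply2 g) (member P))) (trans (g-line {P} {Q} e μ) (trans (cong (λ x → toGF2 (scale x Q)) μ-ok) (sym (proj₂ (inMember {P = Q} s)))))
        (inSpan-apply g {member P} (member-in μ P))
      where
      ν μ : F16
      ν = proj₁ (inMember {P = Q} s)
      μ = proj₁ (frob-onto k (ν *F inv λ₀))
      μ-ok : σ μ *F λ₀ ≡ ν
      μ-ok = trans (cong (_*F λ₀) (proj₂ (frob-onto k (ν *F inv λ₀)))) (trans (*-assoc ν (inv λ₀) λ₀) (trans (cong (ν *F_) (inv-left λ₀ λ≢0)) (*-identityʳ ν)))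

ovalEquiv⇒PE : ∀ {Ω Ω′} → OvalEquiv Ω Ω′ → PseudoOvalEquiv (elementary Ω) (elementary Ω′)
ovalEquiv⇒PE {Ω} {Ω′} (M , k , d , fwd , bwd) = g , matrixOf-invertible F F-+ F-injective ,
  (λ i → proj₁ (fwd i) , g-member (Ω i) (Ω′ (proj₁ (fwd i))) (proj₂ (fwd i))) ,
  (λ j → proj₁ (bwd j) , g-member (Ω (proj₁ (bwd j))) (Ω′ j) (proj₂ (bwd j)))
  where open Semilinear M d k

-- The order is reversed because `enumF16` puts the lowest bit first and `encode` the highest.
code : F16 → Fin 16
code (a ∷ b ∷ c ∷ d ∷ []) = encode (d ∷ c ∷ b ∷ a ∷ [])

enum-code : ∀ t → enumF16 (code t) ≡ t
enum-code t = eqV-sound _ _ (all₁-sound (λ t → eqV (enumF16 (code t)) t) refl t)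

-- Rigidity of the conic and the pointed conic

affinePoint : (F16 → F16) → F16 → V3
affinePoint h t = 1F ∷ t ∷ h t ∷ []

square : F16 → F16
square t = t *F t

P₀ P₁ : V3
P₀ = 1F ∷ 0F ∷ 0F ∷ []
P₁ = 1F ∷ 1F ∷ 1F ∷ []

-- Ovals containing the points (1, t, t²), with coordinates with respect to t = 0, t = 1 and the point at infinity

record Target (Ω : Points17) : Set where
  field
    affine-point : ∀ t → Ω (suc (code t)) ≡ affinePoint square t
    α β γ        : F16 → F16
    decompose    : ∀ t → affinePoint square t ≡ combo (α t) (β t) (γ t) P₀ P₁ (Ω zero)
    τ            : F16 → F16
    τ-ratio      : ∀ r → r ≢ 0F → r ≢ 1F → β (τ r) ≡ r *F α (τ r)
    τ-α          : ∀ r → r ≢ 0F → r ≢ 1F → α (τ r) ≢ 0F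
    α-x          : α xF ≢ 0F
    γ-x          : γ xF ≢ 0F
    coordinates  : ∀ Q → Σ F16 λ u → Σ F16 λ v → Σ F16 λ w → Q ≡ combo u v w P₀ P₁ (Ω zero)
    nondegenerate : det3 P₀ P₁ (Ω zero) ≢ 0F

implies : ∀ a {b} → not a ∨ b ≡ true → a ≡ true → b ≡ true
implies true e refl = e

eqV-refl′ : ∀ {n} (u : Vec Bool n) → eqV u u ≡ true
eqV-refl′ [] = refl
eqV-refl′ (false ∷ u) = eqV-refl′ u
eqV-refl′ (true ∷ u) = eqV-refl′ u

≢-from : ∀ {n} {u v : Vec Bool n} → eqV u v ≡ false → u ≢ v
≢-from {u = u} p refl = contra (trans (sym p) (eqV-refl′ u))
  where
  contra : false ≡ true → ⊥
  contra ()

private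
  -- The solutions t of t/(1 + t) = r and t²/(1 + t²) = r, the ratios of the first two coordinates
  -- on the two ovals. Three applications of Frobenius give the eighth power, which is the square
  -- root in GF(16).
  conic-τ pointed-τ : F16 → F16
  conic-τ r = r *F inv (r +ᵥ 1F)
  pointed-τ r = frob 3 (conic-τ r)

  off01 : (F16 → Bool) → F16 → Bool
  off01 p r = (eqV r 0F ∨ eqV r 1F) ∨ p r

  off01-sound : ∀ p → all₁ (off01 p) ≡ true → ∀ r → r ≢ 0F → r ≢ 1F → p r ≡ true
  off01-sound p e r r≢0 r≢1 = ∨-elim (eqV r 0F ∨ eqV r 1F)
    (∨-elim (eqV r 0F) (λ q → ⊥-elim (r≢0 (eqV-sound r 0F q))) (λ q → ⊥-elim (r≢1 (eqV-sound r 1F q)))) (λ q → q) (all₁-sound (off01 p) e r)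

  not-true : ∀ {b} → not b ≡ true → b ≡ false
  not-true {false} e = refl

conicTarget : Target conic
conicTarget = record
  { affine-point = λ t → cong (affinePoint square) (enum-code t)
  ; α = λ t → 1F +ᵥ t ; β = λ t → t ; γ = λ t → (t *F t) +ᵥ t
  ; decompose = λ t → eqM-sound _ _ (all₁-sound (λ t → eqM (affinePoint square t) (combo (1F +ᵥ t) t ((t *F t) +ᵥ t) P₀ P₁ (conic zero))) refl t)
  ; τ = conic-τ
  ; τ-ratio = λ r p q → eqV-sound _ _ (off01-sound (λ r → eqV (conic-τ r) (r *F (1F +ᵥ conic-τ r))) refl r p q)
  ; τ-α = λ r p q → ≢-from (not-true (off01-sound (λ r → not (eqV (1F +ᵥ conic-τ r) 0F)) refl r p q))
  ; α-x = λ () ; γ-x = λ ()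
  ; coordinates = λ { (a ∷ b ∷ c ∷ []) → a +ᵥ b , b , b +ᵥ c ,
      eqM-sound _ _ (all₃-sound (λ a b c → eqM (a ∷ b ∷ c ∷ []) (combo (a +ᵥ b) b (b +ᵥ c) P₀ P₁ (conic zero))) refl a b c) }
  ; nondegenerate = λ () }

pointedTarget : Target pointedConic
pointedTarget = record
  { affine-point = λ t → cong (affinePoint square) (enum-code t)
  ; α = λ t → 1F +ᵥ (t *F t) ; β = λ t → t *F t ; γ = λ t → (t *F t) +ᵥ t
  ; decompose = λ t → eqM-sound _ _ (all₁-sound (λ t → eqM (affinePoint square t) (combo (1F +ᵥ (t *F t)) (t *F t) ((t *F t) +ᵥ t) P₀ P₁ (pointedConic zero))) refl t)
  ; τ = pointed-τ
  ; τ-ratio = λ r p q → eqV-sound _ _ (off01-sound (λ r → eqV (pointed-τ r *F pointed-τ r) (r *F (1F +ᵥ (pointed-τ r *F pointed-τ r)))) refl r p q)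
  ; τ-α = λ r p q → ≢-from (not-true (off01-sound (λ r → not (eqV (1F +ᵥ (pointed-τ r *F pointed-τ r)) 0F)) refl r p q))
  ; α-x = λ () ; γ-x = λ ()
  ; coordinates = λ { (a ∷ b ∷ c ∷ []) → a +ᵥ c , c , b +ᵥ c ,
      eqM-sound _ _ (all₃-sound (λ a b c → eqM (a ∷ b ∷ c ∷ []) (combo (a +ᵥ c) c (b +ᵥ c) P₀ P₁ (pointedConic zero))) refl a b c) }
  ; nondegenerate = λ () }

combo-+ : ∀ a b c a′ b′ c′ P Q R → combo a b c P Q R ⊞ combo a′ b′ c′ P Q R ≡ combo (a +ᵥ a′) (b +ᵥ b′) (c +ᵥ c′) P Q R
combo-+ a b c a′ b′ c′ P Q R = sym (trans (cong₂ _⊞_ (scale-+ a a′ P) (cong₂ _⊞_ (scale-+ b b′ Q) (scale-+ c c′ R)))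
    (trans (cong ((scale a P ⊞ scale a′ P) ⊞_) (interchange (scale b Q) (scale b′ Q) (scale c R) (scale c′ R))) (interchange (scale a P) (scale a′ P) _ _)))
  where
  interchange : ∀ (A B C D : V3) → (A ⊞ B) ⊞ (C ⊞ D) ≡ (A ⊞ C) ⊞ (B ⊞ D)
  interchange A B C D = trans (⊞-assoc A B (C ⊞ D)) (trans (cong (A ⊞_) (trans (sym (⊞-assoc B C D)) (trans (cong (_⊞ D) (⊞-comm B C)) (⊞-assoc C B D)))) (sym (⊞-assoc A C (B ⊞ D))))

scale-combo : ∀ m a b c P Q R → scale m (combo a b c P Q R) ≡ combo (m *F a) (m *F b) (m *F c) P Q R
scale-combo m a b c P Q R = trans (scale-⊞ m (scale a P) _) (cong₂ _⊞_ (sym (scale-* m a P)) (trans (scale-⊞ m (scale b Q) (scale c R)) (cong₂ _⊞_ (sym (scale-* m b Q)) (sym (scale-* m c R)))))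

⊞-self : ∀ (P : V3) → P ⊞ P ≡ 𝟘
⊞-self (a ∷ b ∷ c ∷ []) = cong₂ _∷_ (+-self a) (cong₂ _∷_ (+-self b) (cong (_∷ []) (+-self c)))

combo-injective : ∀ {a b c a′ b′ c′} P Q R → det3 P Q R ≢ 0F → combo a b c P Q R ≡ combo a′ b′ c′ P Q R → a ≡ a′ × b ≡ b′ × c ≡ c′
combo-injective {a} {b} {c} {a′} {b′} {c′} P Q R d e = +≡𝟎⇒≡ (proj₁ z) , +≡𝟎⇒≡ (proj₁ (proj₂ z)) , +≡𝟎⇒≡ (proj₂ (proj₂ z))
  where
  z : a +ᵥ a′ ≡ 0F × b +ᵥ b′ ≡ 0F × c +ᵥ c′ ≡ 0F
  z = independent _ _ _ P Q R d (trans (sym (combo-+ a b c a′ b′ c′ P Q R)) (trans (cong (_⊞ combo a′ b′ c′ P Q R) e) (⊞-self _)))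

-- An additive map preserving every point of a target oval is a scalar.
module Rigidity {Ω} (T : Target Ω) (φ : V3 → V3) (add : ∀ P Q → φ (P ⊞ Q) ≡ φ P ⊞ φ Q)
                (lines : ∀ j μ → Σ F16 λ ν → φ (scale μ (Ω j)) ≡ scale ν (Ω j)) where
  open Target T

  private
    P₂ : V3
    P₂ = Ω zero

    on : ∀ t μ → Σ F16 λ ν → φ (scale μ (affinePoint square t)) ≡ scale ν (affinePoint square t)
    on t μ = subst (λ P → Σ F16 λ ν → φ (scale μ P) ≡ scale ν P) (affine-point t) (lines (suc (code t)) μ)

    h₀ h₁ h₂ : F16 → F16
    h₀ μ = proj₁ (on 0F μ)
    h₁ μ = proj₁ (on 1F μ)
    h₂ μ = proj₁ (lines zero μ)

    φ-combo : ∀ a b c → φ (combo a b c P₀ P₁ P₂) ≡ combo (h₀ a) (h₁ b) (h₂ c) P₀ P₁ P₂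
    φ-combo a b c = trans (add (scale a P₀) _) (cong₂ _⊞_ (proj₂ (on 0F a)) (trans (add (scale b P₁) (scale c P₂)) (cong₂ _⊞_ (proj₂ (on 1F b)) (proj₂ (lines zero c)))))

    related : ∀ t μ → h₀ (μ *F α t) ≡ proj₁ (on t μ) *F α t × h₁ (μ *F β t) ≡ proj₁ (on t μ) *F β t × h₂ (μ *F γ t) ≡ proj₁ (on t μ) *F γ t
    related t μ = combo-injective P₀ P₁ P₂ nondegenerate (trans (sym (φ-combo (μ *F α t) (μ *F β t) (μ *F γ t)))
      (trans (cong φ (sym (trans (cong (scale μ) (decompose t)) (scale-combo μ (α t) (β t) (γ t) P₀ P₁ P₂))))
      (trans (proj₂ (on t μ)) (trans (cong (scale (proj₁ (on t μ))) (decompose t)) (scale-combo (proj₁ (on t μ)) (α t) (β t) (γ t) P₀ P₁ P₂)))))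

    cancel : ∀ μ a → a ≢ 0F → (μ *F inv a) *F a ≡ μ
    cancel μ a p = trans (*-assoc μ (inv a) a) (trans (cong (μ *F_) (inv-left a p)) (*-identityʳ μ))

    -- The point with parameter `τ r` has first two coordinates in the ratio r. As φ maps its
    -- multiples to multiples, the images of these two coordinates keep that ratio.
    generic : ∀ r → r ≢ 0F → r ≢ 1F → ∀ μ → h₁ (μ *F r) ≡ r *F h₀ μ
    generic r p q μ = begin
      h₁ (μ *F r)                 ≡⟨ cong h₁ (trans (cong (_*F r) (sym (cancel μ a aₙ))) (trans (*-assoc (μ *F inv a) a r) (cong ((μ *F inv a) *F_) (trans (*-comm a r) (sym (τ-ratio r p q)))))) ⟩
      h₁ ((μ *F inv a) *F β t)    ≡⟨ proj₁ (proj₂ (related t (μ *F inv a))) ⟩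
      m *F β t                    ≡⟨ cong (m *F_) (τ-ratio r p q) ⟩
      m *F (r *F a)               ≡⟨ trans (sym (*-assoc m r a)) (trans (cong (_*F a) (*-comm m r)) (*-assoc r m a)) ⟩
      r *F (m *F a)               ≡⟨ cong (r *F_) (proj₁ (related t (μ *F inv a))) ⟨
      r *F h₀ ((μ *F inv a) *F a) ≡⟨ cong (λ x → r *F h₀ x) (cancel μ a aₙ) ⟩
      r *F h₀ μ                   ∎
      where
      open ≡-Reasoning
      t a m : F16
      t = τ r
      a = α t
      m = proj₁ (on t (μ *F inv a))
      aₙ : a ≢ 0F
      aₙ = τ-α r p q

    head-scale : ∀ κ → head (scale κ P₁) ≡ κ
    head-scale κ = *-identityʳ κ

    h₁-+ : ∀ μ ν → h₁ (μ +ᵥ ν) ≡ h₁ μ +ᵥ h₁ ν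
    h₁-+ μ ν = trans (sym (head-scale _)) (trans (cong head (trans (sym (proj₂ (on 1F (μ +ᵥ ν)))) (trans (cong φ (scale-+ μ ν P₁)) (trans (add (scale μ P₁) (scale ν P₁))
      (trans (cong₂ _⊞_ (proj₂ (on 1F μ)) (proj₂ (on 1F ν))) (sym (scale-+ (h₁ μ) (h₁ ν) P₁))))))) (head-scale _))

    x≢0 : xF ≢ 0F
    x≢0 ()
    x≢1 : xF ≢ 1F
    x≢1 ()
    y : F16
    y = xF +ᵥ 1F
    y≢0 : y ≢ 0F
    y≢0 ()
    y≢1 : y ≢ 1F
    y≢1 ()

    -- No affine point realises the ratio 1. But 1 = x + (x + 1) is a sum of two ratios that do
    -- occur, and h₁ is additive.
    h₁≡h₀ : ∀ μ → h₁ μ ≡ h₀ μ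
    h₁≡h₀ μ = begin
      h₁ μ                            ≡⟨ cong h₁ (sym (trans (sym (*-distribˡ-+ᵥ μ xF y)) (*-identityʳ μ))) ⟩
      h₁ ((μ *F xF) +ᵥ (μ *F y))      ≡⟨ h₁-+ _ _ ⟩
      h₁ (μ *F xF) +ᵥ h₁ (μ *F y)     ≡⟨ cong₂ _+ᵥ_ (generic xF x≢0 x≢1 μ) (generic y y≢0 y≢1 μ) ⟩
      (xF *F h₀ μ) +ᵥ (y *F h₀ μ)     ≡⟨ *-distribʳ-+ᵥ (h₀ μ) xF y ⟨
      1F *F h₀ μ                      ≡⟨ *-identityˡ (h₀ μ) ⟩
      h₀ μ                            ∎
      where open ≡-Reasoning

  κ : F16
  κ = h₀ 1F

  private
    h₁-scalar : ∀ r → h₁ r ≡ r *F κ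
    h₁-scalar r = cases (eqV r 0F) refl (eqV r 1F) refl
      where
      h₁-0 : h₁ 0F ≡ 0F
      h₁-0 = trans (h₁-+ 0F 0F) (+-self (h₁ 0F))
      cases : ∀ a → eqV r 0F ≡ a → ∀ b → eqV r 1F ≡ b → h₁ r ≡ r *F κ
      cases true p _ _ = trans (cong h₁ (eqV-sound r 0F p)) (trans h₁-0 (sym (trans (cong (_*F κ) (eqV-sound r 0F p)) (*-zeroˡ κ))))
      cases false p true q = trans (cong h₁ (eqV-sound r 1F q)) (trans (h₁≡h₀ 1F) (sym (trans (cong (_*F κ) (eqV-sound r 1F q)) (*-identityˡ κ))))
      cases false p false q = trans (cong h₁ (sym (*-identityˡ r))) (generic r (≢-from p) (≢-from q) 1F)

    h₀-scalar : ∀ r → h₀ r ≡ r *F κ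
    h₀-scalar r = trans (sym (h₁≡h₀ r)) (h₁-scalar r)

    h₂-scalar : ∀ r → h₂ r ≡ r *F κ
    h₂-scalar r = begin
      h₂ r            ≡⟨ cong h₂ (cancel r c γ-x) ⟨
      h₂ (μ *F c)     ≡⟨ proj₂ (proj₂ (related xF μ)) ⟩
      m *F c          ≡⟨ cong (_*F c) m-eq ⟩
      (μ *F κ) *F c   ≡⟨ trans (*-assoc μ κ c) (trans (cong (μ *F_) (*-comm κ c)) (sym (*-assoc μ c κ))) ⟩
      (μ *F c) *F κ   ≡⟨ cong (_*F κ) (cancel r c γ-x) ⟩
      r *F κ          ∎
      where
      open ≡-Reasoning
      a c μ m : F16
      a = α xF
      c = γ xF
      μ = r *F inv c
      m = proj₁ (on xF μ)
      m-eq : m ≡ μ *F κ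
      m-eq = trans (sym (trans (*-assoc m a (inv a)) (trans (cong (m *F_) (inv-right a α-x)) (*-identityʳ m))))
        (trans (cong (_*F inv a) (trans (sym (proj₁ (related xF μ))) (trans (h₀-scalar (μ *F a)) (trans (*-assoc μ a κ) (trans (cong (μ *F_) (*-comm a κ)) (sym (*-assoc μ κ a)))))))
        (trans (*-assoc (μ *F κ) a (inv a)) (trans (cong ((μ *F κ) *F_) (inv-right a α-x)) (*-identityʳ _))))

  rigid : ∀ Q → φ Q ≡ scale κ Q
  rigid Q = go (coordinates Q)
    where
    go : (Σ F16 λ u → Σ F16 λ v → Σ F16 λ w → Q ≡ combo u v w P₀ P₁ P₂) → φ Q ≡ scale κ Q
    go (u , v , w , refl) = trans (φ-combo u v w) (trans (cong₂ _⊞_ (times u P₀ (h₀-scalar u)) (cong₂ _⊞_ (times v P₁ (h₁-scalar v)) (times w P₂ (h₂-scalar w))))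
        (sym (scale-combo κ u v w P₀ P₁ P₂)))
      where
      times : ∀ {k} u P → k ≡ u *F κ → scale k P ≡ scale (κ *F u) P
      times u P e = cong (λ k → scale k P) (trans e (*-comm u κ))

-- The four automorphisms of GF(16)

root⇒frob : ∀ y → (y *F y) *F (y *F y) ≡ y +ᵥ 1F → Σ (Fin 4) λ k → y ≡ frob (toℕ k) xF
root⇒frob y e = ∨-elim (eqV y (frob 0 xF)) (found zero)
    (∨-elim (eqV y (frob 1 xF)) (found (suc zero))
    (∨-elim (eqV y (frob 2 xF)) (found (suc (suc zero))) (found (suc (suc (suc zero))))))
    (implies (eqV ((y *F y) *F (y *F y)) (y +ᵥ 1F)) (all₁-sound test refl y) (trans (cong (eqV ((y *F y) *F (y *F y))) (sym e)) (eqV-refl′ ((y *F y) *F (y *F y)))))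
  where
  test : F16 → Bool
  test y = not (eqV ((y *F y) *F (y *F y)) (y +ᵥ 1F)) ∨ (eqV y (frob 0 xF) ∨ (eqV y (frob 1 xF) ∨ (eqV y (frob 2 xF) ∨ eqV y (frob 3 xF))))
  found : ∀ (k : Fin 4) → eqV y (frob (toℕ k) xF) ≡ true → Σ (Fin 4) λ k → y ≡ frob (toℕ k) xF
  found k p = k , eqV-sound y (frob (toℕ k) xF) p

-- The image of x is again a root of x⁴ + x + 1, hence one of x, x², x⁴, x⁸, and it determines σ on
-- the basis of powers of x.
automorphism : ∀ (σ : F16 → F16) → (∀ a b → σ (a +ᵥ b) ≡ σ a +ᵥ σ b) → (∀ a b → σ (a *F b) ≡ σ a *F σ b) → σ 1F ≡ 1F →
               Σ (Fin 4) λ k → ∀ a → σ a ≡ frob (toℕ k) a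
automorphism σ add mul one′ = k , λ a → trans (cong σ (sym (lc-basisF16 a))) (trans (sym (lc-map σ add a basisF16))
    (trans (cong (lc a) basis-eq) (trans (lc-map (frob (toℕ k)) (frob-+ (toℕ k)) a basisF16) (cong (frob (toℕ k)) (lc-basisF16 a)))))
  where
  y : F16
  y = σ xF
  root : Σ (Fin 4) λ k → y ≡ frob (toℕ k) xF
  root = root⇒frob y (trans (sym (trans (mul (xF *F xF) (xF *F xF)) (cong₂ _*F_ (mul xF xF) (mul xF xF)))) (trans (add xF 1F) (cong (y +ᵥ_) one′)))
  k : Fin 4
  k = proj₁ root
  x-eq : σ xF ≡ frob (toℕ k) xF
  x-eq = proj₂ root
  frob-1 : ∀ n → frob n 1F ≡ 1F
  frob-1 zero = refl
  frob-1 (suc n) = frob-1 n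
  x²-eq : σ (xF *F xF) ≡ frob (toℕ k) (xF *F xF)
  x²-eq = trans (mul xF xF) (trans (cong₂ _*F_ x-eq x-eq) (sym (frob-* (toℕ k) xF xF)))
  basis-eq : map σ basisF16 ≡ map (frob (toℕ k)) basisF16
  basis-eq = cong₂ _∷_ (trans one′ (sym (frob-1 (toℕ k)))) (cong₂ _∷_ x-eq (cong₂ _∷_ x²-eq
    (cong (_∷ []) (trans (mul (xF *F xF) xF) (trans (cong₂ _*F_ x²-eq x-eq) (sym (frob-* (toℕ k) (xF *F xF) xF)))))))

-- From equivalent pseudo-ovals to equivalent ovals

fromColumns : V3 → V3 → V3 → Mat16
fromColumns (a ∷ b ∷ c ∷ []) (d ∷ e ∷ f ∷ []) (g ∷ h ∷ i ∷ []) = (a ∷ d ∷ g ∷ []) ∷ (b ∷ e ∷ h ∷ []) ∷ (c ∷ f ∷ i ∷ []) ∷ []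

apply16-fromColumns : ∀ C D E x y z → apply16 (fromColumns C D E) (x ∷ y ∷ z ∷ []) ≡ combo x y z C D E
apply16-fromColumns C@(a ∷ b ∷ c ∷ []) D@(d ∷ e ∷ f ∷ []) E@(g ∷ h ∷ i ∷ []) x y z = apply16-columns (fromColumns C D E) x y z

module FromPE {Ω Ω′ : Points17} (o : IsOval Ω) (T : Target Ω′) (pe : PseudoOvalEquiv (elementary Ω) (elementary Ω′)) where
  private
    g h : Mat2 12
    g = proj₁ pe
    h = proj₁ (proj₁ (proj₂ pe))

    G G⁻¹ : V3 → V3
    G P = fromGF2 (apply2 g (toGF2 P))
    G⁻¹ P = fromGF2 (apply2 h (toGF2 P))

    apply2-+ : ∀ (m : Mat2 12) u v → apply2 m (u +ᵥ v) ≡ apply2 m u +ᵥ apply2 m v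
    apply2-+ m u v = trans (apply2≡lc m (u +ᵥ v)) (trans (lc-+ u v (m ᵀ)) (sym (cong₂ _+ᵥ_ (apply2≡lc m u) (apply2≡lc m v))))

    additive : ∀ (m : Mat2 12) P Q → fromGF2 (apply2 m (toGF2 (P ⊞ Q))) ≡ fromGF2 (apply2 m (toGF2 P)) ⊞ fromGF2 (apply2 m (toGF2 Q))
    additive m P Q = trans (cong (λ v → fromGF2 (apply2 m v)) (toGF2-⊞ P Q)) (trans (cong fromGF2 (apply2-+ m (toGF2 P) (toGF2 Q))) (fromGF2-+ (apply2 m (toGF2 P)) (apply2 m (toGF2 Q))))

    undo : ∀ (m n : Mat2 12) → mul2 m n ≡ id2 12 → ∀ P → fromGF2 (apply2 m (toGF2 (fromGF2 (apply2 n (toGF2 P))))) ≡ P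
    undo m n e P = trans (cong (λ v → fromGF2 (apply2 m v)) (to-from (apply2 n (toGF2 P)))) (trans (cong fromGF2 (trans (sym (apply2-mul2 m n (toGF2 P)))
      (trans (cong (λ M → apply2 M (toGF2 P)) e) (apply2-id (toGF2 P))))) (from-to P))

    G-G⁻¹ : ∀ P → G (G⁻¹ P) ≡ P
    G-G⁻¹ = undo g h (proj₂ (proj₂ (proj₁ (proj₂ pe))))

    G⁻¹-G : ∀ P → G⁻¹ (G P) ≡ P
    G⁻¹-G = undo h g (proj₁ (proj₂ (proj₁ (proj₂ pe))))

    G-𝟘 : ∀ P → G P ≡ 𝟘 → P ≡ 𝟘
    G-𝟘 P e = trans (sym (G⁻¹-G P)) (trans (cong G⁻¹ e) (trans (cong G⁻¹ (sym (⊞-self 𝟘))) (trans (additive h 𝟘 𝟘) (⊞-self (G⁻¹ 𝟘)))))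

    Matched : Fin 17 → Fin 17 → Set
    Matched i j = SameSpan (map (apply2 g) (elementary Ω i)) (elementary Ω′ j)

    forth : ∀ {i j} → Matched i j → ∀ μ → Σ F16 λ ν → G (scale μ (Ω i)) ≡ scale ν (Ω′ j)
    forth {i} {j} s μ = proj₁ m , trans (cong fromGF2 (proj₂ m)) (from-to (scale (proj₁ m) (Ω′ j)))
      where
      m : Σ F16 λ ν → apply2 g (toGF2 (scale μ (Ω i))) ≡ toGF2 (scale ν (Ω′ j))
      m = inMember {P = Ω′ j} (proj₁ (s (apply2 g (toGF2 (scale μ (Ω i))))) (inSpan-apply g {member (Ω i)} (member-in μ (Ω i))))

    back : ∀ {i j} → Matched i j → ∀ ν → Σ F16 λ μ → scale ν (Ω′ j) ≡ G (scale μ (Ω i))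
    back {i} {j} s ν = go (unapply g {member (Ω i)} (proj₂ (s (toGF2 (scale ν (Ω′ j)))) (member-in ν (Ω′ j))))
      where
      go : (Σ (Vec Bool 12) λ u → InSpan u (member (Ω i)) × toGF2 (scale ν (Ω′ j)) ≡ apply2 g u) → Σ F16 λ μ → scale ν (Ω′ j) ≡ G (scale μ (Ω i))
      go (u , t , e) = proj₁ m , trans (sym (from-to (scale ν (Ω′ j)))) (cong fromGF2 (trans e (cong (apply2 g) (proj₂ m))))
        where
        m : Σ F16 λ μ → u ≡ toGF2 (scale μ (Ω i))
        m = inMember {P = Ω i} t

    φ : F16 → V3 → V3
    φ l Q = G (scale l (G⁻¹ Q))

    φ-+ : ∀ l P Q → φ l (P ⊞ Q) ≡ φ l P ⊞ φ l Q
    φ-+ l P Q = trans (cong (λ X → G (scale l X)) (additive h P Q)) (trans (cong G (scale-⊞ l (G⁻¹ P) (G⁻¹ Q))) (additive g (scale l (G⁻¹ P)) (scale l (G⁻¹ Q))))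

    φ-lines : ∀ l j ν → Σ F16 λ ν′ → φ l (scale ν (Ω′ j)) ≡ scale ν′ (Ω′ j)
    φ-lines l j ν = proj₁ m′ , trans (cong (λ X → G (scale l X)) (trans (cong G⁻¹ (proj₂ m)) (G⁻¹-G (scale (proj₁ m) (Ω i)))))
        (trans (cong G (sym (scale-* l (proj₁ m) (Ω i)))) (proj₂ m′))
      where
      i : Fin 17
      i = proj₁ (proj₂ (proj₂ (proj₂ pe)) j)
      s : Matched i j
      s = proj₂ (proj₂ (proj₂ (proj₂ pe)) j)
      m : Σ F16 λ μ → scale ν (Ω′ j) ≡ G (scale μ (Ω i))
      m = back s ν
      m′ : Σ F16 λ ν′ → G (scale (l *F proj₁ m) (Ω i)) ≡ scale ν′ (Ω′ j)
      m′ = forth s (l *F proj₁ m)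

    module R (l : F16) = Rigidity T (φ l) (φ-+ l) (φ-lines l)

    σ : F16 → F16
    σ = R.κ

    semilinear : ∀ l P → G (scale l P) ≡ scale (σ l) (G P)
    semilinear l P = trans (cong (λ X → G (scale l X)) (sym (G⁻¹-G P))) (R.rigid l (G P))

    -- A preimage of a fixed nonzero vector. Scalars are recovered from multiples of P₀, so
    -- additivity and multiplicativity of σ can be read off on this one line.
    P* : V3
    P* = G⁻¹ P₀

    σ-unique : ∀ {l κ} → G (scale l P*) ≡ scale κ P₀ → σ l ≡ κ
    σ-unique {l} {κ} e = trans (sym (*-identityʳ (σ l))) (trans (cong head (trans (sym (trans (semilinear l P*) (cong (scale (σ l)) (G-G⁻¹ P₀)))) e)) (*-identityʳ κ))

    σ-line : ∀ l → G (scale l P*) ≡ scale (σ l) P₀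
    σ-line l = trans (semilinear l P*) (cong (scale (σ l)) (G-G⁻¹ P₀))

    σ-+ : ∀ a b → σ (a +ᵥ b) ≡ σ a +ᵥ σ b
    σ-+ a b = σ-unique (trans (cong G (scale-+ a b P*)) (trans (additive g (scale a P*) (scale b P*)) (trans (cong₂ _⊞_ (σ-line a) (σ-line b)) (sym (scale-+ (σ a) (σ b) P₀)))))

    σ-* : ∀ a b → σ (a *F b) ≡ σ a *F σ b
    σ-* a b = σ-unique (trans (cong G (scale-* a b P*)) (trans (semilinear a (scale b P*)) (trans (cong (scale (σ a)) (σ-line b)) (sym (scale-* (σ a) (σ b) P₀)))))

    σ-1 : σ 1F ≡ 1F
    σ-1 = σ-unique (trans (cong G (scale-1 P*)) (trans (G-G⁻¹ P₀) (sym (scale-1 P₀))))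

    aut : Σ (Fin 4) λ k → ∀ a → σ a ≡ frob (toℕ k) a
    aut = automorphism σ σ-+ σ-* σ-1

    k : Fin 4
    k = proj₁ aut

    e₁ e₂ e₃ : V3
    e₁ = 1F ∷ 0F ∷ 0F ∷ []
    e₂ = 0F ∷ 1F ∷ 0F ∷ []
    e₃ = 0F ∷ 0F ∷ 1F ∷ []

    M : Mat16
    M = fromColumns (G e₁) (G e₂) (G e₃)

    units : ∀ x y z → x ∷ y ∷ z ∷ [] ≡ combo x y z e₁ e₂ e₃
    units x y z = eqM-sound _ _ (all₃-sound (λ x y z → eqM (x ∷ y ∷ z ∷ []) (combo x y z e₁ e₂ e₃)) refl x y z)

    acts : ∀ P → apply16 M (map (frob (toℕ k)) P) ≡ G P
    acts (x ∷ y ∷ z ∷ []) = trans (apply16-fromColumns (G e₁) (G e₂) (G e₃) _ _ _)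
      (sym (trans (cong G (units x y z)) (trans (additive g (scale x e₁) (scale y e₂ ⊞ scale z e₃)) (cong₂ _⊞_ (part x e₁) (trans (additive g (scale y e₂) (scale z e₃)) (cong₂ _⊞_ (part y e₂) (part z e₃)))))))
      where
      part : ∀ a e → G (scale a e) ≡ scale (frob (toℕ k) a) (G e)
      part a e = trans (semilinear a e) (cong (λ s → scale s (G e)) (proj₂ aut a))

    samePoint : ∀ {i j} → Matched i j → SamePoint (G (Ω i)) (Ω′ j)
    samePoint {i} {j} s = proj₁ m , (λ z → oval-point {Ω} o i (G-𝟘 (Ω i) (trans e (trans (cong (λ ν → scale ν (Ω′ j)) z) (scale-0 (Ω′ j)))))) , e
      where
      m : Σ F16 λ ν → G (scale 1F (Ω i)) ≡ scale ν (Ω′ j)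
      m = forth s 1F
      e : G (Ω i) ≡ scale (proj₁ m) (Ω′ j)
      e = trans (cong G (sym (scale-1 (Ω i)))) (proj₂ m)

    samePoint′ : ∀ {i j} → Matched i j → SamePoint (apply16 M (map (frob (toℕ k)) (Ω i))) (Ω′ j)
    samePoint′ {i} {j} s = subst (λ P → SamePoint P (Ω′ j)) (sym (acts (Ω i))) (samePoint s)

    bwd : ∀ j → Σ (Fin 17) λ i → SamePoint (apply16 M (map (frob (toℕ k)) (Ω i))) (Ω′ j)
    bwd j = proj₁ (proj₂ (proj₂ (proj₂ pe)) j) , samePoint′ (proj₂ (proj₂ (proj₂ (proj₂ pe)) j))

    j₀ j₁ : Fin 17
    j₀ = suc (code 0F)
    j₁ = suc (code 1F)

    -- M carries three vectors to nonzero multiples of target points with nonzero determinant, and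
    -- the determinant of the images is divisible by that of M.
    det-M : detM M ≢ 0F
    det-M z = *-≢0 (*-≢0 (λ≢ j₀) (*-≢0 (λ≢ j₁) (λ≢ zero))) target-det (trans (sym (det3-scale (λ₀ j₀) (λ₀ j₁) (λ₀ zero) (Ω′ j₀) (Ω′ j₁) (Ω′ zero)))
        (trans (sym (cong₂ (λ X F → F X) (image j₀) (cong₂ (λ Y Z X → det3 X Y Z) (image j₁) (image zero)))) (trans (det3-product M (pre j₀) (pre j₁) (pre zero)) (trans (cong (_*F det3 (pre j₀) (pre j₁) (pre zero)) z) (*-zeroˡ (det3 (pre j₀) (pre j₁) (pre zero)))))))
      where
      λ₀ : Fin 17 → F16
      λ₀ j = proj₁ (proj₂ (bwd j))
      λ≢ : ∀ j → λ₀ j ≢ 0F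
      λ≢ j = proj₁ (proj₂ (proj₂ (bwd j)))
      pre : Fin 17 → V3
      pre j = map (frob (toℕ k)) (Ω (proj₁ (bwd j)))
      image : ∀ j → apply16 M (pre j) ≡ scale (λ₀ j) (Ω′ j)
      image j = proj₂ (proj₂ (proj₂ (bwd j)))
      target-det : det3 (Ω′ j₀) (Ω′ j₁) (Ω′ zero) ≢ 0F
      target-det q = Target.nondegenerate T (trans (sym (cong₂ (λ X Y → det3 X Y (Ω′ zero)) (Target.affine-point T 0F) (Target.affine-point T 1F))) q)

  ovalEquiv : OvalEquiv Ω Ω′
  ovalEquiv = M , k , det-M , (λ i → proj₁ (proj₁ (proj₂ (proj₂ pe)) i) , samePoint′ (proj₂ (proj₁ (proj₂ (proj₂ pe)) i))) , bwd

-- The three ovals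

code-enum : ∀ i → code (enumF16 i) ≡ i
code-enum = from-yes (all? (λ i → code (enumF16 i) Fin.≟ i))

module Polynomials where
  open AlmostCommutativeRing ring using (_+_; _*_; _≈_; 0#; 1#)

  vandermonde : ∀ s t u → ((1# * ((t * (u * u)) + ((t * t) * u))) + ((s * ((1# * (u * u)) + ((t * t) * 1#))) + ((s * s) * ((1# * u) + (t * 1#))))) ≈ ((s + t) * ((t + u) * (s + u)))
  vandermonde = solve-∀ ring

  affine-det : ∀ s t u a b c → ((1# * ((t * c) + (b * u))) + ((s * ((1# * c) + (b * 1#))) + (a * ((1# * u) + (t * 1#))))) ≈ (((s + t) * (c + a)) + ((s + u) * (b + a)))
  affine-det = solve-∀ ring

  det-001 : ∀ s t a b → ((0# * ((s * b) + (a * t))) + ((0# * ((1# * b) + (a * 1#))) + (1# * ((1# * t) + (s * 1#))))) ≈ (s + t)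
  det-001 = solve-∀ ring

  det-010 : ∀ s t → ((0# * ((s * (t * t)) + ((s * s) * t))) + ((1# * ((1# * (t * t)) + ((s * s) * 1#))) + (0# * ((1# * t) + (s * 1#))))) ≈ ((s + t) * (s + t))
  det-010 = solve-∀ ring

  quad-scale : ∀ l x y z → (((l * x) * (l * z)) + ((l * y) * (l * y))) ≈ ((l * l) * ((x * z) + (y * y)))
  quad-scale = solve-∀ ring

  quad-affine : ∀ t → ((1# * (t * t)) + (t * t)) ≈ 0#
  quad-affine = solve-∀ ring

  quad-apply : ∀ m n o p q r s t u x y z →
    ((((m * x) + ((n * y) + ((o * z) + 0#))) * ((s * x) + ((t * y) + ((u * z) + 0#)))) + (((p * x) + ((q * y) + ((r * z) + 0#))) * ((p * x) + ((q * y) + ((r * z) + 0#))))) ≈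
    ((((m * s) + (p * p)) * (x * x)) + ((((n * t) + (q * q)) * (y * y)) + ((((o * u) + (r * r)) * (z * z)) +
      ((((m * t) + (n * s)) * (x * y)) + ((((m * u) + (o * s)) * (x * z)) + ((((n * u) + (o * t)) * (y * z)) + 0#))))))
  quad-apply = solve-∀ ring

  -- Expansion along the middle row. The cofactors are the coefficients of yz, xz and xy in xz + y²
  -- pulled back along the matrix.
  det-middle : ∀ m n o p q r s t u →
    ((m * ((q * u) + (r * t))) + ((n * ((p * u) + (r * s))) + (o * ((p * t) + (q * s))))) ≈
    ((p * ((n * u) + (o * t))) + ((q * ((m * u) + (o * s))) + (r * ((m * t) + (n * s)))))
  det-middle = solve-∀ ring

  det-multiple : ∀ μ a b c g h i →
    (((μ * a) * ((b * i) + (c * h))) + (((μ * b) * ((a * i) + (c * g))) + ((μ * c) * ((a * h) + (b * g))))) ≈ 0#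
  det-multiple = solve-∀ ring

-- Ovals {∞} ∪ {(1, t, h t)}

module Arc (Ω : Points17) (h : F16 → F16) (shape : ∀ i → Ω (suc i) ≡ affinePoint h (enumF16 i))
           (affine-arc : ∀ s t u → s ≢ t → t ≢ u → s ≢ u → det3 (affinePoint h s) (affinePoint h t) (affinePoint h u) ≢ 0F)
           (infinite-arc : ∀ s t → s ≢ t → det3 (Ω zero) (affinePoint h s) (affinePoint h t) ≢ 0F) where
  private
    enum-injective : ∀ {i j} → enumF16 i ≡ enumF16 j → i ≡ j
    enum-injective {i} {j} e = trans (sym (code-enum i)) (trans (cong code e) (code-enum j))

    apart : ∀ {i j : Fin 16} → suc i ≢ suc j → enumF16 i ≢ enumF16 j
    apart p e = p (cong suc (enum-injective e))

    with∞ : ∀ i j → suc i ≢ suc j → det3 (Ω zero) (Ω (suc i)) (Ω (suc j)) ≢ 0F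
    with∞ i j p z = infinite-arc (enumF16 i) (enumF16 j) (apart p) (trans (sym (cong₂ (det3 (Ω zero)) (shape i) (shape j))) z)

  isOval : IsOval Ω
  isOval zero zero k (p , _) = ⊥-elim (p refl)
  isOval zero (suc j) zero (_ , _ , p) = ⊥-elim (p refl)
  isOval (suc i) zero zero (_ , p , _) = ⊥-elim (p refl)
  isOval zero (suc j) (suc k) (_ , p , _) = with∞ j k p
  isOval (suc i) zero (suc k) (_ , _ , p) z = with∞ i k p (trans (det3-swap₁ (Ω zero) (Ω (suc i)) (Ω (suc k))) z)
  isOval (suc i) (suc j) zero (p , _) z = with∞ i j p (trans (trans (det3-swap₁ (Ω zero) (Ω (suc i)) (Ω (suc j))) (det3-swap₂ (Ω (suc i)) (Ω zero) (Ω (suc j)))) z)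
  isOval (suc i) (suc j) (suc k) (p , q , r) z = affine-arc (enumF16 i) (enumF16 j) (enumF16 k) (apart p) (apart q) (apart r)
    (trans (sym (cong₂ (λ X F → F X) (shape i) (cong₂ (λ Y Z X → det3 X Y Z) (shape j) (shape k)))) z)

+F-≢0 : ∀ {a b} → a ≢ b → a +F b ≢ 0F
+F-≢0 {a} {b} p z = p (+≡𝟎⇒≡ (trans (sym (+F≡+ᵥ a b)) z))

square-arc : ∀ s t u → s ≢ t → t ≢ u → s ≢ u → det3 (affinePoint square s) (affinePoint square t) (affinePoint square u) ≢ 0F
square-arc s t u p q r z = *-≢0 (+F-≢0 p) (*-≢0 (+F-≢0 q) (+F-≢0 r)) (trans (sym (Polynomials.vandermonde s t u)) z)

001-arc : ∀ h s t → s ≢ t → det3 (0F ∷ 0F ∷ 1F ∷ []) (affinePoint h s) (affinePoint h t) ≢ 0F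
001-arc h s t p z = +F-≢0 p (trans (sym (Polynomials.det-001 s t (h s) (h t))) z)

conic-isOval : IsOval conic
conic-isOval = Arc.isOval conic square (λ _ → refl) square-arc (001-arc square)

pointedConic-isOval : IsOval pointedConic
pointedConic-isOval = Arc.isOval pointedConic square (λ _ → refl) square-arc (λ s t p z → *-≢0 (+F-≢0 p) (+F-≢0 p) (trans (sym (Polynomials.det-010 s t)) z))

private
  hTable : Table F16
  hTable = table 4 hLS

  arcTest : Table F16 → F16 → F16 → F16 → Bool
  arcTest H s t u = (eqV s t ∨ (eqV t u ∨ eqV s u)) ∨ nonzero (((s +F t) *F (get 0F H u +F get 0F H s)) +F ((s +F u) *F (get 0F H t +F get 0F H s)))

  allArcs : Table F16 → Bool
  allArcs H = all₁ (λ s → all₁ (λ t → all₁ (arcTest H s t)))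

  allArcs-ok : allArcs hTable ≡ true
  allArcs-ok = refl

lunelliSce-arc : ∀ s t u → s ≢ t → t ≢ u → s ≢ u → det3 (affinePoint hLS s) (affinePoint hLS t) (affinePoint hLS u) ≢ 0F
lunelliSce-arc s t u p q r z = ∨-elim (eqV s t ∨ (eqV t u ∨ eqV s u))
  (∨-elim (eqV s t) (λ e → p (eqV-sound s t e)) (∨-elim (eqV t u) (λ e → q (eqV-sound t u e)) (λ e → r (eqV-sound s u e))))
  (λ e → nonzero-sound e (trans (cong₂ _+F_ (cong₂ (λ x y → (s +F t) *F (x +F y)) (lookup-h u) (lookup-h s)) (cong₂ (λ x y → (s +F u) *F (x +F y)) (lookup-h t) (lookup-h s)))
    (trans (sym (Polynomials.affine-det s t u (hLS s) (hLS t) (hLS u))) z)))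
  (all₃-sound (arcTest hTable) allArcs-ok s t u)
  where
  lookup-h : ∀ v → get 0F hTable v ≡ hLS v
  lookup-h = get-table 0F 4 hLS

lunelliSce-isOval : IsOval lunelliSce
lunelliSce-isOval = Arc.isOval lunelliSce hLS (λ _ → refl) lunelliSce-arc (001-arc hLS)

-- The quadratic form xz + y² pulled back along an equivalence

quad : V3 → F16
quad (x ∷ y ∷ z ∷ []) = (x *F z) +F (y *F y)

quad-scale : ∀ l P → quad (scale l P) ≡ (l *F l) *F quad P
quad-scale l (x ∷ y ∷ z ∷ []) = Polynomials.quad-scale l x y z

monomials : V3 → Vec F16 6
monomials (x ∷ y ∷ z ∷ []) = x *F x ∷ y *F y ∷ z *F z ∷ x *F y ∷ x *F z ∷ y *F z ∷ []

coefficients : Mat16 → Vec F16 6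
coefficients ((m ∷ n ∷ o ∷ []) ∷ (p ∷ q ∷ r ∷ []) ∷ (s ∷ t ∷ u ∷ []) ∷ []) =
  (m *F s) +F (p *F p) ∷ (n *F t) +F (q *F q) ∷ (o *F u) +F (r *F r) ∷ (m *F t) +F (n *F s) ∷ (m *F u) +F (o *F s) ∷ (n *F u) +F (o *F t) ∷ []

dotF : ∀ {n} → Vec F16 n → Vec F16 n → F16
dotF [] [] = 0F
dotF (a ∷ u) (b ∷ v) = (a *F b) +F dotF u v

quad-coefficients : ∀ M P → quad (apply16 M P) ≡ dotF (coefficients M) (monomials P)
quad-coefficients ((m ∷ n ∷ o ∷ []) ∷ (p ∷ q ∷ r ∷ []) ∷ (s ∷ t ∷ u ∷ []) ∷ []) (x ∷ y ∷ z ∷ []) = Polynomials.quad-apply m n o p q r s t u x y z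

frob-dotF : ∀ k {n} (u v : Vec F16 n) → frob k (dotF u v) ≡ dotF (map (frob k) u) (map (frob k) v)
frob-dotF k [] [] = frob-0 k
  where
  frob-0 : ∀ k → frob k 0F ≡ 0F
  frob-0 zero = refl
  frob-0 (suc k) = frob-0 k
frob-dotF k (a ∷ u) (b ∷ v) = trans (cong (frob k) (+F≡+ᵥ _ _)) (trans (frob-+ k (a *F b) (dotF u v)) (trans (cong₂ _+ᵥ_ (frob-* k a b) (frob-dotF k u v)) (sym (+F≡+ᵥ _ _))))

dotF-+ : ∀ {n} (c u v : Vec F16 n) → dotF c (u ⊞ v) ≡ dotF c u +F dotF c v
dotF-+ [] [] [] = refl
dotF-+ (c ∷ cs) (a ∷ u) (b ∷ v) = trans (cong₂ _+F_ (trans (*-distribˡ-+ᵥ′ c a b) refl) (dotF-+ cs u v)) (interchange (c *F a) (c *F b) (dotF cs u) (dotF cs v))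
  where
  *-distribˡ-+ᵥ′ : ∀ a b c → a *F (b +ᵥ c) ≡ (a *F b) +F (a *F c)
  *-distribˡ-+ᵥ′ a b c = trans (cong (a *F_) (sym (+F≡+ᵥ b c))) (*-distribˡ a b c)
  open AlmostCommutativeRing ring using (_+_; _≈_)
  interchange : ∀ a b c d → ((a + b) + (c + d)) ≈ ((a + c) + (b + d))
  interchange = solve-∀ ring

dotF-scale : ∀ {n} (c : Vec F16 n) w u → dotF c (map (w *F_) u) ≡ w *F dotF c u
dotF-scale [] w [] = sym (*-zeroʳ w)
dotF-scale (c ∷ cs) w (a ∷ u) = trans (cong₂ _+F_ (trans (sym (*-assoc c w a)) (trans (cong (_*F a) (*-comm c w)) (*-assoc w c a))) (dotF-scale cs w u)) (sym (*-distribˡ w (c *F a) (dotF cs u)))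

other : ∀ (i i′ : Fin 17) → Σ (Fin 17) λ k → i ≢ k × i′ ≢ k
other zero zero = suc zero , (λ ()) , (λ ())
other zero (suc zero) = suc (suc zero) , (λ ()) , (λ ())
other zero (suc (suc _)) = suc zero , (λ ()) , (λ ())
other (suc zero) zero = suc (suc zero) , (λ ()) , (λ ())
other (suc zero) (suc _) = zero , (λ ()) , (λ ())
other (suc (suc _)) zero = suc zero , (λ ()) , (λ ())
other (suc (suc _)) (suc _) = zero , (λ ()) , (λ ())

-- Two proportional points give determinant 0 together with any third, and a third index is always
-- available.
oval-distinct : ∀ {Ω} → IsOval Ω → ∀ μ i i′ → scale μ (Ω i) ≡ Ω i′ → i ≡ i′
oval-distinct {Ω} o μ i i′ e = decide (i Fin.≟ i′)
  where
  degenerate : ∀ P R → det3 (scale μ P) P R ≡ 0F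
  degenerate (a ∷ b ∷ c ∷ []) (g ∷ h ∷ i ∷ []) = Polynomials.det-multiple μ a b c g h i
  decide : Dec (i ≡ i′) → i ≡ i′
  decide (yes p) = p
  decide (no i≢i′) = ⊥-elim (go (other i i′))
    where
    go : (Σ (Fin 17) λ k → i ≢ k × i′ ≢ k) → ⊥
    go (k , p , q) = o i′ i k (≢-sym i≢i′ , p , q) (trans (cong (λ X → det3 X (Ω i) (Ω k)) (sym e)) (degenerate (Ω i) (Ω k)))

-- Both families have 17 members, so an injective map of the points is onto.
module Forward {Ω Ω′ : Points17} (distinct : ∀ μ i i′ → scale μ (Ω i) ≡ Ω i′ → i ≡ i′) (M : Mat16) (d : detM M ≢ 0F) (k : Fin 4)
               (image : ∀ i → Σ (Fin 17) λ j → SamePoint (apply16 M (map (frob (toℕ k)) (Ω i))) (Ω′ j)) where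
  open Semilinear M d k

  act-injective : ∀ P Q → act P ≡ act Q → P ≡ Q
  act-injective P Q e = trans (sym (from-to P)) (trans (cong fromGF2 (+≡𝟎⇒≡ (F-injective (toGF2 P +ᵥ toGF2 Q) (trans (F-+ (toGF2 P) (toGF2 Q))
    (≡⇒+≡𝟎 (trans (cong (λ X → toGF2 (act X)) (from-to P)) (trans (cong toGF2 e) (sym (cong (λ X → toGF2 (act X)) (from-to Q)))))))))) (from-to Q))

  target-injective : ∀ i i′ → proj₁ (image i) ≡ proj₁ (image i′) → i ≡ i′
  target-injective i i′ e = distinct μ i i′ (act-injective (scale μ (Ω i)) (Ω i′) (trans (act-scale μ (Ω i)) (trans (cong₂ scale (proj₂ (frob-onto k (l′ *F inv l))) (proj₂ (proj₂ (hits i))))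
      (trans (sym (scale-* (l′ *F inv l) l (Ω′ (proj₁ (image i))))) (trans (cong₂ scale (trans (*-assoc l′ (inv l) l) (trans (cong (l′ *F_) (inv-left l (proj₁ (proj₂ (hits i))))) (*-identityʳ l′))) (cong Ω′ e))
        (sym (proj₂ (proj₂ (hits i′)))))))))
    where
    hits : ∀ i → SamePoint (act (Ω i)) (Ω′ (proj₁ (image i)))
    hits i = proj₂ (image i)
    l l′ μ : F16
    l = proj₁ (hits i)
    l′ = proj₁ (hits i′)
    μ = proj₁ (frob-onto k (l′ *F inv l))

  ovalEquiv : OvalEquiv Ω Ω′
  ovalEquiv = M , k , d , image , λ j → proj₁ (covered j) ,
      subst (λ j′ → SamePoint (act (Ω (proj₁ (covered j)))) (Ω′ j′)) (proj₂ (covered j)) (proj₂ (image (proj₁ (covered j))))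
    where
    covered : ∀ j → Σ (Fin 17) λ i → proj₁ (image i) ≡ j
    covered = injective⇒surjective (λ i → proj₁ (image i)) target-injective

module Quadric {Ω Ω′ : Points17} (o : IsOval Ω) (oe : OvalEquiv Ω Ω′) where
  private
    M : Mat16
    M = proj₁ oe
    k : Fin 4
    k = proj₁ (proj₂ oe)
    d : detM M ≢ 0F
    d = proj₁ (proj₂ (proj₂ oe))
  open Semilinear M d k

  target : Fin 17 → Fin 17
  target i = proj₁ (proj₁ (proj₂ (proj₂ (proj₂ oe))) i)

  hits : ∀ i → SamePoint (act (Ω i)) (Ω′ (target i))
  hits i = proj₂ (proj₁ (proj₂ (proj₂ (proj₂ oe))) i)

  open Forward (oval-distinct o) M d k (proj₁ (proj₂ (proj₂ (proj₂ oe)))) using (target-injective)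

  -- the form, with the field automorphism undone
  form : Vec F16 6
  form = map (λ a → proj₁ (frob-onto k a)) (coefficients M)

  private
    σ-form : map σ form ≡ coefficients M
    σ-form = go (coefficients M)
      where
      go : ∀ {n} (c : Vec F16 n) → map σ (map (λ a → proj₁ (frob-onto k a)) c) ≡ c
      go [] = refl
      go (a ∷ c) = cong₂ _∷_ (proj₂ (frob-onto k a)) (go c)

    σ-monomials : ∀ P → map σ (monomials P) ≡ monomials (map σ P)
    σ-monomials (x ∷ y ∷ z ∷ []) = cong₂ _∷_ (frob-* (toℕ k) x x) (cong₂ _∷_ (frob-* (toℕ k) y y) (cong₂ _∷_ (frob-* (toℕ k) z z)
      (cong₂ _∷_ (frob-* (toℕ k) x y) (cong₂ _∷_ (frob-* (toℕ k) x z) (cong (_∷ []) (frob-* (toℕ k) y z))))))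

  pullback : ∀ P → σ (dotF form (monomials P)) ≡ quad (act P)
  pullback P = trans (frob-dotF (toℕ k) form (monomials P)) (trans (cong₂ dotF σ-form (σ-monomials P)) (sym (quad-coefficients M (map σ P))))

  vanishes : ∀ i → quad (Ω′ (target i)) ≡ 0F → dotF form (monomials (Ω i)) ≡ 0F
  vanishes i e = frob-≢0 (toℕ k) (trans (pullback (Ω i)) (trans (cong quad (proj₂ (proj₂ (hits i)))) (trans (quad-scale (proj₁ (hits i)) (Ω′ (target i)))
    (trans (cong ((proj₁ (hits i) *F proj₁ (hits i)) *F_) e) (*-zeroʳ _)))))

  nonvanishing : ∀ i j → SamePoint (act (Ω i)) (Ω′ j) → quad (Ω′ j) ≢ 0F → dotF form (monomials (Ω i)) ≢ 0F
  nonvanishing i j (l , l≢0 , e) q z = *-≢0 (*-≢0 l≢0 l≢0) q (trans (sym (quad-scale l (Ω′ j))) (trans (cong quad (sym e)) (trans (sym (pullback (Ω i))) (trans (cong σ z) (σ-0 (toℕ k))))))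
    where
    σ-0 : ∀ k → frob k 0F ≡ 0F
    σ-0 zero = refl
    σ-0 (suc k) = σ-0 k

  -- the form vanishes on one of two disjoint sets of affine points, if only the point at infinity of the target is off the quadric
  module _ (h : F16 → F16) (shape : ∀ t → Ω (suc (code t)) ≡ affinePoint h t) (on-quadric : ∀ j → quad (Ω′ (suc j)) ≡ 0F) where
    Zero : F16 → Set
    Zero t = dotF form (monomials (affinePoint h t)) ≡ 0F

    private
      index : F16 → Fin 17
      index t = suc (code t)

      zero-at : ∀ t → target (index t) ≢ zero → Zero t
      zero-at t p = subst (λ P → dotF form (monomials P) ≡ 0F) (shape t) (vanishes (index t) (off (target (index t)) p))
        where
        off : ∀ j → j ≢ zero → quad (Ω′ j) ≡ 0F
        off zero q = ⊥-elim (q refl)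
        off (suc j) q = on-quadric j

      code-injective : ∀ {s t} → index s ≡ index t → s ≡ t
      code-injective {s} {t} e = trans (sym (enum-code s)) (trans (cong enumF16 (suc-injective e)) (enum-code t))

      elsewhere : ∀ s → target (index s) ≡ zero → ∀ S → allL (λ t → not (eqV s t)) S ≡ true → All Zero S
      elsewhere s p S e = All.map (λ {t} q → zero-at t (λ r → ≢-from {u = s} {t} (not-true q) (code-injective {s} {t} (target-injective (index s) (index t) (trans p (sym r)))))) (allL-sound _ S e)

    -- Distinct points have distinct images, so at most one affine point is sent to the point of the
    -- target that may lie off the quadric. That point is missing from one of the two disjoint
    -- lists.
    one-of : ∀ S S′ → allL (λ s → allL (λ t → not (eqV s t)) S′) S ≡ true → All Zero S ⊎ All Zero S′
    one-of [] S′ e = inj₁ []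
    one-of (s ∷ S) S′ e = decide (target (index s) Fin.≟ zero)
      where
      es : allL (λ t → not (eqV s t)) S′ ≡ true × allL (λ s → allL (λ t → not (eqV s t)) S′) S ≡ true
      es = ∧-split (allL (λ t → not (eqV s t)) S′) e
      decide : Dec (target (index s) ≡ zero) → All Zero (s ∷ S) ⊎ All Zero S′
      decide (yes p) = inj₂ (elsewhere s p S′ (proj₁ es))
      decide (no p) = [ (λ zs → inj₁ (zero-at s p ∷ zs)) , inj₂ ]′ (one-of S S′ (proj₂ es))

-- Linear functionals of a form recovered from its values

weighted : (F16 → F16) → List F16 → List F16 → Vec F16 6
weighted h (t ∷ S) (w ∷ ws) = map (w *F_) (monomials (affinePoint h t)) ⊞ weighted h S ws
weighted h _ _ = 0F ∷ 0F ∷ 0F ∷ 0F ∷ 0F ∷ 0F ∷ []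

interpolate : ∀ h c S ws → All (λ t → dotF c (monomials (affinePoint h t)) ≡ 0F) S → dotF c (weighted h S ws) ≡ 0F
interpolate h c [] ws [] = dotF-zero c
  where
  dotF-zero : ∀ c → dotF c (0F ∷ 0F ∷ 0F ∷ 0F ∷ 0F ∷ 0F ∷ []) ≡ 0F
  dotF-zero (a ∷ b ∷ c ∷ d ∷ e ∷ f ∷ []) = cong₂ _+F_ (*-zeroʳ a) (cong₂ _+F_ (*-zeroʳ b) (cong₂ _+F_ (*-zeroʳ c) (cong₂ _+F_ (*-zeroʳ d) (cong₂ _+F_ (*-zeroʳ e) (cong (_+F 0F) (*-zeroʳ f))))))
interpolate h c (t ∷ S) [] (z ∷ zs) = interpolate h c [] [] []
interpolate h c (t ∷ S) (w ∷ ws) (z ∷ zs) = trans (dotF-+ c (map (w *F_) (monomials (affinePoint h t))) (weighted h S ws))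
  (cong₂ _+F_ (trans (dotF-scale c w (monomials (affinePoint h t))) (trans (cong (w *F_) z) (*-zeroʳ w))) (interpolate h c S ws zs))

nums : List ℕ → List F16
nums = mapL (binary 4)

-- These pick out the coefficients of a form, except that number 1 picks out the sum of those of y²
-- and xz: the two monomials agree on (1, t, t²), so values on the conic determine only this sum.
unit : ℕ → Vec F16 6
unit 0 = 1F ∷ 0F ∷ 0F ∷ 0F ∷ 0F ∷ 0F ∷ []
unit 1 = 0F ∷ 1F ∷ 0F ∷ 0F ∷ 1F ∷ 0F ∷ []
unit 2 = 0F ∷ 0F ∷ 1F ∷ 0F ∷ 0F ∷ 0F ∷ []
unit 3 = 0F ∷ 0F ∷ 0F ∷ 1F ∷ 0F ∷ 0F ∷ []
unit 4 = 0F ∷ 0F ∷ 0F ∷ 0F ∷ 1F ∷ 0F ∷ []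
unit _ = 0F ∷ 0F ∷ 0F ∷ 0F ∷ 0F ∷ 1F ∷ []

-- Pairwise inequivalence of the three ovals

module LunelliSce {Ω′ : Points17} (on-quadric : ∀ j → quad (Ω′ (suc j)) ≡ 0F) (oe : OvalEquiv lunelliSce Ω′) where
  open Quadric lunelliSce-isOval oe

  private
    -- Two disjoint sets of six affine points, six being the number of coefficients of a ternary
    -- quadratic form. The weights below express the coefficients of xy, xz and yz through the six
    -- values.
    S S′ : List F16
    S = nums (1 ∷ 4 ∷ 9 ∷ 12 ∷ 13 ∷ 15 ∷ [])
    S′ = nums (3 ∷ 5 ∷ 6 ∷ 7 ∷ 8 ∷ 11 ∷ [])

    mixed : ∀ n → Set
    mixed n = dotF form (unit n) ≡ 0F

    extract : ∀ n S ws → weighted hLS S ws ≡ unit n → All (Zero hLS (λ t → cong (affinePoint hLS) (enum-code t)) on-quadric) S → mixed n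
    extract n S ws e zs = subst (λ u → dotF form u ≡ 0F) e (interpolate hLS form S ws zs)

    mixed-terms : mixed 3 × mixed 4 × mixed 5
    mixed-terms = [ (λ zs → extract 3 S (nums (12 ∷ 5 ∷ 9 ∷ 15 ∷ 11 ∷ 4 ∷ [])) refl zs , extract 4 S (nums (9 ∷ 4 ∷ 11 ∷ 11 ∷ 6 ∷ 11 ∷ [])) refl zs , extract 5 S (nums (5 ∷ 15 ∷ 1 ∷ 13 ∷ 1 ∷ 7 ∷ [])) refl zs)
      , (λ zs → extract 3 S′ (nums (15 ∷ 15 ∷ 11 ∷ 4 ∷ 2 ∷ 13 ∷ [])) refl zs , extract 4 S′ (nums (11 ∷ 14 ∷ 10 ∷ 12 ∷ 9 ∷ 10 ∷ [])) refl zs , extract 5 S′ (nums (9 ∷ 5 ∷ 14 ∷ 1 ∷ 14 ∷ 13 ∷ [])) refl zs) ]′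
      (one-of hLS (λ t → cong (affinePoint hLS) (enum-code t)) on-quadric S S′ refl)

  -- If the mixed terms of the pulled back form vanish, so do the 2 × 2 minors of the first and
  -- third rows of the matrix, which is then singular. The argument serves the conic and the pointed
  -- conic at once, since they share their affine points.
  impossible : ⊥
  impossible = proj₁ (proj₂ (proj₂ oe)) (det-zero (proj₁ oe) (coefficient 3 (proj₁ mixed-terms)) (coefficient 4 (proj₁ (proj₂ mixed-terms))) (coefficient 5 (proj₂ (proj₂ mixed-terms))))
    where
    k : Fin 4
    k = proj₁ (proj₂ oe)
    coefficient : ∀ n → mixed n → dotF (coefficients (proj₁ oe)) (unit n) ≡ 0F
    coefficient n e = trans (cong₂ dotF (sym (go (coefficients (proj₁ oe)))) (unit-σ n)) (trans (sym (frob-dotF (toℕ k) form (unit n))) (trans (cong (frob (toℕ k)) e) (frob-0 (toℕ k))))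
      where
      frob-0 : ∀ k → frob k 0F ≡ 0F
      frob-0 zero = refl
      frob-0 (suc k) = frob-0 k
      frob-1 : ∀ k → 1F ≡ frob k 1F
      frob-1 zero = refl
      frob-1 (suc k) = frob-1 k
      go : ∀ {n} (c : Vec F16 n) → map (frob (toℕ k)) (map (λ a → proj₁ (frob-onto k a)) c) ≡ c
      go [] = refl
      go (a ∷ c) = cong₂ _∷_ (proj₂ (frob-onto k a)) (go c)
      bitsV : ∀ {n} (v : Vec Bool n) → Vec F16 n
      bitsV [] = []
      bitsV (false ∷ v) = 0F ∷ bitsV v
      bitsV (true ∷ v) = 1F ∷ bitsV v
      bitsV-σ : ∀ {n} (v : Vec Bool n) → bitsV v ≡ map (frob (toℕ k)) (bitsV v)
      bitsV-σ [] = refl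
      bitsV-σ (false ∷ v) = cong₂ _∷_ (sym (frob-0 (toℕ k))) (bitsV-σ v)
      bitsV-σ (true ∷ v) = cong₂ _∷_ (frob-1 (toℕ k)) (bitsV-σ v)
      unit-σ : ∀ n → unit n ≡ map (frob (toℕ k)) (unit n)
      unit-σ 0 = bitsV-σ (true ∷ false ∷ false ∷ false ∷ false ∷ false ∷ [])
      unit-σ 1 = bitsV-σ (false ∷ true ∷ false ∷ false ∷ true ∷ false ∷ [])
      unit-σ 2 = bitsV-σ (false ∷ false ∷ true ∷ false ∷ false ∷ false ∷ [])
      unit-σ 3 = bitsV-σ (false ∷ false ∷ false ∷ true ∷ false ∷ false ∷ [])
      unit-σ 4 = bitsV-σ (false ∷ false ∷ false ∷ false ∷ true ∷ false ∷ [])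
      unit-σ (suc (suc (suc (suc (suc n))))) = bitsV-σ (false ∷ false ∷ false ∷ false ∷ false ∷ true ∷ [])
    det-zero : ∀ M → dotF (coefficients M) (unit 3) ≡ 0F → dotF (coefficients M) (unit 4) ≡ 0F → dotF (coefficients M) (unit 5) ≡ 0F → detM M ≡ 0F
    det-zero ((m ∷ n ∷ o ∷ []) ∷ (p ∷ q ∷ r ∷ []) ∷ (s ∷ t ∷ u ∷ []) ∷ []) xy xz yz = trans (Polynomials.det-middle m n o p q r s t u)
      (cong₂ _+F_ (times p (trans (sym (pick₅ _ _ _ _ _ _)) yz)) (cong₂ _+F_ (times q (trans (sym (pick₄ _ _ _ _ _ _)) xz)) (times r (trans (sym (pick₃ _ _ _ _ _ _)) xy))))
      where
      times : ∀ a {b} → b ≡ 0F → a *F b ≡ 0F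
      times a refl = *-zeroʳ a
      open AlmostCommutativeRing ring using (_+_; _*_; _≈_; 0#; 1#)
      pick₃ : ∀ a b c d e f → ((a * 0#) + ((b * 0#) + ((c * 0#) + ((d * 1#) + ((e * 0#) + ((f * 0#) + 0#)))))) ≈ d
      pick₃ = solve-∀ ring
      pick₄ : ∀ a b c d e f → ((a * 0#) + ((b * 0#) + ((c * 0#) + ((d * 0#) + ((e * 1#) + ((f * 0#) + 0#)))))) ≈ e
      pick₄ = solve-∀ ring
      pick₅ : ∀ a b c d e f → ((a * 0#) + ((b * 0#) + ((c * 0#) + ((d * 0#) + ((e * 0#) + ((f * 1#) + 0#)))))) ≈ f
      pick₅ = solve-∀ ring

quad-square : ∀ t → quad (affinePoint square t) ≡ 0F
quad-square t = Polynomials.quad-affine t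

lunelliSce≁conic : ¬ OvalEquiv lunelliSce conic
lunelliSce≁conic oe = LunelliSce.impossible (λ j → quad-square (enumF16 j)) oe

lunelliSce≁pointedConic : ¬ OvalEquiv lunelliSce pointedConic
lunelliSce≁pointedConic oe = LunelliSce.impossible (λ j → quad-square (enumF16 j)) oe

lunelliSce-isLunelliSce : IsLunelliSce lunelliSce
lunelliSce-isLunelliSce = lunelliSce-isOval , lunelliSce≁conic , lunelliSce≁pointedConic

-- Restricted to the affine part of the conic, a quadratic form is a polynomial of degree at most 4
-- in t; its coefficients are fixed by five values and are 0 if these vanish. The pulled back form
-- then vanishes on the whole conic, but the preimage of (0, 1, 0), where xz + y² is 1, contradicts
-- this.
conic≁pointedConic : ¬ OvalEquiv conic pointedConic
conic≁pointedConic oe = nonvanishing (proj₁ back) zero (proj₂ back) (λ ()) (everywhere (proj₁ back))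
  where
  open Quadric conic-isOval oe
  back : Σ (Fin 17) λ i → SamePoint _ (pointedConic zero)
  back = proj₂ (proj₂ (proj₂ (proj₂ oe))) zero
  S S′ : List F16
  S = nums (0 ∷ 1 ∷ 6 ∷ 7 ∷ 15 ∷ [])
  S′ = nums (2 ∷ 9 ∷ 11 ∷ 12 ∷ 13 ∷ [])
  shape : ∀ t → conic (suc (code t)) ≡ affinePoint square t
  shape t = cong (affinePoint square) (enum-code t)
  Z : F16 → Set
  Z = Zero square shape (λ j → quad-square (enumF16 j))
  extract : ∀ n S ws → weighted square S ws ≡ unit n → All Z S → dotF form (unit n) ≡ 0F
  extract n S ws e zs = subst (λ u → dotF form u ≡ 0F) e (interpolate square form S ws zs)
  five : dotF form (unit 0) ≡ 0F × dotF form (unit 1) ≡ 0F × dotF form (unit 2) ≡ 0F × dotF form (unit 3) ≡ 0F × dotF form (unit 5) ≡ 0F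
  five = [ (λ zs → extract 0 S (nums (1 ∷ 0 ∷ 0 ∷ 0 ∷ 0 ∷ [])) refl zs , extract 1 S (nums (0 ∷ 1 ∷ 6 ∷ 7 ∷ 0 ∷ [])) refl zs , extract 2 S (nums (8 ∷ 3 ∷ 2 ∷ 15 ∷ 6 ∷ [])) refl zs ,
        extract 3 S (nums (8 ∷ 2 ∷ 5 ∷ 9 ∷ 6 ∷ [])) refl zs , extract 5 S (nums (1 ∷ 1 ∷ 1 ∷ 1 ∷ 0 ∷ [])) refl zs)
    , (λ zs → extract 0 S′ (nums (14 ∷ 10 ∷ 3 ∷ 12 ∷ 10 ∷ [])) refl zs , extract 1 S′ (nums (9 ∷ 10 ∷ 9 ∷ 3 ∷ 9 ∷ [])) refl zs , extract 2 S′ (nums (2 ∷ 15 ∷ 1 ∷ 2 ∷ 14 ∷ [])) refl zs ,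
        extract 3 S′ (nums (7 ∷ 7 ∷ 15 ∷ 1 ∷ 14 ∷ [])) refl zs , extract 5 S′ (nums (6 ∷ 1 ∷ 10 ∷ 9 ∷ 4 ∷ [])) refl zs) ]′
    (one-of square shape (λ j → quad-square (enumF16 j)) S S′ refl)
  combination : ∀ t → monomials (affinePoint square t) ≡ unit 0 ⊞ (map ((t *F t) *F_) (unit 1) ⊞ (map (((t *F t) *F (t *F t)) *F_) (unit 2) ⊞ (map (t *F_) (unit 3) ⊞ map ((t *F (t *F t)) *F_) (unit 5))))
  combination t = eqM-sound _ _ (all₁-sound (λ t → eqM (monomials (affinePoint square t)) (unit 0 ⊞ (map ((t *F t) *F_) (unit 1) ⊞ (map (((t *F t) *F (t *F t)) *F_) (unit 2) ⊞ (map (t *F_) (unit 3) ⊞ map ((t *F (t *F t)) *F_) (unit 5)))))) refl t)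
  scaled : ∀ w u → dotF form u ≡ 0F → dotF form (map (w *F_) u) ≡ 0F
  scaled w u e = trans (dotF-scale form w u) (trans (cong (w *F_) e) (*-zeroʳ w))
  summed : ∀ u v → dotF form u ≡ 0F → dotF form v ≡ 0F → dotF form (u ⊞ v) ≡ 0F
  summed u v p q = trans (dotF-+ form u v) (cong₂ _+F_ p q)
  everywhere : ∀ i → dotF form (monomials (conic i)) ≡ 0F
  -- At (0, 0, 1) every monomial except z² is zero, so the coefficient with number 2 is the value
  -- there.
  everywhere zero = proj₁ (proj₂ (proj₂ five))
  everywhere (suc i) = trans (cong (dotF form) (combination t))
    (summed (unit 0) _ (proj₁ five) (summed _ _ (scaled (t *F t) (unit 1) (proj₁ (proj₂ five))) (summed _ _ (scaled ((t *F t) *F (t *F t)) (unit 2) (proj₁ (proj₂ (proj₂ five))))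
      (summed _ _ (scaled t (unit 3) (proj₁ (proj₂ (proj₂ (proj₂ five))))) (scaled (t *F (t *F t)) (unit 5) (proj₂ (proj₂ (proj₂ (proj₂ five)))))))))
    where
    t : F16
    t = enumF16 i

-- From verified certificates to equivalences

PE-pointwise : ∀ {O O′ : Family17} → (∀ i → O i ≡ O′ i) → PseudoOvalEquiv O O′
PE-pointwise {O} {O′} e = ≅⇒PE (record { Θ = one 12 ; Θ-inj = one-inj 12 ; T = λ _ → one 4 ; T-inj = λ _ → one-inj 4
  ; eq = λ i → trans (one-⊗ (O i ᵀ)) (trans (cong _ᵀ (e i)) (sym (⊗-one (O′ i ᵀ)))) })

module ImageSound (mul quo : F16 → F16 → F16) (h : Table F16) (mul-ok : ∀ a b → mul a b ≡ a *F b)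
                  (quo-ok : ∀ a b → quo a b ≡ a *F inv b) (h-ok : ∀ t → get 0F h t ≡ hLS t) where

  OnOval : Kind → V3 → Set
  OnOval K P = Σ (Fin 17) λ j → SamePoint P (oval K j)

  polynomial : Kind → F16 → F16
  polynomial lunelliSceK = hLS
  polynomial _ = square

  private
    value-ok : ∀ K t → value mul quo h K t ≡ polynomial K t
    value-ok regularK t = mul-ok t t
    value-ok pointedK t = mul-ok t t
    value-ok lunelliSceK t = h-ok t

    oval-affine : ∀ K t → oval K (suc (code t)) ≡ affinePoint (polynomial K) t
    oval-affine regularK t = cong (affinePoint square) (enum-code t)
    oval-affine pointedK t = cong (affinePoint square) (enum-code t)
    oval-affine lunelliSceK t = cong (affinePoint hLS) (enum-code t)

    not-nonzero : ∀ (a : F16) → not (nonzero a) ≡ true → a ≡ 0F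
    not-nonzero a e = nonzero-complete a (not-true e)

    proper : ∀ K x y z → nonzero x ≡ true → z ≡ mul x (value mul quo h K (quo y x)) → OnOval K (x ∷ y ∷ z ∷ [])
    proper K x y z nz e = suc (code t) , x , x≢0 , trans (cong₂ _∷_ (sym (*-identityʳ x)) (cong₂ (λ u v → u ∷ v ∷ [])
        (sym (trans (cong (x *F_) (*-comm y (inv x))) (trans (sym (*-assoc x (inv x) y)) (trans (cong (_*F y) (inv-right x x≢0)) (*-identityˡ y)))))
        (trans e (trans (mul-ok x _) (cong (x *F_) (trans (value-ok K (quo y x)) (cong (polynomial K) (quo-ok y x))))))))
      (cong (scale x) (sym (oval-affine K t)))
      where
      t : F16
      t = y *F inv x
      x≢0 : x ≢ 0F
      x≢0 = nonzero-sound nz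

    improper : ∀ K x y z → nonzero x ≡ false → atInfinity mul quo h K y z ≡ true → OnOval K (x ∷ y ∷ z ∷ [])
    improper pointedK x y z nz e = zero , y , nonzero-sound (proj₁ es) , cong₂ _∷_ (trans (nonzero-complete x nz) (sym (*-zeroʳ y)))
        (cong₂ (λ u v → u ∷ v ∷ []) (sym (*-identityʳ y)) (trans (not-nonzero z (proj₂ es)) (sym (*-zeroʳ y))))
      where
      es : nonzero y ≡ true × not (nonzero z) ≡ true
      es = ∧-split (nonzero y) e
    improper regularK x y z nz e = zero , z , nonzero-sound (proj₁ es) , cong₂ _∷_ (trans (nonzero-complete x nz) (sym (*-zeroʳ z)))
        (cong₂ (λ u v → u ∷ v ∷ []) (trans (not-nonzero y (proj₂ es)) (sym (*-zeroʳ z))) (sym (*-identityʳ z)))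
      where
      es : nonzero z ≡ true × not (nonzero y) ≡ true
      es = ∧-split (nonzero z) e
    improper lunelliSceK x y z nz e = zero , z , nonzero-sound (proj₁ es) , cong₂ _∷_ (trans (nonzero-complete x nz) (sym (*-zeroʳ z)))
        (cong₂ (λ u v → u ∷ v ∷ []) (trans (not-nonzero y (proj₂ es)) (sym (*-zeroʳ z))) (sym (*-identityʳ z)))
      where
      es : nonzero z ≡ true × not (nonzero y) ≡ true
      es = ∧-split (nonzero z) e

    onOval-sound : ∀ K x y z → onOval mul quo h K x y z ≡ true → OnOval K (x ∷ y ∷ z ∷ [])
    onOval-sound K x y z = go (nonzero x) refl
      where
      go : ∀ b → nonzero x ≡ b → (if b then eqV z (mul x (value mul quo h K (quo y x))) else atInfinity mul quo h K y z) ≡ true → OnOval K (x ∷ y ∷ z ∷ [])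
      go true nz e = proper K x y z nz (eqV-sound z _ e)
      go false nz e = improper K x y z nz e

    dotm-ok : ∀ r v → dotm mul quo h r v ≡ dot16 r v
    dotm-ok (a ∷ b ∷ c ∷ []) (x ∷ y ∷ z ∷ []) = trans (cong₂ _+ᵥ_ (mul-ok a x) (cong₂ _+ᵥ_ (mul-ok b y) (mul-ok c z)))
      (trans (sym (+F≡+ᵥ (a *F x) _)) (cong ((a *F x) +F_) (trans (sym (+F≡+ᵥ (b *F y) (c *F z))) (cong ((b *F y) +F_) (sym (trans (+F-comm (c *F z) 0F) (+F-identityˡ (c *F z))))))))

  onImage-sound : ∀ K M x y z → onImage mul quo h K M x y z ≡ true → OnOval K (apply16 M (x ∷ y ∷ z ∷ []))
  onImage-sound K (r₀ ∷ r₁ ∷ r₂ ∷ []) x y z e = subst (OnOval K) (cong₂ _∷_ (dotm-ok r₀ v) (cong₂ (λ a b → a ∷ b ∷ []) (dotm-ok r₁ v) (dotm-ok r₂ v)))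
      (onOval-sound K _ _ _ e)
    where
    v : V3
    v = x ∷ y ∷ z ∷ []

  frobm-ok : ∀ k a → frobm mul quo h k a ≡ frob k a
  frobm-ok zero a = refl
  frobm-ok (suc k) a = trans (frobm-ok k (mul a a)) (cong (frob k) (mul-ok a a))

  module _ (f : F16 → F16) (label : Fin 16 → F16) (label-injective : ∀ {i j} → label i ≡ label j → i ≡ j) (image-maps : Maps mul quo h f) where
    open Maps image-maps

    points : Points17
    points zero = 0F ∷ 0F ∷ 1F ∷ []
    points (suc i) = affinePoint f (label i)

    private
      points-distinct : ∀ μ i j → scale μ (points i) ≡ points j → i ≡ j
      points-distinct μ zero zero e = refl
      points-distinct μ zero (suc j) e = ⊥-elim (contra (trans (sym (*-zeroʳ μ)) (∷-injectiveˡ e)))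
        where
        contra : 0F ≢ 1F
        contra ()
      points-distinct μ (suc i) zero e = ⊥-elim (contra (trans (sym (cong (_*F f (label i)) μ≡0)) (∷-injectiveˡ (∷-injectiveʳ (∷-injectiveʳ e)))))
        where
        μ≡0 : μ ≡ 0F
        μ≡0 = trans (sym (*-identityʳ μ)) (∷-injectiveˡ e)
        contra : 0F *F f (label i) ≢ 1F
        contra p = 1F≢0F (trans (sym p) (trans (*-comm 0F (f (label i))) (*-zeroʳ (f (label i)))))
      points-distinct μ (suc i) (suc j) e = cong suc (label-injective (trans (sym (*-identityˡ (label i))) (trans (sym (cong (_*F label i) μ≡1)) (∷-injectiveˡ (∷-injectiveʳ e)))))
        where
        μ≡1 : μ ≡ 1F
        μ≡1 = trans (sym (*-identityʳ μ)) (∷-injectiveˡ e)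

      frob-0 : ∀ k → frob k 0F ≡ 0F
      frob-0 zero = refl
      frob-0 (suc k) = frob-0 k
      frob-1 : ∀ k → frob k 1F ≡ 1F
      frob-1 zero = refl
      frob-1 (suc k) = frob-1 k

      image : ∀ i → OnOval K (apply16 M (map (frob (toℕ k)) (points i)))
      image zero = subst (λ P → OnOval K (apply16 M P)) (cong₂ _∷_ (sym (frob-0 (toℕ k))) (cong₂ (λ a b → a ∷ b ∷ []) (sym (frob-0 (toℕ k))) (sym (frob-1 (toℕ k)))))
        (onImage-sound K M 0F 0F 1F infinite-ok)
      image (suc i) = subst (λ P → OnOval K (apply16 M P)) (cong₂ _∷_ (sym (frob-1 (toℕ k))) (cong₂ (λ a b → a ∷ b ∷ []) (frobm-ok (toℕ k) (label i)) (frobm-ok (toℕ k) (f (label i)))))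
        (onImage-sound K M 1F (frobm mul quo h (toℕ k) (label i)) (frobm mul quo h (toℕ k) (f (label i))) (affine-ok (label i)))

    points-equiv : OvalEquiv points (oval K)
    points-equiv = Forward.ovalEquiv points-distinct M (nonzero-sound det-ok) k image

family-scalar : ∀ {A B : Fin 16 → M4} (f : F16 → F16) (label : Fin 16 → F16) (Ω : Points17) → Ω zero ≡ 0F ∷ 0F ∷ 1F ∷ [] → (∀ i → Ω (suc i) ≡ affinePoint f (label i)) →
                (∀ i → A i ≡ scal (label i)) → (∀ i → B i ≡ scal (f (label i))) → ∀ i → family A B i ≡ elementary Ω i
family-scalar {A} {B} f label Ω Ω₀ Ω₊ A-l B-l zero = trans (cong _ᵀ (sym (member-ᵀ 0F 0F 1F))) (trans (ᵀ-ᵀ (member (0F ∷ 0F ∷ 1F ∷ []))) (cong member (sym Ω₀)))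
family-scalar {A} {B} f label Ω Ω₀ Ω₊ A-l B-l (suc i) = trans (cong _ᵀ (trans (cong₂ (λ X Y → one 4 ++ (X ++ Y)) (A-l i) (B-l i)) (sym (member-ᵀ 1F (label i) (f (label i))))))
  (trans (ᵀ-ᵀ (member (affinePoint f (label i)))) (cong member (sym (Ω₊ i))))

Has-find : ∀ {A} N X → Has A X → anyL (eqM N) X ≡ true → Σ (Fin 16) λ i → A i ≡ N
Has-find N (M ∷ X) ((i , e) ∷ hs) = ∨-elim (eqM N M) (λ p → i , trans e (sym (eqM-sound N M p))) (Has-find N X hs)

-- The Desarguesian spread

module Desarguesian (gl : Trie) (gl-ok : ∀ (A : M4) → Inj A → mem gl (concat A) ≡ true)
                    (pr qu : Table₂) (h : Table F16) (pr-ok : ∀ a b → get₂ pr a b ≡ a *F b) (qu-ok : ∀ a b → get₂ qu a b ≡ a *F inv b) (h-ok : ∀ t → get 0F h t ≡ hLS t)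
                    {m n} (Ms : List M4) (rs : Vec F16 m) (scalar-ok : scalarCheck gl qu Ms rs ≡ true)
                    (ps : Vec F16 n) (dif : allDiffer (0F ∷ 1F ∷ xF ∷ ps) ≡ true)
                    (cov : ∀ t → anyL (eqV t) (reverseOnto ps (xF ∷ 1F ∷ 0F ∷ [])) ≡ true)
                    (cs : List ℕ) (oval-ok : ovalSearch pr qu h ps cs ≡ true) where

  normal-equiv : ∀ {A B} → Normal A B → Σ Kind λ K → PseudoOvalEquiv (family A B) (elementary (oval K))
  normal-equiv {A} {B} nor = Maps.K image-maps , PE-trans (PE-pointwise (family-scalar f label (points f label label-injective image-maps) refl (λ _ → refl) A-label B-label))
      (ovalEquiv⇒PE (points-equiv f label label-injective image-maps))
    where
    open Normal nor
    open Labels nor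
    open ImageSound (get₂ pr) (get₂ qu) h pr-ok qu-ok h-ok
    scalar : ∀ t → Σ F16 λ q → B (idx t) ≡ scal q
    scalar = all-scalar (Scalars.x²-scalar gl gl-ok qu qu-ok Ms rs scalar-ok) nor
    f : F16 → F16
    f t = proj₁ (scalar t)
    image-maps : Maps (get₂ pr) (get₂ qu) h f
    image-maps = OvalStage.mapped pr qu h qu-ok ps dif cov cs oval-ok nor f (λ t → proj₂ (scalar t))
    A-label : ∀ i → A i ≡ scal (label i)
    A-label i = trans (cong A (sym (idx-label i))) (A-idx (label i))
    B-label : ∀ i → B i ≡ scal (f (label i))
    B-label i = trans (cong B (sym (idx-label i))) (proj₂ (scalar (label i)))

  desarguesian-equiv : ∀ {A B} → Sys A B → (∀ t → Σ (Fin 16) λ i → A i ≡ scal t) → Σ Kind λ K → PseudoOvalEquiv (family A B) (elementary (oval K))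
  desarguesian-equiv {A} {B} sys at = proj₁ result , PE-trans NB.equiv′ (proj₂ result)
    where
    index : F16 → Fin 16
    index t = proj₁ (at t)
    index-≢ : ∀ {s t} → s ≢ t → index s ≢ index t
    index-≢ {s} {t} p e = p (scal-injective (trans (sym (proj₂ (at s))) (trans (cong A e) (proj₂ (at t)))))
    module NB = NormaliseB sys (index 0F) (index 1F) (index xF) (index-≢ {0F} {1F} (λ ())) (index-≢ {1F} {xF} (λ ())) (index-≢ {0F} {xF} (λ ()))
    result : Σ Kind λ K → PseudoOvalEquiv (family NB.A′ NB.B′) (elementary (oval K))
    result = normal-equiv (record { sys = NB.sys′ ; idx = index ; A-idx = λ t → trans (NB.same-A (index t)) (proj₂ (at t)) ; B-0 = NB.B′-i ; B-1 = NB.B′-j ; B-x = NB.B′-k })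

-- The classification

Classified : Family17 → Set
Classified O = Σ Kind λ K → PseudoOvalEquiv O (elementary (oval K))

Classified-PE : ∀ {O O′} → PseudoOvalEquiv O O′ → Classified O′ → Classified O
Classified-PE e (K , e′) = K , PE-trans e e′

open Searches GL mem-GL
open Goodness Classified Classified-PE

-- The searches keep the newest element in front while frames are stated from 0 upwards; this passes
-- from one order to the other.
permuted : ∀ X Y → allL (λ N → anyL (eqM N) X) Y ≡ true → Good Y → Good X
permuted X Y e g A B h hs = g A B h (All.map (λ {N} → Has-find N X hs) (allL-sound (λ N → anyL (eqM N) X) Y e))

get₂-table : ∀ (f : F16 → F16 → F16) a b → get₂ (table 4 (λ a → table 4 (f a))) a b ≡ f a b
get₂-table f a b = trans (cong (λ T → get 0F T b) (get-table {A = Table F16} (val 0F) 4 (λ a → table 4 (f a)) a)) (get-table {A = F16} 0F 4 (f a) b)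

products-correct : ∀ a b → get₂ products a b ≡ a *F b
products-correct = get₂-table _*F_

quotients-correct : ∀ a b → get₂ quotients a b ≡ a *F inv b
quotients-correct = get₂-table (λ a b → a *F inv b)

ovalOrder-different : allDiffer (0F ∷ 1F ∷ xF ∷ ovalOrder) ≡ true
ovalOrder-different = refl

ovalOrder-covers : ∀ t → anyL (eqV t) (reverseOnto ovalOrder (xF ∷ 1F ∷ 0F ∷ [])) ≡ true
ovalOrder-covers = all₁-sound (λ t → anyL (eqV t) (reverseOnto ovalOrder (xF ∷ 1F ∷ 0F ∷ []))) refl

desarguesian-scalars : ∀ t → anyL (eqM (scal t)) desarguesian ≡ true
desarguesian-scalars = all₁-sound (λ t → anyL (eqM (scal t)) desarguesian) refl

desarguesian-good : Good desarguesian
desarguesian-good A B h hs = Desarguesian.desarguesian-equiv GL mem-GL products quotients (table 4 hLS) products-correct quotients-correct (get-table 0F 4 hLS)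
  (mapL mat scalarReps) scalarOrder scalars-ok ovalOrder ovalOrder-different ovalOrder-covers ovalCerts ovals-ok
  h (λ t → Has-find (scal t) desarguesian hs (desarguesian-scalars t))

spreads-good : All Good spreads
spreads-good = ++⁺ (All.map (λ {X} e A B h hs → ⊥-elim (noOval-refutes X e A B h hs)) (allL-sound noOval nonDesarguesian spreads-refuted)) (desarguesian-good ∷ [])

never-good : ∀ X → never X ≡ true → Good X
never-good X ()

failing-good : ∀ X → Succeeds (failing X) → Good X
failing-good X (_ , _ , ())

class-good : ∀ c → classCheck GL c ≡ true → Good (classFrame c)
class-good (M , as , cs) = spreadCheck-good never (certified spreads) never-good (certified-good spreads-good) (map (binary 4) as) (mat M ∷ W ∷ 1M ∷ 0M ∷ []) cs

classes-good : ∀ cs → All (λ c → classCheck GL c ≡ true) cs → All Good (mapL classFrame cs)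
classes-good [] [] = []
classes-good (c ∷ cs) (e ∷ es) = class-good c e ∷ classes-good cs es

normalFrame-good : Good normalFrame
normalFrame-good = permuted normalFrame (W ∷ 1M ∷ 0M ∷ []) refl (spreadCheck-good never (certified (mapL classFrame classData)) never-good
  (certified-good (classes-good classData (allL-sound (classCheck GL) classData classes-ok))) (binary 4 9 ∷ []) (W ∷ 1M ∷ 0M ∷ []) top top-ok)

W₆-good : Good (0M ∷ 1M ∷ W₆ ∷ [])
W₆-good = permuted (0M ∷ 1M ∷ W₆ ∷ []) (W₆ ∷ 1M ∷ 0M ∷ []) refl (spreadCheck-good irreducible failing (irreducible-good normalFrame-good) failing-good
  (map (binary 4) (14 ∷ 3 ∷ 11 ∷ 13 ∷ 10 ∷ 7 ∷ [])) (W₆ ∷ 1M ∷ 0M ∷ []) [] W₆-ok)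

W₃-good : Good (0M ∷ 1M ∷ W₃ ∷ [])
W₃-good = permuted (0M ∷ 1M ∷ W₃ ∷ []) (W₃ ∷ 1M ∷ 0M ∷ []) refl (spreadCheck-good irreducible failing (irreducible-good normalFrame-good) failing-good
  (map (binary 4) (2 ∷ 7 ∷ 13 ∷ 14 ∷ 12 ∷ 3 ∷ [])) (W₃ ∷ 1M ∷ 0M ∷ []) [] W₃-ok)

classified : ∀ O → IsPseudoOval O → Classified O
classified O po = go (normalise O po)
  where
  go : (Σ (Fin 16 → M4) λ A → Σ (Fin 16 → M4) λ B → Sys A B × PseudoOvalEquiv O (family A B)) → Classified O
  go (A , B , h , e) = Classified-PE e (all-good (spreadCheck-good normalisable failing (normalisable-good normalFrame-good W₆-good W₃-good) failing-good
      (binary 4 2 ∷ []) (1M ∷ 0M ∷ []) [] root-ok) A B h)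
-- The classification applied to the pseudo-oval of Ω leaves three classes, and two of them would
-- give an equivalence of Ω with the conic or the pointed conic by rigidity. So all Lunelli-Sce
-- ovals yield the class of the explicit one.
lunelliSce-class : ∀ Ω → IsLunelliSce Ω → PseudoOvalEquiv (elementary Ω) (elementary lunelliSce)
lunelliSce-class Ω (o , ≁conic , ≁pointed) = go (classified (elementary Ω) (oval⇒pseudoOval Ω o))
  where
  go : Classified (elementary Ω) → PseudoOvalEquiv (elementary Ω) (elementary lunelliSce)
  go (regularK , e) = ⊥-elim (≁conic (FromPE.ovalEquiv o conicTarget e))
  go (pointedK , e) = ⊥-elim (≁pointed (FromPE.ovalEquiv o pointedTarget e))
  go (lunelliSceK , e) = e

theorem6 :
    -- the three classes consist of pseudo-ovals, and a Lunelli–Sce oval exists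
    (IsPseudoOval (elementary conic) ×
     IsPseudoOval (elementary pointedConic) ×
     Σ Points17 IsLunelliSce ×
     (∀ Ω → IsLunelliSce Ω → IsPseudoOval (elementary Ω))) ×
    -- every 4-dimensional pseudo-oval of PG(11,2) is equivalent to one of them
    (∀ O → IsPseudoOval O →
      PseudoOvalEquiv O (elementary conic) ⊎
      PseudoOvalEquiv O (elementary pointedConic) ⊎
      Σ Points17 (λ Ω → IsLunelliSce Ω × PseudoOvalEquiv O (elementary Ω))) ×
    -- the three classes are pairwise distinct
    (¬ PseudoOvalEquiv (elementary conic) (elementary pointedConic) ×
     (∀ Ω → IsLunelliSce Ω → ¬ PseudoOvalEquiv (elementary Ω) (elementary conic)) ×
     (∀ Ω → IsLunelliSce Ω → ¬ PseudoOvalEquiv (elementary Ω) (elementary pointedConic))) ×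
    -- all Lunelli–Sce ovals give the same class
    (∀ Ω Ω' → IsLunelliSce Ω → IsLunelliSce Ω' →
      PseudoOvalEquiv (elementary Ω) (elementary Ω'))
theorem6 =
  ( oval⇒pseudoOval conic conic-isOval
  , oval⇒pseudoOval pointedConic pointedConic-isOval
  , (lunelliSce , lunelliSce-isLunelliSce)
  , (λ Ω ls → oval⇒pseudoOval Ω (proj₁ ls)) ) ,
  (λ O po → one-of-three (classified O po)) ,
  ( (λ e → conic≁pointedConic (FromPE.ovalEquiv conic-isOval pointedTarget e))
  , (λ Ω ls e → proj₁ (proj₂ ls) (FromPE.ovalEquiv (proj₁ ls) conicTarget e))
  , (λ Ω ls e → proj₂ (proj₂ ls) (FromPE.ovalEquiv (proj₁ ls) pointedTarget e)) ) ,
  (λ Ω Ω' ls ls' → PE-trans (lunelliSce-class Ω ls) (PE-sym (lunelliSce-class Ω' ls')))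
  where
  one-of-three : ∀ {O} → Classified O → PseudoOvalEquiv O (elementary conic) ⊎ PseudoOvalEquiv O (elementary pointedConic) ⊎
                 Σ Points17 (λ Ω → IsLunelliSce Ω × PseudoOvalEquiv O (elementary Ω))
  one-of-three (regularK , e) = inj₁ e
  one-of-three (pointedK , e) = inj₂ (inj₁ e)
  one-of-three (lunelliSceK , e) = inj₂ (inj₂ (lunelliSce , lunelliSce-isLunelliSce , e))
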